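{- Let $k>0$. The complete closure operation is a bijection between the set $\mathcal{T}_k$ of well-charged trees of total charge $k$ and the set of $\mathsf{d}$-trumpets $(\mathrm{m},\tau)$ with $\deg(\tau)=k$. Similarly, the complete closure operation is a bijection between $\mathcal{T}_{ -k}$ and the set of $\mathsf{d}$-cornets $(\mathrm{m},\tau)$ with $\deg(\tau)=k$. Moreover, these bijections preserve the vertex-degree distribution and the color of the root vertex.
   Context: Maps are planar maps (embedded connected multigraphs on the sphere), rooted at a corner; bipartite maps carry a fixed proper black/white vertex coloring. A blossoming tree is a plane tree rooted at a corner whose vertices may carry opening stems (outgoing dangling half-edges) and closing stems (ingoing dangling half-edges); its charge is #closing stems minus #opening stems, and the charge of a vertex is the charge of its subtree. A well-charged tree is a rooted properly black/white colored blossoming tree such that black vertices carry no closing stems and each non-root black vertex has charge $\le 1$, and white vertices carry no opening stems and each non-root white vertex has charge $\ge 0$. $\mathcal{T}_j$ is the set of well-charged trees of total charge $j$. Closure: reading the stems clockwise around the tree gives a parenthesis matching (opening stem = opening parenthesis); each matched pair is merged into an edge with the outer face on its left when oriented from opening to closing stem. If the charge is $j\neq 0$, $|j|$ stems stay unmatched (closing if $j>0$, opening if $j<0$). The complete closure is obtained by adding a new vertex $\tau$ in the outer face and replacing each unmatched stem by an edge joining its vertex to $\tau$; $\tau$ is colored black if $j>0$ and white if $j<0$. The result is a rooted bipartite map with a marked vertex $\tau$. For a rooted planar map $\mathrm{m}$ with root vertex $\rho$ and a marked vertex $\tau\neq\rho$, a cut is a partition $(R,S)$ of the vertex set with $\rho\in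 R$, $\tau\in S$; its cut-set is the set of edges joining $R$ to $S$ and its weight is the size of the cut-set. For bipartite $\mathrm{m}$, a cut is black (resp. white) if all vertices of $S$ incident to cut-set edges are black (resp. white); it is minimal if its weight is minimal among cuts of that color. The trivial cut is $(V\setminus\{\tau\},\{\tau\})$, of the color of $\tau$ and of weight $\deg(\tau)$. $(\mathrm{m},\tau)$ is tight if the trivial cut is minimal among cuts of its color, and strictly tight if it is the unique minimal cut of its color. A $\mathsf{d}$-trumpet is a tight pair with $\tau$ black; a $\mathsf{d}$-cornet is a strictly tight pair with $\tau$ white. -}

module Defs where

open import Data.Bool.Base using (Bool; true; false; if_then_else_; not; _∧_; _∨_)
open import Data.Nat.Base using (ℕ; zero; suc; _+_; _*_; _≤_; _<_; _≡ᵇ_; _≤ᵇ_; _<ᵇ_; _∸_)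
open import Data.Nat.Properties using (_<?_)
open import Data.Integer.Base as ℤ using (ℤ; _⊖_)
open import Data.Fin.Base using (Fin; toℕ; fromℕ<)
open import Data.List.Base using (List; []; _∷_; _++_; [_]; length; filterᵇ; upTo; allFin; reverse; map; concat)
open import Data.Maybe.Base using (Maybe; just; nothing)
open import Data.Product.Base using (Σ; _×_; _,_; proj₁; proj₂; ∃)
open import Data.List.Relation.Binary.Permutation.Propositional using (_↭_)
open import Function.Bundles using (_↔_; Inverse)
open import Relation.Binary.PropositionalEquality using (_≡_)
open import Relation.Nullary.Decidable using (yes; no)
open import Data.Empty using (⊥)
open import Data.Unit.Base using (⊤)
import Data.Maybe.Base
import Data.Fin.Base
open import Data.Bool.ListAction using (all; any)

data Color : Set where
  black white : Color

flipC : Color → Color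
flipC black = white
flipC white = black

isBlackᵇ : Color → Bool
isBlackᵇ black = true
isBlackᵇ white = false

-- Rooted planar maps, encoded as combinatorial maps (rotation systems).
-- Darts are Fin n.  σ = next dart clockwise around its vertex,
-- α = the other half of its edge.  Vertices = σ-orbits, faces = (σ∘α)-orbits.
-- The root corner is encoded by the dart following it clockwise.
-- A bipartite map carries its colouring (colour of the vertex of each dart)
-- and the marked vertex τ is encoded by the set of darts incident to it.

record Map : Set where
  field
    n      : ℕ
    σ      : Fin n → Fin n
    α      : Fin n → Fin n
    root   : Fin n
    color  : Fin n → Color
    marked : Fin n → Bool

iter : {A : Set} → (A → A) → ℕ → A → A
iter f zero    x = x
iter f (suc k) x = f (iter f k x)

_≡ᶠᵇ_ : {n : ℕ} → Fin n → Fin n → Bool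
x ≡ᶠᵇ y = toℕ x ≡ᵇ toℕ y

count : {A : Set} → (A → Bool) → List A → ℕ
count p xs = length (filterᵇ p xs)

module _ (m : Map) where
  open Map m

  sameVertexᵇ : Fin n → Fin n → Bool
  sameVertexᵇ x y = any (λ k → iter σ k x ≡ᶠᵇ y) (upTo n)

  -- number of orbits of a permutation f of the darts
  -- (an orbit is counted through its dart of least index)
  numOrbits : (Fin n → Fin n) → ℕ
  numOrbits f = count (λ x → all (λ k → toℕ x ≤ᵇ toℕ (iter f k x)) (upTo n)) (allFin n)

  numVertices numFaces : ℕ
  numVertices = numOrbits σ
  numFaces    = numOrbits (λ x → σ (α x))

  degreeAt : Fin n → ℕ
  degreeAt x = count (sameVertexᵇ x) (allFin n)

  data Reach : Fin n → Fin n → Set where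
    here  : ∀ {x} → Reach x x
    stepσ : ∀ {x y} → Reach x y → Reach x (σ y)
    stepα : ∀ {x y} → Reach x y → Reach x (α y)

  -- planar map: σ a permutation, α a fixed-point-free involution,
  -- connected, and Euler's formula V - E + F = 2 (with 2E = n)
  record IsPlanarMap : Set where
    field
      σ-perm      : Σ (Fin n → Fin n) λ σ⁻ → (∀ x → σ (σ⁻ x) ≡ x) × (∀ x → σ⁻ (σ x) ≡ x)
      α-invol     : ∀ x → α (α x) ≡ x
      α-fixfree   : ∀ x → (α x ≡ x → ⊥)
      connected   : ∀ x y → Reach x y
      euler       : 2 * (numVertices + numFaces) ≡ n + 4

  record IsBipartite : Set where
    field
      color-σ : ∀ x → color (σ x) ≡ color x
      color-α : ∀ x → color (α x) ≡ flipC (color x)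

  record IsMarkedVertex : Set where
    field
      nonempty   : Σ (Fin n) λ x → marked x ≡ true
      marked-σ   : ∀ x → marked (σ x) ≡ marked x
      one-vertex : ∀ x y → marked x ≡ true → marked y ≡ true → sameVertexᵇ x y ≡ true
      root-not-τ : marked root ≡ false

  record IsPointedBipartiteMap : Set where
    field
      planar    : IsPlanarMap
      bipartite : IsBipartite
      pointed   : IsMarkedVertex

  degτ : ℕ
  degτ = count marked (allFin n)

  rootColor : Color
  rootColor = color root

  τColorIs : Color → Set
  τColorIs c = ∀ x → marked x ≡ true → color x ≡ c

  -- Cuts.  A cut (R,S) is given by the indicator S of the darts whose vertex
  -- lies in S (constant on vertices), with ρ ∈ R and τ ∈ S.
  record IsCut (S : Fin n → Bool) : Set where
    field
      S-vertex : ∀ x → S (σ x) ≡ S x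
      ρ∈R      : S root ≡ false
      τ∈S      : ∀ x → marked x ≡ true → S x ≡ true

  -- weight: number of edges of the cut-set (each counted by its dart on the S side)
  weight : (Fin n → Bool) → ℕ
  weight S = count (λ x → S x ∧ not (S (α x))) (allFin n)

  HasColor : Color → (Fin n → Bool) → Set
  HasColor c S = ∀ x → S x ≡ true → S (α x) ≡ false → color x ≡ c

  -- trivial cut S = {τ}, of weight deg τ; it has the colour of τ.
  -- tight: the trivial cut is minimal among cuts of the colour of τ
  Tight : Color → Set
  Tight c = ∀ S → IsCut S → HasColor c S → degτ ≤ weight S

  StrictlyTight : Color → Set
  StrictlyTight c = Tight c × (∀ S → IsCut S → HasColor c S → weight S ≤ degτ → ∀ x → S x ≡ marked x)

  IsTrumpet : Set
  IsTrumpet = IsPointedBipartiteMap × τColorIs black × Tight black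

  IsCornet : Set
  IsCornet = IsPointedBipartiteMap × τColorIs white × StrictlyTight white

  degDistMap : List (Color × ℕ)
  degDistMap =
    map (λ x → color x , degreeAt x)
      (filterᵇ (λ x → not (marked x) ∧ all (λ k → toℕ x ≤ᵇ toℕ (iter σ k x)) (upTo n)) (allFin n))



record _≅_ (m m' : Map) : Set where
  private
    module M  = Map m
    module M' = Map m'
  field
    bij      : Fin M.n ↔ Fin M'.n
  open Inverse bij using (to)
  field
    pres-σ      : ∀ x → to (M.σ x) ≡ M'.σ (to x)
    pres-α      : ∀ x → to (M.α x) ≡ M'.α (to x)
    pres-root   : to M.root ≡ M'.root
    pres-color  : ∀ x → M'.color (to x) ≡ M.color x
    pres-marked : ∀ x → M'.marked (to x) ≡ M.marked x

-- Blossoming trees (plane trees rooted at a corner).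
-- A vertex is given by the clockwise list of what is attached to it
-- (stems and child subtrees); for a non-root vertex the list starts right
-- after the edge to its parent, for the root it starts at the root corner.

data Stem : Set where
  opening closing : Stem

mutual
  data Item : Set where
    stem  : Stem → Item
    child : Tree → Item

  data Tree : Set where
    node : List Item → Tree

-- a rooted properly bicoloured blossoming tree: colour of the root + tree
BTree : Set
BTree = Color × Tree

mutual
  nOpen : Tree → ℕ
  nOpen (node is) = nOpenItems is

  nOpenItems : List Item → ℕ
  nOpenItems []                    = 0
  nOpenItems (stem opening ∷ is)   = suc (nOpenItems is)
  nOpenItems (stem closing ∷ is)   = nOpenItems is
  nOpenItems (child t ∷ is)        = nOpen t + nOpenItems is

  nClose : Tree → ℕ
  nClose (node is) = nCloseItems is

  nCloseItems : List Item → ℕ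
  nCloseItems []                   = 0
  nCloseItems (stem opening ∷ is)  = nCloseItems is
  nCloseItems (stem closing ∷ is)  = suc (nCloseItems is)
  nCloseItems (child t ∷ is)       = nClose t + nCloseItems is

charge : Tree → ℤ
charge t = nClose t ⊖ nOpen t

mutual
  WCItems : Color → List Item → Set
  WCItems c []                  = ⊤
  WCItems c (stem opening ∷ is) = c ≡ black × WCItems c is
  WCItems c (stem closing ∷ is) = c ≡ white × WCItems c is
  WCItems c (child t ∷ is)      = WCNonRoot (flipC c) t × WCItems c is

  WCNonRoot : Color → Tree → Set
  WCNonRoot black (node is) = WCItems black is × charge (node is) ℤ.≤ ℤ.+ 1
  WCNonRoot white (node is) = WCItems white is × ℤ.+ 0 ℤ.≤ charge (node is)

WellCharged : BTree → Set
WellCharged (c , node is) = WCItems c is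

InT : ℤ → BTree → Set
InT j t = WellCharged t × charge (proj₂ t) ≡ j

mutual
  degDistV : Color → ℕ → Tree → List (Color × ℕ)
  degDistV c e (node is) = (c , e + length is) ∷ degDistItems c is

  degDistItems : Color → List Item → List (Color × ℕ)
  degDistItems c []             = []
  degDistItems c (stem _ ∷ is)  = degDistItems c is
  degDistItems c (child t ∷ is) = degDistV (flipC c) 1 t ++ degDistItems c is

degDistTree : BTree → List (Color × ℕ)
degDistTree (c , t) = degDistV c 0 t

-- Complete closure.
-- Darts are numbered by a depth-first (clockwise contour) traversal.

record St : Set where
  constructor st
  field
    fresh : ℕ
    rots  : List (Color × List ℕ)   -- per vertex: colour, clockwise rotation of its darts
    edges : List (ℕ × ℕ)
    stems : List (ℕ × Stem)         -- stems in clockwise contour order from the root corner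

mutual
  -- process a vertex of colour c whose parent dart is p (nothing for the root)
  goVertex : Color → Maybe ℕ → Tree → St → St
  goVertex c p (node is) s with goItems c is s
  ... | ds , st f r e sm = st f (r ++ [ (c , addParent p ds) ]) e sm

  goItems : Color → List Item → St → List ℕ × St
  goItems c [] s = [] , s
  goItems c (stem x ∷ is) (st f r e sm) with goItems c is (st (suc f) r e (sm ++ [ (f , x) ]))
  ... | ds , s' = f ∷ ds , s'
  goItems c (child t ∷ is) (st f r e sm)
    with goItems c is (goVertex (flipC c) (just (suc f)) t (st (suc (suc f)) r (e ++ [ (f , suc f) ]) sm))
  ... | ds , s' = f ∷ ds , s'

  addParent : Maybe ℕ → List ℕ → List ℕ
  addParent nothing  ds = ds
  addParent (just u) ds = u ∷ ds

-- linear parenthesis matching: returns (matched pairs, unmatched closing stems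
-- in contour order, stack of unmatched opening stems, last one first)
linMatch : List (ℕ × Stem) → List ℕ → List (ℕ × ℕ) × List ℕ × List ℕ
linMatch []                     stk       = [] , [] , stk
linMatch ((x , opening) ∷ xs)   stk       = linMatch xs (x ∷ stk)
linMatch ((x , closing) ∷ xs)   (o ∷ stk) with linMatch xs stk
... | ps , cs , stk' = (o , x) ∷ ps , cs , stk'
linMatch ((x , closing) ∷ xs)   []        with linMatch xs []
... | ps , cs , stk' = ps , x ∷ cs , stk'

-- cyclic completion: the remaining word is  )^a (^b ; match cyclically.
-- returns (pairs, unmatched stems in contour order)
cycMatch : List ℕ → List ℕ → List (ℕ × ℕ) × List ℕ
cycMatch (o ∷ os) (c ∷ cs) with cycMatch os cs
... | ps , us = (o , c) ∷ ps , us
cycMatch os [] = [] , reverse os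
cycMatch [] cs = [] , cs

nextCyc : List ℕ → ℕ → Maybe ℕ
nextCyc []       x = nothing
nextCyc (a ∷ as) x = go a (a ∷ as)
  where
  go : ℕ → List ℕ → Maybe ℕ
  go h []           = nothing
  go h (b ∷ [])     = if b ≡ᵇ x then just h else nothing
  go h (b ∷ c ∷ bs) = if b ≡ᵇ x then just c else go h (c ∷ bs)

lookupRot : List (Color × List ℕ) → ℕ → Maybe (Color × ℕ)
lookupRot []              x = nothing
lookupRot ((c , l) ∷ rs)  x with nextCyc l x
... | just y  = just (c , y)
... | nothing = lookupRot rs x

lookupPair : List (ℕ × ℕ) → ℕ → Maybe ℕ
lookupPair []             x = nothing
lookupPair ((a , b) ∷ ps) x =
  if a ≡ᵇ x then just b else if b ≡ᵇ x then just a else lookupPair ps x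

toFinOr : {m : ℕ} → Maybe ℕ → Fin m → Fin m
toFinOr {m} nothing  d = d
toFinOr {m} (just y) d with y <? m
... | yes p = fromℕ< p
... | no  _ = d

-- the raw closure data of a tree: number of darts, rotations, edge pairing,
-- number N of darts of the tree (darts ≥ N are the darts of τ)
record Raw : Set where
  constructor raw
  field
    total : ℕ
    N     : ℕ
    rs    : List (Color × List ℕ)
    pairs : List (ℕ × ℕ)

closureRaw : BTree → Raw
closureRaw (c , t) with goVertex c nothing t (st 0 [] [] [])
... | st N r e sm with linMatch sm []
...   | ps , cs , stk with cycMatch stk cs
...     | ps' , us =
  raw (N + length us) N (r ++ [ (τcol , reverse τdarts) ]) (e ++ ps ++ ps' ++ τedges)
  where
  τcol : Color
  τcol = if nOpen t <ᵇ nClose t then black else white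
  -- the i-th unmatched stem u_i (contour order) is joined to the dart N+i of τ;
  -- clockwise around τ these darts appear in the reverse order
  τdarts : List ℕ
  τdarts = map (N +_) (upTo (length us))
  zipIdx : ℕ → List ℕ → List (ℕ × ℕ)
  zipIdx i []       = []
  zipIdx i (u ∷ xs) = (u , N + i) ∷ zipIdx (suc i) xs
  τedges : List (ℕ × ℕ)
  τedges = zipIdx 0 us

rawToMap : Raw → Map
rawToMap (raw zero N rs ps) =    -- only for the single-vertex tree (never used)
  record { n = 1 ; σ = λ x → x ; α = λ x → x ; root = Data.Fin.Base.zero
         ; color = λ _ → black ; marked = λ _ → false }
rawToMap (raw (suc D) N rs ps) = record
  { n      = suc D
  ; σ      = λ x → toFinOr (Data.Maybe.Base.map proj₂ (lookupRot rs (toℕ x))) x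
  ; α      = λ x → toFinOr (lookupPair ps (toℕ x)) x
  ; root   = Data.Fin.Base.zero      -- dart 0 = first dart after the root corner
  ; color  = λ x → Data.Maybe.Base.maybe proj₁ black (lookupRot rs (toℕ x))
  ; marked = λ x → N ≤ᵇ toℕ x
  }

completeClosure : BTree → Map
completeClosure t = rawToMap (closureRaw t)

rootColorTree : BTree → Color
rootColorTree = proj₁

record ClosureBijection (j : ℤ) (Target : Map → Set) : Set where
  field
    into      : ∀ t → InT j t → Target (completeClosure t)
    injective : ∀ t t' → InT j t → InT j t' →
                completeClosure t ≅ completeClosure t' → t ≡ t'
    onto      : ∀ m → Target m → Σ BTree λ t → InT j t × (completeClosure t ≅ m)
    pres-degrees   : ∀ t → InT j t → degDistTree t ↭ degDistMap (completeClosure t)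
    pres-rootColor : ∀ t → InT j t → rootColor (completeClosure t) ≡ rootColorTree t

-- Let N exceed the number of darts.  A spanning tree T of the map without τ corresponds to a flow x on
-- darts, antisymmetric along edges, in which every vertex other than the root vertex and τ absorbs one
-- unit per dart and every edge outside T carries N units from its black to its white end.  Conservation
-- gives the edge above a subtree with s darts the value N · charge - s, so the charge conditions say
-- precisely that the edges of T are those carrying less than N.  Summing a flow over a cut bounds the
-- weight of the cut from below, which is (strict) tightness.
--
-- Uniqueness: the difference of the flows of two such trees is the coboundary of a height on the faces.
-- Heights cannot increase across an opening-closing pair of the first tree and cannot decrease across
-- one of the second, and they agree around τ; so both flows, hence both trees, coincide.
--
-- Existence: by max-flow min-cut, tightness provides a flow.  A search through the faces, starting from
-- those around τ and raising the heights of the faces already reached, saturates one edge per new face.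
-- Modulo N the unsaturated edges connect all vertices, and Euler's formula leaves room for no other
-- edge.  The last face reached is bordered by tree edges except for the edge entering it, whose two
-- stems are therefore adjacent in the contour: deleting such pairs in turn is the parenthesis matching.

module Submission where

open import Defs
open import Data.Bool.Base using (Bool; true; false; if_then_else_; not; _∧_; _∨_; T)
open import Data.Nat.Base using (ℕ; zero; suc; _+_; _*_; _≤_; _<_; _≡ᵇ_; _≤ᵇ_; _<ᵇ_; z≤n; s≤s)
import Data.Nat.Properties as ℕ
open import Data.Integer.Base as ℤ using (ℤ; _⊖_; +_; -_; 0ℤ; 1ℤ)
import Data.Integer.Properties as ℤ
open import Data.Integer.Tactic.RingSolver using (solve-∀)
import Data.Nat.Tactic.RingSolver as ℕSolver
open import Data.Fin.Base using (Fin; toℕ)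
import Data.Fin.Properties as Fin
open import Data.List.Base using (List; []; _∷_; _++_; [_]; length; filterᵇ; upTo; allFin; reverse; map; concat)
import Data.List.Properties as List
open import Data.Maybe.Base using (Maybe; just; nothing)
open import Data.Product.Base using (_×_; _,_; proj₁; proj₂; ∃; ∃₂)
open import Data.Sum.Base using (_⊎_; inj₁; inj₂)
open import Data.Empty using (⊥; ⊥-elim)
open import Data.Unit.Base using (⊤; tt)
open import Data.List.Membership.Propositional as ∈ using (_∈_; _∉_)
import Data.List.Membership.Propositional.Properties as ∈
open import Data.List.Relation.Unary.Any using (here; there)
import Data.List.Relation.Unary.Any.Properties as Any
import Data.Bool.ListAction
open import Data.List.Relation.Binary.Pointwise as Pointwise using (Pointwise; []; _∷_)
open import Data.List.Relation.Unary.All as All using (All; []; _∷_)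
import Data.List.Relation.Unary.All.Properties as All
open import Data.List.Relation.Unary.AllPairs using ([]; _∷_)
open import Data.List.Relation.Unary.Unique.Propositional using (Unique)
import Data.List.Relation.Unary.Unique.Propositional.Properties as Unique
open import Data.List.Relation.Binary.Permutation.Propositional using (_↭_; refl; prep; swap; trans; ↭-sym; ↭-reflexive; module PermutationReasoning)
import Data.List.Relation.Binary.Permutation.Propositional.Properties as ↭
open import Relation.Binary.PropositionalEquality using (_≡_; _≢_; refl; sym; cong; cong₂; subst; module ≡-Reasoning)
import Relation.Binary.PropositionalEquality as ≡
open import Relation.Nullary.Decidable using (Dec; yes; no; does; T?; _×-dec_; _⊎-dec_)
import Data.Bool.Properties as Bool
open import Function.Bundles using (mk↔ₛ′; Inverse)
open import Function.Base using (_∘_; id; case_of_)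

-- The numbering of darts by the closure algorithm is the obstacle. It is confined by `Structure`: a
-- forest labelled by the darts of a map, together with the stems left for τ. Every closure carries
-- such a forest, a map carrying one is isomorphic to the closure of its shape, and the theorem
-- becomes existence and uniqueness of the forest in a tight map. The unit absorbed per dart is a
-- perturbation that breaks ties. Capacities are multiples of `N`, while a nonempty set of vertices
-- away from the root vertex and τ absorbs strictly between 0 and `N`; so saturated edges alone
-- never separate such a set. The sign of the perturbation distinguishes the two families: it yields
-- the bounds 1 for black and 0 for white charges, and it makes the trivial cut the unique minimum
-- for white τ but possibly one of several for black τ. Only the flow from black to white is
-- bounded, which is why cuts of a single colour are the relevant ones.

private variable
  A B : Set

-- Lists without repetition and permutations

∷-uniq : {x : A} {l : List A} → x ∉ l → Unique l → Unique (x ∷ l)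
∷-uniq x∉ u = All.¬Any⇒All¬ _ x∉ ∷ u

uniq-head : {x : A} {l : List A} → Unique (x ∷ l) → x ∉ l
uniq-head (a ∷ _) = All.All¬⇒¬Any a

uniq-tail : {x : A} {l : List A} → Unique (x ∷ l) → Unique l
uniq-tail (_ ∷ u) = u

uniq-↭ : {l l' : List A} → l ↭ l' → Unique l → Unique l'
uniq-↭ refl u = u
uniq-↭ (prep x p) u = ∷-uniq (λ i → uniq-head u (↭.∈-resp-↭ (↭-sym p) i)) (uniq-↭ p (uniq-tail u))
uniq-↭ (swap x y p) ((x≢y ∷ x≢) ∷ (y≢ ∷ u)) =
  ((λ e → x≢y (sym e)) ∷ ↭.All-resp-↭ p y≢) ∷ (↭.All-resp-↭ p x≢ ∷ uniq-↭ p u)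
uniq-↭ (trans p q) u = uniq-↭ q (uniq-↭ p u)

uniq-++ˡ : (u : List A) {v : List A} → Unique (u ++ v) → Unique u
uniq-++ˡ [] _ = []
uniq-++ˡ (x ∷ u) q = ∷-uniq (λ i → uniq-head q (∈.∈-++⁺ˡ i)) (uniq-++ˡ u (uniq-tail q))

uniq-++ʳ : (u : List A) {v : List A} → Unique (u ++ v) → Unique v
uniq-++ʳ [] q = q
uniq-++ʳ (x ∷ u) q = uniq-++ʳ u (uniq-tail q)

uniq-disj : (u : List A) {v : List A} → Unique (u ++ v) → ∀ {x} → x ∈ u → x ∉ v
uniq-disj (x ∷ u) q (here refl) j = uniq-head q (∈.∈-++⁺ʳ u j)
uniq-disj (x ∷ u) q (there i) j = uniq-disj u (uniq-tail q) i j

uniq-++ : (u : List A) {v : List A} → Unique u → Unique v → (∀ {x} → x ∈ u → x ∉ v) → Unique (u ++ v)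
uniq-++ u p q d = Unique.++⁺ p q (λ (i , j) → d i j)

∈-split : {x : A} {l : List A} → x ∈ l → ∃₂ λ u v → l ≡ u ++ x ∷ v
∈-split = ∈.∈-∃++

∈-↭ : {x : A} {l : List A} → x ∈ l → ∃ λ l' → l ↭ x ∷ l'
∈-↭ i with u , v , refl ← ∈-split i = u ++ v , ↭.shift _ u v

sub-↭ : {l m : List A} → Unique l → (∀ {x} → x ∈ l → x ∈ m) → ∃ λ r → m ↭ l ++ r
sub-↭ {l = []} {m} _ s = m , refl
sub-↭ {l = x ∷ l} {m} u s with m' , p ← ∈-↭ (s (here refl)) = r , trans p (prep x q)
  where
  s' : ∀ {y} → y ∈ l → y ∈ m'
  s' i with ↭.∈-resp-↭ p (s (there i))
  ... | here refl = ⊥-elim (uniq-head u i)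
  ... | there j = j
  r = proj₁ (sub-↭ (uniq-tail u) s')
  q = proj₂ (sub-↭ (uniq-tail u) s')

sub-length : {l m : List A} → Unique l → (∀ {x} → x ∈ l → x ∈ m) → length l ≤ length m
sub-length {l = l} u s with r , p ← sub-↭ u s =
  subst (length l ≤_) (≡.trans (sym (List.length-++ l)) (sym (↭.↭-length p))) (ℕ.m≤m+n _ _)

-- Pigeonhole. With `m` the list of all darts it turns a count into the statement that `l` is
-- exhaustive.
sub-full : {l m : List A} → Unique l → (∀ {x} → x ∈ l → x ∈ m) → length m ≤ length l → m ↭ l
sub-full {l = l} u s le with sub-↭ u s
... | [] , p = subst (_ ↭_) (List.++-identityʳ l) p
... | (x ∷ r) , p = ⊥-elim (ℕ.<-irrefl refl (ℕ.<-≤-trans (subst (length l <_)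
    (≡.trans (ℕ.+-comm (suc (length r)) (length l)) (≡.trans (sym (List.length-++ l)) (sym (↭.↭-length p)))) (s≤s (ℕ.m≤n+m _ _))) le))

same-↭ : {l m : List A} → Unique l → Unique m → (∀ {x} → x ∈ l → x ∈ m) → (∀ {x} → x ∈ m → x ∈ l) → l ↭ m
same-↭ ul um s t = sub-full um t (sub-length ul s)

uniq-map : {f : A → B} {l : List A} → Unique (map f l) → ∀ {x y} → x ∈ l → y ∈ l → f x ≡ f y → x ≡ y
uniq-map {l = _ ∷ _} u (here refl) (here refl) e = refl
uniq-map {f = f} {l = _ ∷ l} u (here refl) (there j) e = ⊥-elim (uniq-head u (subst (_∈ map f l) (sym e) (∈.∈-map⁺ f j)))
uniq-map {f = f} {l = _ ∷ l} u (there i) (here refl) e = ⊥-elim (uniq-head u (subst (_∈ map f l) e (∈.∈-map⁺ f i)))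
uniq-map {l = _ ∷ _} u (there i) (there j) e = uniq-map (uniq-tail u) i j e

concat-↭ : {l m : List (List A)} → l ↭ m → concat l ↭ concat m
concat-↭ refl = refl
concat-↭ (prep x p) = ↭.++⁺ˡ x (concat-↭ p)
concat-↭ (swap x y p) = trans (↭.shifts x y) (↭.++⁺ˡ y (↭.++⁺ˡ x (concat-↭ p)))
concat-↭ (trans p q) = trans (concat-↭ p) (concat-↭ q)

-- Cyclic lists

Chain : (A → A → Set) → A → List A → A → Set
Chain R x [] y = R x y
Chain R x (z ∷ l) y = R x z × Chain R z l y

-- Built on a relation rather than a function, so that it serves for orbits of a permutation, for
-- the stems met around τ and for cyclic sequences of gaps alike.
Cyc : (A → A → Set) → List A → Set
Cyc R [] = ⊤
Cyc R (x ∷ l) = Chain R x l x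

module _ {R : A → A → Set} where

  chain-++ : ∀ {x} l {z} {m} {y} → Chain R x l z → Chain R z m y → Chain R x (l ++ z ∷ m) y
  chain-++ [] r c = r , c
  chain-++ (w ∷ l) (r , c) d = r , chain-++ l c d

  chain-split : ∀ {x} l {z} {m} {y} → Chain R x (l ++ z ∷ m) y → Chain R x l z × Chain R z m y
  chain-split [] (r , c) = r , c
  chain-split (w ∷ l) (r , c) with p , q ← chain-split l c = (r , p) , q

  cyc-rot : ∀ u v → Cyc R (u ++ v) → Cyc R (v ++ u)
  cyc-rot [] v c = subst (Cyc R) (sym (List.++-identityʳ v)) c
  cyc-rot (x ∷ u) [] c = subst (Cyc R) (List.++-identityʳ (x ∷ u)) c
  cyc-rot (x ∷ u) (y ∷ v) c with p , q ← chain-split u c = chain-++ v q p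

  chain-closed : {P : A → Set} → (∀ {x y} → R x y → P x → P y) → ∀ {x y} l → Chain R x l y → P x → All P l × P y
  chain-closed f [] r p = [] , f r p
  chain-closed f (z ∷ l) (r , c) p with q , q' ← chain-closed f l c (f r p) = f r p ∷ q , q'

  cyc-closed : {P : A → Set} → (∀ {x y} → R x y → P x → P y) → ∀ {x} l → Cyc R l → x ∈ l → P x → All P l
  cyc-closed f l c i p with u , v , refl ← ∈-split i
    with a , b ← All.++⁻ v (proj₁ (chain-closed f (v ++ u) (cyc-rot u (_ ∷ v) c) p)) = All.++⁺ b (p ∷ a)

  cyc-next : ∀ {x} l → Cyc R l → x ∈ l → ∃ λ y → R x y × y ∈ l
  cyc-next l c i with u , v , refl ← ∈-split i with v ++ u in eq | cyc-rot u (_ ∷ v) c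
  ... | [] | r = _ , r , i
  ... | y ∷ w | (r , _) = y , r , ↭.∈-resp-↭ (↭.++-comm (_ ∷ v) u) (there (subst (_ ∈_) (sym eq) (here refl)))

chain-map : {R : A → A → Set} {S : B → B → Set} (f : A → B) → ∀ {x y} l →
  (∀ {a b} → a ∈ (x ∷ l) → R a b → S (f a) (f b)) → Chain R x l y → Chain S (f x) (map f l) (f y)
chain-map f [] h r = h (here refl) r
chain-map f (z ∷ l) h (r , c) = h (here refl) r , chain-map f l (λ i → h (there i)) c

cyc-map : {R : A → A → Set} {S : B → B → Set} (f : A → B) → ∀ l →
  (∀ {a b} → a ∈ l → R a b → S (f a) (f b)) → Cyc R l → Cyc S (map f l)
cyc-map f [] h c = tt
cyc-map f (x ∷ l) h c = chain-map f l h c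

chain-imp : {R S : A → A → Set} → ∀ {x y} l → (∀ {a b} → a ∈ (x ∷ l) → R a b → S a b) → Chain R x l y → Chain S x l y
chain-imp [] h r = h (here refl) r
chain-imp (z ∷ l) h (r , c) = h (here refl) r , chain-imp l (λ i → h (there i)) c

chain-both : {R : A → A → Set} {M : List A} → ∀ {x y} l → x ∈ M → (∀ {z} → z ∈ l → z ∈ M) → y ∈ M → Chain R x l y → Chain (λ a b → R a b × a ∈ M × b ∈ M) x l y
chain-both [] i s j r = r , i , j
chain-both (z ∷ l) i s j (r , c) = (r , i , s (here refl)) , chain-both l (s (here refl)) (s ∘ there) j c

cyc-both : {R : A → A → Set} → ∀ l → Cyc R l → Cyc (λ a b → R a b × a ∈ l × b ∈ l) l
cyc-both [] c = tt
cyc-both (x ∷ l) c = chain-both l (here refl) there (here refl) c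

chain-rev : {R : A → A → Set} → ∀ {x y} l → Chain R x l y → Chain (λ a b → R b a) y (reverse l) x
chain-rev [] r = r
chain-rev {R = R} (z ∷ l) (r , c) = subst (λ w → Chain (λ a b → R b a) _ w _) (sym (List.unfold-reverse z l))
  (chain-++ (reverse l) (chain-rev l c) r)

cyc-rev : {R : A → A → Set} → ∀ l → Cyc R l → Cyc (λ a b → R b a) (reverse l)
cyc-rev [] c = tt
cyc-rev {R = R} (x ∷ l) c = subst (Cyc _) (sym (List.unfold-reverse x l))
  (cyc-rot [ x ] (reverse l) (chain-rev l c))

Graph : (A → A) → A → A → Set
Graph f x y = f x ≡ y

chain-shift : (f : A → A) → ∀ {x y} l → Chain (Graph f) x l y → map f (x ∷ l) ≡ l ++ [ y ]
chain-shift f [] refl = refl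
chain-shift f (z ∷ l) (refl , c) = cong (_ ∷_) (chain-shift f l c)

cyc-shift : (f : A → A) → ∀ l → Cyc (Graph f) l → map f l ↭ l
cyc-shift f [] c = refl
cyc-shift f (x ∷ l) c = subst (_↭ x ∷ l) (sym (chain-shift f l c)) (↭-sym (↭.∷↭∷ʳ x l))

cycs-shift : (f : A → A) → ∀ ls → All (Cyc (Graph f)) ls → map f (concat ls) ↭ concat ls
cycs-shift f [] c = refl
cycs-shift f (l ∷ ls) (c ∷ cs) = subst (_↭ l ++ concat ls) (sym (List.map-++ f l (concat ls)))
  (↭.++⁺ (cyc-shift f l c) (cycs-shift f ls cs))

cyc-sub : {f : A → A} → ∀ {x} l m → Cyc (Graph f) l → Cyc (Graph f) m → x ∈ l → x ∈ m → ∀ {y} → y ∈ l → y ∈ m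
cyc-sub {f = f} l m cl cm i j k = All.lookup (cyc-closed stay l cl i j) k
  where
  stay : ∀ {x y} → f x ≡ y → x ∈ m → y ∈ m
  stay refl i with y , refl , h ← cyc-next m cm i = h

cyc-↭ : {f : A → A} → ∀ {x} {l m} → Unique l → Unique m → Cyc (Graph f) l → Cyc (Graph f) m → x ∈ l → x ∈ m → l ↭ m
cyc-↭ {l = l} {m} ul um cl cm i j = same-↭ ul um (cyc-sub l m cl cm i j) (cyc-sub m l cm cl j i)

chain-≡ : {f : A → A} → ∀ {x y y'} l m → Chain (Graph f) x l y → Chain (Graph f) x m y' → length l ≡ length m → l ≡ m
chain-≡ [] [] _ _ _ = refl
chain-≡ (z ∷ l) (w ∷ m) (refl , c) (refl , d) e = cong (_ ∷_) (chain-≡ l m c d (ℕ.suc-injective e))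

-- Integer sums over lists

∑ : (A → ℤ) → List A → ℤ
∑ g [] = 0ℤ
∑ g (x ∷ l) = g x ℤ.+ ∑ g l

∑-++ : (g : A → ℤ) → ∀ l m → ∑ g (l ++ m) ≡ ∑ g l ℤ.+ ∑ g m
∑-++ g [] m = sym (ℤ.+-identityˡ _)
∑-++ g (x ∷ l) m = ≡.trans (cong (λ s → g x ℤ.+ s) (∑-++ g l m)) (sym (ℤ.+-assoc (g x) _ _))

∑-↭ : (g : A → ℤ) → ∀ {l m} → l ↭ m → ∑ g l ≡ ∑ g m
∑-↭ g refl = refl
∑-↭ g (prep x p) = cong (λ s → g x ℤ.+ s) (∑-↭ g p)
∑-↭ g (swap x y p) = ≡.trans (cong (λ s → g x ℤ.+ (g y ℤ.+ s)) (∑-↭ g p)) (lem (g x) (g y) _)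
  where
  lem : ∀ a b c → a ℤ.+ (b ℤ.+ c) ≡ b ℤ.+ (a ℤ.+ c)
  lem = solve-∀
∑-↭ g (trans p q) = ≡.trans (∑-↭ g p) (∑-↭ g q)

∑-cong : {g h : A → ℤ} → ∀ l → (∀ {x} → x ∈ l → g x ≡ h x) → ∑ g l ≡ ∑ h l
∑-cong [] e = refl
∑-cong (x ∷ l) e = cong₂ ℤ._+_ (e (here refl)) (∑-cong l (e ∘ there))

∑-+ : (g h : A → ℤ) → ∀ l → ∑ (λ x → g x ℤ.+ h x) l ≡ ∑ g l ℤ.+ ∑ h l
∑-+ g h [] = refl
∑-+ g h (x ∷ l) = ≡.trans (cong (λ s → (g x ℤ.+ h x) ℤ.+ s) (∑-+ g h l)) (lem (g x) (h x) _ _)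
  where
  lem : ∀ a b c d → (a ℤ.+ b) ℤ.+ (c ℤ.+ d) ≡ (a ℤ.+ c) ℤ.+ (b ℤ.+ d)
  lem = solve-∀

∑-* : (k : ℤ) (g : A → ℤ) → ∀ l → ∑ (λ x → k ℤ.* g x) l ≡ k ℤ.* ∑ g l
∑-* k g [] = sym (ℤ.*-zeroʳ k)
∑-* k g (x ∷ l) = ≡.trans (cong (λ s → k ℤ.* g x ℤ.+ s) (∑-* k g l)) (sym (ℤ.*-distribˡ-+ k (g x) _))

∑-neg : (g : A → ℤ) → ∀ l → ∑ (λ x → - g x) l ≡ - ∑ g l
∑-neg g [] = refl
∑-neg g (x ∷ l) = ≡.trans (cong (λ s → - g x ℤ.+ s) (∑-neg g l)) (sym (ℤ.neg-distrib-+ (g x) _))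

∑-0 : (l : List A) → ∑ (λ _ → 0ℤ) l ≡ 0ℤ
∑-0 [] = refl
∑-0 (x ∷ l) = ≡.trans (ℤ.+-identityˡ _) (∑-0 l)

∑-map : (f : A → B) (g : B → ℤ) → ∀ l → ∑ g (map f l) ≡ ∑ (g ∘ f) l
∑-map f g [] = refl
∑-map f g (x ∷ l) = cong (λ s → g (f x) ℤ.+ s) (∑-map f g l)

∑-mono : {g h : A → ℤ} → ∀ l → (∀ {x} → x ∈ l → g x ℤ.≤ h x) → ∑ g l ℤ.≤ ∑ h l
∑-mono [] e = ℤ.≤-refl
∑-mono (x ∷ l) e = ℤ.+-mono-≤ (e (here refl)) (∑-mono l (e ∘ there))

∑-swap : (g : A → B → ℤ) → ∀ l m → ∑ (λ x → ∑ (g x) m) l ≡ ∑ (λ y → ∑ (λ x → g x y) l) m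
∑-swap g [] m = sym (∑-0 m)
∑-swap g (x ∷ l) m = ≡.trans (cong (λ s → ∑ (g x) m ℤ.+ s) (∑-swap g l m)) (sym (∑-+ (g x) (λ y → ∑ (λ x → g x y) l) m))

bit : Bool → ℤ
bit true = 1ℤ
bit false = 0ℤ

∑-count : (p : A → Bool) → ∀ l → ∑ (bit ∘ p) l ≡ + count p l
∑-count p [] = refl
∑-count p (x ∷ l) with p x
... | true = cong (λ s → 1ℤ ℤ.+ s) (∑-count p l)
... | false = ≡.trans (ℤ.+-identityˡ _) (∑-count p l)

∑-length : (l : List A) → ∑ (λ _ → 1ℤ) l ≡ + length l
∑-length [] = refl
∑-length (x ∷ l) = cong (λ s → 1ℤ ℤ.+ s) (∑-length l)

T→≡ : ∀ {b} → T b → b ≡ true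
T→≡ {true} _ = refl

≡→T : ∀ {b} → b ≡ true → T b
≡→T refl = tt

filter-same : (p : A → Bool) {l m : List A} → Unique l → Unique m →
  (∀ {x} → x ∈ l → T (p x) → x ∈ m) → (∀ {x} → x ∈ m → x ∈ l × T (p x)) → filterᵇ p l ↭ m
filter-same p ul um s t = same-↭ (Unique.filter⁺ (T? ∘ p) ul) um
  (λ i → let a , b = ∈.∈-filter⁻ (T? ∘ p) i in s a b)
  (λ i → let a , b = t i in ∈.∈-filter⁺ (T? ∘ p) a b)

-- Cycle decompositions of permutations of the darts

iter-suc : (f : A → A) → ∀ k x → iter f k (f x) ≡ f (iter f k x)
iter-suc f zero x = refl
iter-suc f (suc k) x = cong f (iter-suc f k x)

chain-iter : (f : A → A) → ∀ {x y z} l → Chain (Graph f) x l z → y ∈ (x ∷ l) → ∃ λ k → k < suc (length l) × iter f k x ≡ y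
chain-iter f l c (here refl) = 0 , s≤s z≤n , refl
chain-iter f (_ ∷ l) (refl , c) (there i) with k , k< , e ← chain-iter f l c i =
  suc k , s≤s k< , ≡.trans (sym (iter-suc f k _)) e

cyc-iter : (f : A → A) → ∀ {x y} l → Cyc (Graph f) l → x ∈ l → y ∈ l → ∃ λ k → k < length l × iter f k x ≡ y
cyc-iter f l c i j with u , v , refl ← ∈-split i
  with k , k< , e ← chain-iter f (v ++ u) (cyc-rot u (_ ∷ v) c) (↭.∈-resp-↭ (↭.++-comm u (_ ∷ v)) j) =
  k , subst (k <_) (sym (↭.↭-length (↭.++-comm u (_ ∷ v)))) k< , e

iter-∈ : (f : A → A) → ∀ {x} l → Cyc (Graph f) l → x ∈ l → ∀ k → iter f k x ∈ l
iter-∈ f l c i zero = i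
iter-∈ f l c i (suc k) with y , refl , h ← cyc-next l c (iter-∈ f l c i k) = h

concat-disj : ∀ {x : A} (L : List (List A)) → Unique (concat L) → ∀ {c d} → c ∈ L → d ∈ L → x ∈ c → x ∈ d → c ≡ d
concat-disj (c ∷ L) u (here refl) (here refl) i j = refl
concat-disj (c ∷ L) u (here refl) (there q) i j = ⊥-elim (uniq-disj c u i (∈.∈-concat⁺′ j q))
concat-disj (c ∷ L) u (there p) (here refl) i j = ⊥-elim (uniq-disj c u j (∈.∈-concat⁺′ i p))
concat-disj (c ∷ L) u (there p) (there q) i j = concat-disj L (uniq-++ʳ c u) p q i j

concat-uniq : (L : List (List A)) → Unique (concat L) → ∀ {c} → c ∈ L → Unique c
concat-uniq (c ∷ L) u (here refl) = uniq-++ˡ c u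
concat-uniq (c ∷ L) u (there i) = concat-uniq L (uniq-++ʳ c u) i

pointwise-∈ˡ : {R : A → B → Set} → ∀ {l m} → Pointwise R l m → ∀ {x} → x ∈ l → ∃ λ y → y ∈ m × R x y
pointwise-∈ˡ (r ∷ p) (here refl) = _ , here refl , r
pointwise-∈ˡ (r ∷ p) (there i) with y , j , s ← pointwise-∈ˡ p i = y , there j , s

pointwise-∈ʳ : {R : A → B → Set} → ∀ {l m} → Pointwise R l m → ∀ {y} → y ∈ m → ∃ λ x → x ∈ l × R x y
pointwise-∈ʳ (r ∷ p) (here refl) = _ , here refl , r
pointwise-∈ʳ (r ∷ p) (there i) with y , j , s ← pointwise-∈ʳ p i = y , there j , s

transversal-uniq : {L : List (List A)} {ms : List A} → Unique (concat L) → Pointwise (λ c x → x ∈ c) L ms → Unique ms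
transversal-uniq u [] = []
transversal-uniq {L = c ∷ L} u (r ∷ p) = ∷-uniq
  (λ i → let d , d∈ , j = pointwise-∈ʳ p i in uniq-disj c u r (∈.∈-concat⁺′ j d∈)) (transversal-uniq (uniq-++ʳ c u) p)

IsMin : ∀ {n} → List (Fin n) → Fin n → Set
IsMin c m = m ∈ c × (∀ {y} → y ∈ c → toℕ m ≤ toℕ y)

minimum : ∀ {n} (x : Fin n) l → ∃ (IsMin (x ∷ l))
minimum x [] = x , here refl , λ { (here refl) → ℕ.≤-refl }
minimum x (z ∷ l) with m , i , le ← minimum z l with ℕ.≤-total (toℕ x) (toℕ m)
... | inj₁ q = x , here refl , λ { (here refl) → ℕ.≤-refl ; (there j) → ℕ.≤-trans q (le j) }
... | inj₂ q = m , there i , λ { (here refl) → q ; (there j) → le j }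

Inhabited : List A → Set
Inhabited l = ∃ λ x → x ∈ l

minima : ∀ {n} {M : List (List (Fin n))} → All Inhabited M → ∃ λ ms → Pointwise IsMin M ms
minima [] = [] , []
minima {M = (x ∷ l) ∷ M} (_ ∷ h) = proj₁ (minimum x l) ∷ proj₁ (minima h) , proj₂ (minimum x l) ∷ proj₂ (minima h)

-- Links the definitions that iterate a permutation `n` times (`numOrbits`, `degreeAt`,
-- `sameVertexᵇ`) with explicit cycles: a listed cycle has at most `n` elements, so `n` iterations
-- see all of it.
record Decomp {n} (f : Fin n → Fin n) (L : List (List (Fin n))) : Set where
  field
    cycles : All (Cyc (Graph f)) L
    inhabited : All Inhabited L
    cover : concat L ↭ allFin n

  uniq : Unique (concat L)
  uniq = uniq-↭ (↭-sym cover) (Unique.allFin⁺ n)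

  cycleOf : ∀ x → ∃ λ c → x ∈ c × c ∈ L
  cycleOf x = ∈.∈-concat⁻′ L (↭.∈-resp-↭ (↭-sym cover) (∈.∈-allFin x))

  cyc : ∀ {c} → c ∈ L → Cyc (Graph f) c
  cyc = All.lookup cycles

  short : ∀ {c} → c ∈ L → length c ≤ n
  short i = ℕ.≤-trans (sub-length (concat-uniq L uniq i) (λ _ → ∈.∈-allFin _)) (ℕ.≤-reflexive (List.length-tabulate {n = n} id))

  isLeast : Fin n → Bool
  isLeast x = Data.Bool.ListAction.all (λ k → toℕ x ≤ᵇ toℕ (iter f k x)) (upTo n)

  least⇒ : ∀ {c x} → c ∈ L → x ∈ c → T (isLeast x) → IsMin c x
  least⇒ {c} {x} q i t = i , λ j → let k , k< , e = cyc-iter f c (cyc q) i j in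
    subst (λ z → toℕ x ≤ toℕ z) e
      (ℕ.≤ᵇ⇒≤ _ _ (All.lookup (All.all⁺ (λ k → toℕ x ≤ᵇ toℕ (iter f k x)) (upTo n) t) (∈.∈-upTo⁺ (ℕ.<-≤-trans k< (short q)))))

  least⇐ : ∀ {c x} → c ∈ L → IsMin c x → T (isLeast x)
  least⇐ {c} {x} q (i , le) = All.all⁻ (λ k → toℕ x ≤ᵇ toℕ (iter f k x)) {upTo n}
    (All.tabulate (λ {k} _ → ℕ.≤⇒≤ᵇ (le (iter-∈ f c (cyc q) i k))))

  leasts : ∃ λ ms → Pointwise IsMin L ms
  leasts = minima inhabited

  filter-leasts : filterᵇ isLeast (allFin n) ↭ proj₁ leasts
  filter-leasts = filter-same isLeast (Unique.allFin⁺ n) (transversal-uniq uniq (Pointwise.map proj₁ pw))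
    (λ {x} _ t → let c , i , q = cycleOf x
                     m , j , (k , le) = pointwise-∈ˡ pw q
                     _ , le' = least⇒ q i t
                 in subst (_∈ _) (Fin.toℕ-injective (ℕ.≤-antisym (le i) (le' k))) j)
    (λ j → let c , q , h = pointwise-∈ʳ pw j in ∈.∈-allFin _ , least⇐ q h)
    where pw = proj₂ leasts

  orbits : length (filterᵇ isLeast (allFin n)) ≡ length L
  orbits = ≡.trans (↭.↭-length filter-leasts) (sym (Pointwise.Pointwise-length (proj₂ leasts)))

  inverse : ∃ λ f⁻ → (∀ x → f (f⁻ x) ≡ x) × (∀ x → f⁻ (f x) ≡ x)
  inverse = f⁻ , (λ x → proj₂ (pre x)) , λ x → uniq-map (uniq-↭ (↭-sym (cycs-shift f L cycles)) uniq) (all∈ _) (all∈ _) (proj₂ (pre (f x)))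
    where
    all∈ : ∀ x → x ∈ concat L
    all∈ x = ↭.∈-resp-↭ (↭-sym cover) (∈.∈-allFin x)
    pre : ∀ x → ∃ λ y → f y ≡ x
    pre x with y , _ , e ← ∈.∈-map⁻ f (↭.∈-resp-↭ (↭-sym (cycs-shift f L cycles)) (all∈ x)) = y , sym e
    f⁻ = λ x → proj₁ (pre x)

  same-orbit : ∀ {c x y} → c ∈ L → x ∈ c → y ∈ c → T (Data.Bool.ListAction.any (λ k → iter f k x ≡ᶠᵇ y) (upTo n))
  same-orbit {c} {x} {y} q i j = let k , k< , e = cyc-iter f c (cyc q) i j in
    Any.any⁺ (λ k → iter f k x ≡ᶠᵇ y) (∈.lose (∈.∈-upTo⁺ (ℕ.<-≤-trans k< (short q))) (ℕ.≡⇒≡ᵇ _ _ (cong toℕ e)))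

  orbit-size : ∀ {c x} → c ∈ L → x ∈ c →
    count (λ y → Data.Bool.ListAction.any (λ k → iter f k x ≡ᶠᵇ y) (upTo n)) (allFin n) ≡ length c
  orbit-size {c} {x} q i = ↭.↭-length (filter-same _ (Unique.allFin⁺ n) (concat-uniq L uniq q)
    (λ {y} _ t → let k , _ , e = ∈.find (Any.any⁻ (λ k → iter f k x ≡ᶠᵇ y) (upTo n) t)
               in subst (_∈ c) (Fin.toℕ-injective (ℕ.≡ᵇ⇒≡ _ _ e)) (iter-∈ f c (cyc q) i k))
    (λ {y} j → ∈.∈-allFin _ , same-orbit q i j))

module _ {n} (f f⁻ : Fin n → Fin n) (left : ∀ x → f⁻ (f x) ≡ x) where

  private
    Closed : List (Fin n) → Set
    Closed l = ∀ {d} → d ∈ l → f d ∈ l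

  -- Follows `f` from `x`; `y` is the last dart visited and `Av` holds the unvisited ones. The last
  -- hypothesis says that a visited dart other than `x` already has its preimage before `y`, so the
  -- walk can close up only at `x`.
  cycle-through : ∀ fuel x l y Av → length Av ≤ fuel → Unique ((x ∷ l) ++ Av) → Closed ((x ∷ l) ++ Av) → y ∈ x ∷ l →
    (∀ {z} → f y ≡ z → Chain (Graph f) x l z) → (∀ {z} → z ∈ x ∷ l → z ≡ x ⊎ (f⁻ z ∈ x ∷ l × f⁻ z ≢ y)) →
    ∃₂ λ c Av' → Cyc (Graph f) c × x ∈ c × (x ∷ l) ++ Av ↭ c ++ Av'
  cycle-through fuel x l y Av le u cl y∈ ch pre with ∈.∈-++⁻ (x ∷ l) (cl (∈.∈-++⁺ˡ y∈))
  ... | inj₁ i with pre i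
  ...   | inj₁ e = x ∷ l , Av , ch e , here refl , refl
  ...   | inj₂ (_ , ne) = ⊥-elim (ne (left y))
  cycle-through zero x l y [] le u cl y∈ ch pre | inj₂ ()
  cycle-through (suc fuel) x l y Av le u cl y∈ ch pre | inj₂ i with Av' , p ← ∈-↭ i =
    let c , Av'' , cy , x∈ , q = cycle-through fuel x (l ++ [ f y ]) (f y) Av'
          (ℕ.≤-pred (ℕ.≤-trans (ℕ.≤-reflexive (sym (↭.↭-length p))) le)) (uniq-↭ π u)
          (λ j → ↭.∈-resp-↭ π (cl (↭.∈-resp-↭ (↭-sym π) j))) (∈.∈-++⁺ʳ (x ∷ l) (here refl))
          (λ e → chain-++ l (ch refl) e) pre'
    in c , Av'' , cy , x∈ , trans π q
    where
    π : (x ∷ l) ++ Av ↭ (x ∷ l ++ [ f y ]) ++ Av'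
    π = trans (↭.++⁺ˡ (x ∷ l) p) (↭-reflexive (sym (List.++-assoc (x ∷ l) [ f y ] Av')))
    fresh : ∀ {z} → z ∈ x ∷ l → z ≢ f y
    fresh j e = uniq-disj (x ∷ l) u j (subst (_∈ Av) (sym e) i)
    pre' : ∀ {z} → z ∈ x ∷ l ++ [ f y ] → z ≡ x ⊎ (f⁻ z ∈ x ∷ l ++ [ f y ] × f⁻ z ≢ f y)
    pre' {z} j with ∈.∈-++⁻ (x ∷ l) j
    ... | inj₂ (here refl) = inj₂ (subst (_∈ _) (sym (left y)) (∈.∈-++⁺ˡ y∈) , λ e → fresh y∈ (≡.trans (sym (left y)) e))
    ... | inj₁ k with pre k
    ...   | inj₁ e = inj₁ e
    ...   | inj₂ (a , b) = inj₂ (∈.∈-++⁺ˡ a , fresh a)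

  cycles-of : ∀ fuel Av → length Av ≤ fuel → Unique Av → Closed Av →
    ∃ λ L → All (Cyc (Graph f)) L × All Inhabited L × concat L ↭ Av
  cycles-of fuel [] le u cl = [] , [] , [] , refl
  cycles-of (suc fuel) (x ∷ Av) le u cl
    with c , Av' , cy , x∈ , q ← cycle-through (length Av) x [] x Av ℕ.≤-refl u cl (here refl) id (λ { (here e) → inj₁ e }) =
    let L , a , b , p = cycles-of fuel Av' (ℕ.≤-trans lt (ℕ.≤-pred le)) (uniq-++ʳ c u') cl'
    in c ∷ L , cy ∷ a , (x , x∈) ∷ b , trans (↭.++⁺ˡ c p) (↭-sym q)
    where
    u' = uniq-↭ q u
    lt : length Av' ≤ length Av
    lt = ℕ.≤-pred (ℕ.≤-trans (ℕ.+-monoˡ-≤ (length Av') (∈.∈-length x∈))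
      (ℕ.≤-reflexive (sym (≡.trans (↭.↭-length q) (List.length-++ c)))))
    cl' : Closed Av'
    cl' {d} i with ∈.∈-++⁻ c (↭.∈-resp-↭ q (cl (↭.∈-resp-↭ (↭-sym q) (∈.∈-++⁺ʳ c i))))
    ... | inj₂ j = j
    ... | inj₁ j with e , e∈ , eq ← ∈.∈-map⁻ f (↭.∈-resp-↭ (↭-sym (cyc-shift f c cy)) j) =
      ⊥-elim (uniq-disj c u' (subst (_∈ c) (≡.trans (sym (left e)) (≡.trans (cong f⁻ (sym eq)) (left d))) e∈) i)

  decompose : ∃ (Decomp f)
  decompose with L , a , b , p ← cycles-of n (allFin n) (ℕ.≤-reflexive (List.length-tabulate {n = n} id)) (Unique.allFin⁺ n) (λ _ → ∈.∈-allFin _)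
    = L , record { cycles = a ; inhabited = b ; cover = p }

-- Labelled plane forests

-- Plane trees whose stems and edge sides carry labels; whether a stem opens or closes is
-- determined by the colour of its vertex.  In `edge d d' b r` the dart d lies on the current
-- vertex, d' on the child, b lists what hangs from the child and r what follows d.
data Forest (D : Set) : Set where
  ε    : Forest D
  leaf : D → Forest D → Forest D
  edge : D → D → Forest D → Forest D → Forest D

row : Forest A → List A
row ε = []
row (leaf d r) = d ∷ row r
row (edge d d' b r) = d ∷ row r

-- A vertex comes after its descendants because `goVertex` appends a rotation on the way back. The
-- root vertex is left out: its rotation is `row`.
rots : Color → Forest A → List (Color × List A)
rots c ε = []
rots c (leaf d r) = rots c r
rots c (edge d d' b r) = rots (flipC c) b ++ (flipC c , d' ∷ row b) ∷ rots c r

-- The order in which `goItems` numbers darts: both sides of an edge when it is first met. In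
-- `contour` the far side comes only when the walk returns.
labels : Forest A → List A
labels ε = []
labels (leaf d r) = d ∷ labels r
labels (edge d d' b r) = d ∷ d' ∷ labels b ++ labels r

leaves : Forest A → List A
leaves ε = []
leaves (leaf d r) = d ∷ leaves r
leaves (edge d d' b r) = leaves b ++ leaves r

contour : Forest A → List A
contour ε = []
contour (leaf d r) = d ∷ contour r
contour (edge d d' b r) = d ∷ contour b ++ d' ∷ contour r

edges : Forest A → List (A × A)
edges ε = []
edges (leaf d r) = edges r
edges (edge d d' b r) = (d , d') ∷ edges b ++ edges r

sides : List (A × A) → List A
sides [] = []
sides ((a , b) ∷ ps) = a ∷ b ∷ sides ps

stemOf : Color → Stem
stemOf black = opening
stemOf white = closing

typed : Color → Forest A → List (A × Stem)
typed c ε = []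
typed c (leaf d r) = (d , stemOf c) ∷ typed c r
typed c (edge d d' b r) = typed (flipC c) b ++ typed c r

stemCharge : Color → ℤ
stemCharge black = ℤ.-1ℤ
stemCharge white = 1ℤ

chg : Color → Forest A → ℤ
chg c ε = 0ℤ
chg c (leaf d r) = stemCharge c ℤ.+ chg c r
chg c (edge d d' b r) = chg (flipC c) b ℤ.+ chg c r

Bounded : Color → ℤ → Set
Bounded black z = z ℤ.≤ 1ℤ
Bounded white z = 0ℤ ℤ.≤ z

Charged : Color → Forest A → Set
Charged c ε = ⊤
Charged c (leaf d r) = Charged c r
Charged c (edge d d' b r) = Bounded (flipC c) (chg (flipC c) b) × Charged (flipC c) b × Charged c r

mapF : (A → B) → Forest A → Forest B
mapF g ε = ε
mapF g (leaf d r) = leaf (g d) (mapF g r)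
mapF g (edge d d' b r) = edge (g d) (g d') (mapF g b) (mapF g r)

rows : Color → Forest A → List (List A)
rows c F = row F ∷ map proj₂ (rots c F)

rows-labels : ∀ c (F : Forest A) → concat (rows c F) ↭ labels F
rows-labels c ε = refl
rows-labels c (leaf d r) = prep d (rows-labels c r)
rows-labels c (edge d d' b r) = prep d (begin
    row r ++ concat (map proj₂ (rots (flipC c) b ++ (flipC c , d' ∷ row b) ∷ rots c r))
      ≡⟨ cong (λ z → row r ++ concat z) (List.map-++ proj₂ (rots (flipC c) b) _) ⟩
    row r ++ concat (map proj₂ (rots (flipC c) b) ++ (d' ∷ row b) ∷ map proj₂ (rots c r))
      ≡⟨ cong (row r ++_) (sym (List.concat-++ (map proj₂ (rots (flipC c) b)) _)) ⟩
    row r ++ concat (map proj₂ (rots (flipC c) b)) ++ d' ∷ row b ++ concat (map proj₂ (rots c r))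
      ↭⟨ ↭.shifts (row r) (concat (map proj₂ (rots (flipC c) b))) ⟩
    concat (map proj₂ (rots (flipC c) b)) ++ row r ++ d' ∷ row b ++ concat (map proj₂ (rots c r))
      ↭⟨ ↭.++⁺ˡ (concat (map proj₂ (rots (flipC c) b))) (↭.shifts (row r) (d' ∷ row b)) ⟩
    concat (map proj₂ (rots (flipC c) b)) ++ d' ∷ row b ++ row r ++ concat (map proj₂ (rots c r))
      ↭⟨ ↭.shifts (concat (map proj₂ (rots (flipC c) b))) (d' ∷ row b) ⟩
    d' ∷ row b ++ concat (map proj₂ (rots (flipC c) b)) ++ row r ++ concat (map proj₂ (rots c r))
      ≡⟨ cong (d' ∷_) (sym (List.++-assoc (row b) _ _)) ⟩
    d' ∷ (row b ++ concat (map proj₂ (rots (flipC c) b))) ++ row r ++ concat (map proj₂ (rots c r))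
      ↭⟨ prep d' (↭.++⁺ (rows-labels (flipC c) b) (rows-labels c r)) ⟩
    d' ∷ labels b ++ labels r ∎)
  where open PermutationReasoning

contour-labels : (F : Forest A) → contour F ↭ labels F
contour-labels ε = refl
contour-labels (leaf d r) = prep d (contour-labels r)
contour-labels (edge d d' b r) = prep d (trans (↭.shift d' (contour b) (contour r))
  (prep d' (↭.++⁺ (contour-labels b) (contour-labels r))))

sides-++ : ∀ (ps qs : List (A × A)) → sides (ps ++ qs) ≡ sides ps ++ sides qs
sides-++ [] qs = refl
sides-++ ((a , b) ∷ ps) qs = cong (λ z → a ∷ b ∷ z) (sides-++ ps qs)

sides-leaves : (F : Forest A) → sides (edges F) ++ leaves F ↭ labels F
sides-leaves ε = refl
sides-leaves (leaf d r) = trans (↭.shift d (sides (edges r)) (leaves r)) (prep d (sides-leaves r))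
sides-leaves (edge d d' b r) = prep d (prep d' (begin
    sides (edges b ++ edges r) ++ leaves b ++ leaves r
      ≡⟨ cong (_++ (leaves b ++ leaves r)) (sides-++ (edges b) (edges r)) ⟩
    (sides (edges b) ++ sides (edges r)) ++ leaves b ++ leaves r
      ≡⟨ List.++-assoc (sides (edges b)) _ _ ⟩
    sides (edges b) ++ sides (edges r) ++ leaves b ++ leaves r
      ↭⟨ ↭.++⁺ˡ (sides (edges b)) (↭.shifts (sides (edges r)) (leaves b)) ⟩
    sides (edges b) ++ leaves b ++ sides (edges r) ++ leaves r
      ≡⟨ sym (List.++-assoc (sides (edges b)) _ _) ⟩
    (sides (edges b) ++ leaves b) ++ sides (edges r) ++ leaves r
      ↭⟨ ↭.++⁺ (sides-leaves b) (sides-leaves r) ⟩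
    labels b ++ labels r ∎))
  where open PermutationReasoning

length-sides : (ps : List (A × A)) → length (sides ps) ≡ length ps + length ps
length-sides [] = refl
length-sides (_ ∷ ps) = cong suc (≡.trans (cong suc (length-sides ps)) (sym (ℕ.+-suc _ _)))

length-rots : ∀ c (F : Forest A) → length (rots c F) ≡ length (edges F)
length-rots c ε = refl
length-rots c (leaf d r) = length-rots c r
length-rots c (edge d d' b r) = begin
    length (rots (flipC c) b ++ (flipC c , d' ∷ row b) ∷ rots c r) ≡⟨ List.length-++ (rots (flipC c) b) ⟩
    length (rots (flipC c) b) + suc (length (rots c r)) ≡⟨ ℕ.+-suc _ _ ⟩
    suc (length (rots (flipC c) b) + length (rots c r)) ≡⟨ cong suc (cong₂ _+_ (length-rots (flipC c) b) (length-rots c r)) ⟩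
    suc (length (edges b) + length (edges r)) ≡⟨ cong suc (sym (List.length-++ (edges b))) ⟩
    suc (length (edges b ++ edges r)) ∎
  where open ≡-Reasoning

row⊆labels : ∀ (F : Forest A) {x} → x ∈ row F → x ∈ labels F
row⊆labels F i = ↭.∈-resp-↭ (rows-labels black F) (∈.∈-++⁺ˡ i)

leaves⊆labels : ∀ (F : Forest A) {x} → x ∈ leaves F → x ∈ labels F
leaves⊆labels F i = ↭.∈-resp-↭ (sides-leaves F) (∈.∈-++⁺ʳ (sides (edges F)) i)

row-mapF : ∀ (g : A → B) F → row (mapF g F) ≡ map g (row F)
row-mapF g ε = refl
row-mapF g (leaf d r) = cong (g d ∷_) (row-mapF g r)
row-mapF g (edge d d' b r) = cong (g d ∷_) (row-mapF g r)

labels-mapF : ∀ (g : A → B) F → labels (mapF g F) ≡ map g (labels F)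
labels-mapF g ε = refl
labels-mapF g (leaf d r) = cong (g d ∷_) (labels-mapF g r)
labels-mapF g (edge d d' b r) = cong (λ z → g d ∷ g d' ∷ z)
  (≡.trans (cong₂ _++_ (labels-mapF g b) (labels-mapF g r)) (sym (List.map-++ g (labels b) (labels r))))

leaves-mapF : ∀ (g : A → B) F → leaves (mapF g F) ≡ map g (leaves F)
leaves-mapF g ε = refl
leaves-mapF g (leaf d r) = cong (g d ∷_) (leaves-mapF g r)
leaves-mapF g (edge d d' b r) =
  ≡.trans (cong₂ _++_ (leaves-mapF g b) (leaves-mapF g r)) (sym (List.map-++ g (leaves b) (leaves r)))

chg-mapF : ∀ (g : A → B) c F → chg c (mapF g F) ≡ chg c F
chg-mapF g c ε = refl
chg-mapF g c (leaf d r) = cong (λ z → stemCharge c ℤ.+ z) (chg-mapF g c r)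
chg-mapF g c (edge d d' b r) = cong₂ ℤ._+_ (chg-mapF g (flipC c) b) (chg-mapF g c r)

typed-leaves : ∀ c (F : Forest A) → map proj₁ (typed c F) ≡ leaves F
typed-leaves c ε = refl
typed-leaves c (leaf d r) = cong (d ∷_) (typed-leaves c r)
typed-leaves c (edge d d' b r) = ≡.trans (List.map-++ proj₁ (typed (flipC c) b) (typed c r))
  (cong₂ _++_ (typed-leaves (flipC c) b) (typed-leaves c r))

-- Reduction of stem words, and forests inside a map

-- The words of stems that reduce to us by cyclically deleting adjacent pairs related by P.
data Good (P : A → A → Set) (us : List A) : List A → Set where
  base : Good P us us
  ins  : ∀ {o c w} → P o c → Good P us w → Good P us (o ∷ c ∷ w)
  rot  : ∀ {x w} → Good P us (x ∷ w) → Good P us (w ++ [ x ])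

good-rot : ∀ {P : A → A → Set} {us} u v → Good P us (u ++ v) → Good P us (v ++ u)
good-rot {P = P} {us} [] v g = subst (Good P us) (sym (List.++-identityʳ v)) g
good-rot {P = P} {us} (x ∷ u) v g = subst (Good P us) (List.++-assoc v [ x ] u)
  (good-rot u (v ++ [ x ]) (subst (Good P us) (List.++-assoc u v [ x ]) (rot g)))

good-ins : ∀ {P : A → A → Set} {us} u {o c} v → P o c → Good P us (u ++ v) → Good P us (u ++ o ∷ c ∷ v)
good-ins u v p g = good-rot (_ ∷ _ ∷ v) u (ins p (good-rot u v g))

good-map : ∀ {P : A → A → Set} {Q : B → B → Set} (f : A → B) {us w} → (∀ {x y} → P x y → Q (f x) (f y)) →
  Good P us w → Good Q (map f us) (map f w)
good-map f h base = base
good-map f h (ins p g) = ins (h p) (good-map f h g)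
good-map f h (rot {x} {w} g) = subst (Good _ _) (sym (List.map-++ f w [ x ])) (rot (good-map f h g))

module _ {D : Set} (σ α : D → D) (color : D → Color) where

  -- The rotation of the vertex carrying the forest is not constrained here, since in the recursion
  -- `row` is only the end of a rotation. For the root vertex `Structure.rootRow` adds the
  -- condition.
  Wf : Color → Forest D → Set
  Wf c ε = ⊤
  Wf c (leaf d r) = color d ≡ c × Wf c r
  Wf c (edge d d' b r) = (color d ≡ c × color d' ≡ flipC c × α d ≡ d' × Cyc (Graph σ) (d' ∷ row b))
                         × Wf (flipC c) b × Wf c r

-- States that the map is the complete closure of `F` without reference to any numbering. The stems
-- `us` stay unmatched, in cyclic contour order; by `τ-rot` their other ends turn around τ in the
-- opposite order. All that is proved about closures goes through this record.
record Structure (m : Map) (c τc : Color) (F : Forest (Fin (Map.n m))) (us : List (Fin (Map.n m))) : Set where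
  open Map m
  Pairs : Fin n → Fin n → Set
  Pairs o z = color o ≡ black × color z ≡ white × α o ≡ z
  field
    α-invol : ∀ x → α (α x) ≡ x
    wf      : Wf σ α color c F
    rootRow : Cyc (Graph σ) (row F)
    good    : Good Pairs us (leaves F)
    τ-rot   : Cyc (λ u u' → σ (α u') ≡ α u) us
    us-col  : All (λ u → color u ≡ flipC τc) us
    τ-col   : All (λ u → color (α u) ≡ τc) us
    us-inh  : Inhabited us
    cover   : labels F ++ map α us ↭ allFin n
    mark⇒   : ∀ {x} → marked x ≡ true → x ∈ map α us
    mark⇐   : ∀ {x} → x ∈ map α us → marked x ≡ true
    rootHd  : ∃ λ l → row F ≡ root ∷ l
    charged : Charged c F

-- The closure algorithm computed on labelled forests

goN : ℕ → ℕ → List ℕ → Maybe ℕ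
goN x h []           = nothing
goN x h (b ∷ [])     = if b ≡ᵇ x then just h else nothing
goN x h (b ∷ c ∷ bs) = if b ≡ᵇ x then just c else goN x h (c ∷ bs)

go-unique : ∀ x h (G : List ℕ → Maybe ℕ) → G [] ≡ nothing → (∀ b → G (b ∷ []) ≡ (if b ≡ᵇ x then just h else nothing))
  → (∀ b c bs → G (b ∷ c ∷ bs) ≡ (if b ≡ᵇ x then just c else G (c ∷ bs))) → ∀ l → G l ≡ goN x h l
go-unique x h G e1 e2 e3 [] = e1
go-unique x h G e1 e2 e3 (b ∷ []) = e2 b
go-unique x h G e1 e2 e3 (b ∷ c ∷ bs) = ≡.trans (e3 b c bs) (cong (if b ≡ᵇ x then just c else_) (go-unique x h G e1 e2 e3 (c ∷ bs)))

mutual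
  private
    goM : ℕ → List ℕ → ℕ → List ℕ → Maybe ℕ
    goM = _

  nextCyc-goN : ∀ a as x → nextCyc (a ∷ as) x ≡ goN x a (a ∷ as)
  -- With the list generalised to a variable, the goal applies the function local to `nextCyc` to
  -- distinct variables, and unification solves `goM` by it.
  nextCyc-goN a as x with a ∷ as
  ... | l = go-unique x a (goM a as x) refl (λ _ → refl) (λ _ _ _ → refl) l

zipFrom : ℕ → ℕ → List ℕ → List (ℕ × ℕ)
zipFrom N i []       = []
zipFrom N i (u ∷ us) = (u , N + i) ∷ zipFrom N (suc i) us

zip-unique : ∀ N (G : ℕ → List ℕ → List (ℕ × ℕ)) → (∀ i → G i [] ≡ []) → (∀ i u us → G i (u ∷ us) ≡ (u , N + i) ∷ G (suc i) us)
   → ∀ i l → G i l ≡ zipFrom N i l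
zip-unique N G e1 e2 i [] = e1 i
zip-unique N G e1 e2 i (u ∷ us) = ≡.trans (e2 i u us) (cong (_ ∷_) (zip-unique N G e1 e2 (suc i) us))

-- `closureRaw` ends in a local function that cannot be named from outside; abstracting its
-- arguments to distinct variables lets unification find it.
mutual
  private
    zipM : List ℕ → List ℕ → List (ℕ × ℕ) → List ℕ → List (ℕ × Stem) → List (ℕ × ℕ) → Color → Tree → ℕ →
      List (Color × List ℕ) → List (ℕ × ℕ) → ℕ → List ℕ → List (ℕ × ℕ)
    zipM = _

  closureRaw-pairs : ∀ c t → let s = goVertex c nothing t (st 0 [] [] [])
                                 m = linMatch (St.stems s) []
                                 w = cycMatch (proj₂ (proj₂ m)) (proj₁ (proj₂ m))
    in Raw.pairs (closureRaw (c , t)) ≡ St.edges s ++ proj₁ m ++ proj₁ w ++ zipFrom (St.fresh s) 0 (proj₂ w)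
  closureRaw-pairs c t with goVertex c nothing t (st 0 [] [] [])
  ... | st N r e sm with linMatch sm []
  ...   | ps , cs , stk with cycMatch stk cs
  ...     | ps' , [] = refl
  ...     | ps' , (u ∷ us) with u ∷ us | 1
  ...        | l | i = cong (λ z → e ++ ps ++ ps' ++ (u , N + 0) ∷ z)
    (zip-unique N (zipM cs stk ps' l sm ps c t N r e) (λ _ → refl) (λ _ _ _ → refl) i us)

rng : ℕ → ℕ → List ℕ
rng k zero = []
rng k (suc m) = k ∷ rng (suc k) m

rng-++ : ∀ k a b → rng k (a + b) ≡ rng k a ++ rng (k + a) b
rng-++ k zero b = cong (λ z → rng z b) (sym (ℕ.+-identityʳ k))
rng-++ k (suc a) b = cong (k ∷_) (≡.trans (rng-++ (suc k) a b) (cong (λ z → rng (suc k) a ++ rng z b) (sym (ℕ.+-suc k a))))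

length-rng : ∀ k m → length (rng k m) ≡ m
length-rng k zero = refl
length-rng k (suc m) = cong suc (length-rng (suc k) m)

applyUpTo-rng : ∀ (f : ℕ → ℕ) k m → (∀ i → f i ≡ k + i) → Data.List.Base.applyUpTo f m ≡ rng k m
applyUpTo-rng f k zero e = refl
applyUpTo-rng f k (suc m) e = cong₂ _∷_ (≡.trans (e 0) (ℕ.+-identityʳ k))
  (applyUpTo-rng (f ∘ suc) (suc k) m (λ i → ≡.trans (e (suc i)) (ℕ.+-suc k i)))

upTo-rng : ∀ k m → map (λ i → k + i) (upTo m) ≡ rng k m
upTo-rng k m = ≡.trans (List.map-upTo (λ i → k + i) m) (applyUpTo-rng (λ i → k + i) k m (λ _ → refl))

darts : List Item → ℕ
darts [] = 0
darts (stem _ ∷ is) = suc (darts is)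
darts (child (node js) ∷ is) = suc (suc (darts js + darts is))

label : ℕ → List Item → Forest ℕ
label k [] = ε
label k (stem _ ∷ is) = leaf k (label (suc k) is)
label k (child (node js) ∷ is) = edge k (suc k) (label (2 + k) js) (label (2 + k + darts js) is)

shape : Color → Forest A → List Item
shape c ε = []
shape c (leaf d r) = stem (stemOf c) ∷ shape c r
shape c (edge d d' b r) = child (node (shape (flipC c) b)) ∷ shape c r

labels-label : ∀ k is → labels (label k is) ≡ rng k (darts is)
labels-label k [] = refl
labels-label k (stem _ ∷ is) = cong (k ∷_) (labels-label (suc k) is)
labels-label k (child (node js) ∷ is) = cong (λ z → k ∷ suc k ∷ z)
  (≡.trans (cong₂ _++_ (labels-label (2 + k) js) (labels-label (2 + k + darts js) is)) (sym (rng-++ (2 + k) (darts js) (darts is))))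

-- The kinds of stems that `label` forgets are dictated by the colours in a well-charged tree.
shape-label : ∀ c k is → WCItems c is → shape c (label k is) ≡ is
shape-label c k [] w = refl
shape-label c k (stem opening ∷ is) (refl , w) = cong (_ ∷_) (shape-label c (suc k) is w)
shape-label c k (stem closing ∷ is) (refl , w) = cong (_ ∷_) (shape-label c (suc k) is w)
shape-label black k (child (node js) ∷ is) ((w , _) , w') = cong₂ (λ a b → child (node a) ∷ b) (shape-label white _ js w) (shape-label black _ is w')
shape-label white k (child (node js) ∷ is) ((w , _) , w') = cong₂ (λ a b → child (node a) ∷ b) (shape-label black _ js w) (shape-label white _ is w')

shape-mapF : ∀ (g : A → B) c F → shape c (mapF g F) ≡ shape c F
shape-mapF g c ε = refl
shape-mapF g c (leaf d r) = cong (_ ∷_) (shape-mapF g c r)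
shape-mapF g c (edge d d' b r) = cong₂ (λ x y → child (node x) ∷ y) (shape-mapF g (flipC c) b) (shape-mapF g c r)

darts-shape : ∀ c (F : Forest A) → darts (shape c F) ≡ length (labels F)
darts-shape c ε = refl
darts-shape c (leaf d r) = cong suc (darts-shape c r)
darts-shape c (edge d d' b r) = cong (suc ∘ suc) (≡.trans (cong₂ _+_ (darts-shape (flipC c) b) (darts-shape c r))
  (sym (List.length-++ (labels b))))

++-split : ∀ (a a' : List A) {b b'} → length a ≡ length a' → a ++ b ≡ a' ++ b' → a ≡ a' × b ≡ b'
++-split [] [] l e = refl , e
++-split (x ∷ a) (y ∷ a') l e with p , q ← ++-split a a' (ℕ.suc-injective l) (List.∷-injectiveʳ e) =
  cong₂ _∷_ (List.∷-injectiveˡ e) p , q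

-- A forest amounts to its shape and its list of labels, because consecutive numbering and `labels`
-- follow the same order.
relabel : ∀ c (F : Forest A) k (g : ℕ → A) → map g (rng k (length (labels F))) ≡ labels F → mapF g (label k (shape c F)) ≡ F
relabel c ε k g e = refl
relabel c (leaf d r) k g e = cong₂ leaf (List.∷-injectiveˡ e) (relabel c r (suc k) g (List.∷-injectiveʳ e))
relabel c (edge d d' b r) k g e = ≡.trans
    (cong₂ (λ x y → edge x y (mapF g (label (2 + k) (shape (flipC c) b))) (mapF g (label (2 + k + darts (shape (flipC c) b)) (shape c r))))
      (List.∷-injectiveˡ e) (List.∷-injectiveˡ (List.∷-injectiveʳ e)))
    (cong₂ (edge d d') (relabel (flipC c) b (2 + k) g (proj₁ both))
      (≡.trans (cong (λ z → mapF g (label (2 + k + z) (shape c r))) (darts-shape (flipC c) b)) (relabel c r (2 + k + length (labels b)) g (proj₂ both))))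
  where
  both = ++-split (map g (rng (2 + k) (length (labels b)))) (labels b)
    (≡.trans (List.length-map g (rng (2 + k) (length (labels b)))) (length-rng (2 + k) (length (labels b))))
    (≡.trans (sym (List.map-++ g (rng (2 + k) (length (labels b))) _))
      (≡.trans (cong (map g) (sym (rng-++ (2 + k) (length (labels b)) (length (labels r)))))
        (≡.trans (cong (λ z → map g (rng (2 + k) z)) (sym (List.length-++ (labels b)))) (List.∷-injectiveʳ (List.∷-injectiveʳ e)))))

private
  st-≡ : ∀ {f f' r r' e e' s s'} → f ≡ f' → r ≡ r' → e ≡ e' → s ≡ s' → st f r e s ≡ st f' r' e' s'
  st-≡ refl refl refl refl = refl

wc-child : ∀ c js → WCNonRoot (flipC c) (node js) → WCItems (flipC c) js
wc-child black js (w , _) = w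
wc-child white js (w , _) = w

goItems-spec : ∀ c is f r e s → WCItems c is → let F = label f is in
  goItems c is (st f r e s) ≡ (row F , st (f + darts is) (r ++ rots c F) (e ++ edges F) (s ++ typed c F))
goItems-spec c [] f r e s w = cong₂ _,_ refl (st-≡ (sym (ℕ.+-identityʳ f)) (sym (List.++-identityʳ r)) (sym (List.++-identityʳ e)) (sym (List.++-identityʳ s)))
goItems-spec c (stem opening ∷ is) f r e s (refl , w)
  rewrite goItems-spec c is (suc f) r e (s ++ [ (f , opening) ]) w =
  cong₂ _,_ refl (st-≡ (sym (ℕ.+-suc f (darts is))) refl refl (List.++-assoc s _ _))
goItems-spec c (stem closing ∷ is) f r e s (refl , w)
  rewrite goItems-spec c is (suc f) r e (s ++ [ (f , closing) ]) w =
  cong₂ _,_ refl (st-≡ (sym (ℕ.+-suc f (darts is))) refl refl (List.++-assoc s _ _))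
goItems-spec c (child (node js) ∷ is) f r e s (w , w')
  rewrite goItems-spec (flipC c) js (suc (suc f)) r (e ++ [ (f , suc f) ]) s (wc-child c js w)
  | goItems-spec c is (2 + f + darts js)
       ((r ++ rots (flipC c) (label (2 + f) js)) ++ [ (flipC c , suc f ∷ row (label (2 + f) js)) ])
       ((e ++ [ (f , suc f) ]) ++ edges (label (2 + f) js)) (s ++ typed (flipC c) (label (2 + f) js)) w' =
  cong₂ _,_ refl (st-≡ (≡.trans (cong (suc ∘ suc) (ℕ.+-assoc f (darts js) (darts is))) (sym (≡.trans (ℕ.+-suc f _) (cong suc (ℕ.+-suc f _)))))
    (≡.trans (List.++-assoc (r ++ rots (flipC c) (label (2 + f) js)) _ _) (List.++-assoc r _ _))
    (≡.trans (List.++-assoc (e ++ [ _ ]) _ _) (List.++-assoc e _ _))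
    (List.++-assoc s _ _))

linPairs : List (ℕ × Stem) → List ℕ → List (ℕ × ℕ)
linPairs w s = proj₁ (linMatch w s)

linCl linOp : List (ℕ × Stem) → List ℕ → List ℕ
linCl w s = proj₁ (proj₂ (linMatch w s))
linOp w s = proj₂ (proj₂ (linMatch w s))

matched : List (ℕ × Stem) → List (ℕ × ℕ)
matched w = linPairs w [] ++ proj₁ (cycMatch (linOp w []) (linCl w []))

unmatched : List (ℕ × Stem) → List ℕ
unmatched w = proj₂ (cycMatch (linOp w []) (linCl w []))

linMatch-↭ : ∀ w s → sides (linPairs w s) ++ linCl w s ++ linOp w s ↭ map proj₁ w ++ s
linMatch-↭ [] s = refl
linMatch-↭ ((x , opening) ∷ w) s = trans (linMatch-↭ w (x ∷ s)) (↭.shift x (map proj₁ w) s)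
linMatch-↭ ((x , closing) ∷ w) (o ∷ s) = begin
  o ∷ x ∷ sides (linPairs w s) ++ linCl w s ++ linOp w s ↭⟨ prep o (prep x (linMatch-↭ w s)) ⟩
  o ∷ x ∷ map proj₁ w ++ s ↭⟨ swap o x refl ⟩
  x ∷ o ∷ map proj₁ w ++ s ↭⟨ prep x (↭-sym (↭.shift o (map proj₁ w) s)) ⟩
  x ∷ map proj₁ w ++ o ∷ s ∎
  where open PermutationReasoning
linMatch-↭ ((x , closing) ∷ w) [] = trans (↭.shift x (sides (linPairs w [])) _) (prep x (linMatch-↭ w []))

cycMatch-↭ : ∀ os cs → sides (proj₁ (cycMatch os cs)) ++ proj₂ (cycMatch os cs) ↭ cs ++ os
cycMatch-↭ (o ∷ os) (c ∷ cs) = trans (prep o (prep c (cycMatch-↭ os cs)))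
  (trans (swap o c refl) (prep c (↭-sym (↭.shift o cs os))))
cycMatch-↭ (o ∷ os) [] = ↭.↭-reverse (o ∷ os)
cycMatch-↭ [] [] = refl
cycMatch-↭ [] (c ∷ cs) = ↭-sym (↭-reflexive (List.++-identityʳ (c ∷ cs)))

matched-↭ : ∀ w → sides (matched w) ++ unmatched w ↭ map proj₁ w
matched-↭ w = begin
  sides (linPairs w [] ++ ps) ++ us        ≡⟨ cong (_++ us) (sides-++ (linPairs w []) ps) ⟩
  (sides (linPairs w []) ++ sides ps) ++ us ≡⟨ List.++-assoc (sides (linPairs w [])) _ _ ⟩
  sides (linPairs w []) ++ sides ps ++ us  ↭⟨ ↭.++⁺ˡ (sides (linPairs w [])) (cycMatch-↭ (linOp w []) (linCl w [])) ⟩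
  sides (linPairs w []) ++ linCl w [] ++ linOp w [] ↭⟨ linMatch-↭ w [] ⟩
  map proj₁ w ++ []                        ≡⟨ List.++-identityʳ _ ⟩
  map proj₁ w ∎
  where
  open PermutationReasoning
  ps = proj₁ (cycMatch (linOp w []) (linCl w []))
  us = unmatched w

opens closes : List ℕ → List (ℕ × Stem)
opens = map (_, opening)
closes = map (_, closing)

-- At each moment of the run, the word stands for the unmatched closings `p`, then the stack, then
-- the unread `w`. Matching a closing with the top of the stack deletes an adjacent pair, so the
-- induction restores the pairs from the final word backwards.
lin-good : ∀ {P : ℕ × Stem → ℕ × Stem → Set} {us} w p s →
  (∀ {o c} → (o , c) ∈ linPairs w s → P (o , opening) (c , closing)) →
  Good P us (closes (p ++ linCl w s) ++ opens (reverse (linOp w s))) → Good P us (closes p ++ opens (reverse s) ++ w)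
lin-good {P} {us} [] p s h g = subst (Good P us) (cong₂ _++_ (cong closes (List.++-identityʳ p)) (sym (List.++-identityʳ _))) g
lin-good {P} {us} ((x , opening) ∷ w) p s h g = subst (Good P us) (cong (closes p ++_)
  (≡.trans (cong (λ z → opens z ++ w) (List.unfold-reverse x s))
    (≡.trans (cong (_++ w) (List.map-++ _ (reverse s) [ x ])) (List.++-assoc (opens (reverse s)) _ _))))
  (lin-good w p (x ∷ s) h g)
lin-good {P} {us} ((x , closing) ∷ w) p (o ∷ s) h g = subst (Good P us) (≡.trans (List.++-assoc (closes p) _ _) (cong (closes p ++_)
  (sym (≡.trans (cong (λ z → opens z ++ (x , closing) ∷ w) (List.unfold-reverse o s))
    (≡.trans (cong (_++ (x , closing) ∷ w) (List.map-++ _ (reverse s) [ o ])) (List.++-assoc (opens (reverse s)) _ _))))))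
  (good-ins (closes p ++ opens (reverse s)) w (h (here refl))
    (subst (Good P us) (sym (List.++-assoc (closes p) _ _)) (lin-good w p s (h ∘ there) g)))
lin-good {P} {us} ((x , closing) ∷ w) p [] h g = subst (Good P us)
  (≡.trans (cong (_++ w) (List.map-++ _ p [ x ])) (List.++-assoc (closes p) _ _))
  (lin-good w (p ++ [ x ]) [] h (subst (λ z → Good P us (closes z ++ opens (reverse (linOp w [])))) (sym (List.++-assoc p [ x ] _)) g))

-- In the leftover word of closings followed by openings, the first closing and the last opening are
-- neighbours cyclically; this is the pair that `cycMatch` takes.
cyc-good : ∀ {P : ℕ × Stem → ℕ × Stem → Set} os cs →
  (∀ {o c} → (o , c) ∈ proj₁ (cycMatch os cs) → P (o , opening) (c , closing)) →
  ∃ λ s → Good P (map (_, s) (proj₂ (cycMatch os cs))) (closes cs ++ opens (reverse os))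
cyc-good {P} (o ∷ os) (c ∷ cs) h with s , g ← cyc-good os cs (h ∘ there) =
  s , subst (Good P _) (cong ((c , closing) ∷_) (≡.trans (List.++-assoc (closes cs) _ _)
    (cong (closes cs ++_) (≡.trans (sym (List.map-++ _ (reverse os) [ o ])) (cong opens (sym (List.unfold-reverse o os)))))))
  (rot (ins (h (here refl)) g))
cyc-good (o ∷ os) [] h = opening , base
cyc-good [] [] h = opening , base
cyc-good [] (c ∷ cs) h = closing , subst (Good _ _) (sym (List.++-identityʳ _)) base

matching-good : ∀ {P : ℕ × Stem → ℕ × Stem → Set} w →
  (∀ {o c} → (o , c) ∈ matched w → P (o , opening) (c , closing)) → ∃ λ s → Good P (map (_, s) (unmatched w)) w
matching-good w h with s , g ← cyc-good (linOp w []) (linCl w []) (h ∘ ∈.∈-++⁺ʳ (linPairs w [])) =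
  s , lin-good w [] [] (h ∘ ∈.∈-++⁺ˡ) g

-- A presentation of `Good` without rotations, along which the linear matching is easily followed.
data Nested (P : A → A → Set) (Q : List A → Set) : List A → Set where
  base : ∀ {w} → Q w → Nested P Q w
  ins  : ∀ u {o c} v → P o c → Nested P Q (u ++ v) → Nested P Q (u ++ o ∷ c ∷ v)
  wrap : ∀ {o c} w → P o c → Nested P Q w → Nested P Q (c ∷ w ++ [ o ])

module _ {P : A → A → Set} {Q : List A → Set} (Q-rot : ∀ {x w} → Q (x ∷ w) → Q (w ++ [ x ])) where

  -- Rotating the opening of an adjacent leading pair to the end makes the pair wrap around the
  -- word, and rotating a wrapping pair makes it adjacent at the end. The two constructors therefore
  -- absorb all rotations.
  nested-rot : ∀ {w' x w} → Nested P Q w' → w' ≡ x ∷ w → Nested P Q (w ++ [ x ])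
  nested-rot (base q) refl = base (Q-rot q)
  nested-rot (ins [] v p g) refl = wrap v p g
  nested-rot (ins (x ∷ u) {o} {c} v p g) refl = subst (Nested P Q) (sym (List.++-assoc u _ _))
    (ins u (v ++ [ x ]) p (subst (Nested P Q) (List.++-assoc u v [ x ]) (nested-rot g refl)))
  nested-rot (wrap {o} {c} w p g) refl = subst (Nested P Q) (sym (List.++-assoc w [ o ] [ c ]))
    (ins w [] p (subst (Nested P Q) (sym (List.++-identityʳ w)) g))

  good-nested : ∀ {us w} → Q us → Good P us w → Nested P Q w
  good-nested q base = base q
  good-nested q (ins p g) = ins [] _ p (good-nested q g)
  good-nested q (rot g) = nested-rot (good-nested q g) refl

-- The opening is on top of the stack when its partner is read, so the state is restored and the
-- rest of the run does not change.
lin-ins : ∀ u {o c} v s → let a = linMatch (u ++ (o , opening) ∷ (c , closing) ∷ v) s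
                              b = linMatch (u ++ v) s in
  proj₂ a ≡ proj₂ b × (∀ {p} → p ∈ proj₁ a → p ≡ (o , c) ⊎ p ∈ proj₁ b)
lin-ins [] v s = refl , λ { (here refl) → inj₁ refl ; (there i) → inj₂ i }
lin-ins ((x , opening) ∷ u) v s = lin-ins u v (x ∷ s)
lin-ins ((x , closing) ∷ u) v (y ∷ s) with e , f ← lin-ins u v s =
  e , λ { (here refl) → inj₂ (here refl) ; (there i) → case f i of λ { (inj₁ q) → inj₁ q ; (inj₂ j) → inj₂ (there j) } }
lin-ins ((x , closing) ∷ u) v [] with e , f ← lin-ins u v [] = cong (λ z → x ∷ proj₁ z , proj₂ z) e , f

lin-snoc : ∀ w o s → linMatch (w ++ [ (o , opening) ]) s ≡ (linPairs w s , linCl w s , o ∷ linOp w s)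
lin-snoc [] o s = refl
lin-snoc ((x , opening) ∷ w) o s = lin-snoc w o (x ∷ s)
lin-snoc ((x , closing) ∷ w) o (y ∷ s) rewrite lin-snoc w o s = refl
lin-snoc ((x , closing) ∷ w) o [] rewrite lin-snoc w o [] = refl

lin-opens : ∀ l s → linMatch (opens l) s ≡ ([] , [] , l Data.List.Base.ʳ++ s)
lin-opens [] s = refl
lin-opens (x ∷ l) s = lin-opens l (x ∷ s)

lin-closes : ∀ l → linMatch (closes l) [] ≡ ([] , l , [])
lin-closes [] = refl
lin-closes (x ∷ l) rewrite lin-closes l = refl

cyc-[]ˡ : ∀ cs → cycMatch [] cs ≡ ([] , cs)
cyc-[]ˡ [] = refl
cyc-[]ˡ (c ∷ cs) = refl

cyc-[] : ∀ os → cycMatch os [] ≡ ([] , reverse os)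
cyc-[] [] = refl
cyc-[] (o ∷ os) = refl

module _ {P : ℕ × Stem → ℕ × Stem → Set} (typing : ∀ {x y} → P x y → proj₂ x ≡ opening × proj₂ y ≡ closing)
         {R : List ℕ → Set} {s : Stem} where

  -- Independence of the order of deletion: whichever reduction is given, the algorithm only forms
  -- pairs allowed by `P`. The stems it leaves may be a rotation of the original ones, hence the
  -- control through `R` alone.
  nested-matching : ∀ {w} → Nested P (λ v → ∃ λ l → v ≡ map (_, s) l × R l) w →
    (∀ {o c} → (o , c) ∈ matched w → P (o , opening) (c , closing)) × R (unmatched w)
  nested-matching (base (l , refl , r)) = go s
    where
    go : ∀ s → (∀ {o c} → (o , c) ∈ matched (map (_, s) l) → P (o , opening) (c , closing)) × R (unmatched (map (_, s) l))
    go opening rewrite lin-opens l [] | cyc-[] (reverse l) | List.reverse-involutive l = (λ ()) , r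
    go closing rewrite lin-closes l | cyc-[]ˡ l = (λ ()) , r
  nested-matching (ins u {o , t} {c , t'} v p g) with refl , refl ← typing p
    with h , r ← nested-matching g with e , f ← lin-ins u {o} {c} v []
    rewrite e = (λ i → case ∈.∈-++⁻ (linPairs (u ++ (o , opening) ∷ (c , closing) ∷ v) []) i of λ
      { (inj₁ j) → case f j of λ { (inj₁ refl) → p ; (inj₂ k) → h (∈.∈-++⁺ˡ k) }
      ; (inj₂ j) → h (∈.∈-++⁺ʳ (linPairs (u ++ v) []) j) }) , r
  -- The leading closing is the first one left unmatched and the trailing opening ends on top of the
  -- stack, so `cycMatch` joins them at once.
  nested-matching (wrap {o , t} {c , t'} w p g) with refl , refl ← typing p
    with h , r ← nested-matching g rewrite lin-snoc w o [] = (λ i → case ∈.∈-++⁻ (linPairs w []) i of λ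
      { (inj₁ j) → h (∈.∈-++⁺ˡ j)
      ; (inj₂ (here refl)) → p
      ; (inj₂ (there j)) → h (∈.∈-++⁺ʳ (linPairs w []) j) }) , r

-- Correctness of the lookups in rotations and pairings

≡ᵇ-refl : ∀ x → (x ≡ᵇ x) ≡ true
≡ᵇ-refl x = T→≡ (ℕ.≡⇒≡ᵇ x x refl)

≡ᵇ-≢ : ∀ {x y} → x ≢ y → (x ≡ᵇ y) ≡ false
≡ᵇ-≢ {x} {y} ne with x ≡ᵇ y in e
... | false = refl
... | true = ⊥-elim (ne (ℕ.≡ᵇ⇒≡ x y (≡→T e)))

goN-sound : ∀ {R : ℕ → ℕ → Set} x h b l {y} → goN x h (b ∷ l) ≡ just y → Chain R b l h → R x y
goN-sound x h b [] e c with b ≡ᵇ x in q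
goN-sound x h b [] refl c | true with refl ← ℕ.≡ᵇ⇒≡ b x (≡→T q) = c
goN-sound x h b (d ∷ l) e (r , c) with b ≡ᵇ x in q
goN-sound x h b (d ∷ l) refl (r , c) | true with refl ← ℕ.≡ᵇ⇒≡ b x (≡→T q) = r
... | false = goN-sound x h d l e c

goN-complete : ∀ x h b l → x ∈ b ∷ l → ∃ λ y → goN x h (b ∷ l) ≡ just y
goN-complete x h b [] (here refl) rewrite ≡ᵇ-refl b = h , refl
goN-complete x h b (d ∷ l) i with b ≡ᵇ x in q
... | true = d , refl
goN-complete x h b (d ∷ l) (here refl) | false with () ← ≡.trans (sym q) (≡ᵇ-refl b)
goN-complete x h b (d ∷ l) (there i) | false = goN-complete x h d l i

goN-none : ∀ x h l → x ∉ l → goN x h l ≡ nothing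
goN-none x h [] i = refl
goN-none x h (b ∷ []) i rewrite ≡ᵇ-≢ {b} {x} (λ e → i (here (sym e))) = refl
goN-none x h (b ∷ d ∷ l) i = ≡.trans (cong (λ z → if z then just d else goN x h (d ∷ l)) (≡ᵇ-≢ {b} {x} (λ e → i (here (sym e)))))
  (goN-none x h (d ∷ l) (i ∘ there))

goN-chain : ∀ h b l → Unique (b ∷ l) → Chain (λ a y → goN a h (b ∷ l) ≡ just y) b l h
goN-chain h b [] u rewrite ≡ᵇ-refl b = refl
goN-chain h b (d ∷ l) u rewrite ≡ᵇ-refl b = refl , chain-imp l
  (λ {a} {y} i e → subst (λ z → (if z then just d else goN a h (d ∷ l)) ≡ just y) (sym (≡ᵇ-≢ {b} {a} λ { refl → uniq-head u i })) e)
  (goN-chain h d l (uniq-tail u))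

nextCyc-sound : ∀ {R : ℕ → ℕ → Set} l {x y} → nextCyc l x ≡ just y → Cyc R l → R x y
nextCyc-sound (a ∷ l) {x} e c = goN-sound x a a l (≡.trans (sym (nextCyc-goN a l x)) e) c

nextCyc-complete : ∀ l {x} → x ∈ l → ∃ λ y → nextCyc l x ≡ just y
nextCyc-complete (a ∷ l) {x} i with y , e ← goN-complete x a a l i = y , ≡.trans (nextCyc-goN a l x) e

nextCyc-none : ∀ l {x} → x ∉ l → nextCyc l x ≡ nothing
nextCyc-none [] i = refl
nextCyc-none (a ∷ l) {x} i = ≡.trans (nextCyc-goN a l x) (goN-none x a (a ∷ l) i)

nextCyc-cyc : ∀ l → Unique l → Cyc (λ a b → nextCyc l a ≡ just b) l
nextCyc-cyc [] u = tt
nextCyc-cyc (a ∷ l) u = chain-imp l (λ {x} _ e → ≡.trans (nextCyc-goN a l x) e) (goN-chain a a l u)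

chain-∈ : ∀ {L : List A} {h} b m → b ∈ L → (∀ {z} → z ∈ m → z ∈ L) → h ∈ L → Chain (λ a b → a ∈ L × b ∈ L) b m h
chain-∈ b [] i s j = i , j
chain-∈ b (d ∷ m) i s j = (i , s (here refl)) , chain-∈ d m (s (here refl)) (s ∘ there) j

nextCyc-∈ : ∀ l {x y} → nextCyc l x ≡ just y → x ∈ l × y ∈ l
nextCyc-∈ (a ∷ l) e = nextCyc-sound (a ∷ l) e (chain-∈ a l (here refl) there (here refl))

lookupRot-sound : ∀ rs {x c y} → lookupRot rs x ≡ just (c , y) → ∃ λ l → (c , l) ∈ rs × nextCyc l x ≡ just y
lookupRot-sound ((c , l) ∷ rs) {x} e with nextCyc l x in q
lookupRot-sound ((c , l) ∷ rs) {x} refl | just y = l , here refl , q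
... | nothing with l' , i , q' ← lookupRot-sound rs e = l' , there i , q'

lookupRot-complete : ∀ rs {x} → x ∈ concat (map proj₂ rs) → ∃ λ cy → lookupRot rs x ≡ just cy
lookupRot-complete ((c , l) ∷ rs) {x} i with nextCyc l x in q
... | just y = (c , y) , refl
... | nothing with ∈.∈-++⁻ l i
...   | inj₂ j = lookupRot-complete rs j
...   | inj₁ j with y , e ← nextCyc-complete l j with () ← ≡.trans (sym q) e

lookupRot-unique : ∀ rs → Unique (concat (map proj₂ rs)) → ∀ {x c l y} → (c , l) ∈ rs → nextCyc l x ≡ just y → lookupRot rs x ≡ just (c , y)
lookupRot-unique ((c , l) ∷ rs) u (here refl) e rewrite e = refl
lookupRot-unique ((c , l) ∷ rs) u {x} {_} {l'} (there i) e
  rewrite nextCyc-none l {x} (λ j → uniq-disj l u j (∈.∈-concat⁺′ (proj₁ (nextCyc-∈ l' e)) (∈.∈-map⁺ proj₂ i))) =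
  lookupRot-unique rs (uniq-++ʳ l u) i e

∈-sides : ∀ {ps : List (A × A)} {a b} → (a , b) ∈ ps → a ∈ sides ps × b ∈ sides ps
∈-sides (here refl) = here refl , there (here refl)
∈-sides (there i) with p , q ← ∈-sides i = there (there p) , there (there q)

sides-∈ : ∀ (ps : List (A × A)) {x} → x ∈ sides ps → ∃ λ y → (x , y) ∈ ps ⊎ (y , x) ∈ ps
sides-∈ ((a , b) ∷ ps) (here refl) = b , inj₁ (here refl)
sides-∈ ((a , b) ∷ ps) (there (here refl)) = a , inj₂ (here refl)
sides-∈ ((a , b) ∷ ps) (there (there i)) with sides-∈ ps i
... | y , inj₁ j = y , inj₁ (there j)
... | y , inj₂ j = y , inj₂ (there j)

lookupPair-unique : ∀ ps → Unique (sides ps) → ∀ {a b} → (a , b) ∈ ps → lookupPair ps a ≡ just b × lookupPair ps b ≡ just a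
lookupPair-unique ((a , b) ∷ ps) u (here refl)
  rewrite ≡ᵇ-refl a | ≡ᵇ-refl b | ≡ᵇ-≢ {a} {b} (λ e → uniq-head u (here e)) = refl , refl
lookupPair-unique ((c , d) ∷ ps) u {a} {b} (there i) with p , q ← ∈-sides i
  rewrite ≡ᵇ-≢ {c} {a} (λ { refl → uniq-head u (there p) }) | ≡ᵇ-≢ {d} {a} (λ { refl → uniq-head (uniq-tail u) p })
        | ≡ᵇ-≢ {c} {b} (λ { refl → uniq-head u (there q) }) | ≡ᵇ-≢ {d} {b} (λ { refl → uniq-head (uniq-tail u) q }) =
  lookupPair-unique ps (uniq-tail (uniq-tail u)) i

toFin : ∀ {D} → ℕ → Fin (suc D)
toFin k = toFinOr (just k) Fin.zero

toFinOr-eq : ∀ {D} k (d : Fin (suc D)) → k < suc D → toFinOr (just k) d ≡ toFin k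
toFinOr-eq {D} k d lt with k ℕ.<? suc D
... | yes p = refl
... | no q = ⊥-elim (q lt)

toℕ-toFin : ∀ {D} {k} → k < suc D → toℕ (toFin {D} k) ≡ k
toℕ-toFin {D} {k} lt with k ℕ.<? suc D
... | yes p = Fin.toℕ-fromℕ< p
... | no q = ⊥-elim (q lt)

toFin-toℕ : ∀ {D} (x : Fin (suc D)) → toFin (toℕ x) ≡ x
toFin-toℕ x = Fin.toℕ-injective (toℕ-toFin (Fin.toℕ<n x))

module _ {D N : ℕ} {rs : List (Color × List ℕ)} {ps : List (ℕ × ℕ)} where

  open Map (rawToMap (raw (suc D) N rs ps))

  raw-σ : ∀ {a b c} → lookupRot rs a ≡ just (c , b) → a < suc D → b < suc D → σ (toFin a) ≡ toFin b
  raw-σ e la lb rewrite toℕ-toFin la | e = toFinOr-eq _ _ lb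

  raw-color : ∀ {a b c} → lookupRot rs a ≡ just (c , b) → a < suc D → color (toFin a) ≡ c
  raw-color e la rewrite toℕ-toFin la | e = refl

  raw-α : ∀ {a b} → lookupPair ps a ≡ just b → a < suc D → b < suc D → α (toFin a) ≡ toFin b
  raw-α e la lb rewrite toℕ-toFin la | e = toFinOr-eq _ _ lb

∈-rng⁻ : ∀ k m {x} → x ∈ rng k m → k ≤ x × x < k + m
∈-rng⁻ k (suc m) (here refl) = ℕ.≤-refl , ℕ.m<m+n k (s≤s z≤n)
∈-rng⁻ k (suc m) {x} (there i) with p , q ← ∈-rng⁻ (suc k) m i = ℕ.≤-trans (ℕ.n≤1+n k) p , subst (x <_) (sym (ℕ.+-suc k m)) q

∈-rng⁺ : ∀ k m {x} → k ≤ x → x < k + m → x ∈ rng k m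
∈-rng⁺ k zero {x} p q = ⊥-elim (ℕ.<⇒≱ q (ℕ.≤-trans (ℕ.≤-reflexive (ℕ.+-identityʳ k)) p))
∈-rng⁺ k (suc m) {x} p q with k ℕ.≟ x
... | yes refl = here refl
... | no ne = there (∈-rng⁺ (suc k) m (ℕ.≤∧≢⇒< p ne) (subst (x <_) (ℕ.+-suc k m) q))

rng-uniq : ∀ k m → Unique (rng k m)
rng-uniq k zero = []
rng-uniq k (suc m) = ∷-uniq (λ i → ℕ.<-irrefl refl (proj₁ (∈-rng⁻ (suc k) m i))) (rng-uniq (suc k) m)

τColor : Tree → Color
τColor t = if nOpen t <ᵇ nClose t then black else white

closureRaw-eq : ∀ c is → WCItems c is → let F = label 0 is
                                            us = unmatched (typed c F)
                                            N = darts is in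
  closureRaw (c , node is) ≡ raw (N + length us) N
    ((rots c F ++ [ (c , row F) ]) ++ [ (τColor (node is) , reverse (map (λ i → N + i) (upTo (length us)))) ])
    (edges F ++ linPairs (typed c F) [] ++ proj₁ (cycMatch (linOp (typed c F) []) (linCl (typed c F) [])) ++ zipFrom N 0 us)
closureRaw-eq c is wc with closureRaw-pairs c (node is)
... | e rewrite goItems-spec c is 0 [] [] [] wc = cong (raw _ _ _) e

good-∈ : ∀ {P : A → A → Set} {us w w₀} → (∀ {x} → x ∈ w → x ∈ w₀) → Good P us w → Good (λ x y → P x y × x ∈ w₀ × y ∈ w₀) us w
good-∈ s base = base
good-∈ s (ins p g) = ins (p , s (here refl) , s (there (here refl))) (good-∈ (s ∘ there ∘ there) g)
good-∈ s (rot {x} {w} g) = rot (good-∈ (s ∘ ↭.∈-resp-↭ (↭.++-comm [ x ] w)) g)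

-- Deleted pairs sum to zero and rotations preserve sums, so a sum over stems is an invariant of the
-- reduction; for charges it determines what stays unmatched.
good-∑ : ∀ {P : A → A → Set} {us w} (g : A → ℤ) → (∀ {x y} → P x y → g x ℤ.+ g y ≡ 0ℤ) → Good P us w → ∑ g w ≡ ∑ g us
good-∑ g h base = refl
good-∑ g h (ins {o} {c} {w} p q) = ≡.trans (sym (ℤ.+-assoc (g o) (g c) (∑ g w))) (≡.trans (cong (λ z → z ℤ.+ ∑ g w) (h p)) (≡.trans (ℤ.+-identityˡ _) (good-∑ g h q)))
good-∑ g h (rot {x} {w} q) = ≡.trans (∑-↭ g (↭.++-comm w [ x ])) (good-∑ g h q)

good-⊇ : ∀ {P : A → A → Set} {us w} → Good P us w → ∀ {x} → x ∈ us → x ∈ w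
good-⊇ base i = i
good-⊇ (ins p g) i = there (there (good-⊇ g i))
good-⊇ (rot {x} {w} g) i = ↭.∈-resp-↭ (↭.++-comm [ x ] w) (good-⊇ g i)

cyc-unmap : ∀ {R : B → B → Set} (f : A → B) l → Cyc R (map f l) → Cyc (λ x y → R (f x) (f y)) l
cyc-unmap f [] c = tt
cyc-unmap {R = R} f (x ∷ l) c = go l c
  where
  go : ∀ {x y} l → Chain R (f x) (map f l) (f y) → Chain (λ x y → R (f x) (f y)) x l y
  go [] r = r
  go (z ∷ l) (r , c) = r , go l c

stemColor : Stem → Color
stemColor opening = black
stemColor closing = white

stemColor-stemOf : ∀ c → stemColor (stemOf c) ≡ c
stemColor-stemOf black = refl
stemColor-stemOf white = refl

stemOf-stemColor : ∀ s → stemOf (stemColor s) ≡ s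
stemOf-stemColor opening = refl
stemOf-stemColor closing = refl

signed : Color → ℕ → ℤ
signed black k = + k
signed white k = - + k

∑-typed : ∀ c (F : Forest A) → ∑ (stemCharge ∘ stemColor ∘ proj₂) (typed c F) ≡ chg c F
∑-typed c ε = refl
∑-typed c (leaf d r) = cong₂ ℤ._+_ (cong stemCharge (stemColor-stemOf c)) (∑-typed c r)
∑-typed c (edge d d' b r) = ≡.trans (∑-++ _ (typed (flipC c) b) (typed c r)) (cong₂ ℤ._+_ (∑-typed (flipC c) b) (∑-typed c r))

⊖-+ : ∀ a b c d → (a + b) ⊖ (c + d) ≡ (a ⊖ c) ℤ.+ (b ⊖ d)
⊖-+ a b c d = begin
  (a + b) ⊖ (c + d) ≡⟨ sym (ℤ.m-n≡m⊖n (a + b) (c + d)) ⟩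
  (+ a ℤ.+ + b) ℤ.- (+ c ℤ.+ + d) ≡⟨ lem (+ a) (+ b) (+ c) (+ d) ⟩
  (+ a ℤ.- + c) ℤ.+ (+ b ℤ.- + d) ≡⟨ cong₂ ℤ._+_ (ℤ.m-n≡m⊖n a c) (ℤ.m-n≡m⊖n b d) ⟩
  (a ⊖ c) ℤ.+ (b ⊖ d) ∎
  where
  open ≡-Reasoning
  lem : ∀ a b c d → (a ℤ.+ b) ℤ.- (c ℤ.+ d) ≡ (a ℤ.- c) ℤ.+ (b ℤ.- d)
  lem = solve-∀

chg-label : ∀ c k is → WCItems c is → chg c (label k is) ≡ nCloseItems is ⊖ nOpenItems is
chg-label c k [] w = refl
chg-label c k (stem opening ∷ is) (refl , w) = ≡.trans (cong (λ z → ℤ.-1ℤ ℤ.+ z) (chg-label c (suc k) is w)) (sym (⊖-+ 0 (nCloseItems is) 1 (nOpenItems is)))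
chg-label c k (stem closing ∷ is) (refl , w) = ≡.trans (cong (λ z → 1ℤ ℤ.+ z) (chg-label c (suc k) is w)) (sym (⊖-+ 1 (nCloseItems is) 0 (nOpenItems is)))
chg-label c k (child (node js) ∷ is) (w , w') = ≡.trans
  (cong₂ ℤ._+_ (chg-label (flipC c) (2 + k) js (wc-child c js w)) (chg-label c (2 + k + darts js) is w'))
  (sym (⊖-+ (nCloseItems js) (nCloseItems is) (nOpenItems js) (nOpenItems is)))

charged-label : ∀ c k is → WCItems c is → Charged c (label k is)
charged-label c k [] w = tt
charged-label c k (stem opening ∷ is) (_ , w) = charged-label c (suc k) is w
charged-label c k (stem closing ∷ is) (_ , w) = charged-label c (suc k) is w
charged-label c k (child (node js) ∷ is) (w , w') =
  bound c w , charged-label (flipC c) (2 + k) js (wc-child c js w) , charged-label c (2 + k + darts js) is w'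
  where
  bound : ∀ c → WCNonRoot (flipC c) (node js) → Bounded (flipC c) (chg (flipC c) (label (2 + k) js))
  bound black (w , le) = subst (0ℤ ℤ.≤_) (sym (chg-label white (2 + k) js w)) le
  bound white (w , le) = subst (ℤ._≤ 1ℤ) (sym (chg-label black (2 + k) js w)) le

rots-mapF : ∀ (g : A → B) c F → rots c (mapF g F) ≡ map (λ (c , l) → c , map g l) (rots c F)
rots-mapF g c ε = refl
rots-mapF g c (leaf d r) = rots-mapF g c r
rots-mapF g c (edge d d' b r) = ≡.trans
  (cong₂ _++_ (rots-mapF g (flipC c) b) (cong₂ (λ x y → (flipC c , g d' ∷ x) ∷ y) (row-mapF g b) (rots-mapF g c r)))
  (sym (List.map-++ _ (rots (flipC c) b) _))

edges-mapF : ∀ (g : A → B) F → edges (mapF g F) ≡ map (λ (x , y) → g x , g y) (edges F)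
edges-mapF g ε = refl
edges-mapF g (leaf d r) = edges-mapF g r
edges-mapF g (edge d d' b r) = cong (_ ∷_) (≡.trans (cong₂ _++_ (edges-mapF g b) (edges-mapF g r)) (sym (List.map-++ _ (edges b) (edges r))))

typed-mapF : ∀ (g : A → B) c F → typed c (mapF g F) ≡ map (λ (x , s) → g x , s) (typed c F)
typed-mapF g c ε = refl
typed-mapF g c (leaf d r) = cong (_ ∷_) (typed-mapF g c r)
typed-mapF g c (edge d d' b r) = ≡.trans (cong₂ _++_ (typed-mapF g (flipC c) b) (typed-mapF g c r)) (sym (List.map-++ _ (typed (flipC c) b) (typed c r)))

module _ {D : Set} (σ α : D → D) (color : D → Color) where

  RotOk : Color × List D → Set
  RotOk (c , l) = Cyc (Graph σ) l × All (λ d → color d ≡ c) l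

  wf-intro : ∀ c F → All (λ d → color d ≡ c) (row F) → All RotOk (rots c F) → All (λ (x , y) → α x ≡ y) (edges F) → Wf σ α color c F
  wf-intro c ε cs rs es = tt
  wf-intro c (leaf d r) (p ∷ cs) rs es = p , wf-intro c r cs rs es
  wf-intro c (edge d d' b r) (p ∷ cs) rs (e ∷ es) with rb , (cy , (q ∷ qs)) ∷ rr ← All.++⁻ (rots (flipC c) b) rs | eb , er ← All.++⁻ (edges b) es =
    (p , q , e , cy) , wf-intro (flipC c) b qs rb eb , wf-intro c r cs rr er

  wf-row : ∀ c F → Wf σ α color c F → All (λ d → color d ≡ c) (row F)
  wf-row c ε w = []
  wf-row c (leaf d r) (p , w) = p ∷ wf-row c r w
  wf-row c (edge d d' b r) ((p , _) , _ , w) = p ∷ wf-row c r w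

  wf-rots : ∀ c F → Wf σ α color c F → All RotOk (rots c F)
  wf-rots c ε w = []
  wf-rots c (leaf d r) (_ , w) = wf-rots c r w
  wf-rots c (edge d d' b r) ((_ , q , _ , cy) , w , w') = All.++⁺ (wf-rots (flipC c) b w) ((cy , q ∷ wf-row (flipC c) b w) ∷ wf-rots c r w')

  wf-edges : ∀ c F → Wf σ α color c F → All (λ (x , y) → α x ≡ y) (edges F)
  wf-edges c ε w = []
  wf-edges c (leaf d r) (_ , w) = wf-edges c r w
  wf-edges c (edge d d' b r) ((_ , _ , e , _) , w , w') = e ∷ All.++⁺ (wf-edges (flipC c) b w) (wf-edges c r w')

  wf-typed : ∀ c F → Wf σ α color c F → All (λ (d , s) → color d ≡ stemColor s) (typed c F)
  wf-typed c ε w = []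
  wf-typed c (leaf d r) (p , w) = ≡.trans p (sym (stemColor-stemOf c)) ∷ wf-typed c r w
  wf-typed c (edge d d' b r) (_ , w , w') = All.++⁺ (wf-typed (flipC c) b w) (wf-typed c r w')

flipC-flipC : ∀ c → flipC (flipC c) ≡ c
flipC-flipC black = refl
flipC-flipC white = refl

signed-inj : ∀ a b m k → 0 < k → signed a m ≡ signed b k → a ≡ b × m ≡ k
signed-inj black black m k p e = refl , ℤ.+-injective e
signed-inj black white m (suc k) p ()
signed-inj white black zero (suc k) p ()
signed-inj white black (suc m) (suc k) p ()
signed-inj white white m k p e = refl , ℤ.+-injective (ℤ.neg-injective e)

∑-stems : ∀ s (l : List A) → ∑ (stemCharge ∘ stemColor ∘ proj₂) (map (_, s) l) ≡ signed (flipC (stemColor s)) (length l)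
∑-stems opening [] = refl
∑-stems closing [] = refl
∑-stems opening (x ∷ l) = ≡.trans (cong (λ z → ℤ.-1ℤ ℤ.+ z) (∑-stems opening l)) (sym (ℤ.neg-distrib-+ 1ℤ (+ length l)))
∑-stems closing (x ∷ l) = cong (λ z → 1ℤ ℤ.+ z) (∑-stems closing l)

⊖-color : ∀ a b τ k → 0 < k → a ⊖ b ≡ signed τ k → (if b <ᵇ a then black else white) ≡ τ
⊖-color a b τ k p e with b <ᵇ a in q | τ
... | true | black = refl
... | false | white = refl
... | true | white = ⊥-elim (ℤ.<-irrefl (≡.trans (sym e) (ℤ.⊖-≥ (ℕ.<⇒≤ lt)))
    (ℤ.<-≤-trans (ℤ.neg-mono-< (ℤ.+<+ p)) (ℤ.+≤+ z≤n)))
  where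
  lt : b < a
  lt = ℕ.<ᵇ⇒< b a (≡→T q)
... | false | black = ⊥-elim (ℤ.<-irrefl (≡.trans (sym (ℤ.⊖-≤ le)) e)
    (ℤ.≤-<-trans (ℤ.neg-mono-≤ (ℤ.+≤+ {0} z≤n)) (ℤ.+<+ p)))
  where
  le : a ≤ b
  le = ℕ.≮⇒≥ (λ lt → subst T q (ℕ.<⇒<ᵇ lt))

sides-zip : ∀ N i us → sides (zipFrom N i us) ↭ us ++ rng (N + i) (length us)
sides-zip N i [] = refl
sides-zip N i (u ∷ us) = prep u (trans (prep (N + i) (sides-zip N (suc i) us))
  (trans (↭-reflexive (cong (λ z → N + i ∷ us ++ rng z (length us)) (ℕ.+-suc N i))) (↭-sym (↭.shift (N + i) us _))))

zip-map : ∀ {f : ℕ → A} {h : A → A} N i us → All (λ (x , y) → h (f x) ≡ f y) (zipFrom N i us) → map h (map f us) ≡ map f (rng (N + i) (length us))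
zip-map N i [] a = refl
zip-map {f = f} {h} N i (u ∷ us) (e ∷ a) = cong₂ _∷_ e
  (≡.trans (zip-map N (suc i) us a) (cong (λ z → map f (rng z (length us))) (ℕ.+-suc N i)))

-- The closure of a well-charged tree carries a structure

module Closure (c : Color) (is : List Item) where

  F = label 0 is
  w = typed c F
  us = unmatched w
  N = darts is
  K = length us
  rs = (rots c F ++ [ (c , row F) ]) ++ [ (τColor (node is) , reverse (map (λ i → N + i) (upTo K))) ]
  ps = edges F ++ linPairs w [] ++ proj₁ (cycMatch (linOp w []) (linCl w [])) ++ zipFrom N 0 us

  labelsF : labels F ≡ rng 0 N
  labelsF = labels-label 0 is

  all-labels : labels F ++ rng N K ≡ rng 0 (N + K)
  all-labels = ≡.trans (cong (_++ rng N K) labelsF) (sym (rng-++ 0 N K))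

  τ-list : map (λ i → N + i) (upTo K) ≡ rng N K
  τ-list = upTo-rng N K

  ps-eq : ps ≡ edges F ++ matched w ++ zipFrom N 0 us
  ps-eq = cong (edges F ++_) (sym (List.++-assoc (linPairs w []) _ _))

  -- Tree edges, matched pairs and edges at τ use every number once. Hence each lookup in `ps` has a
  -- single answer and the pairing is an involution.
  sides-ps : sides ps ↭ rng 0 (N + K)
  sides-ps = begin
    sides ps ≡⟨ cong sides ps-eq ⟩
    sides (edges F ++ matched w ++ zipFrom N 0 us) ≡⟨ sides-++ (edges F) _ ⟩
    sides (edges F) ++ sides (matched w ++ zipFrom N 0 us) ≡⟨ cong (sides (edges F) ++_) (sides-++ (matched w) _) ⟩
    sides (edges F) ++ sides (matched w) ++ sides (zipFrom N 0 us)
      ↭⟨ ↭.++⁺ˡ (sides (edges F)) (↭.++⁺ˡ (sides (matched w)) (sides-zip N 0 us)) ⟩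
    sides (edges F) ++ sides (matched w) ++ us ++ rng (N + 0) K
      ≡⟨ cong (λ z → sides (edges F) ++ sides (matched w) ++ us ++ rng z K) (ℕ.+-identityʳ N) ⟩
    sides (edges F) ++ sides (matched w) ++ us ++ rng N K
      ≡⟨ cong (sides (edges F) ++_) (sym (List.++-assoc (sides (matched w)) us _)) ⟩
    sides (edges F) ++ (sides (matched w) ++ us) ++ rng N K
      ↭⟨ ↭.++⁺ˡ (sides (edges F)) (↭.++⁺ʳ (rng N K) (matched-↭ w)) ⟩
    sides (edges F) ++ map proj₁ w ++ rng N K ≡⟨ cong (λ z → sides (edges F) ++ z ++ rng N K) (typed-leaves c F) ⟩
    sides (edges F) ++ leaves F ++ rng N K ≡⟨ sym (List.++-assoc (sides (edges F)) _ _) ⟩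
    (sides (edges F) ++ leaves F) ++ rng N K ↭⟨ ↭.++⁺ʳ (rng N K) (sides-leaves F) ⟩
    labels F ++ rng N K ≡⟨ all-labels ⟩
    rng 0 (N + K) ∎
    where open PermutationReasoning

  rs-↭ : concat (map proj₂ rs) ↭ rng 0 (N + K)
  rs-↭ = begin
    concat (map proj₂ rs) ≡⟨ cong concat (List.map-++ proj₂ (rots c F ++ _) _) ⟩
    concat (map proj₂ (rots c F ++ [ (c , row F) ]) ++ [ reverse τs ]) ≡⟨ sym (List.concat-++ (map proj₂ (rots c F ++ [ (c , row F) ])) _) ⟩
    concat (map proj₂ (rots c F ++ [ (c , row F) ])) ++ concat [ reverse τs ]
      ≡⟨ cong₂ _++_ (cong concat (List.map-++ proj₂ (rots c F) _)) (List.++-identityʳ _) ⟩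
    concat (map proj₂ (rots c F) ++ [ row F ]) ++ reverse τs ↭⟨ ↭.++⁺ (concat-↭ (↭.++-comm (map proj₂ (rots c F)) [ row F ])) (↭.↭-reverse τs) ⟩
    concat (rows c F) ++ τs ↭⟨ ↭.++⁺ (rows-labels c F) (↭-reflexive τ-list) ⟩
    labels F ++ rng N K ≡⟨ all-labels ⟩
    rng 0 (N + K) ∎
    where
    open PermutationReasoning
    τs = map (λ i → N + i) (upTo K)

  uniq-ps : Unique (sides ps)
  uniq-ps = uniq-↭ (↭-sym sides-ps) (rng-uniq 0 (N + K))

  uniq-rs : Unique (concat (map proj₂ rs))
  uniq-rs = uniq-↭ (↭-sym rs-↭) (rng-uniq 0 (N + K))

  rs-< : ∀ {c l x} → (c , l) ∈ rs → x ∈ l → x < N + K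
  rs-< i j = proj₂ (∈-rng⁻ 0 (N + K) (↭.∈-resp-↭ rs-↭ (∈.∈-concat⁺′ j (∈.∈-map⁺ proj₂ i))))

  ps-< : ∀ {a b} → (a , b) ∈ ps → a < N + K × b < N + K
  ps-< i with p , q ← ∈-sides i = proj₂ (∈-rng⁻ 0 (N + K) (↭.∈-resp-↭ sides-ps p)) , proj₂ (∈-rng⁻ 0 (N + K) (↭.∈-resp-↭ sides-ps q))

  edges⊆ps : ∀ {p} → p ∈ edges F → p ∈ ps
  edges⊆ps i = ∈.∈-++⁺ˡ i

  matched⊆ps : ∀ {p} → p ∈ matched w → p ∈ ps
  matched⊆ps i = subst (_ ∈_) (sym ps-eq) (∈.∈-++⁺ʳ (edges F) (∈.∈-++⁺ˡ i))

  zip⊆ps : ∀ {p} → p ∈ zipFrom N 0 us → p ∈ ps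
  zip⊆ps i = subst (_ ∈_) (sym ps-eq) (∈.∈-++⁺ʳ (edges F) (∈.∈-++⁺ʳ (matched w) i))

  ps-split : ∀ {p} → p ∈ ps → p ∈ edges F ⊎ p ∈ matched w ⊎ p ∈ zipFrom N 0 us
  ps-split i with ∈.∈-++⁻ (edges F) (subst (_ ∈_) ps-eq i)
  ... | inj₁ j = inj₁ j
  ... | inj₂ j with ∈.∈-++⁻ (matched w) j
  ...   | inj₁ k = inj₂ (inj₁ k)
  ...   | inj₂ k = inj₂ (inj₂ k)

  rots⊆rs : ∀ {p} → p ∈ rots c F → p ∈ rs
  rots⊆rs i = ∈.∈-++⁺ˡ (∈.∈-++⁺ˡ i)

  row∈rs : (c , row F) ∈ rs
  row∈rs = ∈.∈-++⁺ˡ (∈.∈-++⁺ʳ (rots c F) (here refl))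

  τ∈rs : (τColor (node is) , reverse (rng N K)) ∈ rs
  τ∈rs = ∈.∈-++⁺ʳ (rots c F ++ [ (c , row F) ]) (here (cong (λ z → τColor (node is) , reverse z) (sym τ-list)))

  rs-split : ∀ {p} → p ∈ rs → p ∈ rots c F ⊎ p ≡ (c , row F) ⊎ p ≡ (τColor (node is) , reverse (rng N K))
  rs-split i with ∈.∈-++⁻ (rots c F ++ [ (c , row F) ]) i
  ... | inj₂ (here e) = inj₂ (inj₂ (≡.trans e (cong (λ z → τColor (node is) , reverse z) τ-list)))
  ... | inj₁ j with ∈.∈-++⁻ (rots c F) j
  ...   | inj₁ k = inj₁ k
  ...   | inj₂ (here e) = inj₂ (inj₁ e)

  module _ (wc : WCItems c is) (τc : Color) (k : ℕ) (0<k : 0 < k) (ch : charge (node is) ≡ signed τc k) where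

    Match : ℕ × Stem → ℕ × Stem → Set
    Match (a , s) (b , t) = s ≡ opening × t ≡ closing × (a , b) ∈ matched w

    word : ∃ λ s → Good Match (map (_, s) us) w
    word = matching-good w (λ i → refl , refl , i)

    s = proj₁ word

    -- A matched pair has charge zero and the unmatched stems are all of the same kind `s`, so the
    -- charge is `K` up to a sign given by `s`. As it is nonzero, both can be read off.
    unmatched-charge : flipC (stemColor s) ≡ τc × K ≡ k
    unmatched-charge = signed-inj _ τc K k 0<k (begin
      signed (flipC (stemColor s)) K ≡⟨ sym (∑-stems s us) ⟩
      ∑ (stemCharge ∘ stemColor ∘ proj₂) (map (_, s) us) ≡⟨ sym (good-∑ _ (λ { (refl , refl , _) → refl }) (proj₂ word)) ⟩
      ∑ (stemCharge ∘ stemColor ∘ proj₂) w ≡⟨ ∑-typed c F ⟩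
      chg c F ≡⟨ chg-label c 0 is wc ⟩
      charge (node is) ≡⟨ ch ⟩
      signed τc k ∎)
      where open ≡-Reasoning

    K≡k = proj₂ unmatched-charge

    τColor≡ : τColor (node is) ≡ τc
    τColor≡ = ⊖-color (nCloseItems is) (nOpenItems is) τc k 0<k ch

private
  WithStructure : Color → Color → ℕ → List Item → Map → Set
  WithStructure c τc k is m = ∃₂ λ F us → Structure m c τc F us × shape c F ≡ is × length us ≡ k

closure-structure : ∀ c is τc k → 0 < k → WCItems c is → charge (node is) ≡ signed τc k →
  WithStructure c τc k is (completeClosure (c , node is))
closure-structure c is τc k@(suc k') 0<k wc ch = subst (WithStructure c τc k is) (sym map-eq)
  (mapF g F , map g us , structure , ≡.trans (shape-mapF g c F) (shape-label c 0 is wc) , ≡.trans (List.length-map g us) K≡)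
  where
  open Closure c is
  K≡ = K≡k wc τc k 0<k ch
  D = N + k'
  -- The number of darts is exhibited as a successor, which lets `rawToMap` reduce to its second
  -- clause.
  T≡ : N + K ≡ suc D
  T≡ = ≡.trans (cong (λ z → N + z) K≡) (ℕ.+-suc N k')
  map-eq : completeClosure (c , node is) ≡ rawToMap (raw (suc D) N rs ps)
  map-eq = cong rawToMap (≡.trans (closureRaw-eq c is wc) (cong (λ z → raw z N rs ps) T≡))
  open Map (rawToMap (raw (suc D) N rs ps))
  g : ℕ → Fin n
  g = toFin

  <T : ∀ {x} → x < N + K → x < suc D
  <T {x} = subst (x <_) T≡

  rot-ok : ∀ {c' l} → (c' , l) ∈ rs → RotOk σ α color (c' , map g l)
  rot-ok {c'} {l} i = cyc-map g l (λ j e → raw-σ {D} {N} {rs} {ps} (lookupRot-unique rs uniq-rs i e) (<T (rs-< i j)) (<T (rs-< i (proj₂ (nextCyc-∈ l e)))))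
      (nextCyc-cyc l (concat-uniq _ uniq-rs (∈.∈-map⁺ proj₂ i)))
    , All.map⁺ (All.tabulate (λ j → let y , e = nextCyc-complete l j in raw-color {D} {N} {rs} {ps} (lookupRot-unique rs uniq-rs i e) (<T (rs-< i j))))

  α-ok : ∀ {a b} → (a , b) ∈ ps → α (g a) ≡ g b × α (g b) ≡ g a
  α-ok i = let p , q = lookupPair-unique ps uniq-ps i
               a< , b< = ps-< i
           in raw-α {D} {N} {rs} {ps} p (<T a<) (<T b<) , raw-α {D} {N} {rs} {ps} q (<T b<) (<T a<)

  F' : Forest (Fin n)
  F' = mapF g F

  us' : List (Fin n)
  us' = map g us

  wf' : Wf σ α color c F'
  wf' = wf-intro σ α color c F'
    (subst (All (λ d → color d ≡ c)) (sym (row-mapF g F)) (proj₂ (rot-ok row∈rs)))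
    (subst (All (RotOk σ α color)) (sym (rots-mapF g c F)) (All.map⁺ (All.tabulate (λ {(c' , l)} i → rot-ok {c'} {l} (rots⊆rs i)))))
    (subst (All (λ (x , y) → α x ≡ y)) (sym (edges-mapF g F)) (All.map⁺ (All.tabulate (λ i → proj₁ (α-ok (edges⊆ps i))))))

  τ-darts : map α us' ≡ map g (rng N K)
  τ-darts = ≡.trans (zip-map N 0 us (All.tabulate (λ i → proj₁ (α-ok (zip⊆ps i))))) (cong (λ z → map g (rng z K)) (ℕ.+-identityʳ N))

  total : map g (rng 0 (N + K)) ≡ labels F' ++ map α us'
  total = ≡.trans (cong (map g) (sym all-labels)) (≡.trans (List.map-++ g (labels F) (rng N K)) (cong₂ _++_ (sym (labels-mapF g F)) (sym τ-darts)))

  ∈-total : ∀ x → x ∈ map g (rng 0 (N + K))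
  ∈-total x = subst (_∈ map g (rng 0 (N + K))) (toFin-toℕ x) (∈.∈-map⁺ g (∈-rng⁺ 0 (N + K) z≤n (subst (toℕ x <_) (sym T≡) (Fin.toℕ<n x))))

  typed-color : ∀ {x t} → (x , t) ∈ w → color (g x) ≡ stemColor t
  typed-color i = All.lookup (wf-typed σ α color c F' wf') (subst (_ ∈_) (sym (typed-mapF g c F)) (∈.∈-map⁺ _ i))

  word' = word wc τc k 0<k ch
  s' = proj₁ word'

  τ-head : flipC (stemColor s') ≡ τc
  τ-head = proj₁ (unmatched-charge wc τc k 0<k ch)

  us-color : ∀ {u} → u ∈ us → color (g u) ≡ flipC τc
  us-color i = ≡.trans (typed-color (good-⊇ (proj₂ word') (∈.∈-map⁺ (_, s') i)))
    (≡.trans (sym (flipC-flipC (stemColor s'))) (cong flipC τ-head))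

  structure : Structure (rawToMap (raw (suc D) N rs ps)) c τc F' us'
  structure = record
    { α-invol = invol
    ; wf = wf'
    ; rootRow = subst (Cyc (Graph σ)) (sym (row-mapF g F)) (proj₁ (rot-ok row∈rs))
    ; good = subst₂ (Good _) (≡.trans (sym (List.map-∘ us)) refl) (≡.trans (List.map-∘ w) (≡.trans (cong (map g) (typed-leaves c F)) (sym (leaves-mapF g F))))
        (good-map (g ∘ proj₁) pairs (good-∈ id (proj₂ word')))
    -- `closureRaw` lists the darts of τ against the order of the unmatched stems; reversing the
    -- cycle restores that order, with `σ` running backwards.
    ; τ-rot = cyc-unmap α us' (subst (Cyc (λ a b → σ b ≡ a)) (≡.trans (cong reverse (List.reverse-map g (rng N K))) (≡.trans (List.reverse-involutive (map g (rng N K))) (sym τ-darts)))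
        (cyc-rev (map g (reverse (rng N K))) (proj₁ (rot-ok τ∈rs))))
    ; us-col = All.map⁺ (All.tabulate us-color)
    ; τ-col = All.map⁻ (subst (All (λ d → color d ≡ τc)) (sym τ-darts) (All.map⁺ (All.tabulate (λ i →
        ≡.trans (All.lookup (All.map⁻ (proj₂ (rot-ok τ∈rs))) (↭.∈-resp-↭ (↭-sym (↭.↭-reverse (rng N K))) i)) (τColor≡ wc τc k 0<k ch)))))
    ; us-inh = inh us' (≡.trans (List.length-map g us) K≡)
    ; cover = subst (_↭ allFin n) total (sub-full (Unique.allFin⁺ n) (λ _ → ∈-total _)
        (ℕ.≤-reflexive (≡.trans (List.length-map g (rng 0 (N + K))) (≡.trans (length-rng 0 (N + K)) (≡.trans T≡ (sym (List.length-tabulate {n = n} id)))))))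
    ; mark⇒ = λ {x} e → subst₂ _∈_ (toFin-toℕ x) (sym τ-darts) (∈.∈-map⁺ g (∈-rng⁺ N K (ℕ.≤ᵇ⇒≤ N _ (≡→T e)) (subst (toℕ x <_) (sym T≡) (Fin.toℕ<n x))))
    ; mark⇐ = λ i → mark (subst (_ ∈_) τ-darts i)
    ; rootHd = root-head is ch
    ; charged = charged-mapF c F (charged-label c 0 is wc)
    }
    where
    subst₂ = ≡.subst₂
    invol : ∀ x → α (α x) ≡ x
    invol x with a , i , refl ← ∈.∈-map⁻ g (∈-total x) with sides-∈ ps (↭.∈-resp-↭ (↭-sym sides-ps) i)
    ... | b , inj₁ j = ≡.trans (cong α (proj₁ (α-ok j))) (proj₂ (α-ok j))
    ... | b , inj₂ j = ≡.trans (cong α (proj₂ (α-ok j))) (proj₁ (α-ok j))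
    pairs : ∀ {x y} → Match wc τc k 0<k ch x y × x ∈ w × y ∈ w →
      color (g (proj₁ x)) ≡ black × color (g (proj₁ y)) ≡ white × α (g (proj₁ x)) ≡ g (proj₁ y)
    pairs ((refl , refl , i) , x∈ , y∈) = typed-color x∈ , typed-color y∈ , proj₁ (α-ok (matched⊆ps i))
    inh : (l : List (Fin n)) → length l ≡ suc k' → Inhabited l
    inh (x ∷ l) e = x , here refl
    mark : ∀ {x} → x ∈ map g (rng N K) → marked x ≡ true
    mark {x} i with a , j , refl ← ∈.∈-map⁻ g i = T→≡ (ℕ.≤⇒≤ᵇ (subst (N ≤_) (sym (toℕ-toFin (<T (proj₂ (∈-rng⁻ N K j))))) (proj₁ (∈-rng⁻ N K j))))
    g0 : g 0 ≡ root
    g0 = Fin.toℕ-injective (toℕ-toFin {D} {0} (s≤s z≤n))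
    zero-signed : ∀ c → signed c 0 ≡ 0ℤ
    zero-signed black = refl
    zero-signed white = refl
    root-head : ∀ is → charge (node is) ≡ signed τc k → ∃ λ l → row (mapF g (label 0 is)) ≡ root ∷ l
    root-head [] e with () ← proj₂ (signed-inj τc τc 0 k 0<k (≡.trans (zero-signed τc) e))
    root-head (stem x ∷ is) e = _ , cong (_∷ row (mapF g (label 1 is))) g0
    root-head (child (node js) ∷ is) e = _ , cong (_∷ row (mapF g (label (2 + darts js) is))) g0
    charged-mapF : ∀ c (F : Forest ℕ) → Charged c F → Charged c (mapF g F)
    charged-mapF c ε h = tt
    charged-mapF c (leaf d r) h = charged-mapF c r h
    charged-mapF c (edge d d' b r) (p , h , h') = subst (Bounded (flipC c)) (sym (chg-mapF g (flipC c) b)) p , charged-mapF (flipC c) b h , charged-mapF c r h'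

-- A map with a structure is the closure of its tree

nth : A → List A → ℕ → A
nth d [] _ = d
nth d (x ∷ l) zero = x
nth d (x ∷ l) (suc i) = nth d l i

map-nth : (d : A) (p l : List A) → map (nth d (p ++ l)) (rng (length p) (length l)) ≡ l
map-nth d p [] = refl
map-nth d p (x ∷ l) = cong₂ _∷_ (hd p) (subst₂ (λ q k → map (nth d q) (rng k (length l)) ≡ l)
    (List.++-assoc p [ x ] l) (≡.trans (List.length-++ p) (ℕ.+-comm (length p) 1)) (map-nth d (p ++ [ x ]) l))
  where
  open ≡ using (subst₂)
  hd : ∀ p → nth d (p ++ x ∷ l) (length p) ≡ x
  hd [] = refl
  hd (_ ∷ p) = hd p

nth-++ : (d : A) (p l : List A) → ∀ {i} → i < length p → nth d (p ++ l) i ≡ nth d p i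
nth-++ d (x ∷ p) l {zero} lt = refl
nth-++ d (x ∷ p) l {suc i} (s≤s lt) = nth-++ d p l lt

map-cong-∈ : {f g : A → B} → ∀ l → (∀ {x} → x ∈ l → f x ≡ g x) → map f l ≡ map g l
map-cong-∈ [] e = refl
map-cong-∈ (x ∷ l) e = cong₂ _∷_ (e (here refl)) (map-cong-∈ l (e ∘ there))

map-nth-++ : (d : A) (p l : List A) → map (nth d (p ++ l)) (rng 0 (length p)) ≡ p
map-nth-++ d p l = ≡.trans (map-cong-∈ (rng 0 (length p)) (λ i → nth-++ d p l (proj₂ (∈-rng⁻ 0 (length p) i)))) (map-nth d [] p)

map-++-inv : (f : A → B) → ∀ v {v'} w → map f w ≡ v ++ v' → ∃₂ λ w₁ w₂ → w ≡ w₁ ++ w₂ × map f w₁ ≡ v × map f w₂ ≡ v'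
map-++-inv f [] w e = [] , w , refl , refl , e
map-++-inv f (x ∷ v) (y ∷ w) e with w₁ , w₂ , refl , refl , e' ← map-++-inv f v w (List.∷-injectiveʳ e) =
  y ∷ w₁ , w₂ , refl , cong (_∷ map f w₁) (List.∷-injectiveˡ e) , e'

-- A reduction acts on positions of the word, so it lifts along any renaming `f`. This transfers it
-- from the darts of the map to the numbered, typed stems that the algorithm reads.
good-unmap : ∀ {P : B → B → Set} (f : A → B) {us v w w₀} → (∀ {x} → x ∈ w → x ∈ w₀) → v ≡ map f w → Good P us v →
  ∃ λ us' → Good (λ x y → P (f x) (f y) × x ∈ w₀ × y ∈ w₀) us' w × us ≡ map f us'
good-unmap f {w = w} s e base = w , base , e
good-unmap f {w = _ ∷ _ ∷ w} s refl (ins p g) with us' , g' , e ← good-unmap f (s ∘ there ∘ there) refl g =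
  us' , ins (p , s (here refl) , s (there (here refl))) g' , e
good-unmap f {w = w} s e (rot {x} {v} g) with w₁ , w₂ , refl , refl , e₂ ← map-++-inv f v w (sym e) with w₂ | e₂
... | y ∷ [] | refl with us' , g' , e' ← good-unmap f {w = y ∷ w₁} (s ∘ ↭.∈-resp-↭ (↭.++-comm [ y ] w₁)) refl g = us' , rot g' , e'

wc-shape : ∀ c (F : Forest A) → Charged c F → WCItems c (shape c F)
chg-shape : ∀ c (F : Forest A) → Charged c F → chg c F ≡ nCloseItems (shape c F) ⊖ nOpenItems (shape c F)

wc-shape c ε h = tt
wc-shape black (leaf d r) h = refl , wc-shape black r h
wc-shape white (leaf d r) h = refl , wc-shape white r h
wc-shape black (edge d d' b r) (p , h , h') = (wc-shape white b h , subst (0ℤ ℤ.≤_) (chg-shape white b h) p) , wc-shape black r h'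
wc-shape white (edge d d' b r) (p , h , h') = (wc-shape black b h , subst (ℤ._≤ 1ℤ) (chg-shape black b h) p) , wc-shape white r h'

chg-shape c ε h = refl
chg-shape black (leaf d r) h = ≡.trans (cong (λ z → ℤ.-1ℤ ℤ.+ z) (chg-shape black r h)) (sym (⊖-+ 0 (nCloseItems (shape black r)) 1 (nOpenItems (shape black r))))
chg-shape white (leaf d r) h = ≡.trans (cong (λ z → 1ℤ ℤ.+ z) (chg-shape white r h)) (sym (⊖-+ 1 (nCloseItems (shape white r)) 0 (nOpenItems (shape white r))))
chg-shape c (edge d d' b r) (p , h , h') = ≡.trans (cong₂ ℤ._+_ (chg-shape (flipC c) b h) (chg-shape c r h'))
  (sym (⊖-+ (nCloseItems (shape (flipC c) b)) (nCloseItems (shape c r)) (nOpenItems (shape (flipC c) b)) (nOpenItems (shape c r))))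

structure-charge : ∀ {m c τc F us} → Structure m c τc F us → chg c F ≡ signed τc (length us)
structure-charge {m} {c} {τc} {F} {us} S = begin
  chg c F ≡⟨ sym (∑-typed c F) ⟩
  ∑ (stemCharge ∘ stemColor ∘ proj₂) (typed c F)
    ≡⟨ ∑-cong (typed c F) (λ i → cong stemCharge (sym (All.lookup (wf-typed σ α color c F wf) i))) ⟩
  ∑ (stemCharge ∘ color ∘ proj₁) (typed c F) ≡⟨ sym (∑-map proj₁ (stemCharge ∘ color) (typed c F)) ⟩
  ∑ (stemCharge ∘ color) (map proj₁ (typed c F)) ≡⟨ cong (∑ (stemCharge ∘ color)) (typed-leaves c F) ⟩
  ∑ (stemCharge ∘ color) (leaves F) ≡⟨ good-∑ _ (λ (p , q , _) → cong₂ (λ a b → stemCharge a ℤ.+ stemCharge b) p q) good ⟩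
  ∑ (stemCharge ∘ color) us ≡⟨ ∑-cong us (λ i → cong stemCharge (All.lookup us-col i)) ⟩
  ∑ (λ _ → stemCharge (flipC τc)) us ≡⟨ const τc us ⟩
  signed τc (length us) ∎
  where
  open ≡-Reasoning
  open Structure S
  open Map m
  const : ∀ τ (l : List A) → ∑ (λ _ → stemCharge (flipC τ)) l ≡ signed τ (length l)
  const black [] = refl
  const white [] = refl
  const black (x ∷ l) = cong (λ z → 1ℤ ℤ.+ z) (const black l)
  const white (x ∷ l) = ≡.trans (cong (λ z → ℤ.-1ℤ ℤ.+ z) (const white l)) (sym (ℤ.neg-distrib-+ 1ℤ (+ length l)))

zip-unmap : ∀ {f : ℕ → A} {h : A → A} N i us → map h (map f us) ≡ map f (rng (N + i) (length us)) → All (λ (x , y) → h (f x) ≡ f y) (zipFrom N i us)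
zip-unmap N i [] e = []
zip-unmap {f = f} N i (u ∷ us) e = List.∷-injectiveˡ e ∷
  zip-unmap N (suc i) us (≡.trans (List.∷-injectiveʳ e) (cong (λ z → map f (rng z (length us))) (sym (ℕ.+-suc N i))))

labels-head : ∀ (F : Forest A) {r l} → row F ≡ r ∷ l → ∃ λ l' → labels F ≡ r ∷ l'
labels-head (leaf d F) refl = _ , refl
labels-head (edge d d' b F) refl = _ , refl

private
  IsoTo : Map → Map → Set
  IsoTo m m' = m' ≅ m

module _ {m : Map} {c τc : Color} {F : Forest (Fin (Map.n m))} {us : List (Fin (Map.n m))} (S : Structure m c τc F us) where

  open Structure S
  open Map m
  private
    is = shape c F
    module C = Closure c is
    open C using (N; K; w; rs; ps)
    F₀ = C.F
    us₀ = C.us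

    f : ℕ → Fin n
    f = nth root (labels F)

    -- The darts of τ in the order of the stems `us₀` that the algorithm leaves unmatched; these
    -- agree with `us` only up to a permutation.
    tl : List (Fin n)
    tl = map (α ∘ f) us₀

    look : ℕ → Fin n
    look = nth root (labels F ++ tl)

    N≡ : N ≡ length (labels F)
    N≡ = darts-shape c F

    look≡f : ∀ {a} → a < N → look a ≡ f a
    look≡f lt = nth-++ root (labels F) tl (subst (_ <_) N≡ lt)

    f-F : mapF f F₀ ≡ F
    f-F = relabel c F 0 f (map-nth root [] (labels F))

    look-F : mapF look F₀ ≡ F
    look-F = relabel c F 0 look (map-nth-++ root (labels F) tl)

    look-τ : map look (rng N K) ≡ tl
    look-τ = ≡.trans (cong₂ (λ a b → map look (rng a b)) N≡ (sym (List.length-map (α ∘ f) us₀))) (map-nth root (labels F) tl)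

    color-w : ∀ {x} → x ∈ w → color (f (proj₁ x)) ≡ stemColor (proj₂ x)
    color-w {x} i = All.lookup (wf-typed σ α color c (mapF f F₀) (subst (Wf σ α color c) (sym f-F) wf))
      (subst ((f (proj₁ x) , proj₂ x) ∈_) (sym (typed-mapF f c F₀)) (∈.∈-map⁺ _ i))

    word : ∃ λ us' → Good (λ x y → Pairs (f (proj₁ x)) (f (proj₁ y)) × x ∈ w × y ∈ w) us' w × us ≡ map (f ∘ proj₁) us'
    word = good-unmap (f ∘ proj₁) id
      (≡.trans (cong leaves (sym f-F)) (≡.trans (leaves-mapF f F₀) (≡.trans (cong (map f) (sym (typed-leaves c F₀))) (sym (List.map-∘ w))))) good

    us' = proj₁ word
    P' : ℕ × Stem → ℕ × Stem → Set
    P' x y = Pairs (f (proj₁ x)) (f (proj₁ y)) × x ∈ w × y ∈ w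

    s* : Stem
    s* = stemOf (flipC τc)

    typing : ∀ {x y} → P' x y → proj₂ x ≡ opening × proj₂ y ≡ closing
    typing {_ , s} {_ , t} ((p , q , _) , i , j) =
      ≡.trans (sym (stemOf-stemColor s)) (cong stemOf (≡.trans (sym (color-w i)) p)) ,
      ≡.trans (sym (stemOf-stemColor t)) (cong stemOf (≡.trans (sym (color-w j)) q))

    us'-typed : us' ≡ map (_, s*) (map proj₁ us')
    us'-typed = ≡.trans (sym (List.map-id us')) (≡.trans (map-cong-∈ us' (λ {(u , s)} i → cong (u ,_)
      (≡.trans (sym (stemOf-stemColor s)) (cong stemOf (≡.trans (sym (color-w (good-⊇ (proj₁ (proj₂ word)) i)))
        (All.lookup us-col (subst (f u ∈_) (sym (proj₂ (proj₂ word))) (∈.∈-map⁺ (f ∘ proj₁) i)))))))) (List.map-∘ us'))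

    -- The part of the structure at τ that survives rotating the word, as `good-nested` demands.
    R : List ℕ → Set
    R l = Cyc (λ u u' → σ (α u') ≡ α u) (map f l) × map f l ↭ us

    Q : List (ℕ × Stem) → Set
    Q v = ∃ λ l → v ≡ map (_, s*) l × R l

    Q-rot : ∀ {x v} → Q (x ∷ v) → Q (v ++ [ x ])
    Q-rot (u ∷ l , refl , r , p) = l ++ [ u ] , sym (List.map-++ (_, s*) l [ u ]) ,
      subst (Cyc _) (sym (List.map-++ f l [ u ])) (cyc-rot [ f u ] (map f l) r) ,
      trans (↭.map⁺ f (↭.++-comm l [ u ])) p

    f-us : map f (map proj₁ us') ≡ us
    f-us = ≡.trans (sym (List.map-∘ us')) (sym (proj₂ (proj₂ word)))

    matching : (∀ {o c} → (o , c) ∈ matched w → P' (o , opening) (c , closing)) × R us₀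
    matching = nested-matching typing {R = R} (good-nested {Q = Q} Q-rot
      (_ , us'-typed , subst (Cyc _) (sym f-us) τ-rot , ↭-reflexive f-us) (proj₁ (proj₂ word)))

    f-us₀ : map f us₀ ↭ us
    f-us₀ = proj₂ (proj₂ matching)

    K≡ : K ≡ length us
    K≡ = ≡.trans (sym (List.length-map f us₀)) (↭.↭-length f-us₀)

    tl≡ : tl ≡ map α (map f us₀)
    tl≡ = List.map-∘ us₀

    tl-↭ : tl ↭ map α us
    tl-↭ = trans (↭-reflexive tl≡) (↭.map⁺ α f-us₀)

    list : map look (rng 0 (N + K)) ≡ labels F ++ tl
    list = ≡.trans (cong (map look) (rng-++ 0 N K)) (≡.trans (List.map-++ look (rng 0 N) (rng N K))
      (cong₂ _++_ (≡.trans (cong (λ z → map look (rng 0 z)) N≡) (map-nth-++ root (labels F) tl)) look-τ))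

    list-↭ : map look (rng 0 (N + K)) ↭ allFin n
    list-↭ = trans (↭-reflexive list) (trans (↭.++⁺ˡ (labels F) tl-↭) cover)

    list-uniq : Unique (map look (rng 0 (N + K)))
    list-uniq = uniq-↭ (↭-sym list-↭) (Unique.allFin⁺ n)

    leaf< : ∀ {x} → x ∈ w → proj₁ x < N
    leaf< i = proj₂ (∈-rng⁻ 0 N (subst (_ ∈_) C.labelsF (leaves⊆labels F₀ (subst (_ ∈_) (typed-leaves c F₀) (∈.∈-map⁺ proj₁ i)))))

    rot-ok : ∀ {p} → p ∈ rs → RotOk σ α color (proj₁ p , map look (proj₂ p))

    pair-ok : ∀ {p} → p ∈ ps → α (look (proj₁ p)) ≡ look (proj₂ p)
    pair-ok i with C.ps-split i
    ... | inj₁ j = All.lookup (All.map⁻ (subst (All (λ (x , y) → α x ≡ y)) (edges-mapF look F₀)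
            (wf-edges σ α color c (mapF look F₀) (subst (Wf σ α color c) (sym look-F) wf)))) j
    ... | inj₂ (inj₁ j) with (_ , _ , e) , x , y ← proj₁ matching j = ≡.trans (cong α (look≡f (leaf< x))) (≡.trans e (sym (look≡f (leaf< y))))
    ... | inj₂ (inj₂ j) = All.lookup (zip-unmap {f = look} {h = α} N 0 us₀ (≡.trans (cong (map α) (map-cong-∈ us₀ (λ i → look≡f (us₀< i))))
            (≡.trans (sym tl≡) (≡.trans (sym look-τ) (cong (λ z → map look (rng z K)) (sym (ℕ.+-identityʳ N))))))) j
      where
      us₀< : ∀ {a} → a ∈ us₀ → a < N
      us₀< i with (a , s) , j , refl ← ∈.∈-map⁻ proj₁ (↭.∈-resp-↭ (matched-↭ w) (∈.∈-++⁺ʳ (sides (matched w)) i)) = leaf< j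

    τ≡ : 0 < length us → τColor (node is) ≡ τc
    τ≡ p = ⊖-color (nCloseItems is) (nOpenItems is) τc (length us) p
      (≡.trans (sym (chg-shape c F charged)) (structure-charge S))

    us>0 : 0 < length us
    us>0 = ∈.∈-length (proj₂ us-inh)

    rot-ok {c' , l} i with C.rs-split i
    ... | inj₁ j = All.lookup (All.map⁻ (subst (All (RotOk σ α color)) (rots-mapF look c F₀)
            (wf-rots σ α color c (mapF look F₀) (subst (Wf σ α color c) (sym look-F) wf)))) j
    ... | inj₂ (inj₁ refl) = subst (λ l → RotOk σ α color (c , l)) (≡.trans (cong row (sym look-F)) (row-mapF look F₀)) (rootRow , wf-row σ α color c F wf)
    ... | inj₂ (inj₂ refl) = subst (λ l → RotOk σ α color (τColor (node is) , l))
            (sym (≡.trans (List.reverse-map look (rng N K)) (cong reverse look-τ)))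
            (subst (λ l → Cyc (Graph σ) (reverse l)) (sym tl≡) (cyc-rev (map α (map f us₀)) (cyc-map α (map f us₀) (λ _ e → e) (proj₁ (proj₂ matching))))
            , ↭.All-resp-↭ (↭-sym (↭.↭-reverse tl)) (↭.All-resp-↭ (↭-sym tl-↭) (All.map⁺ (All.map (λ e → ≡.trans e (sym (τ≡ us>0))) τ-col))))

  -- The isomorphism sends the dart numbered `i` to the `i`-th entry of the labels followed by the
  -- darts of τ.
  structure-iso : completeClosure (c , node (shape c F)) ≅ m
  structure-iso with length us in len | us>0
  ... | suc k' | _ = subst (IsoTo m) (sym map-eq) iso
    where
    D = N + k'
    T≡ : N + K ≡ suc D
    T≡ = ≡.trans (cong (λ z → N + z) (≡.trans K≡ len)) (ℕ.+-suc N k')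
    map-eq : completeClosure (c , node is) ≡ rawToMap (raw (suc D) N rs ps)
    map-eq = cong rawToMap (≡.trans (closureRaw-eq c is (wc-shape c F charged)) (cong (λ z → raw z N rs ps) T≡))
    M = rawToMap (raw (suc D) N rs ps)

    <T : ∀ {x} → x < N + K → x < suc D
    <T {x} = subst (x <_) T≡
    T< : ∀ {x} → x < suc D → x ∈ rng 0 (N + K)
    T< {x} lt = ∈-rng⁺ 0 (N + K) z≤n (subst (x <_) (sym T≡) lt)

    to : Fin (suc D) → Fin n
    to x = look (toℕ x)

    from-∃ : ∀ y → ∃ λ x → to x ≡ y
    from-∃ y with a , i , e ← ∈.∈-map⁻ look (↭.∈-resp-↭ (↭-sym list-↭) (∈.∈-allFin y)) =
      toFin a , ≡.trans (cong look (toℕ-toFin (<T (proj₂ (∈-rng⁻ 0 (N + K) i))))) (sym e)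

    to-inj : ∀ x y → to x ≡ to y → x ≡ y
    to-inj x y e = Fin.toℕ-injective (uniq-map list-uniq (T< (Fin.toℕ<n x)) (T< (Fin.toℕ<n y)) e)

    rot-at : ∀ x → ∃₂ λ cy l → lookupRot rs (toℕ x) ≡ just cy × (proj₁ cy , l) ∈ rs × nextCyc l (toℕ x) ≡ just (proj₂ cy)
    rot-at x with cy , e ← lookupRot-complete rs (↭.∈-resp-↭ (↭-sym C.rs-↭) (T< (Fin.toℕ<n x)))
      with l , i , q ← lookupRot-sound rs e = cy , l , e , i , q

    pσ : ∀ x → to (Map.σ M x) ≡ σ (to x)
    pσ x = let cy , l , e , i , q = rot-at x in go e i q
      where
      open ≡-Reasoning
      go : ∀ {c' y l} → lookupRot rs (toℕ x) ≡ just (c' , y) → (c' , l) ∈ rs → nextCyc l (toℕ x) ≡ just y → to (Map.σ M x) ≡ σ (to x)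
      go {c'} {y} {l} e i q = begin
        to (Map.σ M x) ≡⟨ cong (to ∘ Map.σ M) (sym (toFin-toℕ x)) ⟩
        to (Map.σ M (toFin (toℕ x))) ≡⟨ cong to (raw-σ {D} {N} {rs} {ps} e (Fin.toℕ<n x) y<) ⟩
        to (toFin y) ≡⟨ cong look (toℕ-toFin y<) ⟩
        look y ≡⟨ sym (nextCyc-sound l q (cyc-unmap look l (proj₁ (rot-ok i)))) ⟩
        σ (to x) ∎
        where
        y< : y < suc D
        y< = <T (C.rs-< i (proj₂ (nextCyc-∈ l q)))

    pcolor : ∀ x → color (to x) ≡ Map.color M x
    pcolor x = let cy , l , e , i , q = rot-at x in ≡.trans
      (All.lookup (All.map⁻ (proj₂ (rot-ok i))) (proj₁ (nextCyc-∈ l q)))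
      (≡.trans (sym (raw-color {D} {N} {rs} {ps} e (Fin.toℕ<n x))) (cong (Map.color M) (toFin-toℕ x)))

    partner : ∀ x → ∃ λ y → lookupPair ps (toℕ x) ≡ just y × α (to x) ≡ look y × y < suc D
    partner x with sides-∈ ps (↭.∈-resp-↭ (↭-sym C.sides-ps) (T< (Fin.toℕ<n x)))
    ... | y , inj₁ i = y , proj₁ (lookupPair-unique ps C.uniq-ps i) , pair-ok i , <T (proj₂ (C.ps-< i))
    ... | y , inj₂ i = y , proj₂ (lookupPair-unique ps C.uniq-ps i) , ≡.trans (cong α (sym (pair-ok i))) (α-invol _) , <T (proj₁ (C.ps-< i))

    pα : ∀ x → to (Map.α M x) ≡ α (to x)
    pα x with y , e , r , y< ← partner x = begin
      to (Map.α M x) ≡⟨ cong (to ∘ Map.α M) (sym (toFin-toℕ x)) ⟩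
      to (Map.α M (toFin (toℕ x))) ≡⟨ cong to (raw-α {D} {N} {rs} {ps} e (Fin.toℕ<n x) y<) ⟩
      to (toFin y) ≡⟨ cong look (toℕ-toFin y<) ⟩
      look y ≡⟨ sym r ⟩
      α (to x) ∎
      where open ≡-Reasoning

    proot : look 0 ≡ root
    proot with l , e ← rootHd with l' , e' ← labels-head F e rewrite e' = refl

    pmarked : ∀ x → marked (to x) ≡ (N ≤ᵇ toℕ x)
    pmarked x with N ≤ᵇ toℕ x in q
    ... | true = mark⇐ (↭.∈-resp-↭ tl-↭ (subst (to x ∈_) look-τ (∈.∈-map⁺ look
            (∈-rng⁺ N K (ℕ.≤ᵇ⇒≤ N _ (≡→T q)) (subst (toℕ x <_) (sym T≡) (Fin.toℕ<n x))))))
    ... | false with marked (to x) in e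
    ...   | false = refl
    ...   | true = ⊥-elim (uniq-disj (labels F) (uniq-↭ (↭-sym cover) (Unique.allFin⁺ n))
            (subst (to x ∈_) (≡.trans (cong (λ z → map look (rng 0 z)) N≡) (map-nth-++ root (labels F) tl)) (∈.∈-map⁺ look
              (∈-rng⁺ 0 N z≤n (ℕ.≰⇒> (λ le → subst T q (ℕ.≤⇒≤ᵇ le)))))) (mark⇒ e))

    iso : M ≅ m
    iso = record
      { bij = mk↔ₛ′ to (proj₁ ∘ from-∃) (proj₂ ∘ from-∃) (λ x → to-inj _ x (proj₂ (from-∃ (to x))))
      ; pres-σ = pσ
      ; pres-α = pα
      ; pres-root = proot
      ; pres-color = pcolor
      ; pres-marked = pmarked
      }

-- The contour of the tree and the faces of the closure

-- A half-open `Chain`: `p` is the first element of the list, or `q` if the list is empty. Empty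
-- forests then fit the induction.
Path : (A → A) → A → List A → A → Set
Path f p [] q = p ≡ q
Path f p (d ∷ l) q = p ≡ d × Path f (f d) l q

path-chain : ∀ {f : A → A} {x} l {y} → Path f (f x) l y → Chain (Graph f) x l y
path-chain [] p = p
path-chain (z ∷ l) (refl , p) = refl , path-chain l p

chain-path : ∀ {f : A → A} {x} l {y} → Chain (Graph f) x l y → Path f (f x) l y
chain-path [] p = p
chain-path (z ∷ l) (refl , p) = refl , chain-path l p

path-++ : ∀ {f : A → A} {p} l {q m r} → Path f p l q → Path f q m r → Path f p (l ++ m) r
path-++ [] refl b = b
path-++ (d ∷ l) (e , a) b = e , path-++ l a b

cyc-path : ∀ {f : A → A} {x l m} → m ≡ x ∷ l → Cyc (Graph f) m → Path f x m x
cyc-path {l = l} refl c = refl , chain-path l c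

path-cyc : ∀ {f : A → A} {x l m} → m ≡ x ∷ l → Path f x m x → Cyc (Graph f) m
path-cyc {l = l} refl (_ , c) = path-chain l c

module Gaps {D : Set} (α φ : D → D) where

  -- A stem with the stretch of contour, free of stems, that follows it.
  Gap : Set
  Gap = D × List D

  -- Follow φ from the other end of the stem x, through the stemless stretch g, to the next stem.
  Next : Gap → Gap → Set
  Next (x , g) (x' , _) = Chain (Graph φ) (α x) g x'

  flat : List Gap → List D
  flat [] = []
  flat ((x , g) ∷ G) = x ∷ g ++ flat G

  flat-++ : ∀ G H → flat (G ++ H) ≡ flat G ++ flat H
  flat-++ [] H = refl
  flat-++ ((x , g) ∷ G) H = cong (x ∷_) (≡.trans (cong (g ++_) (flat-++ G H)) (sym (List.++-assoc g _ _)))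

  module _ (cut : D → Bool) where

    -- The contour walk. For `φ = σ ∘ α` it turns by `σ` at a stem and crosses every other edge.
    θ : D → D
    θ x = φ (if cut x then α x else x)

    gap : List D → List D × List Gap
    gap [] = [] , []
    gap (x ∷ l) = if cut x then ([] , (x , proj₁ (gap l)) ∷ proj₂ (gap l)) else (x ∷ proj₁ (gap l) , proj₂ (gap l))

    gap-flat : ∀ l → proj₁ (gap l) ++ flat (proj₂ (gap l)) ≡ l
    gap-flat [] = refl
    gap-flat (x ∷ l) with cut x
    ... | true = cong (x ∷_) (gap-flat l)
    ... | false = cong (x ∷_) (gap-flat l)

    gap-stems : ∀ l → map proj₁ (proj₂ (gap l)) ≡ filterᵇ cut l
    gap-stems [] = refl
    gap-stems (x ∷ l) with cut x
    ... | true = cong (x ∷_) (gap-stems l)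
    ... | false = gap-stems l

    -- A `φ`-chain that stops at each stem `x` and restarts from `α x`.
    HG : D → List D → List Gap → D → Set
    HG a m [] q = Chain (Graph φ) a m q
    HG a m ((x , g) ∷ G) q = Chain (Graph φ) a m x × HG (α x) g G q

    HG-cons : ∀ {a z m q} G → φ a ≡ z → HG z m G q → HG a (z ∷ m) G q
    HG-cons [] e h = e , h
    HG-cons ((x , g) ∷ G) e (h , h') = (e , h) , h'

    gap-chain : ∀ x l {q} → Chain (Graph θ) x l q → HG (if cut x then α x else x) (proj₁ (gap l)) (proj₂ (gap l)) q
    gap-chain x [] e = e
    gap-chain x (z ∷ l) (e , c) with cut z | gap-chain z l c
    ... | true  | h = e , h
    ... | false | h = HG-cons (proj₂ (gap l)) e h

    HG-next : ∀ {x g} G {q h} → HG (α x) g G q → Chain Next (x , g) G (q , h)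
    HG-next [] c = c
    HG-next (_ ∷ G) (c , h) = c , HG-next G h

    gaps-of : ∀ {C x} → Cyc (Graph θ) C → x ∈ C → cut x ≡ true →
      ∃ λ G → Cyc Next G × flat G ↭ C × ∃₂ λ u v → filterᵇ cut C ≡ u ++ v × map proj₁ G ≡ v ++ u
    gaps-of {_} {x} cy i e with m , l , refl ← ∈-split i = _ ,
        HG-next (proj₂ (gap (l ++ m))) (subst (λ b → HG (if b then α x else x) (proj₁ (gap (l ++ m))) (proj₂ (gap (l ++ m))) x) e (gap-chain x (l ++ m) (cyc-rot m (_ ∷ l) cy))) ,
        trans (↭-reflexive (cong (x ∷_) (gap-flat (l ++ m)))) (↭.++-comm (x ∷ l) m) ,
        filterᵇ cut m , filterᵇ cut (x ∷ l) , List.filter-++ (T? ∘ cut) m (x ∷ l) ,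
        ≡.trans (cong (x ∷_) (gap-stems (l ++ m))) (≡.trans (sym (List.filter-accept (T? ∘ cut) (≡→T e))) (List.filter-++ (T? ∘ cut) (x ∷ l) m))

  next-target : ∀ {x G y g g'} → Chain Next x G (y , g) → Chain Next x G (y , g')
  next-target {G = []} c = c
  next-target {G = _ ∷ G} (c , d) = c , next-target {G = G} d

  -- When o and z = α o are consecutive stems, dropping both merges their gaps into the previous one.
  merge : ∀ {o z m m' y my} H → α z ≡ o → Chain Next (z , m') (H ++ [ (y , my) ]) (o , m) → Cyc Next (H ++ [ (y , my ++ o ∷ m') ])
  merge {o} {m' = m'} {y} {my} [] e (a , b) = chain-++ my b (subst (λ x → Chain (Graph φ) x m' y) e a)
  merge {o} {m' = m'} {y} {my} ((h , mh) ∷ H) e (a , b) with b₁ , b₂ ← chain-split H b =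
    chain-++ H (next-target {G = H} b₁) (chain-++ my b₂ (subst (λ x → Chain (Graph φ) x m' h) e a))

  -- With `p` matched pairs there are `p` faces closed by them and one per unmatched stem, while `w`
  -- has `2p` stems besides `us`; this is `number`.
  record Faces (w us : List D) (l : List D) : Set where
    field
      faces : List (List D)
      cycles : All (Cyc (Graph φ)) faces
      inhabited : All Inhabited faces
      cover : concat faces ↭ l ++ map α us
      number : length w + length us ≡ length faces + length faces

  -- Once every pair is gone, consecutive unmatched stems `u` and `u'` bound a face: from `α u`
  -- along the gap to `u'`, then through τ back to `α u`. The open end `q` is the stem that closes
  -- the cycle.
  base-faces : ∀ {R : D → D → Set} (τ : ∀ {u u'} → R u u' → φ u' ≡ α u) → ∀ {u m q h} G →
    Chain Next (u , m) G (q , h) → Chain R u (map proj₁ G) q →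
    ∃ λ Fs → All (Cyc (Graph φ)) Fs × All Inhabited Fs × concat Fs ↭ (m ++ flat G ++ [ q ]) ++ map α (u ∷ map proj₁ G) × length Fs ≡ suc (length G)
  base-faces τ {u} {m} {q} [] c r = [ α u ∷ m ++ [ q ] ] , chain-++ m c (τ r) ∷ [] , (α u , here refl) ∷ [] ,
    trans (↭-reflexive (List.++-identityʳ _)) (↭.∷↭∷ʳ (α u) (m ++ [ q ])) , refl
  base-faces τ {u} {m} {q} ((u' , m') ∷ G) (c , cs) (r , rs) with Fs , cy , inh , p , e ← base-faces τ G cs rs =
    (α u ∷ m ++ [ u' ]) ∷ Fs , chain-++ m c (τ r) ∷ cy , (α u , here refl) ∷ inh , perm , cong suc e
    where
    open PermutationReasoning
    us = map α (u' ∷ map proj₁ G)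
    perm : (α u ∷ m ++ [ u' ]) ++ concat Fs ↭ (m ++ (u' ∷ m' ++ flat G) ++ [ q ]) ++ α u ∷ us
    perm = begin
      α u ∷ (m ++ [ u' ]) ++ concat Fs ↭⟨ prep (α u) (↭.++⁺ˡ (m ++ [ u' ]) p) ⟩
      α u ∷ (m ++ [ u' ]) ++ (m' ++ flat G ++ [ q ]) ++ us ≡⟨ cong (α u ∷_) (sym (List.++-assoc (m ++ [ u' ]) _ us)) ⟩
      α u ∷ ((m ++ [ u' ]) ++ m' ++ flat G ++ [ q ]) ++ us ↭⟨ ↭-sym (↭.shift (α u) ((m ++ [ u' ]) ++ m' ++ flat G ++ [ q ]) us) ⟩
      ((m ++ [ u' ]) ++ m' ++ flat G ++ [ q ]) ++ α u ∷ us ≡⟨ cong (_++ α u ∷ us) (List.++-assoc m [ u' ] _) ⟩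
      (m ++ u' ∷ m' ++ flat G ++ [ q ]) ++ α u ∷ us ≡⟨ cong (λ z → (m ++ u' ∷ z) ++ α u ∷ us) (sym (List.++-assoc m' (flat G) [ q ])) ⟩
      (m ++ (u' ∷ m' ++ flat G) ++ [ q ]) ++ α u ∷ us ∎

  module _ {P : D → D → Set} (P-α : ∀ {o c} → P o c → α o ≡ c) (α-invol : ∀ x → α (α x) ≡ x)
           {R : D → D → Set} (τ : ∀ {u u'} → R u u' → φ u' ≡ α u) {us} (τ-rot : Cyc R us) (inh : Inhabited us) where

    -- Each matched pair (o , c) closes off the face that follows c.
    good-faces : ∀ {w} → Good P us w → ∀ G → map proj₁ G ≡ w → Cyc Next G → Faces w us (flat G)
    good-faces base [] refl cy with () ← proj₂ inh
    good-faces base ((u , m) ∷ G) refl cy with Fs , a , b , p , e ← base-faces τ G cy τ-rot = record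
      { faces = Fs ; cycles = a ; inhabited = b
      ; cover = trans p (↭.++⁺ʳ _ (trans (↭-reflexive (sym (List.++-assoc m (flat G) [ u ]))) (↭-sym (↭.∷↭∷ʳ u (m ++ flat G)))))
      ; number = cong₂ _+_ e' e' }
      where
      e' : suc (length (map proj₁ G)) ≡ length Fs
      e' = ≡.trans (cong suc (List.length-map proj₁ G)) (sym e)
    good-faces (ins {o} {c} p g) ((o , m) ∷ (c , m') ∷ G) refl (n , ch) with Data.List.Base.initLast G
    ... | [] with () ← good-⊇ g (proj₂ inh)
    ... | H Data.List.Base.∷ʳ′ (y , my) = record
      { faces = (c ∷ m) ∷ faces
      -- As `α o = c`, the gap after `o` leads from `c` to `c`: it already is the boundary of a
      -- face.
      ; cycles = subst (λ z → Chain (Graph φ) z m c) (P-α p) n ∷ cycles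
      ; inhabited = (c , here refl) ∷ inhabited
      ; cover = perm
      ; number = cong suc (≡.trans (cong suc number) (sym (ℕ.+-suc _ _)))
      }
      where
      new = y , my ++ o ∷ m'
      αc : α c ≡ o
      αc = ≡.trans (cong α (sym (P-α p))) (α-invol o)
      rec = good-faces g (H ++ [ new ]) (≡.trans (List.map-++ proj₁ H [ new ]) (sym (List.map-++ proj₁ H [ (y , my) ]))) (merge H αc ch)
      open Faces rec
      open PermutationReasoning
      perm : (c ∷ m) ++ concat faces ↭ (o ∷ m ++ c ∷ m' ++ flat (H ++ [ (y , my) ])) ++ map α us
      perm = begin
        (c ∷ m) ++ concat faces ↭⟨ ↭.++⁺ˡ (c ∷ m) cover ⟩
        (c ∷ m) ++ flat (H ++ [ new ]) ++ map α us ≡⟨ sym (List.++-assoc (c ∷ m) (flat (H ++ [ new ])) (map α us)) ⟩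
        (c ∷ m ++ flat (H ++ [ new ])) ++ map α us ↭⟨ ↭.++⁺ʳ (map α us) body ⟩
        (o ∷ m ++ c ∷ m' ++ flat (H ++ [ (y , my) ])) ++ map α us ∎
        where
        body : c ∷ m ++ flat (H ++ [ new ]) ↭ o ∷ m ++ c ∷ m' ++ flat (H ++ [ (y , my) ])
        body = begin
          c ∷ m ++ flat (H ++ [ new ]) ≡⟨ cong (λ z → c ∷ m ++ z) (≡.trans (flat-++ H [ new ]) (cong (λ z → flat H ++ y ∷ z) (List.++-identityʳ _))) ⟩
          c ∷ m ++ flat H ++ y ∷ my ++ o ∷ m' ≡⟨ cong (λ z → c ∷ m ++ z) (sym (List.++-assoc (flat H) (y ∷ my) _)) ⟩
          c ∷ m ++ (flat H ++ y ∷ my) ++ o ∷ m' ↭⟨ prep c (↭.++⁺ˡ m (↭.++-comm (flat H ++ y ∷ my) (o ∷ m'))) ⟩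
          c ∷ m ++ o ∷ m' ++ flat H ++ y ∷ my ↭⟨ prep c (↭.shift o m _) ⟩
          c ∷ o ∷ m ++ m' ++ flat H ++ y ∷ my ↭⟨ swap c o refl ⟩
          o ∷ c ∷ m ++ m' ++ flat H ++ y ∷ my ↭⟨ prep o (↭-sym (↭.shift c m _)) ⟩
          o ∷ m ++ c ∷ m' ++ flat H ++ y ∷ my ≡⟨ cong (λ z → o ∷ m ++ c ∷ m' ++ z) (sym (≡.trans (flat-++ H [ (y , my) ]) (cong (λ z → flat H ++ y ∷ z) (List.++-identityʳ my)))) ⟩
          o ∷ m ++ c ∷ m' ++ flat (H ++ [ (y , my) ]) ∎
    good-faces (rot {x} {w} g) G e cy with Data.List.Base.initLast G
    ... | [] with w | e
    ...   | [] | ()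
    ...   | _ ∷ _ | ()
    good-faces (rot {x} {w} g) G e cy | H Data.List.Base.∷ʳ′ (y , my)
      with e₁ , refl ← List.∷ʳ-injective (map proj₁ H) w (≡.trans (sym (List.map-++ proj₁ H [ (y , my) ])) e) = record
      { faces = faces ; cycles = cycles ; inhabited = inhabited
      ; cover = trans cover (↭.++⁺ʳ (map α us) (trans (↭.++-comm (y ∷ my) (flat H)) (↭-reflexive (sym (≡.trans (flat-++ H [ (y , my) ]) (cong (λ z → flat H ++ y ∷ z) (List.++-identityʳ my)))))))
      ; number = ≡.trans (cong (_+ length us) (↭.↭-length (↭.++-comm w [ x ]))) number }
      where
      rec = good-faces g ((y , my) ∷ H) (cong (y ∷_) e₁) (cyc-rot H [ (y , my) ] cy)
      open Faces rec

color-flip-≢ : ∀ {c} → c ≡ flipC c → ⊥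
color-flip-≢ {black} ()
color-flip-≢ {white} ()

-- At `d` the walk enters the child by `σ (α d)`, its rotation ends at `α d`, and crossing back
-- gives `σ d`, the next dart of the parent.
contour-path : ∀ {D : Set} {σ α : D → D} {color : D → Color} (α-invol : ∀ x → α (α x) ≡ x) (cut : D → Bool) →
  let open Gaps α (σ ∘ α) in ∀ c F → Wf σ α color c F →
  (∀ {x} → x ∈ leaves F → cut x ≡ true) → (∀ {x} → x ∈ sides (edges F) → cut x ≡ false) →
  ∀ {p q} → Path σ p (row F) q → Path (θ cut) p (contour F) q
contour-path inv cut c ε w l s e = e
contour-path {σ = σ} {α} inv cut c (leaf d r) (_ , w) l s {q = q} (e , p) = e ,
  subst (λ z → Path (Gaps.θ α (σ ∘ α) cut) z (contour r) q) (sym (≡.trans (cong (λ b → σ (α (if b then α d else d))) (l (here refl))) (cong σ (inv d))))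
    (contour-path inv cut c r w (l ∘ there) s p)
contour-path {σ = σ} {α} inv cut c (edge d d' b r) ((_ , _ , refl , cy) , w , w') l s {q = q} (e , p) = e ,
  path-++ (contour b)
    (subst (λ z → Path (Gaps.θ α (σ ∘ α) cut) z (contour b) (α d)) (sym (cong (λ b → σ (α (if b then α d else d))) (s (here refl))))
      (contour-path inv cut (flipC c) b w (l ∘ ∈.∈-++⁺ˡ) (λ i → s (there (there (subst (_ ∈_) (sym (sides-++ (edges b) (edges r))) (∈.∈-++⁺ˡ i)))))
        (chain-path (row b) cy)))
    (refl , subst (λ z → Path (Gaps.θ α (σ ∘ α) cut) z (contour r) q) (sym (≡.trans (cong (λ b → σ (α (if b then α d' else d'))) (s (there (here refl)))) (cong σ (inv d))))
      (contour-path inv cut c r w' (l ∘ ∈.∈-++⁺ʳ (leaves b)) (λ i → s (there (there (subst (_ ∈_) (sym (sides-++ (edges b) (edges r))) (∈.∈-++⁺ʳ (sides (edges b)) i))))) p))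

contour-cyc : ∀ {D : Set} {σ α : D → D} {color : D → Color} (α-invol : ∀ x → α (α x) ≡ x) (cut : D → Bool) →
  let open Gaps α (σ ∘ α) in ∀ c F → Wf σ α color c F →
  (∀ {x} → x ∈ leaves F → cut x ≡ true) → (∀ {x} → x ∈ sides (edges F) → cut x ≡ false) →
  ∀ {r l} → row F ≡ r ∷ l → Cyc (Graph σ) (row F) → Cyc (Graph (θ cut)) (contour F)
contour-cyc inv cut c F wf l s e cy = go e (contour-path inv cut c F wf l s (cyc-path e cy))
  where
  go : ∀ {F : Forest _} {r l} {f} → row F ≡ r ∷ l → Path f r (contour F) r → Cyc (Graph f) (contour F)
  go {leaf d F} refl p = path-cyc {x = d} refl p
  go {edge d d' b F} refl p = path-cyc {x = d} refl p

contour-leaves : ∀ (cut : A → Bool) F → (∀ {x} → x ∈ leaves F → cut x ≡ true) → (∀ {x} → x ∈ sides (edges F) → cut x ≡ false) →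
  filterᵇ cut (contour F) ≡ leaves F
contour-leaves cut ε l s = refl
contour-leaves cut (leaf d r) l s rewrite l (here refl) = cong (d ∷_) (contour-leaves cut r (l ∘ there) s)
contour-leaves cut (edge d d' b r) l s rewrite s (here refl) | List.filter-++ (T? ∘ cut) (contour b) (d' ∷ contour r) | s (there (here refl)) =
  cong₂ _++_ (contour-leaves cut b (l ∘ ∈.∈-++⁺ˡ) (λ i → s (there (there (subst (_ ∈_) (sym (sides-++ (edges b) (edges r))) (∈.∈-++⁺ˡ i))))))
    (contour-leaves cut r (l ∘ ∈.∈-++⁺ʳ (leaves b)) (λ i → s (there (there (subst (_ ∈_) (sym (sides-++ (edges b) (edges r))) (∈.∈-++⁺ʳ (sides (edges b)) i))))))

good-cases : ∀ {P : A → A → Set} {us w} → Good P us w → ∀ {x} → x ∈ w → x ∈ us ⊎ ∃ λ y → P x y ⊎ P y x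
good-cases base i = inj₁ i
good-cases (ins p g) (here refl) = inj₂ (_ , inj₁ p)
good-cases (ins p g) (there (here refl)) = inj₂ (_ , inj₂ p)
good-cases (ins p g) (there (there i)) = good-cases g i
good-cases (rot {x} {w} g) i = good-cases g (↭.∈-resp-↭ (↭.++-comm w [ x ]) i)

rots-inhabited : ∀ c (F : Forest A) → All Inhabited (map proj₂ (rots c F))
rots-inhabited c ε = []
rots-inhabited c (leaf d r) = rots-inhabited c r
rots-inhabited c (edge d d' b r) = subst (All Inhabited) (sym (List.map-++ proj₂ (rots (flipC c) b) _))
  (All.++⁺ (rots-inhabited (flipC c) b) ((d' , here refl) ∷ rots-inhabited c r))

shape-row : ∀ c (F : Forest A) → length (shape c F) ≡ length (row F)
shape-row c ε = refl
shape-row c (leaf d r) = cong suc (shape-row c r)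
shape-row c (edge d d' b r) = cong suc (shape-row c r)

degDist-rots : ∀ c (F : Forest A) → degDistItems c (shape c F) ↭ map (λ (c , l) → c , length l) (rots c F)
degDist-rots c ε = refl
degDist-rots c (leaf d r) = degDist-rots c r
degDist-rots c (edge d d' b r) = begin
  (flipC c , suc (length (shape (flipC c) b))) ∷ degDistItems (flipC c) (shape (flipC c) b) ++ degDistItems c (shape c r)
    ≡⟨ cong (λ k → (flipC c , suc k) ∷ degDistItems (flipC c) (shape (flipC c) b) ++ degDistItems c (shape c r)) (shape-row (flipC c) b) ⟩
  (flipC c , suc (length (row b))) ∷ degDistItems (flipC c) (shape (flipC c) b) ++ degDistItems c (shape c r)
    ↭⟨ prep _ (↭.++⁺ (degDist-rots (flipC c) b) (degDist-rots c r)) ⟩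
  (flipC c , suc (length (row b))) ∷ map _ (rots (flipC c) b) ++ map _ (rots c r) ↭⟨ ↭-sym (↭.shift _ (map _ (rots (flipC c) b)) _) ⟩
  map _ (rots (flipC c) b) ++ (flipC c , suc (length (row b))) ∷ map _ (rots c r) ≡⟨ sym (List.map-++ _ (rots (flipC c) b) _) ⟩
  map _ (rots (flipC c) b ++ (flipC c , d' ∷ row b) ∷ rots c r) ∎
  where open PermutationReasoning

module _ {n : ℕ} where
  open import Data.List.Membership.DecPropositional (Fin._≟_ {n}) public using (_∈?_)

does-yes : {P : Set} (d : Dec P) → P → does d ≡ true
does-yes (yes _) p = refl
does-yes (no q) p = ⊥-elim (q p)

does-no : {P : Set} (d : Dec P) → (P → ⊥) → does d ≡ false
does-no (yes p) q = ⊥-elim (q p)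
does-no (no _) q = refl

module _ (m : Map) where
  open Map m

  reach-trans : ∀ {x y z} → Reach m x y → Reach m y z → Reach m x z
  reach-trans p here = p
  reach-trans p (stepσ q) = stepσ (reach-trans p q)
  reach-trans p (stepα q) = stepα (reach-trans p q)

  reach-cyc : ∀ {l x y} → Cyc (Graph σ) l → x ∈ l → y ∈ l → Reach m x y
  reach-cyc {l} {x} c i j = All.lookup (cyc-closed {P = Reach m x} (λ { refl r → stepσ r }) l c i here) j

-- A map with a structure is planar, bipartite and pointed

module StructureMap {m : Map} {c τc : Color} {F : Forest (Fin (Map.n m))} {us : List (Fin (Map.n m))} (S : Structure m c τc F us) where

  open Structure S
  open Map m

  ts = map α us

  uniq-all : Unique (labels F ++ ts)
  uniq-all = uniq-↭ (↭-sym cover) (Unique.allFin⁺ n)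

  uniq-labels : Unique (labels F)
  uniq-labels = uniq-++ˡ (labels F) uniq-all

  disjoint : ∀ {x} → x ∈ labels F → x ∉ ts
  disjoint = uniq-disj (labels F) uniq-all

  where-dart : ∀ x → x ∈ labels F ⊎ x ∈ ts
  where-dart x = ∈.∈-++⁻ (labels F) (↭.∈-resp-↭ (↭-sym cover) (∈.∈-allFin x))

  unmarked : ∀ {x} → x ∈ labels F → marked x ≡ false
  unmarked {x} i with marked x in e
  ... | false = refl
  ... | true = ⊥-elim (disjoint i (mark⇒ e))

  us⊆leaves : ∀ {u} → u ∈ us → u ∈ leaves F
  us⊆leaves = good-⊇ good

  us⊆labels : ∀ {u} → u ∈ us → u ∈ labels F
  us⊆labels = leaves⊆labels F ∘ us⊆leaves

  split-uniq : Unique (sides (edges F) ++ leaves F)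
  split-uniq = uniq-↭ (↭-sym (sides-leaves F)) uniq-labels

  τ-row : Cyc (Graph σ) (reverse ts)
  τ-row = cyc-rev ts (cyc-map {S = λ a b → σ b ≡ a} α us (λ _ e → e) τ-rot)

  vrows : List (Color × List (Fin n))
  vrows = (c , row F) ∷ rots c F

  vrow-ok : All (RotOk σ α color) vrows
  vrow-ok = (rootRow , wf-row σ α color c F wf) ∷ wf-rots σ α color c F wf

  vertexLists : List (List (Fin n))
  vertexLists = reverse ts ∷ map proj₂ vrows

  vertices : Decomp σ vertexLists
  vertices = record
    { cycles = τ-row ∷ All.map⁺ (All.map proj₁ vrow-ok)
    ; inhabited = (_ , ↭.∈-resp-↭ (↭-sym (↭.↭-reverse ts)) (∈.∈-map⁺ α (proj₂ us-inh))) ∷ (root , subst (root ∈_) (sym (proj₂ rootHd)) (here refl)) ∷ rots-inhabited c F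
    ; cover = trans (↭.++⁺ (↭.↭-reverse ts) (rows-labels c F)) (trans (↭.++-comm ts (labels F)) cover)
    }

  cut : Fin n → Bool
  cut x = does (x ∈? leaves F)

  open Gaps α (σ ∘ α)

  cut-leaf : ∀ {x} → x ∈ leaves F → cut x ≡ true
  cut-leaf {x} = does-yes (x ∈? leaves F)

  cut-side : ∀ {x} → x ∈ sides (edges F) → cut x ≡ false
  cut-side {x} i = does-no (x ∈? leaves F) (uniq-disj (sides (edges F)) split-uniq i)

  -- The contour is cut open at an unmatched stem, so its word is a rotation of `leaves F`, which
  -- `Good` tolerates.
  word-gaps : ∃ λ G → Cyc Next G × Good Pairs us (map proj₁ G) × flat G ↭ contour F × map proj₁ G ↭ leaves F
  word-gaps = let G , cy , fl , u , v , e , e' = gaps-of cut (contour-cyc α-invol cut c F wf cut-leaf cut-side (proj₂ rootHd) rootRow)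
                    (↭.∈-resp-↭ (↭-sym (contour-labels F)) (us⊆labels (proj₂ us-inh))) (cut-leaf (us⊆leaves (proj₂ us-inh)))
                  w = ≡.trans (sym (contour-leaves cut F cut-leaf cut-side)) e
              in G , cy , subst (Good Pairs us) (sym e') (good-rot u v (subst (Good Pairs us) w good)) , fl ,
                 trans (↭-reflexive e') (trans (↭.++-comm v u) (↭-reflexive (sym w)))

  fc : Faces (map proj₁ (proj₁ word-gaps)) us (flat (proj₁ word-gaps))
  fc = let G , cy , g , _ = word-gaps in
    good-faces (λ (_ , _ , e) → e) α-invol (λ {u} {u'} e → e) τ-rot us-inh g G refl cy

  faces : Decomp (σ ∘ α) (Faces.faces fc)
  faces = record
    { cycles = Faces.cycles fc
    ; inhabited = Faces.inhabited fc
    ; cover = trans (Faces.cover fc) (trans (↭.++⁺ʳ ts (trans (proj₁ (proj₂ (proj₂ (proj₂ word-gaps)))) (contour-labels F))) cover)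
    }

  -- With `e` tree edges there are `e + 2` vertices, τ included. `Faces.number` makes twice the
  -- number of faces the number of leaves plus that of unmatched stems, and these together with the
  -- `2e` sides are all the darts.
  euler : 2 * (numVertices m + numFaces m) ≡ n + 4
  euler = begin
    2 * (numVertices m + numFaces m) ≡⟨ cong₂ (λ a b → 2 * (a + b)) (Decomp.orbits vertices) (Decomp.orbits faces) ⟩
    2 * (suc (suc (length (map proj₂ (rots c F)))) + f) ≡⟨ cong (λ z → 2 * (2 + z + f)) (≡.trans (List.length-map proj₂ (rots c F)) (length-rots c F)) ⟩
    2 * (2 + e + f) ≡⟨ arith e f ⟩
    (f + f) + (e + e) + 4 ≡⟨ cong (λ z → z + (e + e) + 4) (sym (Faces.number fc)) ⟩
    length (map proj₁ (proj₁ word-gaps)) + length us + (e + e) + 4 ≡⟨ cong (λ z → z + length us + (e + e) + 4) (↭.↭-length (proj₂ (proj₂ (proj₂ (proj₂ word-gaps))))) ⟩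
    length (leaves F) + length us + (e + e) + 4 ≡⟨ cong (_+ 4) (arith' (length (leaves F)) (length us) (e + e)) ⟩
    e + e + length (leaves F) + length us + 4 ≡⟨ cong (λ z → z + length (leaves F) + length us + 4) (sym (length-sides (edges F))) ⟩
    length (sides (edges F)) + length (leaves F) + length us + 4 ≡⟨ cong (λ z → z + length us + 4) (≡.trans (sym (List.length-++ (sides (edges F)))) (↭.↭-length (sides-leaves F))) ⟩
    length (labels F) + length us + 4 ≡⟨ cong (λ z → length (labels F) + z + 4) (sym (List.length-map α us)) ⟩
    length (labels F) + length ts + 4 ≡⟨ cong (_+ 4) (≡.trans (sym (List.length-++ (labels F))) (≡.trans (↭.↭-length cover) (List.length-tabulate {n = n} id))) ⟩
    n + 4 ∎
    where
    open ≡-Reasoning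
    e = length (edges F)
    f = length (Faces.faces fc)
    arith : ∀ e f → 2 * (2 + e + f) ≡ (f + f) + (e + e) + 4
    arith = ℕSolver.solve-∀
    arith' : ∀ a b e → a + b + e ≡ e + a + b
    arith' = ℕSolver.solve-∀

  edge-colors : ∀ {a b} → (a , b) ∈ edges F → α a ≡ b × color b ≡ flipC (color a)
  edge-colors = All.lookup (go c F wf)
    where
    go : ∀ c F → Wf σ α color c F → All (λ (a , b) → α a ≡ b × color b ≡ flipC (color a)) (edges F)
    go c ε w = []
    go c (leaf d r) (_ , w) = go c r w
    go c (edge d d' b r) ((p , q , e , _) , w , w') = (e , ≡.trans q (cong flipC (sym p))) ∷ All.++⁺ (go (flipC c) b w) (go c r w')

  color-α : ∀ x → color (α x) ≡ flipC (color x)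
  color-α x with where-dart x
  ... | inj₂ i with u , j , refl ← ∈.∈-map⁻ α i = ≡.trans (cong color (α-invol u)) (≡.trans (All.lookup us-col j) (cong flipC (sym (All.lookup τ-col j))))
  ... | inj₁ i with ∈.∈-++⁻ (sides (edges F)) (↭.∈-resp-↭ (↭-sym (sides-leaves F)) i)
  ...   | inj₂ j with good-cases good j
  ...     | inj₁ k = ≡.trans (All.lookup τ-col k) (≡.trans (sym (flipC-flipC τc)) (cong flipC (sym (All.lookup us-col k))))
  ...     | inj₂ (y , inj₁ (p , q , refl)) = ≡.trans q (cong flipC (sym p))
  ...     | inj₂ (y , inj₂ (p , q , refl)) = ≡.trans (cong color (α-invol y)) (≡.trans p (cong flipC (sym q)))
  color-α x | inj₁ i | inj₁ j with sides-∈ (edges F) j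
  ...     | y , inj₁ k with e , q ← edge-colors k = ≡.trans (cong color e) q
  ...     | y , inj₂ k with refl , q ← edge-colors k = ≡.trans (cong color (α-invol y)) (≡.trans (sym (flipC-flipC _)) (cong flipC (sym q)))

  color-σ : ∀ x → color (σ x) ≡ color x
  color-σ x with c' , i , q ← Decomp.cycleOf vertices x with y , refl , j ← cyc-next c' (Decomp.cyc vertices q) i = go q i j
    where
    go : ∀ {c'} → c' ∈ vertexLists → x ∈ c' → σ x ∈ c' → color (σ x) ≡ color x
    go (here refl) i j with a ← All.map⁺ {f = α} τ-col =
      ≡.trans (All.lookup a (↭.∈-resp-↭ (↭.↭-reverse ts) j)) (sym (All.lookup a (↭.∈-resp-↭ (↭.↭-reverse ts) i)))
    go (there q') i j with (k , l) , r , refl ← ∈.∈-map⁻ proj₂ q' with a ← proj₂ (All.lookup vrow-ok r) = ≡.trans (All.lookup a j) (sym (All.lookup a i))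

  connected-labels : ∀ c F → Wf σ α color c F → (∀ {x} → x ∈ row F → Reach m root x × Reach m x root) →
    ∀ {x} → x ∈ labels F → Reach m root x × Reach m x root
  connected-labels c (leaf d r) w h (here refl) = h (here refl)
  connected-labels c (leaf d r) (_ , w) h (there i) = connected-labels c r w (h ∘ there) i
  connected-labels c (edge d d' b r) w h (here refl) = h (here refl)
  connected-labels c (edge d d' b r) ((_ , _ , refl , cy) , w , w') h (there i) = go i
    where
    d'-conn : Reach m root (α d) × Reach m (α d) root
    d'-conn = stepα (proj₁ (h (here refl))) , reach-trans m (subst (Reach m (α d)) (α-invol d) (stepα here)) (proj₂ (h (here refl)))
    go : ∀ {x} → x ∈ α d ∷ labels b ++ labels r → Reach m root x × Reach m x root
    go (here refl) = d'-conn
    go (there i) with ∈.∈-++⁻ (labels b) i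
    ... | inj₁ j = connected-labels (flipC c) b w (λ k → reach-trans m (proj₁ d'-conn) (reach-cyc m cy (here refl) (there k)) ,
                     reach-trans m (reach-cyc m cy (there k) (here refl)) (proj₂ d'-conn)) j
    ... | inj₂ j = connected-labels c r w' (h ∘ there) j

  connected : ∀ x y → Reach m x y
  connected x y = reach-trans m (proj₂ (conn x)) (proj₁ (conn y))
    where
    root∈ : root ∈ row F
    root∈ = subst (root ∈_) (sym (proj₂ rootHd)) (here refl)
    conn-label : ∀ {x} → x ∈ labels F → Reach m root x × Reach m x root
    conn-label = connected-labels c F wf (λ i → reach-cyc m rootRow root∈ i , reach-cyc m rootRow i root∈)
    conn : ∀ x → Reach m root x × Reach m x root
    conn x with where-dart x
    ... | inj₁ i = conn-label i
    ... | inj₂ i with u , j , refl ← ∈.∈-map⁻ α i with p , q ← conn-label (us⊆labels j) =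
      stepα p , reach-trans m (subst (Reach m (α u)) (α-invol u) (stepα here)) q

  marked-σ : ∀ x → marked (σ x) ≡ marked x
  marked-σ x with c' , i , q ← Decomp.cycleOf vertices x with y , refl , j ← cyc-next c' (Decomp.cyc vertices q) i = go q i j
    where
    go : ∀ {c'} → c' ∈ vertexLists → x ∈ c' → σ x ∈ c' → marked (σ x) ≡ marked x
    go (here refl) i j = ≡.trans (mark⇐ (↭.∈-resp-↭ (↭.↭-reverse ts) j)) (sym (mark⇐ (↭.∈-resp-↭ (↭.↭-reverse ts) i)))
    go (there q') i j = ≡.trans (unmarked (label∈ j)) (sym (unmarked (label∈ i)))
      where
      label∈ : ∀ {z} → z ∈ _ → z ∈ labels F
      label∈ k = ↭.∈-resp-↭ (rows-labels c F) (∈.∈-concat⁺′ k q')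

  root∈labels : root ∈ labels F
  root∈labels = row⊆labels F (subst (root ∈_) (sym (proj₂ rootHd)) (here refl))

  isPointedBipartite : IsPointedBipartiteMap m
  isPointedBipartite = record
    { planar = record { σ-perm = Decomp.inverse vertices ; α-invol = α-invol
                      ; α-fixfree = λ x e → color-flip-≢ (≡.trans (sym (cong color e)) (color-α x))
                      ; connected = connected ; euler = euler }
    ; bipartite = record { color-σ = color-σ ; color-α = color-α }
    ; pointed = record
      { nonempty = α (proj₁ us-inh) , mark⇐ (∈.∈-map⁺ α (proj₂ us-inh))
      ; marked-σ = marked-σ
      ; one-vertex = λ x y p q → T→≡ (Decomp.same-orbit vertices (here refl) (↭.∈-resp-↭ (↭-sym (↭.↭-reverse ts)) (mark⇒ p)) (↭.∈-resp-↭ (↭-sym (↭.↭-reverse ts)) (mark⇒ q)))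
      ; root-not-τ = unmarked root∈labels
      }
    }

  τColor-is : τColorIs m τc
  τColor-is x p with u , j , refl ← ∈.∈-map⁻ α (mark⇒ p) = All.lookup τ-col j

  degτ≡ : degτ m ≡ length us
  degτ≡ = ≡.trans (↭.↭-length (filter-same marked (Unique.allFin⁺ n) (uniq-++ʳ (labels F) uniq-all)
    (λ _ t → mark⇒ (T→≡ t)) (λ i → ∈.∈-allFin _ , ≡→T (mark⇐ i)))) (List.length-map α us)

  -- The tree lists its vertices by rotations, the map by least darts; `ms` takes the least dart of
  -- each rotation and so matches the two lists.
  degDist≡ : degDistTree (c , node (shape c F)) ↭ degDistMap m
  degDist≡ = trans (trans (↭-reflexive (cong (λ k → (c , k) ∷ degDistItems c (shape c F)) (shape-row c F))) (prep _ (degDist-rots c F)))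
    (trans (↭-reflexive (tabulated vrows (λ i → i) pw)) (↭.map⁺ _ (↭-sym (filter-same _ (Unique.allFin⁺ n) uniq-ms only these))))
    where
    inh : All Inhabited (map proj₂ vrows)
    inh = All.tail (Decomp.inhabited vertices)
    ms = proj₁ (minima inh)
    pw = proj₂ (minima inh)
    uniq-ms = transversal-uniq (uniq-↭ (↭-sym (rows-labels c F)) uniq-labels) (Pointwise.map proj₁ pw)
    tabulated : ∀ rs {ms} → (∀ {p} → p ∈ rs → p ∈ vrows) → Pointwise IsMin (map proj₂ rs) ms →
      map (λ (c , l) → c , length l) rs ≡ map (λ x → color x , degreeAt m x) ms
    tabulated [] s [] = refl
    tabulated ((c' , l) ∷ rs) s ((i , _) ∷ p) = cong₂ _∷_
      (cong₂ _,_ (sym (All.lookup (proj₂ (All.lookup vrow-ok (s (here refl)))) i)) (sym (Decomp.orbit-size vertices (there (∈.∈-map⁺ proj₂ (s (here refl)))) i)))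
      (tabulated rs (s ∘ there) p)
    split : ∀ {a b} → T (not a ∧ b) → a ≡ false × T b
    split {false} t = refl , t
    join : ∀ {a b} → a ≡ false → T b → T (not a ∧ b)
    join refl t = t
    only : ∀ {x} → x ∈ allFin n → T (not (marked x) ∧ Decomp.isLeast vertices x) → x ∈ ms
    only {x} _ t with split t | Decomp.cycleOf vertices x
    ... | e , t' | l , i , here refl with () ← ≡.trans (sym e) (mark⇐ (↭.∈-resp-↭ (↭.↭-reverse ts) i))
    ... | e , t' | l , i , there q = let y , j , (k , le) = pointwise-∈ˡ pw q
                                         _ , le' = Decomp.least⇒ vertices (there q) i t'
      in subst (_∈ ms) (Fin.toℕ-injective (ℕ.≤-antisym (le i) (le' k))) j
    these : ∀ {x} → x ∈ ms → x ∈ allFin n × T (not (marked x) ∧ Decomp.isLeast vertices x)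
    these j = let l , q , h = pointwise-∈ʳ pw j in ∈.∈-allFin _ ,
      join (unmarked (↭.∈-resp-↭ (rows-labels c F) (∈.∈-concat⁺′ (proj₁ h) q))) (Decomp.least⇐ vertices (there q) h)

  root-color : rootColor m ≡ c
  root-color = All.lookup (wf-row σ α color c F wf) (subst (root ∈_) (sym (proj₂ rootHd)) (here refl))

module _ {n : ℕ} where

  find : ℤ → List (Fin n × ℤ) → Fin n → ℤ
  find z [] d = z
  find z ((k , v) ∷ l) d = if does (k Fin.≟ d) then v else find z l d

  find-∈ : ∀ z l → Unique (map proj₁ l) → ∀ {k v} → (k , v) ∈ l → find z l k ≡ v
  find-∈ z ((k , v) ∷ l) u (here refl) rewrite does-yes (k Fin.≟ k) refl = refl
  find-∈ z ((k' , v') ∷ l) u {k} (there i) rewrite does-no (k' Fin.≟ k) (λ { refl → uniq-head u (∈.∈-map⁺ proj₁ i) }) = find-∈ z l (uniq-tail u) i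

  find-∉ : ∀ z l {k} → k ∉ map proj₁ l → find z l k ≡ z
  find-∉ z [] i = refl
  find-∉ z ((k' , v') ∷ l) {k} i rewrite does-no (k' Fin.≟ k) (λ { refl → i (here refl) }) = find-∉ z l (i ∘ there)

*-bit-∧ : ∀ a b → bit a ≡ bit (a ∧ not b) ℤ.+ bit (a ∧ b)
*-bit-∧ false b = refl
*-bit-∧ true false = refl
*-bit-∧ true true = refl

self-neg : ∀ z → z ≡ - z → z ≡ 0ℤ
self-neg (+ zero) e = refl
self-neg (+ suc k) ()
self-neg (ℤ.-[1+ k ]) ()

count-≤ : (p : A → Bool) → ∀ l → count p l ≤ length l
count-≤ p l = List.length-filter (T? ∘ p) l

count-0 : (p : A → Bool) → ∀ l → count p l ≡ 0 → ∀ {x} → x ∈ l → p x ≡ false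
count-0 p (y ∷ l) e i with p y in q
count-0 p (y ∷ l) () i | true
count-0 p (y ∷ l) e (here refl) | false = q
count-0 p (y ∷ l) e (there i) | false = count-0 p l e i

all-false : (p : A → Bool) → ∀ l → (∀ {x} → x ∈ l → p x ≡ false) → count p l ≡ 0
all-false p [] h = refl
all-false p (y ∷ l) h rewrite h (here refl) = all-false p l (h ∘ there)

count>0 : (p : A → Bool) → ∀ l {x} → x ∈ l → p x ≡ true → 0 < count p l
count>0 p l {x} i e = ℕ.n≢0⇒n>0 (λ z → case ≡.trans (sym e) (count-0 p l z i) of λ ())

-- Flows

-- N exceeds the number of darts, hence the total demand of any set of vertices.
module Flows (m : Map) (pb : IsPointedBipartiteMap m) where

  open Map m public
  open IsPointedBipartiteMap pb public
  open IsPlanarMap planar public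
  open IsBipartite bipartite public
  open IsMarkedVertex pointed public

  allDarts : List (Fin n)
  allDarts = allFin n

  N : ℤ
  N = + suc n

  cap : Color → ℤ
  cap black = N
  cap white = - N

  cap-flip : ∀ c → cap (flipC c) ≡ - cap c
  cap-flip black = refl
  cap-flip white = sym (ℤ.neg-involutive N)

  -- The value of a dart is the flow leaving its vertex. The bound is one-sided: at most `N` from
  -- black to white, anything in the other direction. An edge of a cut thus limits the outflow of a
  -- side only if its end on that side is black, and the inflow only if it is white.
  Within Slack : Color → ℤ → Set
  Within black v = v ℤ.≤ N
  Within white v = - N ℤ.≤ v
  Slack black v = v ℤ.< N
  Slack white v = - N ℤ.< v

  slack-within : ∀ c {v} → Slack c v → Within c v
  slack-within black = ℤ.<⇒≤
  slack-within white = ℤ.<⇒≤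

  slack-neg : ∀ c {v} → Slack c v → Slack (flipC c) (- v)
  slack-neg black s = ℤ.neg-mono-< s
  slack-neg white {v} s = subst (- v ℤ.<_) (ℤ.neg-involutive N) (ℤ.neg-mono-< s)

  within-neg : ∀ c {v} → Within c v → Within (flipC c) (- v)
  within-neg black s = ℤ.neg-mono-≤ s
  within-neg white {v} s = subst (- v ℤ.≤_) (ℤ.neg-involutive N) (ℤ.neg-mono-≤ s)

  within-cap : ∀ c → Within c (cap c)
  within-cap black = ℤ.≤-refl
  within-cap white = ℤ.≤-refl

  slack-≢ : ∀ c → Slack c (cap c) → ⊥
  slack-≢ black = ℤ.<-irrefl refl
  slack-≢ white = ℤ.<-irrefl refl

  slack? : ∀ c {v} → Within c v → v ≡ cap c ⊎ Slack c v
  slack? black {v} w with v ℤ.≟ N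
  ... | yes e = inj₁ e
  ... | no ne = inj₂ (ℤ.≤∧≢⇒< w ne)
  slack? white {v} w with v ℤ.≟ - N
  ... | yes e = inj₁ e
  ... | no ne = inj₂ (ℤ.≤∧≢⇒< w (ne ∘ sym))

  σ⁻ = proj₁ σ-perm

  ∑-σ : (g : Fin n → ℤ) → ∑ (g ∘ σ) allDarts ≡ ∑ g allDarts
  ∑-σ g = ≡.trans (sym (∑-map σ g allDarts)) (∑-↭ g (same-↭
    (Unique.map⁺ (λ {x} {y} e → ≡.trans (sym (proj₂ (proj₂ σ-perm) x)) (≡.trans (cong σ⁻ e) (proj₂ (proj₂ σ-perm) y))) (Unique.allFin⁺ n)) (Unique.allFin⁺ n)
    (λ _ → ∈.∈-allFin _) (λ {x} _ → subst (_∈ map σ allDarts) (proj₁ (proj₂ σ-perm) x) (∈.∈-map⁺ σ (∈.∈-allFin (σ⁻ x))))))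

  ∑-α : (g : Fin n → ℤ) → ∑ (g ∘ α) allDarts ≡ ∑ g allDarts
  ∑-α g = ≡.trans (sym (∑-map α g allDarts)) (∑-↭ g (same-↭
    (Unique.map⁺ (λ {x} {y} e → ≡.trans (sym (α-invol x)) (≡.trans (cong α e) (α-invol y))) (Unique.allFin⁺ n)) (Unique.allFin⁺ n)
    (λ _ → ∈.∈-allFin _) (λ {x} _ → subst (_∈ map α allDarts) (α-invol x) (∈.∈-map⁺ α (∈.∈-allFin (α x))))))

  ∑-list : (g : Fin n → ℤ) (l : List (Fin n)) → Unique l → ∑ (λ d → bit (does (d ∈? l)) ℤ.* g d) allDarts ≡ ∑ g l
  ∑-list g l u with r , p ← sub-↭ u (λ _ → ∈.∈-allFin _) = begin
    ∑ h allDarts ≡⟨ ∑-↭ h p ⟩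
    ∑ h (l ++ r) ≡⟨ ∑-++ h l r ⟩
    ∑ h l ℤ.+ ∑ h r ≡⟨ cong₂ ℤ._+_ (∑-cong l (λ {d} i → ≡.trans (cong (λ b → bit b ℤ.* g d) (does-yes (d ∈? l) i)) (ℤ.*-identityˡ (g d))))
        (≡.trans (∑-cong r (λ {d} i → ≡.trans (cong (λ b → bit b ℤ.* g d) (does-no (d ∈? l) (λ j → uniq-disj l (uniq-↭ p (Unique.allFin⁺ n)) j i))) (ℤ.*-zeroˡ (g d)))) (∑-0 r)) ⟩
    ∑ g l ℤ.+ 0ℤ ≡⟨ ℤ.+-identityʳ _ ⟩
    ∑ g l ∎
    where
    open ≡-Reasoning
    h = λ d → bit (does (d ∈? l)) ℤ.* g d

  Anti : (Fin n → ℤ) → Set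
  Anti x = ∀ d → x (α d) ≡ - x d

  sat-flip : ∀ {x} → Anti x → ∀ {d} → x (α d) ≡ cap (color (α d)) → x d ≡ cap (color d)
  sat-flip {x} anti {d} e = begin
    x d ≡⟨ cong x (sym (α-invol d)) ⟩
    x (α (α d)) ≡⟨ anti (α d) ⟩
    - x (α d) ≡⟨ cong (-_) (≡.trans e (cong cap (color-α d))) ⟩
    - cap (flipC (color d)) ≡⟨ sym (cap-flip (flipC (color d))) ⟩
    cap (flipC (flipC (color d))) ≡⟨ cong cap (flipC-flipC (color d)) ⟩
    cap (color d) ∎
    where open ≡-Reasoning

  cross : (Fin n → Bool) → Fin n → Bool
  cross S d = S d ∧ not (S (α d))

  -- The edges inside S cancel.
  ∑-cross : ∀ {x} → Anti x → ∀ S → ∑ (λ d → bit (S d) ℤ.* x d) allDarts ≡ ∑ (λ d → bit (cross S d) ℤ.* x d) allDarts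
  ∑-cross {x} anti S = begin
    ∑ (λ d → bit (S d) ℤ.* x d) allDarts
      ≡⟨ ∑-cong allDarts (λ {d} _ → ≡.trans (cong (ℤ._* x d) (*-bit-∧ (S d) (S (α d)))) (ℤ.*-distribʳ-+ (x d) (bit (cross S d)) (bit (S d ∧ S (α d))))) ⟩
    ∑ (λ d → bit (cross S d) ℤ.* x d ℤ.+ inner d) allDarts ≡⟨ ∑-+ _ inner allDarts ⟩
    ∑ (λ d → bit (cross S d) ℤ.* x d) allDarts ℤ.+ ∑ inner allDarts ≡⟨ cong (λ z → ∑ (λ d → bit (cross S d) ℤ.* x d) allDarts ℤ.+ z) inner0 ⟩
    ∑ (λ d → bit (cross S d) ℤ.* x d) allDarts ℤ.+ 0ℤ ≡⟨ ℤ.+-identityʳ _ ⟩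
    ∑ (λ d → bit (cross S d) ℤ.* x d) allDarts ∎
    where
    open ≡-Reasoning
    inner : Fin n → ℤ
    inner d = bit (S d ∧ S (α d)) ℤ.* x d
    ∧-comm : ∀ a b → a ∧ b ≡ b ∧ a
    ∧-comm false false = refl
    ∧-comm false true = refl
    ∧-comm true false = refl
    ∧-comm true true = refl
    inner0 : ∑ inner allDarts ≡ 0ℤ
    inner0 = self-neg _ (begin
      ∑ inner allDarts ≡⟨ sym (∑-α inner) ⟩
      ∑ (inner ∘ α) allDarts ≡⟨ ∑-cong allDarts (λ {d} _ → ≡.trans (cong₂ (λ a b → bit a ℤ.* b)
          (≡.trans (cong (S (α d) ∧_) (cong S (α-invol d))) (∧-comm (S (α d)) (S d))) (anti d)) (sym (ℤ.neg-distribʳ-* (bit (S d ∧ S (α d))) (x d)))) ⟩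
      ∑ (λ d → - inner d) allDarts ≡⟨ ∑-neg inner allDarts ⟩
      - ∑ inner allDarts ∎)

  record Away (A : Fin n → Bool) : Set where
    field
      closed : ∀ d → A (σ d) ≡ A d
      ∌ρ : A root ≡ false
      ∌τ : ∀ {d} → marked d ≡ true → A d ≡ false

  -- Net outflow of `A` plus one unit absorbed per dart; its vanishing for all sets away from the
  -- root vertex and τ is conservation.
  demand : (Fin n → ℤ) → (Fin n → Bool) → ℤ
  demand x A = ∑ (λ d → bit (A d) ℤ.* (x d ℤ.+ 1ℤ)) allDarts

  demand-eq : ∀ x A → demand x A ≡ ∑ (λ d → bit (A d) ℤ.* x d) allDarts ℤ.+ + count A allDarts
  demand-eq x A = begin
    demand x A ≡⟨ ∑-cong allDarts (λ {d} _ → ≡.trans (ℤ.*-distribˡ-+ (bit (A d)) (x d) 1ℤ) (cong (λ z → bit (A d) ℤ.* x d ℤ.+ z) (ℤ.*-identityʳ _))) ⟩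
    ∑ (λ d → bit (A d) ℤ.* x d ℤ.+ bit (A d)) allDarts ≡⟨ ∑-+ _ (bit ∘ A) allDarts ⟩
    ∑ (λ d → bit (A d) ℤ.* x d) allDarts ℤ.+ ∑ (bit ∘ A) allDarts ≡⟨ cong (λ z → ∑ (λ d → bit (A d) ℤ.* x d) allDarts ℤ.+ z) (∑-count A allDarts) ⟩
    ∑ (λ d → bit (A d) ℤ.* x d) allDarts ℤ.+ + count A allDarts ∎
    where open ≡-Reasoning

  -- Conservation is left to `Flow`, so that augmentation can start from here. The edges at τ are
  -- saturated from the outset.
  record Preflow (x : Fin n → ℤ) : Set where
    field
      anti : Anti x
      within : ∀ d → Within (color d) (x d)
      sat-τ : ∀ {d} → marked d ≡ true → x d ≡ cap (color d)

  cycle-away : ∀ {l} → Unique l → Cyc (Graph σ) l → root ∉ l → (∀ {d} → d ∈ l → marked d ≡ false) → Away (λ d → does (d ∈? l))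
  cycle-away {l} u cy ρ∉ un = record { closed = cl ; ∌ρ = does-no (root ∈? l) ρ∉
      ; ∌τ = λ {d} e → does-no (d ∈? l) (λ i → case ≡.trans (sym e) (un i) of λ ()) }
    where
    cl : ∀ d → does (σ d ∈? l) ≡ does (d ∈? l)
    cl d with d ∈? l
    ... | yes i with y , refl , j ← cyc-next l cy i = does-yes (σ d ∈? l) j
    ... | no ni = does-no (σ d ∈? l) (λ i → case ∈.∈-map⁻ σ (↭.∈-resp-↭ (↭-sym (cyc-shift σ l cy)) i) of λ
            (e , e∈ , eq) → ni (subst (_∈ l) (≡.trans (sym (proj₂ (proj₂ σ-perm) e)) (≡.trans (cong σ⁻ (sym eq)) (proj₂ (proj₂ σ-perm) d))) e∈))

  cycle-demand : ∀ {x} → (∀ A → Away A → demand x A ≡ 0ℤ) → ∀ {l} → Unique l → Cyc (Graph σ) l → root ∉ l → (∀ {d} → d ∈ l → marked d ≡ false) →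
    ∑ (λ d → x d ℤ.+ 1ℤ) l ≡ 0ℤ
  cycle-demand {x} h {l} u cy ρ∉ un = ≡.trans (sym (∑-list (λ d → x d ℤ.+ 1ℤ) l u)) (h _ (cycle-away u cy ρ∉ un))

  record Flow (x : Fin n → ℤ) : Set where
    field
      preflow : Preflow x
      conserve : ∀ A → Away A → demand x A ≡ 0ℤ
    open Preflow preflow public

  module _ {τc : Color} (τ-is : τColorIs m τc) where

    ∑-τ : ∀ {x} → Preflow x → ∑ (λ d → bit (marked d) ℤ.* x d) allDarts ≡ cap τc ℤ.* + degτ m
    ∑-τ {x} F = begin
      ∑ (λ d → bit (marked d) ℤ.* x d) allDarts ≡⟨ ∑-cong allDarts (λ {d} _ → pt d) ⟩
      ∑ (λ d → cap τc ℤ.* bit (marked d)) allDarts ≡⟨ ∑-* (cap τc) (bit ∘ marked) allDarts ⟩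
      cap τc ℤ.* ∑ (bit ∘ marked) allDarts ≡⟨ cong (λ z → cap τc ℤ.* z) (∑-count marked allDarts) ⟩
      cap τc ℤ.* + degτ m ∎
      where
      open ≡-Reasoning
      pt : ∀ d → bit (marked d) ℤ.* x d ≡ cap τc ℤ.* bit (marked d)
      pt d with marked d in e
      ... | true = ≡.trans (ℤ.*-identityˡ (x d)) (≡.trans (Preflow.sat-τ F e) (≡.trans (cong cap (τ-is d e)) (sym (ℤ.*-identityʳ (cap τc)))))
      ... | false = sym (ℤ.*-zeroʳ (cap τc))

    ∑-∪τ : ∀ {x} → Preflow x → ∀ (A : Fin n → Bool) → (∀ {d} → marked d ≡ true → A d ≡ false) →
      ∑ (λ d → bit (A d ∨ marked d) ℤ.* x d) allDarts ≡ ∑ (λ d → bit (A d) ℤ.* x d) allDarts ℤ.+ cap τc ℤ.* + degτ m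
    ∑-∪τ {x} F A h = ≡.trans (∑-cong allDarts (λ {d} _ → ≡.trans (cong (ℤ._* x d) (pt d)) (ℤ.*-distribʳ-+ (x d) (bit (A d)) (bit (marked d)))))
      (≡.trans (∑-+ _ _ allDarts) (cong (λ z → ∑ (λ d → bit (A d) ℤ.* x d) allDarts ℤ.+ z) (∑-τ F)))
      where
      pt : ∀ d → bit (A d ∨ marked d) ≡ bit (A d) ℤ.+ bit (marked d)
      pt d with marked d in e
      ... | true rewrite h e = refl
      ... | false with A d
      ...   | true = refl
      ...   | false = refl

    -- The net outflow of `A` together with τ, counted across the boundary and counted by vertices,
    -- where each dart of τ contributes `cap τc`.
    cut-flow : ∀ {x} → Preflow x → ∀ (A : Fin n → Bool) → (∀ {d} → marked d ≡ true → A d ≡ false) →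
      ∑ (λ d → bit (cross (λ d → A d ∨ marked d) d) ℤ.* x d) allDarts ℤ.+ + count A allDarts ≡ demand x A ℤ.+ cap τc ℤ.* + degτ m
    cut-flow {x} F A h = begin
      ∑ (λ d → bit (cross S d) ℤ.* x d) allDarts ℤ.+ + count A allDarts ≡⟨ cong (ℤ._+ + count A allDarts) (≡.trans (sym (∑-cross (Preflow.anti F) S)) (∑-∪τ F A h)) ⟩
      (∑ (λ d → bit (A d) ℤ.* x d) allDarts ℤ.+ cap τc ℤ.* + degτ m) ℤ.+ + count A allDarts ≡⟨ lem (∑ (λ d → bit (A d) ℤ.* x d) allDarts) (cap τc ℤ.* + degτ m) (+ count A allDarts) ⟩
      (∑ (λ d → bit (A d) ℤ.* x d) allDarts ℤ.+ + count A allDarts) ℤ.+ cap τc ℤ.* + degτ m ≡⟨ cong (ℤ._+ cap τc ℤ.* + degτ m) (sym (demand-eq x A)) ⟩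
      demand x A ℤ.+ cap τc ℤ.* + degτ m ∎
      where
      open ≡-Reasoning
      S = λ d → A d ∨ marked d
      lem : ∀ a b c → (a ℤ.+ b) ℤ.+ c ≡ (a ℤ.+ c) ℤ.+ b
      lem = solve-∀

  ∑-weight : ∀ c S → ∑ (λ d → bit (cross S d) ℤ.* cap c) allDarts ≡ cap c ℤ.* + weight m S
  ∑-weight c S = ≡.trans (∑-cong allDarts (λ {d} _ → ℤ.*-comm (bit (cross S d)) (cap c)))
    (≡.trans (∑-* (cap c) (bit ∘ cross S) allDarts) (cong (λ z → cap c ℤ.* z) (∑-count (cross S) allDarts)))

  bit-mono : ∀ b {u v} → (b ≡ true → u ℤ.≤ v) → bit b ℤ.* u ℤ.≤ bit b ℤ.* v
  bit-mono true {u} {v} h = subst₂ ℤ._≤_ (sym (ℤ.*-identityˡ u)) (sym (ℤ.*-identityˡ v)) (h refl)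
    where open ≡ using (subst₂)
  bit-mono false h = ℤ.≤-refl

  cross⇒ : ∀ {a b} → a ∧ not b ≡ true → a ≡ true × b ≡ false
  cross⇒ {true} {false} e = refl , refl

  count<N : ∀ A → + count A allDarts ℤ.< N
  count<N A = ℤ.+<+ (s≤s (ℕ.≤-trans (count-≤ A allDarts) (ℕ.≤-reflexive (List.length-tabulate {n = n} id))))

  -- The correction `a` is worth less than one edge, so it cannot alter the comparison of integers.
  cancel-N : ∀ k w {a} → a ℤ.< N → N ℤ.* + k ℤ.≤ N ℤ.* + w ℤ.+ a → k ≤ w
  cancel-N k w {a} lt le = ℕ.≤-pred (ℤ.drop‿+<+ (ℤ.*-cancelˡ-<-nonNeg N (begin-strict
    N ℤ.* + k ≤⟨ le ⟩
    N ℤ.* + w ℤ.+ a <⟨ ℤ.+-monoʳ-< (N ℤ.* + w) lt ⟩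
    N ℤ.* + w ℤ.+ N ≡⟨ lem N (+ w) ⟩
    N ℤ.* + suc w ∎)))
    where
    open ℤ.≤-Reasoning
    lem : ∀ a b → a ℤ.* b ℤ.+ a ≡ a ℤ.* (1ℤ ℤ.+ b)
    lem = solve-∀

ℤ+-cancelˡ-≤ : ∀ a {b c} → a ℤ.+ b ℤ.≤ a ℤ.+ c → b ℤ.≤ c
ℤ+-cancelˡ-≤ a {b} {c} le = ≡.subst₂ ℤ._≤_ (lem a b) (lem a c) (ℤ.+-monoʳ-≤ (- a) le)
  where
  lem : ∀ a b → - a ℤ.+ (a ℤ.+ b) ≡ b
  lem = solve-∀

count-cong : {p q : A → Bool} → (∀ x → p x ≡ q x) → ∀ l → count p l ≡ count q l
count-cong h [] = refl
count-cong {p = p} {q} h (x ∷ l) with p x | q x | h x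
... | true | _ | refl = cong suc (count-cong h l)
... | false | _ | refl = count-cong h l

-- A flow implies tightness

module Tightness (m : Map) (pb : IsPointedBipartiteMap m) where

  open Flows m pb

  module _ (S : Fin n → Bool) (cut : IsCut m S) where
    open IsCut cut

    interior : Fin n → Bool
    interior d = S d ∧ not (marked d)

    interior-∪τ : ∀ d → interior d ∨ marked d ≡ S d
    interior-∪τ d with marked d in e
    ... | true rewrite τ∈S d e = refl
    ... | false with S d
    ...   | true = refl
    ...   | false = refl

    interior-away : Away interior
    interior-away = record
      { closed = λ d → cong₂ (λ a b → a ∧ not b) (S-vertex d) (marked-σ d)
      ; ∌ρ = cong (_∧ not (marked root)) ρ∈R
      ; ∌τ = λ {d} e → ≡.trans (cong (λ b → S d ∧ not b) e) (∧-false (S d)) }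
      where
      ∧-false : ∀ a → a ∧ false ≡ false
      ∧-false true = refl
      ∧-false false = refl

    cross-sum : ∀ {τc x} → τColorIs m τc → Flow x →
      ∑ (λ d → bit (cross S d) ℤ.* x d) allDarts ℤ.+ + count interior allDarts ≡ cap τc ℤ.* + degτ m
    cross-sum {τc} {x} τ-is F = begin
      ∑ (λ d → bit (cross S d) ℤ.* x d) allDarts ℤ.+ + count interior allDarts
        ≡⟨ cong (ℤ._+ + count interior allDarts) (∑-cong allDarts (λ {d} _ → cong (λ b → bit b ℤ.* x d)
             (sym (cong₂ (λ a b → a ∧ not b) (interior-∪τ d) (interior-∪τ (α d)))))) ⟩
      ∑ (λ d → bit (cross (λ d → interior d ∨ marked d) d) ℤ.* x d) allDarts ℤ.+ + count interior allDarts
        ≡⟨ cut-flow τ-is (Flow.preflow F) interior (Away.∌τ interior-away) ⟩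
      demand x interior ℤ.+ cap τc ℤ.* + degτ m ≡⟨ cong (ℤ._+ cap τc ℤ.* + degτ m) (Flow.conserve F interior interior-away) ⟩
      0ℤ ℤ.+ cap τc ℤ.* + degτ m ≡⟨ ℤ.+-identityˡ _ ⟩
      cap τc ℤ.* + degτ m ∎
      where open ≡-Reasoning

  -- A black τ sends out `N` per edge and the cut side absorbs part of it before the boundary. The
  -- part is less than `N`, so minimality survives but uniqueness may not.
  tight-black : ∀ {x} → τColorIs m black → Flow x → Tight m black
  tight-black {x} τ-is F S cut hc = cancel-N (degτ m) (weight m S) (count<N I) (begin
    N ℤ.* + degτ m ≡⟨ sym (cross-sum S cut τ-is F) ⟩
    ∑ (λ d → bit (cross S d) ℤ.* x d) allDarts ℤ.+ + count I allDarts ≤⟨ ℤ.+-monoˡ-≤ (+ count I allDarts) (∑-mono allDarts (λ {d} _ → bit-mono (cross S d) (bound d))) ⟩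
    ∑ (λ d → bit (cross S d) ℤ.* N) allDarts ℤ.+ + count I allDarts ≡⟨ cong (ℤ._+ + count I allDarts) (∑-weight black S) ⟩
    N ℤ.* + weight m S ℤ.+ + count I allDarts ∎)
    where
    open ℤ.≤-Reasoning
    I : Fin n → Bool
    I = interior S cut
    bound : ∀ d → cross S d ≡ true → x d ℤ.≤ N
    bound d e with p , q ← cross⇒ {S d} e = subst (λ c → Within c (x d)) (hc d p q) (Flow.within F d)

  -- A white τ receives `N` per edge and the interior of the cut side absorbs more, all of which
  -- must cross the boundary. A cut of weight `degτ m` therefore has empty interior: tightness is
  -- strict.
  white-bound : ∀ {x} → τColorIs m white → Flow x → ∀ S (cut : IsCut m S) → HasColor m white S →
    N ℤ.* + degτ m ℤ.+ + count (interior S cut) allDarts ℤ.≤ N ℤ.* + weight m S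
  white-bound {x} τ-is F S cut hc = begin
    N ℤ.* + degτ m ℤ.+ cA ≡⟨ lem N (+ degτ m) cA ⟩
    cA ℤ.- (- N) ℤ.* + degτ m ≡⟨ cong (λ z → cA ℤ.- z) (sym (cross-sum S cut τ-is F)) ⟩
    cA ℤ.- (X ℤ.+ cA) ≡⟨ lem' cA X ⟩
    - X ≤⟨ ℤ.neg-mono-≤ (∑-mono allDarts (λ {d} _ → bit-mono (cross S d) (bound d))) ⟩
    - ∑ (λ d → bit (cross S d) ℤ.* (- N)) allDarts ≡⟨ cong (-_) (∑-weight white S) ⟩
    - ((- N) ℤ.* + weight m S) ≡⟨ lem'' N (+ weight m S) ⟩
    N ℤ.* + weight m S ∎
    where
    open ℤ.≤-Reasoning
    cA = + count (interior S cut) allDarts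
    X = ∑ (λ d → bit (cross S d) ℤ.* x d) allDarts
    bound : ∀ d → cross S d ≡ true → - N ℤ.≤ x d
    bound d e with p , q ← cross⇒ {S d} e = subst (λ c → Within c (x d)) (hc d p q) (Flow.within F d)
    lem : ∀ a b c → a ℤ.* b ℤ.+ c ≡ c ℤ.- (- a) ℤ.* b
    lem = solve-∀
    lem' : ∀ a b → a ℤ.- (b ℤ.+ a) ≡ - b
    lem' = solve-∀
    lem'' : ∀ a b → - ((- a) ℤ.* b) ≡ a ℤ.* b
    lem'' = solve-∀

  tight-white : ∀ {x} → τColorIs m white → Flow x → StrictlyTight m white
  tight-white {x} τ-is F = (λ S cut hc → cancel-N (degτ m) (weight m S) (ℤ.+<+ (s≤s z≤n))
        (ℤ.≤-trans (ℤ.≤-trans (ℤ.i≤i+j _ (+ count (interior S cut) allDarts)) (white-bound τ-is F S cut hc)) (ℤ.≤-reflexive (sym (ℤ.+-identityʳ _))))) ,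
    λ S cut hc le d → ≡.trans (sym (interior-∪τ S cut d)) (cong (_∨ marked d) (count-0 (interior S cut) allDarts (empty S cut hc le) (∈.∈-allFin d)))
    where
    empty : ∀ S (cut : IsCut m S) → HasColor m white S → weight m S ≤ degτ m → count (interior S cut) allDarts ≡ 0
    empty S cut hc le = ℕ.n≤0⇒n≡0 (ℤ.drop‿+≤+ (ℤ+-cancelˡ-≤ (N ℤ.* + degτ m) (begin
      N ℤ.* + degτ m ℤ.+ + count (interior S cut) allDarts ≤⟨ white-bound τ-is F S cut hc ⟩
      N ℤ.* + weight m S ≤⟨ ℤ.*-monoˡ-≤-nonNeg N (ℤ.+≤+ le) ⟩
      N ℤ.* + degτ m ≡⟨ sym (ℤ.+-identityʳ _) ⟩
      N ℤ.* + degτ m ℤ.+ 0ℤ ∎)))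
      where open ℤ.≤-Reasoning

-- The flow of a tree

module TreeFlow (m : Map) (pb : IsPointedBipartiteMap m) where

  open Flows m pb public

  -- The flow carried by the edge above a vertex, forced by conservation in the subtree b.
  up : Color → Forest (Fin n) → ℤ
  up c b = N ℤ.* chg (flipC c) b ℤ.- + suc (length (labels b))

  FlowOn : (Fin n → ℤ) → Color → Forest (Fin n) → Set
  FlowOn x c ε = ⊤
  FlowOn x c (leaf d r) = x d ≡ cap c × FlowOn x c r
  FlowOn x c (edge d d' b r) = (x d ≡ - up c b × x d' ≡ up c b) × FlowOn x (flipC c) b × FlowOn x c r

  -- Leaves contribute `N` times their charge up to sign, and child edges contribute `up`. For a
  -- non-root vertex this is the whole balance except the parent dart, whose value is thereby
  -- forced.
  row-demand : ∀ {x} c F → FlowOn x c F → ∑ (λ d → x d ℤ.+ 1ℤ) (row F) ≡ + length (labels F) ℤ.- N ℤ.* chg c F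
  row-demand c ε h = sym (≡.trans (ℤ.+-identityˡ _) (cong (-_) (ℤ.*-zeroʳ N)))
  row-demand {x} c (leaf d r) (e , h) = ≡.trans (cong₂ (λ a b → (a ℤ.+ 1ℤ) ℤ.+ b) e (row-demand c r h)) (lem c N (+ length (labels r)) (chg c r))
    where
    lemb : ∀ a b e → (a ℤ.+ 1ℤ) ℤ.+ (b ℤ.- a ℤ.* e) ≡ (1ℤ ℤ.+ b) ℤ.- a ℤ.* (ℤ.-1ℤ ℤ.+ e)
    lemb = solve-∀
    lemw : ∀ a b e → (- a ℤ.+ 1ℤ) ℤ.+ (b ℤ.- a ℤ.* e) ≡ (1ℤ ℤ.+ b) ℤ.- a ℤ.* (1ℤ ℤ.+ e)
    lemw = solve-∀
    lem : ∀ c a b e → (cap c ℤ.+ 1ℤ) ℤ.+ (b ℤ.- N ℤ.* e) ≡ (1ℤ ℤ.+ b) ℤ.- N ℤ.* (stemCharge c ℤ.+ e)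
    lem black a b e = lemb N b e
    lem white a b e = lemw N b e
  row-demand {x} c (edge d d' b r) ((e , _) , h , h') = ≡.trans (cong₂ (λ a b → (a ℤ.+ 1ℤ) ℤ.+ b) e (row-demand c r h'))
      (≡.trans (lem N (chg (flipC c) b) (+ length (labels b)) (+ length (labels r)) (chg c r))
        (cong (λ z → z ℤ.- N ℤ.* (chg (flipC c) b ℤ.+ chg c r)) (cong (λ k → 1ℤ ℤ.+ (1ℤ ℤ.+ + k)) (sym (List.length-++ (labels b))))))
    where
    lem : ∀ n p b r q → (- (n ℤ.* p ℤ.- (1ℤ ℤ.+ b)) ℤ.+ 1ℤ) ℤ.+ (r ℤ.- n ℤ.* q) ≡ (1ℤ ℤ.+ (1ℤ ℤ.+ (b ℤ.+ r))) ℤ.- n ℤ.* (p ℤ.+ q)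
    lem = solve-∀

  rots-demand : ∀ {x} c F → FlowOn x c F → All (λ (_ , l) → ∑ (λ d → x d ℤ.+ 1ℤ) l ≡ 0ℤ) (rots c F)
  rots-demand c ε h = []
  rots-demand c (leaf d r) (_ , h) = rots-demand c r h
  rots-demand {x} c (edge d d' b r) ((_ , e) , h , h') = All.++⁺ (rots-demand (flipC c) b h)
    (≡.trans (cong₂ (λ p q → (p ℤ.+ 1ℤ) ℤ.+ q) e (row-demand (flipC c) b h)) (lem N (chg (flipC c) b) (+ length (labels b))) ∷ rots-demand c r h')
    where
    lem : ∀ n p b → ((n ℤ.* p ℤ.- (1ℤ ℤ.+ b)) ℤ.+ 1ℤ) ℤ.+ (b ℤ.- n ℤ.* p) ≡ 0ℤ
    lem = solve-∀

  -- With `s` the size subtracted in `up`, `0 < s < N`; so `N · charge - s` stays below `N` when the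
  -- charge is at most 1 and above `- N` when it is at least 0. The next lemma uses the same
  -- inequalities backwards.
  slack-up : ∀ c b → Bounded (flipC c) (chg (flipC c) b) → suc (length (labels b)) ≤ n → Slack (flipC c) (up c b)
  slack-up white b le sz = begin-strict
    N ℤ.* chg black b ℤ.- + suc (length (labels b)) ≤⟨ ℤ.+-monoˡ-≤ (- + suc (length (labels b))) (ℤ.*-monoˡ-≤-nonNeg N le) ⟩
    N ℤ.* 1ℤ ℤ.- + suc (length (labels b)) <⟨ ℤ.+-monoʳ-< (N ℤ.* 1ℤ) (ℤ.neg-mono-< {0ℤ} {+ suc (length (labels b))} (ℤ.+<+ (s≤s z≤n))) ⟩
    N ℤ.* 1ℤ ℤ.- 0ℤ ≡⟨ lem N ⟩
    N ∎
    where
    open ℤ.≤-Reasoning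
    lem : ∀ a → a ℤ.* 1ℤ ℤ.- 0ℤ ≡ a
    lem = solve-∀
  slack-up black b le sz = begin-strict
    - N <⟨ ℤ.neg-mono-< (ℤ.+<+ (s≤s sz)) ⟩
    - + suc (length (labels b)) ≡⟨ lem N (+ suc (length (labels b))) ⟩
    N ℤ.* 0ℤ ℤ.- + suc (length (labels b)) ≤⟨ ℤ.+-monoˡ-≤ (- + suc (length (labels b))) (ℤ.*-monoˡ-≤-nonNeg N le) ⟩
    N ℤ.* chg white b ℤ.- + suc (length (labels b)) ∎
    where
    open ℤ.≤-Reasoning
    lem : ∀ a b → - b ≡ a ℤ.* 0ℤ ℤ.- b
    lem = solve-∀

  up-bounded : ∀ c b → Slack (flipC c) (up c b) → suc (length (labels b)) ≤ n → Bounded (flipC c) (chg (flipC c) b)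
  up-bounded white b s sz = ℤ.≮⇒≥ λ lt → ℤ.<-irrefl refl (begin-strict
    N <⟨ ℤ.≤-<-trans (ℤ.≤-reflexive (sym (ℤ.+-identityʳ N))) (ℤ.+-monoʳ-< N (begin-strict
           0ℤ ≡⟨ sym (ℤ.+-inverseʳ (+ suc (length (labels b)))) ⟩
           + suc (length (labels b)) ℤ.- + suc (length (labels b)) <⟨ ℤ.+-monoˡ-< (- + suc (length (labels b))) (ℤ.+<+ (s≤s sz)) ⟩
           N ℤ.- + suc (length (labels b)) ∎)) ⟩
    N ℤ.+ (N ℤ.- + suc (length (labels b))) ≡⟨ lem N (+ suc (length (labels b))) ⟩
    N ℤ.* + 2 ℤ.- + suc (length (labels b)) ≤⟨ ℤ.+-monoˡ-≤ (- + suc (length (labels b))) (ℤ.*-monoˡ-≤-nonNeg N (ℤ.i<j⇒suc[i]≤j lt)) ⟩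
    N ℤ.* chg black b ℤ.- + suc (length (labels b)) <⟨ s ⟩
    N ∎)
    where
    open ℤ.≤-Reasoning
    lem : ∀ a b → a ℤ.+ (a ℤ.- b) ≡ a ℤ.* + 2 ℤ.- b
    lem = solve-∀
  up-bounded black b s sz = ℤ.≮⇒≥ λ lt → ℤ.<-irrefl refl (begin-strict
    - N <⟨ s ⟩
    N ℤ.* chg white b ℤ.- + suc (length (labels b)) ≤⟨ ℤ.+-monoˡ-≤ (- + suc (length (labels b))) (ℤ.*-monoˡ-≤-nonNeg N (ℤ.i<j⇒i≤pred[j] lt)) ⟩
    N ℤ.* ℤ.-1ℤ ℤ.- + suc (length (labels b)) ≤⟨ ℤ.+-monoʳ-≤ (N ℤ.* ℤ.-1ℤ) (ℤ.neg-mono-≤ {0ℤ} {+ suc (length (labels b))} (ℤ.+≤+ z≤n)) ⟩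
    N ℤ.* ℤ.-1ℤ ℤ.- 0ℤ ≡⟨ lem N ⟩
    - N ∎)
    where
    open ℤ.≤-Reasoning
    lem : ∀ a → a ℤ.* ℤ.-1ℤ ℤ.- 0ℤ ≡ - a
    lem = solve-∀

module StructureFlow {m : Map} {c τc : Color} {F : Forest (Fin (Map.n m))} {us : List (Fin (Map.n m))} (S : Structure m c τc F us) (pb : IsPointedBipartiteMap m) where

  open Structure S using (wf; rootRow; good; us-inh; us-col; τ-col; mark⇒; mark⇐; rootHd; charged; cover)
  open StructureMap S using (ts; uniq-all; uniq-labels; where-dart; us⊆labels; vertices; vertexLists; vrow-ok)
  open TreeFlow m pb public

  values : Color → Forest (Fin n) → List (Fin n × ℤ)
  values c ε = []
  values c (leaf d r) = (d , cap c) ∷ values c r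
  values c (edge d d' b r) = (d , - up c b) ∷ (d' , up c b) ∷ values (flipC c) b ++ values c r

  keys : ∀ c F → map proj₁ (values c F) ≡ labels F
  keys c ε = refl
  keys c (leaf d r) = cong (d ∷_) (keys c r)
  keys c (edge d d' b r) = cong (λ z → d ∷ d' ∷ z) (≡.trans (List.map-++ proj₁ (values (flipC c) b) (values c r)) (cong₂ _++_ (keys (flipC c) b) (keys c r)))

  x : Fin n → ℤ
  -- The default is the value on the darts of τ, the only ones that are not labels.
  x = find (cap τc) (values c F)

  flowOn : ∀ {x : Fin n → ℤ} c F → (∀ {k v} → (k , v) ∈ values c F → x k ≡ v) → FlowOn x c F
  flowOn c ε h = tt
  flowOn c (leaf d r) h = h (here refl) , flowOn c r (h ∘ there)
  flowOn c (edge d d' b r) h = (h (here refl) , h (there (here refl))) ,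
    flowOn (flipC c) b (λ i → h (there (there (∈.∈-++⁺ˡ i)))) , flowOn c r (λ i → h (there (there (∈.∈-++⁺ʳ (values (flipC c) b) i))))

  x-on : FlowOn x c F
  x-on = flowOn c F (find-∈ _ (values c F) (subst Unique (sym (keys c F)) uniq-labels))

  x-τ : ∀ {d} → d ∈ ts → x d ≡ cap τc
  x-τ {d} i = find-∉ _ (values c F) (λ j → uniq-disj (labels F) uniq-all (subst (d ∈_) (keys c F) j) i)

  -- A set away from the root vertex and τ is constant on every rotation, so each rotation
  -- contributes zero or its own balance.
  all-rows : ∀ {A : Fin n → Bool} → Away A → ∀ {l} → l ∈ vertexLists → ∑ (λ d → bit (A d) ℤ.* (x d ℤ.+ 1ℤ)) l ≡ 0ℤ
  all-rows {B} aw {l} i = go i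
    where
    open Away aw
    module D = Decomp vertices
    zero-on : ∀ {l} → l ∈ vertexLists → ∀ {d} → d ∈ l → B d ≡ false → ∑ (λ d → bit (B d) ℤ.* (x d ℤ.+ 1ℤ)) l ≡ 0ℤ
    zero-on {l} i j e = ≡.trans (∑-cong l (λ {d} k → cong (λ b → bit b ℤ.* (x d ℤ.+ 1ℤ))
      (All.lookup (cyc-closed {P = λ d → B d ≡ false} (λ { {a} refl p → ≡.trans (closed a) p }) l (D.cyc i) j e) k))) (∑-0 l)
    one-on : ∀ {l} → l ∈ vertexLists → ∀ {d} → d ∈ l → B d ≡ true → ∑ (λ d → bit (B d) ℤ.* (x d ℤ.+ 1ℤ)) l ≡ ∑ (λ d → x d ℤ.+ 1ℤ) l
    one-on {l} i j e = ∑-cong l (λ {d} k → ≡.trans (cong (λ b → bit b ℤ.* (x d ℤ.+ 1ℤ))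
      (All.lookup (cyc-closed {P = λ d → B d ≡ true} (λ { {a} refl p → ≡.trans (closed a) p }) l (D.cyc i) j e) k)) (ℤ.*-identityˡ _))
    go : ∀ {l} → l ∈ vertexLists → ∑ (λ d → bit (B d) ℤ.* (x d ℤ.+ 1ℤ)) l ≡ 0ℤ
    go i@(here refl) = zero-on i (proj₂ (All.head D.inhabited)) (∌τ (mark⇐ (↭.∈-resp-↭ (↭.↭-reverse ts) (proj₂ (All.head D.inhabited)))))
    go i@(there (here refl)) = zero-on i (subst (root ∈_) (sym (proj₂ rootHd)) (here refl)) ∌ρ
    go i@(there (there j)) with (c' , l) , k , refl ← ∈.∈-map⁻ proj₂ j with d , d∈ ← All.lookup D.inhabited i with B d in e
    ... | false = zero-on i d∈ e
    ... | true = ≡.trans (one-on i d∈ e) (All.lookup (rots-demand c F x-on) k)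

  ∑-concat0 : (g : Fin n → ℤ) → ∀ L → (∀ {l} → l ∈ L → ∑ g l ≡ 0ℤ) → ∑ g (concat L) ≡ 0ℤ
  ∑-concat0 g [] h = refl
  ∑-concat0 g (l ∷ L) h = ≡.trans (∑-++ g l (concat L)) (cong₂ ℤ._+_ (h (here refl)) (∑-concat0 g L (h ∘ there)))

  labels≤n : length (labels F) ≤ n
  labels≤n = ℕ.≤-trans (sub-length uniq-labels (λ _ → ∈.∈-allFin _)) (ℕ.≤-reflexive (List.length-tabulate {n = n} id))

  Local : Fin n → Set
  Local d = x (α d) ≡ - x d × Within (color d) (x d)

  local-flip : ∀ {d} → Local d → Local (α d)
  local-flip {d} (e , w) = ≡.trans (cong x (α-invol d)) (≡.trans (sym (ℤ.neg-involutive (x d))) (cong (-_) (sym e))) ,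
    subst₂ Within (sym (color-α d)) (sym e) (within-neg (color d) w)
    where open ≡ using (subst₂)

  local-edges : ∀ c F → length (labels F) ≤ n → Wf σ α color c F → Charged c F → FlowOn x c F →
    All (λ (d , d') → x d' ≡ - x d × Slack (color d) (x d)) (edges F)
  local-edges c ε sz w q h = []
  local-edges c (leaf d r) sz (_ , w) q (_ , h) = local-edges c r (ℕ.<⇒≤ sz) w q h
  local-edges c (edge d d' b r) sz ((p , _) , w , w') (k , q , q') ((e , e') , h , h') =
    (≡.trans e' (≡.trans (sym (ℤ.neg-involutive (up c b))) (cong (-_) (sym e))) ,
      subst₂ Slack (≡.trans (flipC-flipC c) (sym p)) (sym e) (slack-neg (flipC c) (slack-up c b k (ℕ.≤-trans (ℕ.m≤n+m _ 1) (ℕ.≤-trans (s≤s (s≤s (ℕ.m≤m+n _ (length (labels r))))) sz')))))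
    ∷ All.++⁺ (local-edges (flipC c) b (ℕ.≤-trans (ℕ.m≤m+n _ (length (labels r))) (ℕ.≤-trans (ℕ.m≤n+m _ 2) sz')) w q h)
              (local-edges c r (ℕ.≤-trans (ℕ.m≤n+m _ (length (labels b))) (ℕ.≤-trans (ℕ.m≤n+m _ 2) sz')) w' q' h')
    where
    open ≡ using (subst₂)
    sz' : 2 + (length (labels b) + length (labels r)) ≤ n
    sz' = subst (λ k → 2 + k ≤ n) (List.length-++ (labels b)) sz

  tree-edges : All (λ (d , d') → x d' ≡ - x d × Slack (color d) (x d)) (edges F)
  tree-edges = local-edges c F labels≤n wf charged x-on

  x-leaf : ∀ {d} → d ∈ leaves F → x d ≡ cap (color d)
  x-leaf = All.lookup (go c F wf x-on)
    where
    go : ∀ c F → Wf σ α color c F → FlowOn x c F → All (λ d → x d ≡ cap (color d)) (leaves F)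
    go c ε w h = []
    go c (leaf d r) (p , w) (e , h) = ≡.trans e (cong cap (sym p)) ∷ go c r w h
    go c (edge d d' b r) (_ , w , w') (_ , h , h') = All.++⁺ (go (flipC c) b w h) (go c r w' h')

  edge-local : ∀ {a b} → (a , b) ∈ edges F → Local a
  edge-local {a} k with e , s ← All.lookup tree-edges k = ≡.trans (cong x (All.lookup (wf-edges σ α color c F wf) k)) e , slack-within (color a) s

  local : ∀ d → Local d
  local d with where-dart d
  ... | inj₂ i with u , j , refl ← ∈.∈-map⁻ α i = local-flip (sat-local u (good-⊇ good j) (≡.trans (x-τ i) (cong cap (sym (All.lookup τ-col j)))))
    where
    sat-local : ∀ u → u ∈ leaves F → x (α u) ≡ cap (color (α u)) → Local u
    sat-local u i e = ≡.trans e (≡.trans (cong cap (color-α u)) (≡.trans (cap-flip (color u)) (cong (-_) (sym (x-leaf i))))) ,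
      subst (Within (color u)) (sym (x-leaf i)) (within-cap (color u))
  local d | inj₁ i with ∈.∈-++⁻ (sides (edges F)) (↭.∈-resp-↭ (↭-sym (sides-leaves F)) i)
  ... | inj₁ j with sides-∈ (edges F) j
  ...   | y , inj₁ k = edge-local k
  ...   | y , inj₂ k = subst Local (All.lookup (wf-edges σ α color c F wf) k) (local-flip (edge-local k))
  local d | inj₁ i | inj₂ j = other , subst (Within (color d)) (sym (x-leaf j)) (within-cap (color d))
    where
    sat-neg : x (α d) ≡ cap (color (α d)) → x (α d) ≡ - x d
    sat-neg e = ≡.trans e (≡.trans (cong cap (color-α d)) (≡.trans (cap-flip (color d)) (cong (-_) (sym (x-leaf j)))))
    other : x (α d) ≡ - x d
    other with good-cases (good-∈ id good) j
    ... | inj₁ k = sat-neg (≡.trans (x-τ (∈.∈-map⁺ α k)) (cong cap (sym (All.lookup τ-col k))))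
    ... | inj₂ (y , inj₁ ((_ , _ , refl) , _ , k)) = sat-neg (x-leaf k)
    ... | inj₂ (y , inj₂ ((_ , _ , refl) , k , _)) = sat-neg (x-leaf (subst (_∈ leaves F) (sym (α-invol y)) k))

  flow : Flow x
  flow = record
    { preflow = record { anti = proj₁ ∘ local ; within = proj₂ ∘ local
                       ; sat-τ = λ {d} e → ≡.trans (x-τ (mark⇒ e)) (cong cap (sym (StructureMap.τColor-is S d e))) }
    ; conserve = λ A aw → ≡.trans (∑-↭ _ (↭-sym (Decomp.cover vertices))) (∑-concat0 _ vertexLists (all-rows aw)) }

-- Heights and uniqueness of the tree

-- A height h on the darts with h (σ d) = h d - δ d and h (α d) = h d - δ d: a potential on the
-- faces whose coboundary is the circulation δ.
module Heights {D : Set} (σ α : D → D) (color : D → Color) (δ h : D → ℤ) (δ-anti : ∀ d → δ (α d) ≡ - δ d) where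

  -- `h d` is the height of the face at the corner before `d`. Walking along an edge stays on its
  -- face, so the subtree `b` starts at the height `a` of the edge; passing the edge or a stem
  -- lowers the height by `δ d`.
  On : ℤ → Forest D → Set
  On a ε = ⊤
  On a (leaf d r) = h d ≡ a × On (a ℤ.- δ d) r
  On a (edge d d' b r) = (h d ≡ a × h d' ≡ a ℤ.- δ d) × On a b × On (a ℤ.- δ d) r

  Walk : ℤ → List D → ℤ → Set
  Walk a [] b = a ≡ b
  Walk a (y ∷ w) b = h y ≡ a × Walk (a ℤ.- δ y) w b

  Balanced : Color → Forest D → Set
  Balanced c F = All (λ (_ , l) → ∑ δ l ≡ 0ℤ) (rots c F)

  balanced-b : ∀ c {d d' b r} → Balanced c (edge d d' b r) → Balanced (flipC c) b × ∑ δ (d' ∷ row b) ≡ 0ℤ × Balanced c r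
  balanced-b c {b = b} bal with p , q ∷ r ← All.++⁻ (rots (flipC c) b) bal = p , q , r

  -- The subtree hanging from d absorbs exactly δ d.
  child-end : ∀ a d b → ∑ δ (α d ∷ row b) ≡ 0ℤ → a ℤ.- ∑ δ (row b) ≡ a ℤ.- δ d
  child-end a d b e = cong (λ z → a ℤ.- z) (begin
    ∑ δ (row b) ≡⟨ lem (δ (α d)) (∑ δ (row b)) ⟩
    ∑ δ (α d ∷ row b) ℤ.- δ (α d) ≡⟨ cong₂ ℤ._-_ e (δ-anti d) ⟩
    0ℤ ℤ.- - δ d ≡⟨ lem' (δ d) ⟩
    δ d ∎)
    where
    open ≡-Reasoning
    lem : ∀ a b → b ≡ (a ℤ.+ b) ℤ.- a
    lem = solve-∀
    lem' : ∀ a → 0ℤ ℤ.- - a ≡ a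
    lem' = solve-∀

  private
    tail-end : ∀ a x y → (a ℤ.- x) ℤ.- y ≡ a ℤ.- (x ℤ.+ y)
    tail-end = solve-∀
    nil-end : ∀ a → a ≡ a ℤ.- 0ℤ
    nil-end = solve-∀
    back : ∀ a x → (a ℤ.- x) ℤ.- - x ≡ a
    back = solve-∀

  walk-++ : ∀ {a b e} u {v} → Walk a u b → Walk b v e → Walk a (u ++ v) e
  walk-++ [] refl w = w
  walk-++ (y ∷ u) (p , w) w' = p , walk-++ u w w'

  -- Between consecutive stems the contour follows one face, so the height only changes at stems;
  -- `child-end` settles the return from a subtree.
  on-walk : ∀ c a F → Wf σ α color c F → Balanced c F → On a F → Walk a (leaves F) (a ℤ.- ∑ δ (row F))
  on-walk c a ε w bal o = nil-end a
  on-walk c a (leaf d r) (_ , w) bal (p , o) = p , subst (Walk (a ℤ.- δ d) (leaves r)) (tail-end a (δ d) (∑ δ (row r))) (on-walk c (a ℤ.- δ d) r w bal o)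
  on-walk c a (edge d d' b r) ((_ , _ , refl , _) , w , w') bal (_ , o , o') with p , q , s ← balanced-b c {d} {d'} {b} {r} bal =
    walk-++ (leaves b) (subst (Walk a (leaves b)) (child-end a d b q) (on-walk (flipC c) a b w p o))
      (subst (Walk (a ℤ.- δ d) (leaves r)) (tail-end a (δ d) (∑ δ (row r))) (on-walk c (a ℤ.- δ d) r w' s o'))

  -- Each dart has the height of the next stem on the contour, or of its end, so a property of those
  -- heights reaches every dart.
  on-all : ∀ {P : ℤ → Set} c a F → Wf σ α color c F → Balanced c F → On a F → All (P ∘ h) (leaves F) → P (a ℤ.- ∑ δ (row F)) →
    P a × All (P ∘ h) (labels F)
  on-all {P} c a ε w bal o l e = subst P (sym (nil-end a)) e , []
  on-all {P} c a (leaf d r) (_ , w) bal (p , o) (q ∷ l) e =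
    subst P p q , q ∷ proj₂ (on-all {P} c (a ℤ.- δ d) r w bal o l (subst P (sym (tail-end a (δ d) (∑ δ (row r)))) e))
  on-all {P} c a (edge d d' b r) ((_ , _ , refl , _) , w , w') bal ((hd , hd') , o , o') l e
    with p , q , s ← balanced-b c {d} {d'} {b} {r} bal with lb , lr ← All.++⁻ (leaves b) l
    with pr , ar ← on-all {P} c (a ℤ.- δ d) r w' s o' lr (subst P (sym (tail-end a (δ d) (∑ δ (row r)))) e)
    with pb , ab ← on-all {P} (flipC c) a b w p o lb (subst P (sym (child-end a d b q)) pr) =
    pb , subst P (sym hd) pb ∷ subst P (sym hd') pr ∷ All.++⁺ ab ar

  on-σ : ∀ c a F → Wf σ α color c F → Balanced c F → On a F → ∀ {p q} → Path σ p (row F) q → h q ≡ a ℤ.- ∑ δ (row F) →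
    h p ≡ a × All (λ d → h (σ d) ≡ h d ℤ.- δ d) (labels F)
  on-σ c a ε w bal o refl e = ≡.trans e (sym (nil-end a)) , []
  on-σ c a (leaf d r) (_ , w) bal (hd , o) (refl , p) e
    with i , l ← on-σ c (a ℤ.- δ d) r w bal o p (≡.trans e (sym (tail-end a (δ d) (∑ δ (row r))))) =
    hd , ≡.trans i (cong (λ z → z ℤ.- δ d) (sym hd)) ∷ l
  on-σ c a (edge d d' b r) ((_ , _ , refl , cy) , w , w') bal ((hd , hd') , o , o') (refl , path) e
    with p , q , s ← balanced-b c {d} {d'} {b} {r} bal
    with ir , lr ← on-σ c (a ℤ.- δ d) r w' s o' path (≡.trans e (sym (tail-end a (δ d) (∑ δ (row r)))))
    with ib , lb ← on-σ (flipC c) a b w p o (chain-path (row b) cy) (≡.trans hd' (sym (child-end a d b q))) =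
    hd , ≡.trans ir (cong (λ z → z ℤ.- δ d) (sym hd)) ∷
      ≡.trans ib (sym (≡.trans (cong₂ ℤ._-_ hd' (δ-anti d)) (back a (δ d)))) ∷ All.++⁺ lb lr

  -- Converse of `on-σ`: the local relations alone give heights along the contour of any tree in the
  -- map. This carries `h` over to the second tree.
  on-intro : ∀ c a F → Wf σ α color c F → All (λ d → h (σ d) ≡ h d ℤ.- δ d) (labels F) →
    All (λ (d , d') → h d' ≡ h d ℤ.- δ d) (edges F) → ∀ {p q} → Path σ p (row F) q → h p ≡ a → On a F
  on-intro c a ε w s t p e = tt
  on-intro c a (leaf d r) (_ , w) (s ∷ ss) t (refl , p) e = e , on-intro c (a ℤ.- δ d) r w ss t p (≡.trans s (cong (λ z → z ℤ.- δ d) e))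
  on-intro c a (edge d d' b r) ((_ , _ , refl , cy) , w , w') (s ∷ s' ∷ ss) (t ∷ ts) (refl , p) e
    with sb , sr ← All.++⁻ (labels b) ss with tb , tr ← All.++⁻ (edges b) ts =
    (e , hd') , on-intro (flipC c) a b w sb tb (chain-path (row b) cy) (≡.trans s' (≡.trans (cong₂ ℤ._-_ hd' (δ-anti d)) (back a (δ d))))
    , on-intro c (a ℤ.- δ d) r w' sr tr p (≡.trans s (cong (λ z → z ℤ.- δ d) e))
    where
    hd' : h d' ≡ a ℤ.- δ d
    hd' = ≡.trans t (cong (λ z → z ℤ.- δ d) e)

  on-edges : ∀ a F → On a F → All (λ (d , d') → h d' ≡ h d ℤ.- δ d) (edges F)
  on-edges a ε o = []
  on-edges a (leaf d r) (_ , o) = on-edges (a ℤ.- δ d) r o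
  on-edges a (edge d d' b r) ((p , q) , o , o') = ≡.trans q (cong (λ z → z ℤ.- δ d) (sym p)) ∷ All.++⁺ (on-edges a b o) (on-edges (a ℤ.- δ d) r o')

  walk-split : ∀ {a b} u {v} → Walk a (u ++ v) b → ∃ λ e → Walk a u e × Walk e v b
  walk-split {a} [] w = a , refl , w
  walk-split (y ∷ u) (p , w) with e , w₁ , w₂ ← walk-split u w = e , (p , w₁) , w₂

  walk-unrot : ∀ {a} x w → Walk a (w ++ [ x ]) a → ∃ λ e → Walk e (x ∷ w) e
  walk-unrot x w p with e , w₁ , (q , r) ← walk-split w p = e , q , subst (λ z → Walk z w e) (sym r) w₁

  walk-head : ∀ {a y w} {Q : ℤ → Set} → y ∈ w → Walk a w a → (∀ {y} → y ∈ w → Q (h y)) → Q a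
  walk-head {w = x ∷ w} {Q} _ (p , _) k = subst Q p (k (here refl))

  module _ {P : D → D → Set} (P-α : ∀ {o z} → P o z → α o ≡ z) (α-invol : ∀ d → α (α d) ≡ d) {us : List D} where

    private
      ins-walk : ∀ {o z w a} → P o z → Walk a (o ∷ z ∷ w) a → Walk a w a × h z ≡ h o ℤ.- δ o × h o ≡ h z ℤ.- δ z
      ins-walk {o} {z} {w} {a} p (e , e' , k) with refl ← P-α p =
        subst (λ b → Walk b w a) b≡ k , ≡.trans e' (cong (λ b → b ℤ.- δ o) (sym e)) , sym (≡.trans (cong (λ b → b ℤ.- δ (α o)) e') (≡.trans b≡ (sym e)))
        where
        b≡ : (a ℤ.- δ o) ℤ.- δ (α o) ≡ a
        b≡ = ≡.trans (cong (λ b → (a ℤ.- δ o) ℤ.- b) (δ-anti o)) (back a (δ o))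

    -- The two steps at an adjacent pair cancel, so deleting the pair leaves a closed walk, while
    -- the pair itself acquires the relation of `h` across its edge. Only stems with `δ = 0` remain,
    -- all at one height. Thus heights integrated along the tree are consistent on the whole map.
    good-heights : ∀ {w} → (∀ {u} → u ∈ us → δ u ≡ 0ℤ) → Good P us w → ∀ {a} → Walk a w a →
      (∃ λ κ → ∀ {u} → u ∈ us → h u ≡ κ) × (∀ {y} → y ∈ w → y ∈ us ⊎ h (α y) ≡ h y ℤ.- δ y)
    good-heights z base {a} k = (a , const us z k) , inj₁
      where
      const : ∀ us {b} → (∀ {u} → u ∈ us → δ u ≡ 0ℤ) → Walk a us b → ∀ {u} → u ∈ us → h u ≡ a
      const (u ∷ us) z (p , k) (here refl) = p
      const (u ∷ us) {b} z (p , k) (there i) = const us (z ∘ there)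
        (subst (λ e → Walk e us b) (≡.trans (cong (λ v → a ℤ.- v) (z (here refl))) (ℤ.+-identityʳ a)) k) i
    good-heights z (ins {o} {c} p g) k with k' , e , e' ← ins-walk p k with κ , f ← good-heights z g k' = κ , λ
      { (here refl) → inj₂ (≡.trans (cong h (P-α p)) e)
      ; (there (here refl)) → inj₂ (≡.trans (cong h (≡.trans (cong α (sym (P-α p))) (α-invol o))) e')
      ; (there (there i)) → f i }
    good-heights z (rot {x} {w} g) k with e , k' ← walk-unrot x w k with κ , f ← good-heights z g k' =
      κ , f ∘ ↭.∈-resp-↭ (↭.++-comm w [ x ])

    -- The corner before `o` has the height at which the word remaining after deletion starts, so
    -- the property is known there by induction; crossing `o` brings it to `c`. The matched pairs
    -- make the faces a tree rooted at those of τ.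
    good-bound : ∀ {w} {Q : ℤ → Set} → Inhabited us → (∀ {u} → u ∈ us → Q (h u)) →
      (∀ {o z} → P o z → o ∈ w → Q (h o) → h z ≡ h o ℤ.- δ o → Q (h z)) → Good P us w → ∀ {a} → Walk a w a → ∀ {y} → y ∈ w → Q (h y)
    good-bound inh b s base k = b
    good-bound {Q = Q} inh b s (ins {o} {c} {w} p g) {a} k with k' , e , e' ← ins-walk p k = λ
      { (here refl) → Qo ; (there (here refl)) → s p (here refl) Qo e ; (there (there i)) → rec i }
      where
      rec : ∀ {y} → y ∈ w → Q (h y)
      rec = good-bound {Q = Q} inh b (λ q i → s q (there (there i))) g (proj₁ (ins-walk p k))
      Qo : Q (h o)
      Qo = subst Q (sym (proj₁ k)) (walk-head {Q = Q} (good-⊇ g (proj₂ inh)) (proj₁ (ins-walk p k)) rec)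
    good-bound {Q = Q} inh b s (rot {x} {w} g) k i = good-bound {Q = Q} inh b (λ q j → s q (↭.∈-resp-↭ (↭.++-comm [ x ] w) j)) g
      (proj₂ (walk-unrot x w k)) (↭.∈-resp-↭ (↭.++-comm w [ x ]) i)

module _ {D : Set} {σ α : D → D} {color : D → Color} (Q : D → Set) where

  private
    Sides : Forest D → Set
    Sides F = All Q (leaves F) × All (λ (d , _) → Q d → ⊥) (edges F) × Unique (labels F)

    sides-b : ∀ {d d' b r} → Sides (edge d d' b r) → Sides b × Sides r × Unique (d' ∷ row b)
    sides-b {d} {d'} {b} {r} (l , _ ∷ e , u) with lb , lr ← All.++⁻ (leaves b) l with eb , er ← All.++⁻ (edges b) e =
      (lb , eb , uniq-++ˡ (labels b) (uniq-tail (uniq-tail u))) , (lr , er , uniq-++ʳ (labels b) (uniq-tail (uniq-tail u))) ,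
      ∷-uniq (λ i → uniq-head (uniq-tail u) (∈.∈-++⁺ˡ (row⊆labels b i)))
        (uniq-++ˡ (row b) (uniq-↭ (↭-sym (rows-labels black b)) (uniq-++ˡ (labels b) (uniq-tail (uniq-tail u)))))

  -- `Q` tells stems from tree edges, and `σ` and `α` dictate the darts, so two forests read from
  -- the same dart unfold alike. Their rows end together because they are the same `σ`-cycle.
  forest-≡ : ∀ c F G → Wf σ α color c F → Wf σ α color c G → Sides F → Sides G → length (row F) ≡ length (row G) →
    ∀ {p q q'} → Path σ p (row F) q → Path σ p (row G) q' → F ≡ G
  forest-≡ c ε ε _ _ _ _ _ _ _ = refl
  forest-≡ c (leaf d r) (leaf e s) (_ , w) (_ , v) (_ ∷ l , k , u) (_ ∷ l' , k' , u') len (refl , p) (refl , p') =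
    cong (leaf d) (forest-≡ c r s w v (l , k , uniq-tail u) (l' , k' , uniq-tail u') (ℕ.suc-injective len) p p')
  forest-≡ c (leaf d r) (edge e _ _ _) _ _ (q ∷ _ , _) (_ , nq ∷ _ , _) len (refl , _) (refl , _) = ⊥-elim (nq q)
  forest-≡ c (edge d _ _ _) (leaf e s) _ _ (_ , nq ∷ _ , _) (q ∷ _ , _) len (refl , _) (refl , _) = ⊥-elim (nq q)
  forest-≡ c (edge d _ b r) (edge e _ b' r') ((_ , _ , refl , cy) , w , w') ((_ , _ , refl , cy') , v , v') sf sg len (refl , p) (refl , p')
    with sb , sr , ub ← sides-b {b = b} {r} sf with sb' , sr' , ub' ← sides-b {b = b'} {r'} sg =
    cong₂ (edge d (α d))
      (forest-≡ (flipC c) b b' w v sb sb' (ℕ.suc-injective (↭.↭-length (cyc-↭ ub ub' cy cy' (here refl) (here refl)))) (chain-path (row b) cy) (chain-path (row b') cy'))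
      (forest-≡ c r r' w' v' sr sr' (ℕ.suc-injective len) p p')

rots-avoid : ∀ c (F : Forest A) → Unique (labels F) → ∀ {r} → r ∈ row F → ∀ {p} → p ∈ rots c F →
  Unique (proj₂ p) × r ∉ proj₂ p × (∀ {d} → d ∈ proj₂ p → d ∈ labels F)
rots-avoid c F u r∈ i = concat-uniq _ u' (there (∈.∈-map⁺ proj₂ i)) ,
  (λ j → uniq-disj (row F) u' r∈ (∈.∈-concat⁺′ j (∈.∈-map⁺ proj₂ i))) ,
  (λ j → ↭.∈-resp-↭ (rows-labels c F) (∈.∈-++⁺ʳ (row F) (∈.∈-concat⁺′ j (∈.∈-map⁺ proj₂ i))))
  where
  u' : Unique (row F ++ concat (map proj₂ (rots c F)))
  u' = uniq-↭ (↭-sym (rows-labels c F)) u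

module _ {m : Map} {c τc : Color} {F : Forest (Fin (Map.n m))} {us : List (Fin (Map.n m))} (S : Structure m c τc F us) where

  open Map m
  open StructureMap S using (uniq-labels; vrow-ok; unmarked; ts; vertices; us⊆labels)
  open Structure S using (rootHd; mark⇐)

  root∈row : root ∈ row F
  root∈row = subst (root ∈_) (sym (proj₂ rootHd)) (here refl)

  rot-cycle : ∀ {p} → p ∈ rots c F → Unique (proj₂ p) × Cyc (Graph σ) (proj₂ p) × root ∉ proj₂ p × (∀ {d} → d ∈ proj₂ p → marked d ≡ false)
  rot-cycle i = let u , r , s = rots-avoid c F uniq-labels root∈row i in u , proj₁ (All.lookup vrow-ok (there i)) , r , unmarked ∘ s

  -- Conservation does not speak of the root vertex. Its balance is what remains: `δ` sums to zero
  -- over all darts, over τ and over each other vertex.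
  root-balance : (δ : Fin n → ℤ) → (∀ {d} → marked d ≡ true → δ d ≡ 0ℤ) → All (λ (_ , l) → ∑ δ l ≡ 0ℤ) (rots c F) → ∑ δ (allFin n) ≡ 0ℤ → ∑ δ (row F) ≡ 0ℤ
  root-balance δ z bal tot = begin
    ∑ δ (row F) ≡⟨ sym (ℤ.+-identityʳ _) ⟩
    ∑ δ (row F) ℤ.+ 0ℤ ≡⟨ cong (λ v → ∑ δ (row F) ℤ.+ v) (sym (rest (rots c F) bal)) ⟩
    ∑ δ (row F) ℤ.+ ∑ δ (concat (map proj₂ (rots c F))) ≡⟨ sym (∑-++ δ (row F) _) ⟩
    ∑ δ (concat (rows c F)) ≡⟨ sym (ℤ.+-identityˡ _) ⟩
    0ℤ ℤ.+ ∑ δ (concat (rows c F)) ≡⟨ cong (ℤ._+ ∑ δ (concat (rows c F))) (sym (≡.trans (∑-cong (reverse ts) (λ i → z (mark⇐ (↭.∈-resp-↭ (↭.↭-reverse ts) i)))) (∑-0 (reverse ts)))) ⟩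
    ∑ δ (reverse ts) ℤ.+ ∑ δ (concat (rows c F)) ≡⟨ sym (∑-++ δ (reverse ts) _) ⟩
    ∑ δ (reverse ts ++ concat (rows c F)) ≡⟨ ∑-↭ δ (Decomp.cover vertices) ⟩
    ∑ δ (allFin n) ≡⟨ tot ⟩
    0ℤ ∎
    where
    open ≡-Reasoning
    rest : ∀ rs → All (λ (_ , l) → ∑ δ l ≡ 0ℤ) rs → ∑ δ (concat (map proj₂ rs)) ≡ 0ℤ
    rest [] [] = refl
    rest ((_ , l) ∷ rs) (e ∷ es) = ≡.trans (∑-++ δ l _) (cong₂ ℤ._+_ e (rest rs es))

module _ {m : Map} {c₁ c₂ τ₁ τ₂ : Color} {F₁ F₂ : Forest (Fin (Map.n m))} {us₁ us₂ : List (Fin (Map.n m))}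
         (S₁ : Structure m c₁ τ₁ F₁ us₁) (S₂ : Structure m c₂ τ₂ F₂ us₂) where

  private
    pb = StructureMap.isPointedBipartite S₁
    module I₁ = StructureFlow S₁ pb
    module I₂ = StructureFlow S₂ pb
    module M₁ = StructureMap S₁
    module M₂ = StructureMap S₂
    module T₁ = Structure S₁
    module T₂ = Structure S₂
    open Flows m pb
    open Flow

    x₁ = I₁.x
    x₂ = I₂.x
    f₁ = I₁.flow
    f₂ = I₂.flow

    δ : Fin n → ℤ
    δ d = x₁ d ℤ.- x₂ d

    δ-anti : ∀ d → δ (α d) ≡ - δ d
    δ-anti d = ≡.trans (cong₂ ℤ._-_ (anti f₁ d) (anti f₂ d)) (lem (x₁ d) (x₂ d))
      where
      lem : ∀ a b → - a ℤ.- - b ≡ - (a ℤ.- b)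
      lem = solve-∀

    δ-τ : ∀ {d} → marked d ≡ true → δ d ≡ 0ℤ
    δ-τ {d} e = ≡.trans (cong₂ ℤ._-_ (sat-τ f₁ e) (sat-τ f₂ e)) (ℤ.+-inverseʳ (cap (color d)))

    δ-τ' : ∀ {d} → marked (α d) ≡ true → δ d ≡ 0ℤ
    δ-τ' {d} e = ≡.trans (sym (ℤ.neg-involutive (δ d))) (cong (-_) (≡.trans (sym (δ-anti d)) (δ-τ e)))

    δ-cycle : ∀ {l} → Unique l → Cyc (Graph σ) l → root ∉ l → (∀ {d} → d ∈ l → marked d ≡ false) → ∑ δ l ≡ 0ℤ
    δ-cycle {l} u cy r un = begin
      ∑ δ l ≡⟨ ∑-cong l (λ {d} _ → lem (x₁ d) (x₂ d)) ⟩
      ∑ (λ d → (x₁ d ℤ.+ 1ℤ) ℤ.+ - (x₂ d ℤ.+ 1ℤ)) l ≡⟨ ∑-+ _ _ l ⟩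
      ∑ (λ d → x₁ d ℤ.+ 1ℤ) l ℤ.+ ∑ (λ d → - (x₂ d ℤ.+ 1ℤ)) l ≡⟨ cong₂ ℤ._+_ (cycle-demand {x₁} (conserve f₁) u cy r un)
           (≡.trans (∑-neg (λ d → x₂ d ℤ.+ 1ℤ) l) (cong (-_) (cycle-demand {x₂} (conserve f₂) u cy r un))) ⟩
      0ℤ ∎
      where
      open ≡-Reasoning
      lem : ∀ a b → a ℤ.- b ≡ (a ℤ.+ 1ℤ) ℤ.+ - (b ℤ.+ 1ℤ)
      lem = solve-∀

    bal₁ : All (λ (_ , l) → ∑ δ l ≡ 0ℤ) (rots c₁ F₁)
    bal₁ = All.tabulate (λ i → let u , cy , r , un = rot-cycle S₁ i in δ-cycle u cy r un)
    bal₂ : All (λ (_ , l) → ∑ δ l ≡ 0ℤ) (rots c₂ F₂)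
    bal₂ = All.tabulate (λ i → let u , cy , r , un = rot-cycle S₂ i in δ-cycle u cy r un)

    δ-total : ∑ δ allDarts ≡ 0ℤ
    δ-total = self-neg _ (≡.trans (sym (∑-α δ)) (≡.trans (∑-cong allDarts (λ {d} _ → δ-anti d)) (∑-neg δ allDarts)))

    root₁ : ∑ δ (row F₁) ≡ 0ℤ
    root₁ = root-balance S₁ δ δ-τ bal₁ δ-total
    root₂ : ∑ δ (row F₂) ≡ 0ℤ
    root₂ = root-balance S₂ δ δ-τ bal₂ δ-total

    -- Integrates `δ` along the contour of the first tree, from height 0 at the root corner.
    hvals : ℤ → Forest (Fin n) → List (Fin n × ℤ)
    hvals a ε = []
    hvals a (leaf d r) = (d , a) ∷ hvals (a ℤ.- δ d) r
    hvals a (edge d d' b r) = (d , a) ∷ (d' , a ℤ.- δ d) ∷ hvals a b ++ hvals (a ℤ.- δ d) r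

    hkeys : ∀ a F → map proj₁ (hvals a F) ≡ labels F
    hkeys a ε = refl
    hkeys a (leaf d r) = cong (d ∷_) (hkeys (a ℤ.- δ d) r)
    hkeys a (edge d d' b r) = cong (λ z → d ∷ d' ∷ z) (≡.trans (List.map-++ proj₁ (hvals a b) _) (cong₂ _++_ (hkeys a b) (hkeys (a ℤ.- δ d) r)))

    h : Fin n → ℤ
    h = find 0ℤ (hvals 0ℤ F₁)

    open Heights σ α color δ h δ-anti

    on-find : ∀ a F → (∀ {k v} → (k , v) ∈ hvals a F → h k ≡ v) → On a F
    on-find a ε k = tt
    on-find a (leaf d r) k = k (here refl) , on-find (a ℤ.- δ d) r (k ∘ there)
    on-find a (edge d d' b r) k = (k (here refl) , k (there (here refl))) , on-find a b (λ i → k (there (there (∈.∈-++⁺ˡ i)))) ,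
      on-find (a ℤ.- δ d) r (λ i → k (there (there (∈.∈-++⁺ʳ (hvals a b) i))))

    on₁ : On 0ℤ F₁
    on₁ = on-find 0ℤ F₁ (find-∈ 0ℤ (hvals 0ℤ F₁) (subst Unique (sym (hkeys 0ℤ F₁)) M₁.uniq-labels))

    close : ∀ a F → ∑ δ (row F) ≡ 0ℤ → a ℤ.- ∑ δ (row F) ≡ a
    close a F e = ≡.trans (cong (λ z → a ℤ.- z) e) (ℤ.+-identityʳ a)

    root-path : ∀ {F : Forest (Fin n)} → (∃ λ l → row F ≡ root ∷ l) → Cyc (Graph σ) (row F) → Path σ root (row F) root
    root-path (l , e) cy = cyc-path e cy

    h-root : h root ≡ 0ℤ
    h-root = start F₁ (proj₂ T₁.rootHd) on₁
      where
      start : ∀ F {l a} → row F ≡ root ∷ l → On a F → h root ≡ a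
      start (leaf d r) refl (p , _) = p
      start (edge d d' b r) refl ((p , _) , _) = p

    h-σ : ∀ {d} → d ∈ labels F₁ → h (σ d) ≡ h d ℤ.- δ d
    h-σ = All.lookup (proj₂ (on-σ c₁ 0ℤ F₁ T₁.wf bal₁ on₁ (root-path T₁.rootHd T₁.rootRow) (≡.trans h-root (sym (close 0ℤ F₁ root₁)))))

    walk₁ : Walk 0ℤ (leaves F₁) 0ℤ
    walk₁ = subst (Walk 0ℤ (leaves F₁)) (close 0ℤ F₁ root₁) (on-walk c₁ 0ℤ F₁ T₁.wf bal₁ on₁)

    same-labels : ∀ {d} → d ∈ labels F₂ → d ∈ labels F₁
    same-labels {d} i with M₁.where-dart d
    ... | inj₁ j = j
    ... | inj₂ j = ⊥-elim (case ≡.trans (sym (M₂.unmarked i)) (T₁.mark⇐ j) of λ ())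

    us-marked : ∀ {u} → u ∈ us₁ → marked (α u) ≡ true
    us-marked i = T₁.mark⇐ (∈.∈-map⁺ α i)

    us₂⊆us₁ : ∀ {u} → u ∈ us₂ → u ∈ us₁
    us₂⊆us₁ {u} i with v , j , e ← ∈.∈-map⁻ α (T₁.mark⇒ (T₂.mark⇐ (∈.∈-map⁺ α i))) =
      subst (_∈ us₁) (≡.trans (sym (α-invol v)) (≡.trans (cong α (sym e)) (α-invol u))) j

    heights = good-heights (λ (_ , _ , e) → e) α-invol (λ {u} i → δ-τ' {u} (us-marked i)) T₁.good walk₁
    κ = proj₁ (proj₁ heights)

    h-α : ∀ {d} → d ∈ labels F₁ → marked (α d) ≡ false → h (α d) ≡ h d ℤ.- δ d
    h-α {d} i un = go (∈.∈-++⁻ (sides (edges F₁)) (↭.∈-resp-↭ (↭-sym (sides-leaves F₁)) i))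
      where
      lem : ∀ a b → a ≡ (a ℤ.- b) ℤ.- - b
      lem = solve-∀
      flip-eq : ∀ {y} → α y ≡ d → h d ≡ h y ℤ.- δ y → h (α d) ≡ h d ℤ.- δ d
      flip-eq {y} refl e = ≡.trans (cong h (α-invol y)) (≡.trans (lem (h y) (δ y)) (sym (cong₂ ℤ._-_ e (δ-anti y))))
      leaf-case : d ∈ us₁ ⊎ h (α d) ≡ h d ℤ.- δ d → h (α d) ≡ h d ℤ.- δ d
      leaf-case (inj₁ k) = ⊥-elim (case ≡.trans (sym un) (us-marked k) of λ ())
      leaf-case (inj₂ e) = e
      side-case : (∃ λ y → (d , y) ∈ edges F₁ ⊎ (y , d) ∈ edges F₁) → h (α d) ≡ h d ℤ.- δ d
      side-case (y , inj₁ k) = ≡.trans (cong h (proj₁ (M₁.edge-colors k))) (All.lookup (on-edges 0ℤ F₁ on₁) k)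
      side-case (y , inj₂ k) = flip-eq (proj₁ (M₁.edge-colors k)) (All.lookup (on-edges 0ℤ F₁ on₁) k)
      go : d ∈ sides (edges F₁) ⊎ d ∈ leaves F₁ → h (α d) ≡ h d ℤ.- δ d
      go (inj₁ j) = side-case (sides-∈ (edges F₁) j)
      go (inj₂ j) = leaf-case (proj₂ heights j)

    -- The relations for `h` hold at every dart and every edge away from τ, whatever tree they were
    -- derived from.
    on₂ : On 0ℤ F₂
    on₂ = on-intro c₂ 0ℤ F₂ T₂.wf (All.tabulate (h-σ ∘ same-labels))
      (All.tabulate (λ {(d , d')} i → let e = proj₁ (M₂.edge-colors i)
                                          d∈ , d'∈ = ∈-sides i
                                          lab = λ {z} (k : z ∈ sides (edges F₂)) → ↭.∈-resp-↭ (sides-leaves F₂) (∈.∈-++⁺ˡ k)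
         in ≡.trans (cong h (sym e)) (h-α (same-labels (lab d∈)) (≡.trans (cong marked e) (M₂.unmarked (lab d'∈))))))
      (root-path T₂.rootHd T₂.rootRow) h-root

    walk₂ : Walk 0ℤ (leaves F₂) 0ℤ
    walk₂ = subst (Walk 0ℤ (leaves F₂)) (close 0ℤ F₂ root₂) (on-walk c₂ 0ℤ F₂ T₂.wf bal₂ on₂)

    bound-all : ∀ {Q : ℤ → Set} {c F us} → Wf σ α color c F → Balanced c F → On 0ℤ F → ∑ δ (row F) ≡ 0ℤ →
      Walk 0ℤ (leaves F) 0ℤ → Inhabited us → (∀ {u} → u ∈ us → u ∈ leaves F) → (∀ {y} → y ∈ leaves F → Q (h y)) → All (Q ∘ h) (labels F)
    bound-all {Q} {c} {F} w bal o r wk inh sub q = proj₂ (on-all {Q} c 0ℤ F w bal o (All.tabulate q)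
      (subst Q (sym (close 0ℤ F r)) (walk-head {Q = Q} (sub (proj₂ inh)) wk q)))

    sub-≤ : ∀ a {v} → 0ℤ ℤ.≤ v → a ℤ.- v ℤ.≤ a
    sub-≤ a {v} p = ℤ.≤-trans (ℤ.+-monoʳ-≤ a (ℤ.neg-mono-≤ p)) (ℤ.≤-reflexive (ℤ.+-identityʳ a))

    ≤-sub : ∀ a {v} → v ℤ.≤ 0ℤ → a ℤ.≤ a ℤ.- v
    ≤-sub a {v} p = ℤ.≤-trans (ℤ.≤-reflexive (sym (ℤ.+-identityʳ a))) (ℤ.+-monoʳ-≤ a (ℤ.neg-mono-≤ p))

    black-≤ : ∀ {x o} → Flow x → color o ≡ black → x o ℤ.≤ N
    black-≤ {x} {o} f p = subst (λ c → Within c (x o)) p (within f o)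

    -- An opening stem `o` of the first tree sits at a black vertex and carries `N`, so
    -- `δ o = N - x₂ o` is nonnegative. For `lower` the roles of the two flows are exchanged.
    upper : All (λ d → h d ℤ.≤ κ) (labels F₁)
    upper = bound-all {ℤ._≤ κ} T₁.wf bal₁ on₁ root₁ walk₁ T₁.us-inh M₁.us⊆leaves
      (good-bound (λ (_ , _ , e) → e) α-invol {Q = ℤ._≤ κ} T₁.us-inh (λ i → ℤ.≤-reflexive (proj₂ (proj₁ heights) i))
        (λ {o} (p , _ , _) i le e → ℤ.≤-trans (ℤ.≤-reflexive e) (ℤ.≤-trans (sub-≤ (h o)
          (ℤ.i≤j⇒0≤j-i (ℤ.≤-trans (black-≤ f₂ p) (ℤ.≤-reflexive (sym (≡.trans (I₁.x-leaf i) (cong cap p))))))) le)) T₁.good walk₁)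

    lower : All (λ d → κ ℤ.≤ h d) (labels F₂)
    lower = bound-all {κ ℤ.≤_} T₂.wf bal₂ on₂ root₂ walk₂ T₂.us-inh M₂.us⊆leaves
      (good-bound (λ (_ , _ , e) → e) α-invol {Q = κ ℤ.≤_} T₂.us-inh (λ i → ℤ.≤-reflexive (sym (proj₂ (proj₁ heights) (us₂⊆us₁ i))))
        (λ {o} (p , _ , _) i le e → ℤ.≤-trans le (ℤ.≤-trans (≤-sub (h o)
          (ℤ.i≤j⇒i-j≤0 (ℤ.≤-trans (black-≤ f₁ p) (ℤ.≤-reflexive (sym (≡.trans (I₂.x-leaf i) (cong cap p))))))) (ℤ.≤-reflexive (sym e)))) T₂.good walk₂)

    same-labels' : ∀ {d} → d ∈ labels F₁ → d ∈ labels F₂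
    same-labels' {d} i with M₂.where-dart d
    ... | inj₁ j = j
    ... | inj₂ j = ⊥-elim (case ≡.trans (sym (M₁.unmarked i)) (T₂.mark⇐ j) of λ ())

    h≡κ : ∀ {d} → d ∈ labels F₁ → h d ≡ κ
    h≡κ i = ℤ.≤-antisym (All.lookup upper i) (All.lookup lower (same-labels' i))

    x-eq : ∀ {d} → d ∈ labels F₁ → x₁ d ≡ x₂ d
    x-eq {d} i = ℤ.i-j≡0⇒i≡j (x₁ d) (x₂ d) (go (marked (α d)) refl)
      where
      lem : ∀ a b → b ≡ a ℤ.- (a ℤ.- b)
      lem = solve-∀
      go : ∀ b → marked (α d) ≡ b → δ d ≡ 0ℤ
      go true e = δ-τ' e
      go false e = ≡.trans (lem (h d) (δ d)) (≡.trans (cong (λ z → h d ℤ.- z) (sym (h-α i e)))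
        (≡.trans (cong₂ ℤ._-_ (h≡κ i) (h≡κ αd∈)) (ℤ.+-inverseʳ κ)))
        where
        αd∈ : α d ∈ labels F₁
        αd∈ with M₁.where-dart (α d)
        ... | inj₁ j = j
        ... | inj₂ j = ⊥-elim (case ≡.trans (sym e) (T₁.mark⇐ j) of λ ())

    Sat : Fin n → Set
    Sat d = x₁ d ≡ cap (color d)

  structure-unique : c₁ ≡ c₂ × F₁ ≡ F₂
  structure-unique with refl ← ≡.trans (sym M₁.root-color) M₂.root-color = refl ,
    forest-≡ Sat c₁ F₁ F₂ T₁.wf T₂.wf
      (All.tabulate I₁.x-leaf , All.map (λ {(d , _)} (_ , s) e → slack-≢ (color d) (subst (Slack (color d)) e s)) I₁.tree-edges , M₁.uniq-labels)
      (All.tabulate (λ i → ≡.trans (x-eq (same-labels (leaves⊆labels F₂ i))) (I₂.x-leaf i)) ,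
        All.tabulate (λ {(d , _)} i e → slack-≢ (color d) (subst (Slack (color d))
          (≡.trans (sym (x-eq (same-labels (↭.∈-resp-↭ (sides-leaves F₂) (∈.∈-++⁺ˡ (proj₁ (∈-sides i))))))) e) (proj₂ (All.lookup I₂.tree-edges i)))) , M₂.uniq-labels)
      (↭.↭-length (cyc-↭ (uniq-row M₁.uniq-labels) (uniq-row M₂.uniq-labels) T₁.rootRow T₂.rootRow (root∈row S₁) (root∈row S₂)))
      (root-path T₁.rootHd T₁.rootRow) (root-path T₂.rootHd T₂.rootRow)
    where
    uniq-row : ∀ {F : Forest (Fin n)} → Unique (labels F) → Unique (row F)
    uniq-row {F} u = uniq-++ˡ (row F) (uniq-↭ (↭-sym (rows-labels black F)) u)

-- Existence of a flow by augmentation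

sgn : Color → ℤ
sgn black = 1ℤ
sgn white = ℤ.-1ℤ

sgn-flip : ∀ c → sgn (flipC c) ≡ - sgn c
sgn-flip black = refl
sgn-flip white = refl

-- The sign of a nonzero excess, named by the colour whose `sgn` moves it towards zero.
Neg : Color → ℤ → Set
Neg black z = z ℤ.< 0ℤ
Neg white z = 0ℤ ℤ.< z

neg? : ∀ c z → Dec (Neg c z)
neg? black z = z ℤ.<? 0ℤ
neg? white z = 0ℤ ℤ.<? z

neg-shrink : ∀ c z → Neg c z → ℤ.∣ z ℤ.+ sgn c ∣ < ℤ.∣ z ∣
neg-shrink black (ℤ.-[1+ zero ]) p = s≤s z≤n
neg-shrink black (ℤ.-[1+ suc k ]) p = ℕ.≤-refl
neg-shrink black (+ k) (ℤ.+<+ ())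
neg-shrink white (+ zero) (ℤ.+<+ ())
neg-shrink white (+ suc k) p = ℕ.≤-refl
neg-shrink white (ℤ.-[1+ k ]) ()

not-true : ∀ {b} → (b ≡ true → ⊥) → b ≡ false
not-true {true} h = ⊥-elim (h refl)
not-true {false} h = refl

no-exit : ∀ {a b} → a ∧ not b ≡ false → a ≡ true → b ≡ true
no-exit {true} {true} e p = refl

trichotomy : ∀ z → z ≡ 0ℤ ⊎ ∃ λ c → Neg c z
trichotomy (+ zero) = inj₁ refl
trichotomy (+ suc k) = inj₂ (white , ℤ.+<+ (s≤s z≤n))
trichotomy (ℤ.-[1+ k ]) = inj₂ (black , ℤ.-<+)

neg-sgn : ∀ c {z} → Neg c z → sgn c ℤ.* z ℤ.< 0ℤ
neg-sgn black {z} p = subst (ℤ._< 0ℤ) (sym (ℤ.*-identityˡ z)) p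
neg-sgn white {z} p = subst (ℤ._< 0ℤ) (sym (ℤ.-1*i≡-i z)) (ℤ.neg-mono-< p)

non-neg-sgn : ∀ c {z} → (Neg (flipC c) z → ⊥) → sgn c ℤ.* z ℤ.≤ 0ℤ
non-neg-sgn black {z} p = subst (ℤ._≤ 0ℤ) (sym (ℤ.*-identityˡ z)) (ℤ.≮⇒≥ p)
non-neg-sgn white {z} p = subst (ℤ._≤ 0ℤ) (sym (ℤ.-1*i≡-i z)) (ℤ.neg-mono-≤ (ℤ.≮⇒≥ p))

sumOf : (A → ℕ) → List A → ℕ
sumOf f [] = 0
sumOf f (x ∷ l) = f x + sumOf f l

sumOf-≤ : {f g : A → ℕ} → (∀ x → f x ≤ g x) → ∀ l → sumOf f l ≤ sumOf g l
sumOf-≤ h [] = z≤n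
sumOf-≤ h (x ∷ l) = ℕ.+-mono-≤ (h x) (sumOf-≤ h l)

sumOf-< : {f g : A → ℕ} → (∀ x → f x ≤ g x) → ∀ {u} l → u ∈ l → f u < g u → sumOf f l < sumOf g l
sumOf-< h (x ∷ l) (here refl) lt = ℕ.+-mono-<-≤ lt (sumOf-≤ h l)
sumOf-< h (x ∷ l) (there i) lt = ℕ.+-mono-≤-< (h x) (sumOf-< h l i lt)

search : {P : A → Set} → (∀ x → Dec (P x)) → ∀ l → (∃ λ x → x ∈ l × P x) ⊎ (∀ {x} → x ∈ l → P x → ⊥)
search d [] = inj₂ (λ ())
search d (x ∷ l) with d x | search d l
... | yes p | _ = inj₁ (x , here refl , p)
... | no p | inj₁ (y , i , q) = inj₁ (y , there i , q)
... | no p | inj₂ f = inj₂ (λ { (here refl) → p ; (there i) → f i })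

ι : ∀ {n} → Fin n → Fin n → ℤ
ι a b = bit (does (a Fin.≟ b))

ι-refl : ∀ {n} (a : Fin n) → ι a a ≡ 1ℤ
ι-refl a = cong bit (does-yes (a Fin.≟ a) refl)

ι-≢ : ∀ {n} {a b : Fin n} → a ≢ b → ι a b ≡ 0ℤ
ι-≢ {a = a} {b} ne = cong bit (does-no (a Fin.≟ b) ne)

∑-ι : ∀ {n} (a : Fin n) (g : Fin n → ℤ) → ∑ (λ b → ι a b ℤ.* g b) (allFin n) ≡ g a
∑-ι {n} a g with r , p ← ∈-↭ (∈.∈-allFin {n} a) = begin
  ∑ h (allFin n) ≡⟨ ∑-↭ h p ⟩
  h a ℤ.+ ∑ h r ≡⟨ cong₂ ℤ._+_ (≡.trans (cong (ℤ._* g a) (ι-refl a)) (ℤ.*-identityˡ (g a)))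
      (≡.trans (∑-cong r (λ {b} i → ≡.trans (cong (ℤ._* g b) (ι-≢ {a = a} {b} (λ { refl → uniq-head (uniq-↭ p (Unique.allFin⁺ n)) i }))) (ℤ.*-zeroˡ (g b)))) (∑-0 r)) ⟩
  g a ℤ.+ 0ℤ ≡⟨ ℤ.+-identityʳ (g a) ⟩
  g a ∎
  where
  open ≡-Reasoning
  h = λ b → ι a b ℤ.* g b

module Augment (m : Map) (pb : IsPointedBipartiteMap m) {L : List (List (Fin (Map.n m)))} (vd : Decomp (Map.σ m) L) where

  open Flows m pb

  module V = Decomp vd

  private
    headOr : Fin n → List (Fin n) → Fin n
    headOr d [] = d
    headOr d (x ∷ _) = x

    headOr-∈ : ∀ {d e} l → e ∈ l → headOr d l ∈ l
    headOr-∈ (x ∷ l) _ = here refl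

    headOr-≡ : ∀ {d d' e} l → e ∈ l → headOr d l ≡ headOr d' l
    headOr-≡ (x ∷ l) _ = refl

  -- A vertex is represented by one of its darts.
  vtx : Fin n → Fin n
  vtx d = headOr d (proj₁ (V.cycleOf d))

  vtx-σ : ∀ d → vtx (σ d) ≡ vtx d
  vtx-σ d = let c , i , q = V.cycleOf d
                c' , i' , q' = V.cycleOf (σ d)
            in go q q' i i'
    where
    go : ∀ {c c'} → c ∈ L → c' ∈ L → d ∈ c → σ d ∈ c' → headOr (σ d) c' ≡ headOr d c
    go {c} q q' i i' with y , refl , j ← cyc-next c (V.cyc q) i with refl ← concat-disj L V.uniq q q' j i' = headOr-≡ c i

  at-vtx : ∀ {P : Fin n → Set} → (∀ d → P d → P (σ d)) → ∀ {d} → P d → P (vtx d)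
  at-vtx {P} h {d} p = let c , i , q = V.cycleOf d in All.lookup (cyc-closed {P = P} (λ { {x} refl → h x }) c (V.cyc q) i p) (headOr-∈ c i)

  const-vtx : ∀ {B : Fin n → Bool} → (∀ d → B (σ d) ≡ B d) → ∀ d → B (vtx d) ≡ B d
  const-vtx {B} h d = at-vtx {λ e → B e ≡ B d} (λ e p → ≡.trans (h e) p) refl

  -- Excess at the vertex represented by `v`. It vanishes at darts that represent no vertex, so sums
  -- over vertices can run over all darts.
  ex : (Fin n → ℤ) → Fin n → ℤ
  ex x v = ∑ (λ d → ι (vtx d) v ℤ.* (x d ℤ.+ 1ℤ)) allDarts

  demand-ex : ∀ x (B : Fin n → Bool) → demand x (B ∘ vtx) ≡ ∑ (λ v → bit (B v) ℤ.* ex x v) allDarts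
  demand-ex x B = begin
    ∑ (λ d → bit (B (vtx d)) ℤ.* (x d ℤ.+ 1ℤ)) allDarts ≡⟨ ∑-cong allDarts (λ {d} _ → sym (∑-ι (vtx d) (λ v → bit (B v) ℤ.* (x d ℤ.+ 1ℤ)))) ⟩
    ∑ (λ d → ∑ (λ v → ι (vtx d) v ℤ.* (bit (B v) ℤ.* (x d ℤ.+ 1ℤ))) allDarts) allDarts ≡⟨ ∑-swap _ allDarts allDarts ⟩
    ∑ (λ v → ∑ (λ d → ι (vtx d) v ℤ.* (bit (B v) ℤ.* (x d ℤ.+ 1ℤ))) allDarts) allDarts
      ≡⟨ ∑-cong allDarts (λ {v} _ → ≡.trans (∑-cong allDarts (λ {d} _ → lem (ι (vtx d) v) (bit (B v)) (x d ℤ.+ 1ℤ))) (∑-* (bit (B v)) _ allDarts)) ⟩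
    ∑ (λ v → bit (B v) ℤ.* ex x v) allDarts ∎
    where
    open ≡-Reasoning
    lem : ∀ a b c → a ℤ.* (b ℤ.* c) ≡ b ℤ.* (a ℤ.* c)
    lem = solve-∀

  shift : ℤ → Fin n → (Fin n → ℤ) → Fin n → ℤ
  shift s d x e = x e ℤ.+ s ℤ.* (ι d e ℤ.- ι (α d) e)

  ex-shift : ∀ s d x v → ex (shift s d x) v ≡ ex x v ℤ.+ s ℤ.* (ι (vtx d) v ℤ.- ι (vtx (α d)) v)
  ex-shift s d x v = begin
    ex (shift s d x) v ≡⟨ ∑-cong allDarts (λ {e} _ → lem (ι (vtx e) v) (x e) s (ι d e) (ι (α d) e)) ⟩
    ∑ (λ e → ι (vtx e) v ℤ.* (x e ℤ.+ 1ℤ) ℤ.+ (s ℤ.* (ι d e ℤ.* ι (vtx e) v) ℤ.+ - s ℤ.* (ι (α d) e ℤ.* ι (vtx e) v))) allDarts ≡⟨ ∑-+ _ _ allDarts ⟩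
    ex x v ℤ.+ ∑ (λ e → s ℤ.* (ι d e ℤ.* ι (vtx e) v) ℤ.+ - s ℤ.* (ι (α d) e ℤ.* ι (vtx e) v)) allDarts ≡⟨ cong (λ z → ex x v ℤ.+ z) (∑-+ _ _ allDarts) ⟩
    ex x v ℤ.+ (∑ (λ e → s ℤ.* (ι d e ℤ.* ι (vtx e) v)) allDarts ℤ.+ ∑ (λ e → - s ℤ.* (ι (α d) e ℤ.* ι (vtx e) v)) allDarts)
      ≡⟨ cong (λ z → ex x v ℤ.+ z) (cong₂ ℤ._+_ (≡.trans (∑-* s _ allDarts) (cong (λ z → s ℤ.* z) (∑-ι d (λ e → ι (vtx e) v))))
           (≡.trans (∑-* (- s) _ allDarts) (cong (λ z → - s ℤ.* z) (∑-ι (α d) (λ e → ι (vtx e) v))))) ⟩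
    ex x v ℤ.+ (s ℤ.* ι (vtx d) v ℤ.+ - s ℤ.* ι (vtx (α d)) v) ≡⟨ cong (λ z → ex x v ℤ.+ z) (lem' s (ι (vtx d) v) (ι (vtx (α d)) v)) ⟩
    ex x v ℤ.+ s ℤ.* (ι (vtx d) v ℤ.- ι (vtx (α d)) v) ∎
    where
    open ≡-Reasoning
    lem : ∀ a x s p q → a ℤ.* ((x ℤ.+ s ℤ.* (p ℤ.- q)) ℤ.+ 1ℤ) ≡ a ℤ.* (x ℤ.+ 1ℤ) ℤ.+ (s ℤ.* (p ℤ.* a) ℤ.+ - s ℤ.* (q ℤ.* a))
    lem = solve-∀
    lem' : ∀ s p q → s ℤ.* p ℤ.+ - s ℤ.* q ≡ s ℤ.* (p ℤ.- q)
    lem' = solve-∀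

  α-inj : ∀ {a b} → α a ≡ α b → a ≡ b
  α-inj {a} {b} e = ≡.trans (sym (α-invol a)) (≡.trans (cong α e) (α-invol b))

  ι-α : ∀ a b → ι a (α b) ≡ ι (α a) b
  ι-α a b with a Fin.≟ α b
  ... | yes refl = sym (≡.trans (cong (λ z → ι z b) (α-invol b)) (ι-refl b))
  ... | no ne = sym (ι-≢ (λ e → ne (≡.trans (sym (α-invol a)) (cong α e))))

  Ok : ℤ → (Fin n → ℤ) → Fin n → Set
  Ok s x d = Within (color d) (x d ℤ.+ s)

  within? : ∀ c v → Dec (Within c v)
  within? black v = v ℤ.≤? N
  within? white v = - N ℤ.≤? v

  -- A change by `sgn e` meets a bound only at a dart of colour `e`, since the other colour is
  -- unbounded in that direction.
  blocked : ∀ e c v → Within c v → (Within c (v ℤ.+ sgn e) → ⊥) → c ≡ e × v ≡ cap e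
  blocked black black v w n' = refl , ℤ.≤-antisym w (ℤ.≮⇒≥ (λ lt → n' (ℤ.≤-trans (ℤ.≤-reflexive (ℤ.+-comm v 1ℤ)) (ℤ.i<j⇒suc[i]≤j lt))))
  blocked white white v w n' = refl , ℤ.≤-antisym (ℤ.≮⇒≥ (λ lt → n' (ℤ.≤-trans (ℤ.i<j⇒i≤pred[j] lt) (ℤ.≤-reflexive (ℤ.+-comm ℤ.-1ℤ v))))) w
  blocked black white v w n' = ⊥-elim (n' (ℤ.≤-trans w (ℤ.i≤i+j v 1ℤ)))
  blocked white black v w n' = ⊥-elim (n' (ℤ.≤-trans (ℤ.i-j≤i v 1ℤ) w))

  shift-preflow : ∀ {s d x} → Preflow x → marked d ≡ false → marked (α d) ≡ false → Ok s x d → Preflow (shift s d x)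
  shift-preflow {s} {d} {x} F u u' ok = record { anti = an ; within = wi ; sat-τ = sat }
    where
    open Preflow F
    d≢αd : d ≢ α d
    d≢αd e = α-fixfree d (sym e)
    an : Anti (shift s d x)
    an e = ≡.trans (cong₂ (λ a b → a ℤ.+ s ℤ.* b) (anti e) (cong₂ ℤ._-_ (ι-α d e) (≡.trans (ι-α (α d) e) (cong (λ z → ι z e) (α-invol d)))))
      (lem (x e) s (ι (α d) e) (ι d e))
      where
      lem : ∀ x s p q → - x ℤ.+ s ℤ.* (p ℤ.- q) ≡ - (x ℤ.+ s ℤ.* (q ℤ.- p))
      lem = solve-∀
    at-d : shift s d x d ≡ x d ℤ.+ s
    at-d = ≡.trans (cong₂ (λ a b → x d ℤ.+ s ℤ.* (a ℤ.- b)) (ι-refl d) (ι-≢ (d≢αd ∘ sym))) (lem (x d) s)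
      where
      lem : ∀ x s → x ℤ.+ s ℤ.* (1ℤ ℤ.- 0ℤ) ≡ x ℤ.+ s
      lem = solve-∀
    elsewhere : ∀ {e} → d ≢ e → α d ≢ e → shift s d x e ≡ x e
    elsewhere {e} p q = ≡.trans (cong₂ (λ a b → x e ℤ.+ s ℤ.* (a ℤ.- b)) (ι-≢ p) (ι-≢ q)) (lem (x e) s)
      where
      lem : ∀ x s → x ℤ.+ s ℤ.* (0ℤ ℤ.- 0ℤ) ≡ x
      lem = solve-∀
    wi : ∀ e → Within (color e) (shift s d x e)
    wi e = go (d Fin.≟ e) (α d Fin.≟ e)
      where
      go : Dec (d ≡ e) → Dec (α d ≡ e) → Within (color e) (shift s d x e)
      go (yes refl) _ = subst (Within (color d)) (sym at-d) ok
      go (no _) (yes refl) = ≡.subst₂ Within (sym (color-α d)) (sym (≡.trans (an d) (cong (-_) at-d))) (within-neg (color d) ok)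
      go (no p) (no q) = subst (Within (color e)) (sym (elsewhere p q)) (within e)
    sat : ∀ {e} → marked e ≡ true → shift s d x e ≡ cap (color e)
    sat {e} me = ≡.trans (elsewhere (λ { refl → case ≡.trans (sym u) me of λ () }) (λ { refl → case ≡.trans (sym u') me of λ () })) (sat-τ me)

  -- `Push s u x A y`: one unit can be sent from u to y (in the direction s) through vertices of A.
  record Push (s : ℤ) (u : Fin n) (x : Fin n → ℤ) (B : Fin n → Bool) (y : Fin n) : Set where
    field
      x' : Fin n → ℤ
      pre : Preflow x'
      -- Edges not inside `B` keep their values, so an edge with room under `x` still has room after
      -- the push; this is what lets `extend` add a vertex.
      support : ∀ d → B (vtx d) ≡ false ⊎ B (vtx (α d)) ≡ false → x' d ≡ x d
      excess : ∀ v → ex x' v ≡ ex x v ℤ.+ s ℤ.* (ι u v ℤ.- ι y v)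

  record Reached (s : ℤ) (u : Fin n) (x : Fin n → ℤ) (B : Fin n → Bool) : Set where
    field
      start : B u ≡ true
      push : ∀ {y} → B y ≡ true → Push s u x B y
      unmarked : ∀ {y} → B y ≡ true → marked y ≡ false

  Grow : ℤ → (Fin n → ℤ) → (Fin n → Bool) → Fin n → Set
  Grow s x B d = B (vtx d) ≡ true × B (vtx (α d)) ≡ false × marked (α d) ≡ false × Ok s x d

  grow? : ∀ s x B d → Dec (Grow s x B d)
  grow? s x B d = (B (vtx d) Bool.≟ true) ×-dec (B (vtx (α d)) Bool.≟ false) ×-dec (marked (α d) Bool.≟ false) ×-dec within? (color d) (x d ℤ.+ s)

  marked-vtx : ∀ d → marked (vtx d) ≡ marked d
  marked-vtx = const-vtx marked-σ

  _∪_ : (Fin n → Bool) → Fin n → Fin n → Bool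
  (B ∪ y) z = B z ∨ does (y Fin.≟ z)

  ∪-old : ∀ B y {z} → B z ≡ true → (B ∪ y) z ≡ true
  ∪-old B y {z} e = cong (_∨ does (y Fin.≟ z)) e

  ∪-new : ∀ B y → (B ∪ y) y ≡ true
  ∪-new B y rewrite does-yes (y Fin.≟ y) refl with B y
  ... | true = refl
  ... | false = refl

  ∪-cases : ∀ B y {z} → (B ∪ y) z ≡ true → B z ≡ true ⊎ y ≡ z
  ∪-cases B y {z} e with B z | y Fin.≟ z
  ... | true | _ = inj₁ refl
  ... | false | yes p = inj₂ p
  ... | false | no _ with () ← e

  ∪-false : ∀ B y {z} → (B ∪ y) z ≡ false → B z ≡ false × y ≢ z
  ∪-false B y {z} e with B z | y Fin.≟ z
  ... | true | _ with () ← e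
  ∪-false B y e | false | no p = refl , p

  extend : ∀ {s u x B} → Preflow x → Reached s u x B → ∀ {d} → Grow s x B d → Reached s u x (B ∪ vtx (α d))
  extend {s} {u} {x} {B} F R {d} (b , b' , mk , ok) = record
    { start = ∪-old B y start
    ; push = λ e → case ∪-cases B y e of λ { (inj₁ p) → old p ; (inj₂ refl) → new }
    ; unmarked = λ e → case ∪-cases B y e of λ { (inj₁ p) → unmarked p ; (inj₂ refl) → ≡.trans (marked-vtx (α d)) mk } }
    where
    open Reached R
    y = vtx (α d)
    weaken : ∀ {z} → (B ∪ y) z ≡ false → B z ≡ false
    weaken = proj₁ ∘ ∪-false B y
    old : ∀ {z} → B z ≡ true → Push s u x (B ∪ y) z
    old p = record { x' = x' ; pre = pre ; support = λ e → λ { (inj₁ q) → support e (inj₁ (weaken q)) ; (inj₂ q) → support e (inj₂ (weaken q)) } ; excess = excess }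
      where open Push (push p)
    new : Push s u x (B ∪ y) y
    new = record
      { x' = shift s d x'
      ; pre = shift-preflow pre (≡.trans (sym (marked-vtx d)) (unmarked b)) mk (subst (λ z → Within (color d) (z ℤ.+ s)) (sym (support d (inj₂ b'))) ok)
      ; support = supp
      ; excess = λ v → ≡.trans (ex-shift s d x' v) (≡.trans (cong (ℤ._+ s ℤ.* (ι (vtx d) v ℤ.- ι y v)) (excess v)) (lem (ex x v) s (ι u v) (ι (vtx d) v) (ι y v)))
      }
      where
      open Push (push b)
      lem : ∀ e s a b c → (e ℤ.+ s ℤ.* (a ℤ.- b)) ℤ.+ s ℤ.* (b ℤ.- c) ≡ e ℤ.+ s ℤ.* (a ℤ.- c)
      lem = solve-∀
      lem0 : ∀ e s → e ℤ.+ s ℤ.* (0ℤ ℤ.- 0ℤ) ≡ e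
      lem0 = solve-∀
      off : ∀ {e} → d ≢ e → α d ≢ e → shift s d x' e ≡ x' e
      off {e} p q = ≡.trans (cong₂ (λ a b → x' e ℤ.+ s ℤ.* (a ℤ.- b)) (ι-≢ p) (ι-≢ q)) (lem0 (x' e) s)
      clash : ∀ {z} → B z ≡ true → B z ≡ false → ⊥
      clash p q = case ≡.trans (sym p) q of λ ()
      supp : ∀ e → (B ∪ y) (vtx e) ≡ false ⊎ (B ∪ y) (vtx (α e)) ≡ false → shift s d x' e ≡ x e
      supp e (inj₁ q) = ≡.trans (off (λ { refl → clash b (weaken q) }) (λ { refl → proj₂ (∪-false B y q) refl })) (support e (inj₁ (weaken q)))
      supp e (inj₂ q) = ≡.trans (off (λ { refl → proj₂ (∪-false B y q) refl })
        (λ { refl → clash b (subst (λ z → B (vtx z) ≡ false) (α-invol d) (weaken q)) })) (support e (inj₂ (weaken q)))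

  Stuck : ℤ → (Fin n → ℤ) → (Fin n → Bool) → Set
  Stuck s x B = ∀ d → Grow s x B d → ⊥

  count-∪ : ∀ {B y} → B y ≡ false → count (not ∘ (B ∪ y)) allDarts < count (not ∘ B) allDarts
  count-∪ {B} {y} e = subst₂ _<_ (len (B ∪ y) allDarts) (len B allDarts) (sumOf-< mono allDarts (∈.∈-allFin y) strict)
    where
    open ≡ using (subst₂)
    val : (Fin n → Bool) → Fin n → ℕ
    val C z = if C z then 0 else 1
    len : ∀ C l → sumOf (val C) l ≡ count (not ∘ C) l
    len C [] = refl
    len C (z ∷ l) with C z
    ... | true = len C l
    ... | false = cong suc (len C l)
    mono : ∀ z → val (B ∪ y) z ≤ val B z
    mono z with B z | does (y Fin.≟ z)
    ... | true | _ = z≤n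
    ... | false | true = z≤n
    ... | false | false = ℕ.≤-refl
    strict : val (B ∪ y) y < val B y
    strict rewrite ∪-new B y | e = s≤s z≤n

  saturate : ∀ fuel {s u x B} → count (not ∘ B) allDarts < fuel → Preflow x → Reached s u x B → ∃ λ C → Reached s u x C × Stuck s x C
  saturate (suc fuel) {s} {u} {x} {B} lt F R with search (grow? s x B) allDarts
  ... | inj₂ none = B , R , λ d → none (∈.∈-allFin d)
  ... | inj₁ (d , _ , g@(_ , b' , _)) = saturate fuel (ℕ.≤-trans (count-∪ {B} b') (ℕ.≤-pred lt)) F (extend F R g)

  single : ∀ {s u x} → Preflow x → marked u ≡ false → Reached s u x ((λ _ → false) ∪ u)
  single {s} {u} {x} F mk = record
    { start = ∪-new (λ _ → false) u
    ; push = λ e → case ∪-cases (λ _ → false) u e of λ { (inj₂ refl) → record { x' = x ; pre = F ; support = λ _ _ → refl ; excess = λ v → sym (lem (ex x v) s (ι u v)) } }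
    ; unmarked = λ e → case ∪-cases (λ _ → false) u e of λ { (inj₂ refl) → mk } }
    where
    lem : ∀ e s a → e ℤ.+ s ℤ.* (a ℤ.- a) ≡ e
    lem = solve-∀

∑-<0 : {g : A → ℤ} → ∀ l → (∀ {x} → x ∈ l → g x ℤ.≤ 0ℤ) → ∀ {u} → u ∈ l → g u ℤ.< 0ℤ → ∑ g l ℤ.< 0ℤ
∑-<0 {g = g} (x ∷ l) h (here refl) lt = ℤ.+-mono-<-≤ lt (ℤ.≤-trans (∑-mono l (h ∘ there)) (ℤ.≤-reflexive (∑-0 l)))
∑-<0 {g = g} (x ∷ l) h (there i) lt = ℤ.+-mono-≤-< (h (here refl)) (∑-<0 l (h ∘ there) i lt)

TightFor : Map → Color → Set
TightFor m black = Tight m black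
TightFor m white = StrictlyTight m white

module Feasible (m : Map) (pb : IsPointedBipartiteMap m) {L : List (List (Fin (Map.n m)))} (vd : Decomp (Map.σ m) L)
                {τc : Color} (τ-is : τColorIs m τc) (tight : TightFor m τc) where

  open Flows m pb
  open Augment m pb vd

  -- Edges to τ are exempt because their values are fixed: when `e` is the colour of τ they
  -- disappear inside the cut with τ added, and otherwise they are saturated in the direction `e`
  -- anyway.
  Blocked : Color → (Fin n → ℤ) → (Fin n → Bool) → Set
  Blocked e x B = ∀ {d} → B d ≡ true → B (α d) ≡ false → marked (α d) ≡ false → color d ≡ e × x d ≡ cap e

  private
    ∨-false : ∀ {a b} → a ∨ b ≡ false → a ≡ false × b ≡ false
    ∨-false {false} {false} e = refl , refl

    with-τ : (Fin n → Bool) → Fin n → Bool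
    with-τ B d = B d ∨ marked d

    with-τ-cut : ∀ {B} → Away B → IsCut m (with-τ B)
    with-τ-cut {B} aw = record
      { S-vertex = λ d → cong₂ _∨_ (Away.closed aw d) (marked-σ d)
      ; ρ∈R = cong₂ _∨_ (Away.∌ρ aw) root-not-τ
      ; τ∈S = λ d e → ≡.trans (cong (B d ∨_) e) (∨-true (B d)) }
      where
      ∨-true : ∀ a → a ∨ true ≡ true
      ∨-true true = refl
      ∨-true false = refl

    τ-crossing : ∀ {x B} → Preflow x → Blocked τc x B → ∀ {d} → with-τ B d ≡ true → with-τ B (α d) ≡ false → color d ≡ τc × x d ≡ cap τc
    τ-crossing {x} {B} F bl {d} p q with B d in b | ∨-false {B (α d)} q
    ... | true | q₁ , q₂ = bl b q₁ q₂
    ... | false | _ = τ-is d p , ≡.trans (Preflow.sat-τ F p) (cong cap (τ-is d p))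

    crossing-sum : ∀ (x : Fin n → ℤ) e (S : Fin n → Bool) → (∀ {d} → S d ≡ true → S (α d) ≡ false → x d ≡ cap e) →
      ∑ (λ d → bit (cross S d) ℤ.* x d) allDarts ≡ cap e ℤ.* + weight m S
    crossing-sum x e S h = ≡.trans (∑-cong allDarts (λ {d} _ → pt d)) (∑-weight e S)
      where
      pt : ∀ d → bit (cross S d) ℤ.* x d ≡ bit (cross S d) ℤ.* cap e
      pt d with S d in p | S (α d) in q
      ... | false | _ = refl
      ... | true | true = refl
      ... | true | false = cong (λ z → 1ℤ ℤ.* z) (h p q)

    -- `B` together with τ is a cut of the colour of τ all of whose edges are saturated, so the
    -- bound of `cut-flow` becomes an equality.
    same-side : ∀ {x B} → Preflow x → Away B → Blocked τc x B →
      cap τc ℤ.* + weight m (with-τ B) ℤ.+ + count B allDarts ≡ demand x B ℤ.+ cap τc ℤ.* + degτ m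
    same-side {x} {B} F aw bl = ≡.trans (cong (ℤ._+ + count B allDarts) (sym (crossing-sum x τc (with-τ B) (λ p q → proj₂ (τ-crossing {x} {B} F bl p q)))))
      (cut-flow τ-is F B (Away.∌τ aw))

    -- An edge from `B` to τ is saturated at τ, hence at capacity at its other end, which has the
    -- opposite colour; so the whole boundary of `B` is saturated.
    other-side : ∀ {x B} → Preflow x → Away B → Blocked (flipC τc) x B → demand x B ≡ cap (flipC τc) ℤ.* + weight m B ℤ.+ + count B allDarts
    other-side {x} {B} F aw bl = ≡.trans (demand-eq x B) (cong (ℤ._+ + count B allDarts)
      (≡.trans (∑-cross (Preflow.anti F) B) (crossing-sum x (flipC τc) B full)))
      where
      full : ∀ {d} → B d ≡ true → B (α d) ≡ false → x d ≡ cap (flipC τc)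
      full {d} p q with marked (α d) in e
      ... | false = proj₂ (bl p q e)
      ... | true = begin
        x d ≡⟨ sym (ℤ.neg-involutive (x d)) ⟩
        - - x d ≡⟨ cong (-_) (sym (Preflow.anti F d)) ⟩
        - x (α d) ≡⟨ cong (-_) (≡.trans (Preflow.sat-τ F e) (cong cap (τ-is (α d) e))) ⟩
        - cap τc ≡⟨ sym (cap-flip τc) ⟩
        cap (flipC τc) ∎
        where open ≡-Reasoning

    connected-weight : ∀ {B} → Away B → ∀ {d} → B d ≡ true → 0 < weight m B
    connected-weight {B} aw {d} b = ℕ.n≢0⇒n>0 (λ z → case ≡.trans (sym (reach (λ e → count-0 (cross B) allDarts z (∈.∈-allFin e)) (connected d root))) (Away.∌ρ aw) of λ ())
      where
      reach : (∀ e → cross B e ≡ false) → ∀ {y} → Reach m d y → B y ≡ true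
      reach h here = b
      reach h (stepσ {y = y} r) = ≡.trans (Away.closed aw y) (reach h r)
      reach h (stepα {y = y} r) = no-exit {B y} (h y) (reach h r)

    N-pos : ∀ k {a} → 0 < k → a ℤ.< N → a ℤ.≤ N ℤ.* + k
    N-pos (suc k) {a} _ lt = ℤ.≤-trans (ℤ.<⇒≤ lt) (ℤ.≤-trans (ℤ.≤-reflexive (sym (ℤ.*-identityʳ N))) (ℤ.*-monoˡ-≤-nonNeg N (ℤ.+≤+ (s≤s z≤n))))

  -- A set from which nothing can leave in the direction e has no deficit: this is where tightness enters.
  blocked-demand : ∀ e {x B} → Preflow x → Away B → Blocked e x B → 0ℤ ℤ.≤ sgn e ℤ.* demand x B
  blocked-demand e {x} {B} F aw bl with search (λ d → B d Bool.≟ true) allDarts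
  ... | inj₂ none = ℤ.≤-reflexive (sym (≡.trans (cong (λ z → sgn e ℤ.* z) (≡.trans (∑-cong allDarts (λ {d} i → empty d (none i))) (∑-0 allDarts))) (ℤ.*-zeroʳ (sgn e))))
    where
    empty : ∀ d → (B d ≡ true → ⊥) → bit (B d) ℤ.* (x d ℤ.+ 1ℤ) ≡ 0ℤ
    empty d h with B d
    ... | true = ⊥-elim (h refl)
    ... | false = refl
  ... | inj₁ (d , _ , b) = go e τc refl τ-is tight bl
    where
    open ℤ.≤-Reasoning
    cnt = + count B allDarts
    go : ∀ e τ → τ ≡ τc → τColorIs m τ → TightFor m τ → Blocked e x B → 0ℤ ℤ.≤ sgn e ℤ.* demand x B
    go black black refl τ-is tight bl = ℤ.≤-trans (ℤ.i≤j⇒0≤j-i (begin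
        N ℤ.* + degτ m ≤⟨ ℤ.*-monoˡ-≤-nonNeg N (ℤ.+≤+ (tight (with-τ B) (with-τ-cut aw) (λ d p q → proj₁ (τ-crossing {x} {B} F bl p q)))) ⟩
        N ℤ.* + weight m (with-τ B) ≤⟨ ℤ.i≤i+j _ cnt ⟩
        N ℤ.* + weight m (with-τ B) ℤ.+ cnt ∎))
      (ℤ.≤-reflexive (≡.trans (cong (ℤ._- N ℤ.* + degτ m) (same-side {x} {B} F aw bl)) (lem (demand x B) (N ℤ.* + degτ m))))
      where
      lem : ∀ a b → (a ℤ.+ b) ℤ.- b ≡ 1ℤ ℤ.* a
      lem = solve-∀
    -- The units absorbed in `B` have the wrong sign here and can amount to almost `N`. Strictness
    -- supplies one more edge of the cut, worth `N`.
    go white white refl τ-is (_ , sole) bl = ℤ.≤-trans (ℤ.i≤j⇒0≤j-i (begin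
        N ℤ.* + degτ m ℤ.+ cnt ≤⟨ ℤ.<⇒≤ (ℤ.+-monoʳ-< (N ℤ.* + degτ m) (count<N B)) ⟩
        N ℤ.* + degτ m ℤ.+ N ≡⟨ lem N (+ degτ m) ⟩
        N ℤ.* + suc (degτ m) ≤⟨ ℤ.*-monoˡ-≤-nonNeg N (ℤ.+≤+ w>deg) ⟩
        N ℤ.* + weight m (with-τ B) ∎))
      (ℤ.≤-reflexive (≡.trans (lem₁ N (+ weight m (with-τ B)) (+ degτ m) cnt) (≡.trans (cong (λ z → - (z ℤ.+ N ℤ.* + degτ m)) (same-side {x} {B} F aw bl)) (lem₂ N (demand x B) (+ degτ m)))))
      where
      lem : ∀ a b → a ℤ.* b ℤ.+ a ≡ a ℤ.* (1ℤ ℤ.+ b)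
      lem = solve-∀
      lem₁ : ∀ n w d c → n ℤ.* w ℤ.- (n ℤ.* d ℤ.+ c) ≡ - ((- n ℤ.* w ℤ.+ c) ℤ.+ n ℤ.* d)
      lem₁ = solve-∀
      lem₂ : ∀ n x d → - ((x ℤ.+ - n ℤ.* d) ℤ.+ n ℤ.* d) ≡ ℤ.-1ℤ ℤ.* x
      lem₂ = solve-∀
      w>deg : suc (degτ m) ≤ weight m (with-τ B)
      w>deg = ℕ.≰⇒> (λ le → case ≡.trans (sym b) (Away.∌τ aw (≡.trans (sym (sole (with-τ B) (with-τ-cut aw) (λ d p q → proj₁ (τ-crossing {x} {B} F bl p q)) le d)) (cong (_∨ marked d) b))) of λ ())
    go black white refl τ-is tight bl = ℤ.≤-trans (ℤ.+≤+ {0} {suc n * weight m B + count B allDarts} z≤n)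
      (ℤ.≤-reflexive (≡.trans (cong (λ z → z ℤ.+ cnt) (ℤ.pos-* (suc n) (weight m B))) (≡.trans (sym (other-side {x} {B} F aw bl)) (sym (ℤ.*-identityˡ (demand x B))))))
    -- Connectedness gives at least one boundary edge, whose `N` outweighs the units absorbed in
    -- `B`.
    go white black refl τ-is tight bl = ℤ.≤-trans (ℤ.i≤j⇒0≤j-i (N-pos (weight m B) (connected-weight aw b) (count<N B)))
      (ℤ.≤-reflexive (≡.trans (lem N (+ weight m B) cnt) (cong (λ z → ℤ.-1ℤ ℤ.* z) (sym (other-side {x} {B} F aw bl)))))
      where
      lem : ∀ n w c → n ℤ.* w ℤ.- c ≡ ℤ.-1ℤ ℤ.* (- n ℤ.* w ℤ.+ c)
      lem = solve-∀

  private
    special : Fin n → Bool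
    special v = does (vtx root Fin.≟ v) ∨ marked v

    imbalance : (Fin n → ℤ) → Fin n → ℕ
    imbalance x v = if special v then 0 else ℤ.∣ ex x v ∣

    total : (Fin n → ℤ) → ℕ
    total x = sumOf (imbalance x) allDarts

    ordinary : ∀ {v} → special v ≡ false → vtx root ≢ v × marked v ≡ false
    ordinary {v} e with vtx root Fin.≟ v | marked v
    ... | no p | false = p , refl

  initial : ∃ Preflow
  initial = x , record { anti = anti ; within = within ; sat-τ = λ {d} e → cong (λ b → if b then cap (color d) else (if marked (α d) then cap (color d) else 0ℤ)) e }
    where
    x : Fin n → ℤ
    x d = if marked d then cap (color d) else (if marked (α d) then cap (color d) else 0ℤ)
    anti : Anti x
    anti d rewrite α-invol d | color-α d with marked d | marked (α d)
    ... | true | true = cap-flip (color d)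
    ... | true | false = cap-flip (color d)
    ... | false | true = cap-flip (color d)
    ... | false | false = refl
    zero-within : ∀ c → Within c 0ℤ
    zero-within black = ℤ.+≤+ z≤n
    zero-within white = ℤ.-≤+
    within : ∀ d → Within (color d) (x d)
    within d with marked d | marked (α d)
    ... | true | _ = within-cap (color d)
    ... | false | true = within-cap (color d)
    ... | false | false = zero-within (color d)

  -- One unit is sent from `u` to the root vertex, or to a vertex whose excess has the opposite
  -- sign; either way the total imbalance drops. If neither is reachable, the reached set is blocked
  -- and its excesses all have one sign, against `blocked-demand`.
  improve : ∀ {x} → Preflow x → ∀ {u e} → special u ≡ false → Neg e (ex x u) → ∃ λ x' → Preflow x' × total x' < total x
  improve {x} F {u} {e} sp ng with saturate (suc (count (not ∘ ((λ _ → false) ∪ u)) allDarts)) {sgn e} {u} {x} ℕ.≤-refl F (single F (proj₂ (ordinary sp)))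
  ... | C , R , stuck with search (λ y → (C y Bool.≟ true) ×-dec ((vtx root Fin.≟ y) ⊎-dec neg? (flipC e) (ex x y))) allDarts
  ...   | inj₁ (y , _ , cy , tgt) = x' , pre , sumOf-< smaller allDarts (∈.∈-allFin u) strictly
    where
    open Reached R
    open Push (push cy)
    neg-neg : ∀ c {z} → Neg c z → Neg (flipC c) z → ⊥
    neg-neg black p q = ℤ.<-asym p q
    neg-neg white p q = ℤ.<-asym p q
    u≢y : u ≢ y
    u≢y refl = case tgt of λ { (inj₁ r) → proj₁ (ordinary sp) r ; (inj₂ q) → neg-neg e ng q }
    at-u : ex x' u ≡ ex x u ℤ.+ sgn e
    at-u = ≡.trans (excess u) (≡.trans (cong₂ (λ a b → ex x u ℤ.+ sgn e ℤ.* (a ℤ.- b)) (ι-refl u) (ι-≢ (u≢y ∘ sym))) (lem (ex x u) (sgn e)))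
      where
      lem : ∀ a s → a ℤ.+ s ℤ.* (1ℤ ℤ.- 0ℤ) ≡ a ℤ.+ s
      lem = solve-∀
    at-y : ex x' y ≡ ex x y ℤ.+ sgn (flipC e)
    at-y = ≡.trans (excess y) (≡.trans (cong₂ (λ a b → ex x y ℤ.+ sgn e ℤ.* (a ℤ.- b)) (ι-≢ u≢y) (ι-refl y))
      (≡.trans (lem (ex x y) (sgn e)) (cong (λ z → ex x y ℤ.+ z) (sym (sgn-flip e)))))
      where
      lem : ∀ a s → a ℤ.+ s ℤ.* (0ℤ ℤ.- 1ℤ) ≡ a ℤ.- s
      lem = solve-∀
    at-other : ∀ {v} → u ≢ v → y ≢ v → ex x' v ≡ ex x v
    at-other {v} p q = ≡.trans (excess v) (≡.trans (cong₂ (λ a b → ex x v ℤ.+ sgn e ℤ.* (a ℤ.- b)) (ι-≢ p) (ι-≢ q)) (lem (ex x v) (sgn e)))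
      where
      lem : ∀ a s → a ℤ.+ s ℤ.* (0ℤ ℤ.- 0ℤ) ≡ a
      lem = solve-∀
    strictly : imbalance x' u < imbalance x u
    strictly rewrite sp = subst (λ z → ℤ.∣ z ∣ < ℤ.∣ ex x u ∣) (sym at-u) (neg-shrink e (ex x u) ng)
    drop : ∀ v → Dec (u ≡ v) → Dec (y ≡ v) → special v ≡ false → ℤ.∣ ex x' v ∣ ≤ ℤ.∣ ex x v ∣
    drop v (yes refl) _ _ = ℕ.<⇒≤ (subst (λ z → ℤ.∣ z ∣ < ℤ.∣ ex x u ∣) (sym at-u) (neg-shrink e (ex x u) ng))
    drop v (no _) (yes refl) s = case tgt of λ
      { (inj₁ r) → ⊥-elim (proj₁ (ordinary s) r)
      ; (inj₂ q) → ℕ.<⇒≤ (subst (λ z → ℤ.∣ z ∣ < ℤ.∣ ex x y ∣) (sym at-y) (neg-shrink (flipC e) (ex x y) q)) }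
    drop v (no p) (no q) s = ℕ.≤-reflexive (cong ℤ.∣_∣ (at-other p q))
    smaller : ∀ v → imbalance x' v ≤ imbalance x v
    smaller v with special v in s
    ... | true = z≤n
    ... | false = drop v (u Fin.≟ v) (y Fin.≟ v) s
  ...   | inj₂ none = ⊥-elim (ℤ.<-irrefl refl (ℤ.<-≤-trans negative (blocked-demand e F away blk)))
    where
    open Reached R
    U : Fin n → Bool
    U = C ∘ vtx
    away : Away U
    away = record { closed = λ d → cong C (vtx-σ d)
      ; ∌ρ = not-true (λ q → none (∈.∈-allFin _) (q , inj₁ refl))
      ; ∌τ = λ {d} mk → not-true (λ q → case ≡.trans (sym mk) (≡.trans (sym (marked-vtx d)) (unmarked q)) of λ ()) }
    blk : Blocked e x U
    blk {d} p q mk = blocked e (color d) (x d) (Preflow.within F d) (λ ok → stuck d (p , q , mk , ok))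
    negative : sgn e ℤ.* demand x U ℤ.< 0ℤ
    negative = ℤ.≤-<-trans (ℤ.≤-reflexive (≡.trans (cong (λ z → sgn e ℤ.* z) (demand-ex x C)) (sym (∑-* (sgn e) _ allDarts))))
      (∑-<0 allDarts (λ {v} i → term v i) (∈.∈-allFin u) strict)
      where
      lem : ∀ s v → s ℤ.* (1ℤ ℤ.* v) ≡ s ℤ.* v
      lem = solve-∀
      term : ∀ v → v ∈ allDarts → sgn e ℤ.* (bit (C v) ℤ.* ex x v) ℤ.≤ 0ℤ
      term v i with C v in cv
      ... | true = ℤ.≤-trans (ℤ.≤-reflexive (lem (sgn e) (ex x v))) (non-neg-sgn e (λ q → none i (cv , inj₂ q)))
      ... | false = ℤ.≤-reflexive (ℤ.*-zeroʳ (sgn e))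
      strict : sgn e ℤ.* (bit (C u) ℤ.* ex x u) ℤ.< 0ℤ
      strict rewrite start = ℤ.≤-<-trans (ℤ.≤-reflexive (lem (sgn e) (ex x u))) (neg-sgn e ng)

  balance : ∀ fuel {x} → Preflow x → total x < fuel → ∃ Flow
  balance (suc fuel) {x} F lt with search (λ v → (special v Bool.≟ false) ×-dec Neg≢? (ex x v)) allDarts
    where
    Neg≢? : ∀ z → Dec (z ≢ 0ℤ)
    Neg≢? z with z ℤ.≟ 0ℤ
    ... | yes p = no (λ q → q p)
    ... | no p = yes p
  ... | inj₁ (u , _ , sp , nz) with trichotomy (ex x u)
  ...   | inj₁ z = ⊥-elim (nz z)
  ...   | inj₂ (e , ng) with x' , F' , lt' ← improve F {u} {e} sp ng = balance fuel F' (ℕ.<-≤-trans lt' (ℕ.≤-pred lt))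
  balance (suc fuel) {x} F lt | inj₂ none = x , record { preflow = F ; conserve = cons }
    where
    cons : ∀ B → Away B → demand x B ≡ 0ℤ
    cons B aw = begin
      demand x B ≡⟨ ∑-cong allDarts (λ {d} _ → cong (λ b → bit b ℤ.* (x d ℤ.+ 1ℤ)) (sym (const-vtx (Away.closed aw) d))) ⟩
      demand x (B ∘ vtx) ≡⟨ demand-ex x B ⟩
      ∑ (λ v → bit (B v) ℤ.* ex x v) allDarts ≡⟨ ∑-cong allDarts (λ {v} i → zero-at v i) ⟩
      ∑ (λ _ → 0ℤ) allDarts ≡⟨ ∑-0 allDarts ⟩
      0ℤ ∎
      where
      open ≡-Reasoning
      is-ordinary : ∀ v → B v ≡ true → special v ≡ false
      is-ordinary v b with vtx root Fin.≟ v | marked v in mk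
      ... | yes refl | _ = ⊥-elim (case ≡.trans (sym b) (≡.trans (const-vtx (Away.closed aw) root) (Away.∌ρ aw)) of λ ())
      ... | no _ | true = ⊥-elim (case ≡.trans (sym b) (Away.∌τ aw mk) of λ ())
      ... | no _ | false = refl
      zero-at : ∀ v → v ∈ allDarts → bit (B v) ℤ.* ex x v ≡ 0ℤ
      zero-at v i with B v in b
      ... | false = refl
      ... | true with ex x v ℤ.≟ 0ℤ
      ...   | yes z = ≡.trans (ℤ.*-identityˡ _) z
      ...   | no nz = ⊥-elim (none i (is-ordinary v b , nz))

  feasible : ∃ Flow
  feasible with x , F ← initial = balance (suc (total x)) F ℕ.≤-refl

-- The search through the faces

argmin : {P : A → Set} → (∀ x → Dec (P x)) → (f : A → ℤ) → ∀ l → (∃ λ x → x ∈ l × P x) →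
  ∃ λ x → P x × (∀ {y} → y ∈ l → P y → f x ℤ.≤ f y)
argmin {P = P} d f (x ∷ l) w with search d l | d x
... | inj₂ none | yes p = x , p , λ { (here refl) _ → ℤ.≤-refl ; (there i) q → ⊥-elim (none i q) }
... | inj₂ none | no np = case w of λ { (y , here refl , q) → ⊥-elim (np q) ; (y , there i , q) → ⊥-elim (none i q) }
... | inj₁ w' | no np with y , q , le ← argmin d f l w' = y , q , λ { (here refl) p → ⊥-elim (np p) ; (there i) → le i }
... | inj₁ w' | yes p with y , q , le ← argmin d f l w' with ℤ.≤-total (f x) (f y)
...   | inj₁ xy = x , p , λ { (here refl) _ → ℤ.≤-refl ; (there i) r → ℤ.≤-trans xy (le i r) }
...   | inj₂ yx = y , q , λ { (here refl) _ → yx ; (there i) → le i }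

module Dual (m : Map) (pb : IsPointedBipartiteMap m) {L : List (List (Fin (Map.n m)))} (fd : Decomp (Map.σ m ∘ Map.α m) L) where

  open Flows m pb

  φ : Fin n → Fin n
  φ = σ ∘ α

  module FD = Decomp fd

  -- The faces not yet reached.
  record Rest (Rem : List (List (Fin n))) : Set where
    field
      sub : ∀ {c} → c ∈ Rem → c ∈ L
      uniqR : Unique (concat Rem)

  open Rest

  shrink : ∀ {Rem c Rem'} → Rest Rem → Rem ↭ c ∷ Rem' → Rest Rem' × (∀ {d} → d ∈ c → d ∉ concat Rem') × (∀ {d} → d ∈ concat Rem' → d ∈ concat Rem) × c ∈ Rem
  shrink {Rem} {c} {Rem'} R p =
    record { sub = λ i → sub R (↭.∈-resp-↭ (↭-sym p) (there i)) ; uniqR = uniq-++ʳ c u } ,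
    (λ i j → uniq-disj c u i j) , (λ i → ↭.∈-resp-↭ (concat-↭ (↭-sym p)) (∈.∈-++⁺ʳ c i)) , ↭.∈-resp-↭ (↭-sym p) (here refl)
    where
    u = uniq-↭ (concat-↭ p) (uniqR R)

  -- `fresh` keeps one dart of τ for each face around τ. That it contains all darts of τ only
  -- follows from the final count.
  record TauFaces (ts : List (Fin n)) : Set where
    field
      fresh : List (Fin n)
      Rem : List (List (Fin n))
      rest : Rest Rem
      gone : ∀ {t} → t ∈ ts → t ∉ concat Rem
      number : length fresh + length Rem ≡ length L
      sub-ts : ∀ {t} → t ∈ fresh → t ∈ ts
      uniqF : Unique fresh
      apart : ∀ {t t' c} → t ∈ fresh → t' ∈ fresh → c ∈ L → t ∈ c → t' ∈ c → t ≡ t'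

  tauFaces : ∀ ts → Unique ts → TauFaces ts
  tauFaces [] u = record
    { fresh = [] ; Rem = L ; rest = record { sub = id ; uniqR = FD.uniq } ; gone = λ () ; number = refl ; sub-ts = λ () ; uniqF = [] ; apart = λ () }
  tauFaces (t ∷ ts) u with T ← tauFaces ts (uniq-tail u) with t ∈? concat (TauFaces.Rem T)
  ... | no ni = record
    { fresh = fresh ; Rem = Rem ; rest = rest ; gone = λ { (here refl) → ni ; (there i) → gone i }
    ; number = number ; sub-ts = there ∘ sub-ts ; uniqF = uniqF ; apart = apart }
    where open TauFaces T
  ... | yes i with c , t∈c , c∈ ← ∈.∈-concat⁻′ (TauFaces.Rem T) i with Rem' , p ← ∈-↭ c∈ = record
    { fresh = t ∷ fresh ; Rem = Rem' ; rest = proj₁ sh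
    ; gone = λ { (here refl) → proj₁ (proj₂ sh) t∈c ; (there j) k → gone j (proj₁ (proj₂ (proj₂ sh)) k) }
    ; number = ≡.trans (sym (ℕ.+-suc (length fresh) (length Rem'))) (≡.trans (cong (λ k → length fresh + k) (sym (↭.↭-length p))) number)
    ; sub-ts = λ { (here refl) → here refl ; (there j) → there (sub-ts j) }
    ; uniqF = ∷-uniq (λ j → uniq-head u (sub-ts j)) uniqF
    ; apart = apart' }
    where
    open TauFaces T
    sh = shrink rest p
    only : ∀ {t' c'} → t' ∈ fresh → c' ∈ L → t ∈ c' → t' ∈ c' → ⊥
    only j q a b with refl ← concat-disj L FD.uniq q (sub rest c∈) a t∈c = gone (sub-ts j) (∈.∈-concat⁺′ b c∈)
    apart' : ∀ {t₁ t₂ c'} → t₁ ∈ t ∷ fresh → t₂ ∈ t ∷ fresh → c' ∈ L → t₁ ∈ c' → t₂ ∈ c' → t₁ ≡ t₂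
    apart' (here refl) (here refl) q a b = refl
    apart' (here refl) (there j) q a b = ⊥-elim (only j q a b)
    apart' (there j) (here refl) q a b = ⊥-elim (only j q b a)
    apart' (there j) (there k) q a b = apart j k q a b

  -- An arborescence on the faces grown from those around τ, most recent arc first.
  data Arcs : List (Fin n) → Set where
    start : Arcs []
    arc  : ∀ {e es} c → Cyc (Graph φ) c → color e ≡ black → α e ∈ c → e ∉ c → (∀ {e'} → e' ∈ es → e' ∉ c × α e' ∉ c) →
           (∀ {t} → marked t ≡ true → t ∉ c) → Arcs es → Arcs (e ∷ es)

  color-φ : ∀ d → color (φ d) ≡ flipC (color d)
  color-φ d = ≡.trans (color-σ (α d)) (color-α d)

  module Grow {Rem} (R : Rest Rem) (away-τ : ∀ {t} → marked t ≡ true → t ∉ concat Rem) where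

    X : Fin n → Bool
    X d = does (d ∈? concat Rem)

    X-in : ∀ {d} → d ∈ concat Rem → X d ≡ true
    X-in {d} = does-yes (d ∈? concat Rem)

    X-out : ∀ {d} → d ∉ concat Rem → X d ≡ false
    X-out {d} = does-no (d ∈? concat Rem)

    in-X : ∀ {d} → X d ≡ true → d ∈ concat Rem
    in-X {d} e with d ∈? concat Rem
    ... | yes i = i

    rem-cyc : ∀ {c} → c ∈ Rem → Cyc (Graph φ) c
    rem-cyc i = FD.cyc (sub R i)

    φ-in : ∀ {d} → d ∈ concat Rem → φ d ∈ concat Rem
    φ-in i with c , j , q ← ∈.∈-concat⁻′ Rem i with y , refl , k ← cyc-next c (rem-cyc q) j = ∈.∈-concat⁺′ k q

    φ-inj : ∀ {a b} → φ a ≡ φ b → a ≡ b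
    φ-inj {a} {b} e = ≡.trans (sym (α-invol a)) (≡.trans (cong α (≡.trans (sym (proj₂ (proj₂ σ-perm) (α a))) (≡.trans (cong σ⁻ e) (proj₂ (proj₂ σ-perm) (α b))))) (α-invol b))

    φ-out : ∀ {d} → φ d ∈ concat Rem → d ∈ concat Rem
    φ-out {d} i with c , j , q ← ∈.∈-concat⁻′ Rem i with e , k , eq ← ∈.∈-map⁻ φ (↭.∈-resp-↭ (↭-sym (cyc-shift φ c (rem-cyc q))) j) =
      ∈.∈-concat⁺′ (subst (_∈ c) (sym (φ-inj eq)) k) q

    X-φ : ∀ d → X (φ d) ≡ X d
    X-φ d with d ∈? concat Rem
    ... | yes i = X-in (φ-in i)
    ... | no ni = X-out (ni ∘ φ-out)

    X-σ : ∀ d → X (α d) ≡ X (σ d)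
    X-σ d = ≡.trans (sym (X-φ (α d))) (cong X (cong σ (α-invol d)))

    X-τ : ∀ {t} → marked t ≡ true → X t ≡ false
    X-τ m = X-out (away-τ m)

    X-ατ : ∀ {t} → marked t ≡ true → X (α t) ≡ false
    X-ατ {t} m = ≡.trans (X-σ t) (X-τ (≡.trans (marked-σ t) m))

    private
      y : Fin n → ℤ
      y = sgn ∘ color

      y-anti : Anti y
      y-anti d = ≡.trans (cong sgn (color-α d)) (sgn-flip (color d))

    -- Around every face black and white darts alternate, so the boundary of X is balanced.
    boundary : ∑ (λ d → bit (cross X d) ℤ.* y d) allDarts ≡ 0ℤ
    boundary = ≡.trans (sym (∑-cross y-anti X)) (self-neg _ (begin
      ∑ g allDarts ≡⟨ sym (≡.trans (∑-α (g ∘ σ)) (∑-σ g)) ⟩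
      ∑ (g ∘ φ) allDarts ≡⟨ ∑-cong allDarts (λ {d} _ → ≡.trans (cong₂ (λ a b → bit a ℤ.* b) (X-φ d) (≡.trans (cong sgn (color-φ d)) (sgn-flip (color d))))
          (sym (ℤ.neg-distribʳ-* (bit (X d)) (y d)))) ⟩
      ∑ (λ d → - g d) allDarts ≡⟨ ∑-neg g allDarts ⟩
      - ∑ g allDarts ∎))
      where
      open ≡-Reasoning
      g : Fin n → ℤ
      g d = bit (X d) ℤ.* y d

    Candidate : Fin n → Set
    Candidate e = color e ≡ black × X e ≡ false × X (α e) ≡ true

    candidate? : ∀ e → Dec (Candidate e)
    candidate? e = isBlack? (color e) ×-dec (X e Bool.≟ false) ×-dec (X (α e) Bool.≟ true)
      where
      isBlack? : ∀ c → Dec (c ≡ black)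
      isBlack? black = yes refl
      isBlack? white = no (λ ())

    -- If no candidate existed, every edge of the boundary of `X` would have its black dart inside,
    -- and the balance of `boundary` would leave no boundary edge at all. Then `X` would be closed
    -- under `σ` and `α` and would contain τ by connectedness.
    candidate : ∀ {d} → d ∈ concat Rem → ∃ λ e → e ∈ allDarts × Candidate e
    candidate {d} i with search candidate? allDarts
    ... | inj₁ r = r
    ... | inj₂ none = ⊥-elim (case ≡.trans (sym (reach (connected d (proj₁ nonempty)))) (X-τ (proj₂ nonempty)) of λ ())
      where
      not-white : ∀ e → color e ≡ white → cross X e ≡ true → ⊥
      not-white e p q with a , b ← cross⇒ {X e} q = none (∈.∈-allFin (α e)) (≡.trans (color-α e) (cong flipC p) , b , ≡.trans (cong X (α-invol e)) a)
      term : ∀ e → bit (cross X e) ℤ.* y e ≡ bit (cross X e)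
      term e with cross X e in q | color e in p
      ... | false | _ = refl
      ... | true | black = refl
      ... | true | white = ⊥-elim (not-white e p q)
      no-cross : ∀ e → cross X e ≡ false
      no-cross e = count-0 (cross X) allDarts (ℤ.+-injective (≡.trans (sym (∑-count (cross X) allDarts)) (≡.trans (sym (∑-cong allDarts (λ {e} _ → term e))) boundary))) (∈.∈-allFin e)
      αX : ∀ e → X e ≡ true → X (α e) ≡ true
      αX e p = no-exit {X e} (no-cross e) p
      reach : ∀ {z} → Reach m d z → X z ≡ true
      reach here = X-in i
      reach (stepσ {y = z} r) = ≡.trans (sym (X-σ z)) (αX z (reach r))
      reach (stepα {y = z} r) = αX z (reach r)

    -- Raising the potential of the faces outside X by δ.
    raise : ℤ → (Fin n → ℤ) → Fin n → ℤ
    raise δ x d = x d ℤ.+ δ ℤ.* (bit (X (α d)) ℤ.- bit (X d))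

    raise-same : ∀ δ x d → X (α d) ≡ X d → raise δ x d ≡ x d
    raise-same δ x d e = ≡.trans (cong (λ b → x d ℤ.+ δ ℤ.* (bit b ℤ.- bit (X d))) e) (lem (x d) δ (bit (X d)))
      where
      lem : ∀ x s a → x ℤ.+ s ℤ.* (a ℤ.- a) ≡ x
      lem = solve-∀

    -- Around a vertex the added terms telescope because `X (α d) = X (σ d)`, so conservation
    -- persists. Candidates are the only black darts whose value can grow.
    raise-flow : ∀ {δ x} → Flow x → 0ℤ ℤ.≤ δ → (∀ {e} → Candidate e → x e ℤ.+ δ ℤ.≤ N) → Flow (raise δ x)
    raise-flow {δ} {x} F δ≥0 fits = record
      { preflow = record { anti = an ; within = wi ; sat-τ = λ {d} m → ≡.trans (raise-same δ x d (≡.trans (X-ατ m) (sym (X-τ m)))) (sat-τ m) }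
      ; conserve = cons }
      where
      open Flow F
      an : Anti (raise δ x)
      an d = ≡.trans (cong₂ (λ a b → a ℤ.+ δ ℤ.* (b ℤ.- bit (X (α d)))) (anti d) (cong (bit ∘ X) (α-invol d))) (lem (x d) δ (bit (X d)) (bit (X (α d))))
        where
        lem : ∀ x s a b → - x ℤ.+ s ℤ.* (a ℤ.- b) ≡ - (x ℤ.+ s ℤ.* (b ℤ.- a))
        lem = solve-∀
      black-ok : ∀ d → color d ≡ black → raise δ x d ℤ.≤ N
      black-ok d p = go (X d) refl (X (α d)) refl
        where
        xd≤N : x d ℤ.≤ N
        xd≤N = subst (λ c → Within c (x d)) p (within d)
        go : ∀ a → X d ≡ a → ∀ b → X (α d) ≡ b → raise δ x d ℤ.≤ N
        go false p₁ true q = ℤ.≤-trans (ℤ.≤-reflexive (≡.trans (cong₂ (λ a b → x d ℤ.+ δ ℤ.* (bit a ℤ.- bit b)) q p₁) (lem (x d) δ))) (fits (p , p₁ , q))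
          where
          lem : ∀ x s → x ℤ.+ s ℤ.* (1ℤ ℤ.- 0ℤ) ≡ x ℤ.+ s
          lem = solve-∀
        go true p₁ false q = ℤ.≤-trans (ℤ.≤-reflexive (≡.trans (cong₂ (λ a b → x d ℤ.+ δ ℤ.* (bit a ℤ.- bit b)) q p₁) (lem (x d) δ)))
            (ℤ.≤-trans (ℤ.≤-trans (ℤ.+-monoʳ-≤ (x d) (ℤ.neg-mono-≤ δ≥0)) (ℤ.≤-reflexive (ℤ.+-identityʳ (x d)))) xd≤N)
          where
          lem : ∀ x s → x ℤ.+ s ℤ.* (0ℤ ℤ.- 1ℤ) ≡ x ℤ.- s
          lem = solve-∀
        go true p₁ true q = ℤ.≤-trans (ℤ.≤-reflexive (raise-same δ x d (≡.trans q (sym p₁)))) xd≤N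
        go false p₁ false q = ℤ.≤-trans (ℤ.≤-reflexive (raise-same δ x d (≡.trans q (sym p₁)))) xd≤N
      wi : ∀ d → Within (color d) (raise δ x d)
      wi d with color d in p
      ... | black = black-ok d p
      ... | white = subst (Within white) (≡.trans (cong (-_) (an d)) (ℤ.neg-involutive _)) (within-neg black (black-ok (α d) (≡.trans (color-α d) (cong flipC p))))
      cons : ∀ U → Away U → demand (raise δ x) U ≡ 0ℤ
      cons U aw = begin
        demand (raise δ x) U ≡⟨ ∑-cong allDarts (λ {d} _ → lem (bit (U d)) (x d) δ (bit (X (α d))) (bit (X d))) ⟩
        ∑ (λ d → bit (U d) ℤ.* (x d ℤ.+ 1ℤ) ℤ.+ δ ℤ.* (bit (U d) ℤ.* bit (X (α d)) ℤ.+ - (bit (U d) ℤ.* bit (X d)))) allDarts ≡⟨ ∑-+ _ _ allDarts ⟩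
        demand x U ℤ.+ ∑ (λ d → δ ℤ.* (bit (U d) ℤ.* bit (X (α d)) ℤ.+ - (bit (U d) ℤ.* bit (X d)))) allDarts
          ≡⟨ cong₂ ℤ._+_ (conserve U aw) (≡.trans (∑-* δ _ allDarts) (cong (λ z → δ ℤ.* z) (≡.trans (∑-+ _ _ allDarts) (cong₂ ℤ._+_ turn (∑-neg k allDarts))))) ⟩
        0ℤ ℤ.+ δ ℤ.* (∑ k allDarts ℤ.- ∑ k allDarts) ≡⟨ lem' δ (∑ k allDarts) ⟩
        0ℤ ∎
        where
        open ≡-Reasoning
        k : Fin n → ℤ
        k d = bit (U d) ℤ.* bit (X d)
        turn : ∑ (λ d → bit (U d) ℤ.* bit (X (α d))) allDarts ≡ ∑ k allDarts
        turn = ≡.trans (∑-cong allDarts (λ {d} _ → cong₂ (λ a b → bit a ℤ.* bit b) (sym (Away.closed aw d)) (X-σ d))) (∑-σ k)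
        lem : ∀ u x s a b → u ℤ.* ((x ℤ.+ s ℤ.* (a ℤ.- b)) ℤ.+ 1ℤ) ≡ u ℤ.* (x ℤ.+ 1ℤ) ℤ.+ s ℤ.* (u ℤ.* a ℤ.+ - (u ℤ.* b))
        lem = solve-∀
        lem' : ∀ s a → 0ℤ ℤ.+ s ℤ.* (a ℤ.- a) ≡ 0ℤ
        lem' = solve-∀

    -- `δ` is the least slack among the candidates: the largest raise they all allow, and one that
    -- saturates a minimiser.
    saturate-one : ∀ {x d} → Flow x → d ∈ concat Rem → ∃₂ λ x' e → Flow x' × Candidate e × x' e ≡ N × (∀ z → X z ≡ false → X (α z) ≡ false → x' z ≡ x z)
    saturate-one {x} F i with e , (p , q , r) , le ← argmin candidate? (λ e → - x e) allDarts (candidate i) =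
      raise δ x , e , raise-flow F (ℤ.i≤j⇒0≤j-i (subst (λ c → Within c (x e)) p (Flow.within F e))) fits , (p , q , r) ,
      ≡.trans (cong₂ (λ a b → x e ℤ.+ δ ℤ.* (bit a ℤ.- bit b)) r q) (lem (x e) N) ,
      λ z a b → raise-same δ x z (≡.trans b (sym a))
      where
      δ = N ℤ.- x e
      lem : ∀ x k → x ℤ.+ (k ℤ.- x) ℤ.* (1ℤ ℤ.- 0ℤ) ≡ k
      lem = solve-∀
      fits : ∀ {z} → Candidate z → x z ℤ.+ δ ℤ.≤ N
      fits {z} cz = begin
        x z ℤ.+ (N ℤ.- x e) ≡⟨ lem' (x z) N (x e) ⟩
        (N ℤ.+ x z) ℤ.+ - x e ≤⟨ ℤ.+-monoʳ-≤ (N ℤ.+ x z) (le (∈.∈-allFin z) cz) ⟩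
        (N ℤ.+ x z) ℤ.+ - x z ≡⟨ lem'' N (x z) ⟩
        N ∎
        where
        open ℤ.≤-Reasoning
        lem' : ∀ a b c → a ℤ.+ (b ℤ.- c) ≡ (b ℤ.+ a) ℤ.+ - c
        lem' = solve-∀
        lem'' : ∀ a b → (a ℤ.+ b) ℤ.+ - b ≡ a
        lem'' = solve-∀

  record ArcOk (x : Fin n → ℤ) (e : Fin n) : Set where
    field
      black-e : color e ≡ black
      full : x e ≡ N
      un : marked e ≡ false
      unα : marked (α e) ≡ false

  record DualTree (k : ℕ) : Set where
    field
      x : Fin n → ℤ
      flow : Flow x
      es : List (Fin n)
      arcs : Arcs es
      ok : ∀ {e} → e ∈ es → ArcOk x e
      number : length es ≡ k

  -- Earlier arcs stay saturated: both their sides lie outside the remaining faces, where raising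
  -- changes nothing.
  grow-tree : ∀ Rem (fuel : ℕ) → length Rem ≤ fuel → Rest Rem → (∀ {t} → marked t ≡ true → t ∉ concat Rem) → ∀ {x es} → Flow x → Arcs es →
    (∀ {e} → e ∈ es → ArcOk x e × e ∉ concat Rem × α e ∉ concat Rem) → DualTree (length es + length Rem)
  grow-tree [] fuel lt R aw {x} {es} F as ok = record { x = x ; flow = F ; es = es ; arcs = as ; ok = proj₁ ∘ ok ; number = sym (ℕ.+-identityʳ _) }
  grow-tree (c₀ ∷ Rem₀) (suc fuel) lt R aw {x} {es} F as ok = subst DualTree count-eq
      (grow-tree Rem' fuel (ℕ.≤-pred (ℕ.≤-trans (ℕ.≤-reflexive (sym (↭.↭-length p))) lt)) (proj₁ sh)
        (λ t k → aw t (incl k)) F' (arc c (rem-cyc c∈) (proj₁ cand) αe∈c (e-out ∘ in-c) (λ i → (proj₁ (proj₂ (ok i)) ∘ in-c) , (proj₂ (proj₂ (ok i)) ∘ in-c)) (λ t k → aw t (in-c k)) as)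
        (λ { (here refl) → record { black-e = proj₁ cand ; full = full' ; un = un-e ; unα = un-αe } , (e-out ∘ incl) , proj₁ (proj₂ sh) αe∈c
           ; (there i) → let o , a , b = ok i in record { black-e = ArcOk.black-e o ; full = ≡.trans (keep _ (X-out a) (X-out b)) (ArcOk.full o) ; un = ArcOk.un o ; unα = ArcOk.unα o }
                         , (a ∘ incl) , (b ∘ incl) }))
    where
    open Grow R aw
    Rem = c₀ ∷ Rem₀
    step = saturate-one F (∈.∈-concat⁺′ (proj₂ (All.lookup FD.inhabited (sub R (here refl)))) (here {xs = Rem₀} refl))
    e = proj₁ (proj₂ step)
    F' = proj₁ (proj₂ (proj₂ step))
    cand = proj₁ (proj₂ (proj₂ (proj₂ step)))
    full' = proj₁ (proj₂ (proj₂ (proj₂ (proj₂ step))))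
    keep = proj₂ (proj₂ (proj₂ (proj₂ (proj₂ step))))
    αe-in : α e ∈ concat Rem
    αe-in = in-X (proj₂ (proj₂ cand))
    e-out : e ∉ concat Rem
    e-out i = case ≡.trans (sym (X-in i)) (proj₁ (proj₂ cand)) of λ ()
    home = ∈.∈-concat⁻′ Rem αe-in
    c = proj₁ home
    αe∈c = proj₁ (proj₂ home)
    c∈ = proj₂ (proj₂ home)
    Rem' = proj₁ (∈-↭ c∈)
    p = proj₂ (∈-↭ c∈)
    sh = shrink R p
    incl : ∀ {d} → d ∈ concat Rem' → d ∈ concat Rem
    incl = proj₁ (proj₂ (proj₂ sh))
    in-c : ∀ {d} → d ∈ c → d ∈ concat Rem
    in-c i = ∈.∈-concat⁺′ i c∈
    un-e : marked e ≡ false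
    un-e = not-true (λ t → case ≡.trans (sym (proj₂ (proj₂ cand))) (X-ατ t) of λ ())
    un-αe : marked (α e) ≡ false
    un-αe = not-true (λ t → aw t αe-in)
    count-eq : suc (length es) + length Rem' ≡ length es + length Rem
    count-eq = ≡.trans (sym (ℕ.+-suc (length es) (length Rem'))) (cong (λ k → length es + k) (sym (↭.↭-length p)))

-- Growing a spanning tree

stems : List A → Forest A
stems [] = ε
stems (x ∷ l) = leaf x (stems l)

row-stems : (l : List A) → row (stems l) ≡ l
row-stems [] = refl
row-stems (x ∷ l) = cong (x ∷_) (row-stems l)

labels-stems : (l : List A) → labels (stems l) ≡ l
labels-stems [] = refl
labels-stems (x ∷ l) = cong (x ∷_) (labels-stems l)

edges-stems : (l : List A) → edges (stems l) ≡ []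
edges-stems [] = refl
edges-stems (x ∷ l) = edges-stems l

stems-wf : {σ α : A → A} {color : A → Color} → ∀ {c l} → All (λ z → color z ≡ c) l → Wf σ α color c (stems l)
stems-wf [] = tt
stems-wf (p ∷ ps) = p , stems-wf ps

-- G arises from F by replacing the stem d by an edge to a new vertex with rotation d' ∷ w.
data Insert {A : Set} (d d' : A) (w : List A) : Forest A → Forest A → Set where
  at    : ∀ {r} → Insert d d' w (leaf d r) (edge d d' (stems w) r)
  leafʳ : ∀ {e r r'} → Insert d d' w r r' → Insert d d' w (leaf e r) (leaf e r')
  edgeᵇ : ∀ {e e' b b' r} → Insert d d' w b b' → Insert d d' w (edge e e' b r) (edge e e' b' r)
  edgeʳ : ∀ {e e' b r r'} → Insert d d' w r r' → Insert d d' w (edge e e' b r) (edge e e' b r')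

insert : ∀ {d : A} d' w F → d ∈ leaves F → ∃ (Insert d d' w F)
insert d' w (leaf e r) (here refl) = _ , at
insert d' w (leaf e r) (there i) = let r' , p = insert d' w r i in leaf e r' , leafʳ p
insert d' w (edge e e' b r) i with ∈.∈-++⁻ (leaves b) i
... | inj₁ j = let b' , p = insert d' w b j in edge e e' b' r , edgeᵇ p
... | inj₂ j = let r' , p = insert d' w r j in edge e e' b r' , edgeʳ p

module _ {d d' : A} {w : List A} where

  insert-row : ∀ {F G} → Insert d d' w F G → row G ≡ row F
  insert-row at = refl
  insert-row (leafʳ p) = cong (_ ∷_) (insert-row p)
  insert-row (edgeᵇ p) = refl
  insert-row (edgeʳ p) = cong (_ ∷_) (insert-row p)

  insert-labels : ∀ {F G} → Insert d d' w F G → labels G ↭ labels F ++ d' ∷ w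
  insert-labels (at {r}) = prep d (trans (prep d' (trans (↭-reflexive (cong (_++ labels r) (labels-stems w))) (↭.++-comm w (labels r))))
    (↭-sym (↭.shift d' (labels r) w)))
  insert-labels (leafʳ p) = prep _ (insert-labels p)
  insert-labels (edgeᵇ {e} {e'} {b} {b'} {r} p) = prep e (prep e' (trans (↭.++⁺ʳ (labels r) (insert-labels p))
    (trans (↭-reflexive (List.++-assoc (labels b) (d' ∷ w) (labels r))) (trans (↭.++⁺ˡ (labels b) (↭.++-comm (d' ∷ w) (labels r)))
      (↭-reflexive (sym (List.++-assoc (labels b) (labels r) (d' ∷ w))))))))
  insert-labels (edgeʳ {e} {e'} {b} {r} p) = prep e (prep e' (trans (↭.++⁺ˡ (labels b) (insert-labels p)) (↭-reflexive (sym (List.++-assoc (labels b) (labels r) (d' ∷ w))))))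

  insert-edges : ∀ {F G} → Insert d d' w F G → edges G ↭ (d , d') ∷ edges F
  insert-edges (at {r}) = prep _ (↭-reflexive (cong (_++ edges r) (edges-stems w)))
  insert-edges (leafʳ p) = insert-edges p
  insert-edges (edgeᵇ {e} {e'} {b} {b'} {r} p) = trans (prep (e , e') (↭.++⁺ʳ (edges r) (insert-edges p))) (swap (e , e') (d , d') refl)
  insert-edges (edgeʳ {e} {e'} {b} {r} p) = trans (prep (e , e') (trans (↭.++⁺ˡ (edges b) (insert-edges p)) (↭.shift (d , d') (edges b) (edges r)))) (swap (e , e') (d , d') refl)

  module _ {σ α : A → A} {color : A → Color} (e : α d ≡ d') (cy : Cyc (Graph σ) (d' ∷ w)) (cols : All (λ z → color z ≡ flipC (color d)) (d' ∷ w)) where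

    insert-wf : ∀ {c F G} → Insert d d' w F G → Wf σ α color c F → Wf σ α color c G
    insert-wf at (refl , wf) = (refl , All.head cols , e , subst (λ l → Cyc (Graph σ) (d' ∷ l)) (sym (row-stems w)) cy) ,
      stems-wf (All.tail cols) , wf
    insert-wf (leafʳ p) (q , wf) = q , insert-wf p wf
    insert-wf (edgeᵇ {e' = e'} p) ((q₁ , q₂ , q₃ , cy') , wf , wf') = (q₁ , q₂ , q₃ , subst (λ l → Cyc (Graph σ) (e' ∷ l)) (sym (insert-row p)) cy') , insert-wf p wf , wf'
    insert-wf (edgeʳ p) (q , wf , wf') = q , wf , insert-wf p wf'

module Primal (m : Map) (pb : IsPointedBipartiteMap m) {L : List (List (Fin (Map.n m)))} (vd : Decomp (Map.σ m) L) where

  open Flows m pb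
  module VD = Decomp vd

  τ-home = VD.cycleOf (proj₁ nonempty)
  cτ = proj₁ τ-home
  cτ∈L = proj₂ (proj₂ τ-home)

  cτ-marked : ∀ {d} → d ∈ cτ → marked d ≡ true
  cτ-marked = All.lookup (cyc-closed {P = λ d → marked d ≡ true} (λ { {x} refl p → ≡.trans (marked-σ x) p }) cτ (VD.cyc cτ∈L) (proj₁ (proj₂ τ-home)) (proj₂ nonempty))

  marked-cτ : ∀ {d} → marked d ≡ true → d ∈ cτ
  marked-cτ {d} mk with k , _ , e ← ∈.find (Any.any⁻ (λ k → iter σ k (proj₁ nonempty) ≡ᶠᵇ d) (upTo n) (≡→T (one-vertex (proj₁ nonempty) d (proj₂ nonempty) mk))) =
    subst (_∈ cτ) (Fin.toℕ-injective (ℕ.≡ᵇ⇒≡ _ _ e)) (iter-∈ σ cτ (VD.cyc cτ∈L) (proj₁ (proj₂ τ-home)) k)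

  ρ-home = VD.cycleOf root
  cρ = proj₁ ρ-home

  cycle-color : ∀ {c d} → Cyc (Graph σ) c → d ∈ c → All (λ z → color z ≡ color d) c
  cycle-color {c} {d} cy i = cyc-closed {P = λ z → color z ≡ color d} (λ { {x} refl p → ≡.trans (color-σ x) p }) c cy i refl

  module Span {x : Fin n → ℤ} (flow : Flow x) where

    open Flow flow

    SlackAt : Fin n × Fin n → Set
    SlackAt (d , _) = Slack (color d) (x d)

    -- All darts of reached vertices that lie on no tree edge are leaves for now, including those
    -- that lead to τ or to unreached vertices. `Rem` lists the unreached vertices without τ, which
    -- is never attached.
    record Partial (F : Forest (Fin n)) (Rem : List (List (Fin n))) : Set where
      field
        wf : Wf σ α color (color root) F
        rootRow : Cyc (Graph σ) (row F)
        rootHd : ∃ λ l → row F ≡ root ∷ l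
        slack : All SlackAt (edges F)
        cover : labels F ++ concat Rem ++ cτ ↭ allFin n
        sub : ∀ {c} → c ∈ Rem → c ∈ L

    cap-sgn : ∀ c → cap c ≡ N ℤ.* sgn c
    cap-sgn black = sym (ℤ.*-identityʳ N)
    cap-sgn white = ≡.trans (sym (ℤ.-1*i≡-i N)) (ℤ.*-comm ℤ.-1ℤ N)

    no-multiple : ∀ z k → 0 < k → + k ℤ.< N → N ℤ.* z ℤ.+ + k ≡ 0ℤ → ⊥
    no-multiple (+ z) k 0<k k<N e = ℤ.<-irrefl (sym e) (ℤ.<-≤-trans (ℤ.+<+ 0<k)
      (ℤ.≤-trans (ℤ.i≤j+i (+ k) (+ (suc n * z))) (ℤ.≤-reflexive (cong (ℤ._+ + k) (ℤ.pos-* (suc n) z)))))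
    no-multiple (ℤ.-[1+ z ]) k 0<k k<N e = ℤ.<-irrefl e (begin-strict
      N ℤ.* ℤ.-[1+ z ] ℤ.+ + k ≤⟨ ℤ.+-monoˡ-≤ (+ k) (ℤ.*-monoˡ-≤-nonNeg N {ℤ.-[1+ z ]} {ℤ.-1ℤ} (ℤ.-≤- z≤n)) ⟩
      N ℤ.* ℤ.-1ℤ ℤ.+ + k <⟨ ℤ.+-monoʳ-< (N ℤ.* ℤ.-1ℤ) k<N ⟩
      N ℤ.* ℤ.-1ℤ ℤ.+ N ≡⟨ lem N ⟩
      0ℤ ∎)
      where
      open ℤ.≤-Reasoning
      lem : ∀ a → a ℤ.* ℤ.-1ℤ ℤ.+ a ≡ 0ℤ
      lem = solve-∀

    module Step {F c Rem} (P : Partial F (c ∷ Rem)) where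
      open Partial P

      R : List (Fin n)
      R = concat (c ∷ Rem)

      uniq-all : Unique (labels F ++ R ++ cτ)
      uniq-all = uniq-↭ (↭-sym cover) (Unique.allFin⁺ n)

      U : Fin n → Bool
      U d = does (d ∈? R)

      R-cyc : ∀ {d} → d ∈ R → ∃ λ c' → d ∈ c' × c' ∈ c ∷ Rem
      R-cyc = ∈.∈-concat⁻′ (c ∷ Rem)

      away : Away U
      away = record { closed = cl ; ∌ρ = does-no (root ∈? R) (λ i → uniq-disj (labels F) uniq-all (row⊆labels F (subst (root ∈_) (sym (proj₂ rootHd)) (here refl))) (∈.∈-++⁺ˡ i))
                    ; ∌τ = λ {d} mk → does-no (d ∈? R) (λ i → uniq-disj R (uniq-++ʳ (labels F) uniq-all) i (marked-cτ mk)) }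
        where
        cl : ∀ d → U (σ d) ≡ U d
        cl d with d ∈? R
        ... | yes i with c' , j , q ← R-cyc i with z , refl , k ← cyc-next c' (VD.cyc (sub q)) j = does-yes (σ d ∈? R) (∈.∈-concat⁺′ k q)
        ... | no ni = does-no (σ d ∈? R) back
          where
          back : σ d ∉ R
          back i with c' , j , q ← R-cyc i with e , k , eq ← ∈.∈-map⁻ σ (↭.∈-resp-↭ (↭-sym (cyc-shift σ c' (VD.cyc (sub q)))) j) =
            ni (subst (_∈ R) (≡.trans (sym (proj₂ (proj₂ σ-perm) e)) (≡.trans (cong σ⁻ (sym eq)) (proj₂ (proj₂ σ-perm) d))) (∈.∈-concat⁺′ k q))

      slackAt? : ∀ d → Dec (Slack (color d) (x d))
      slackAt? d with color d
      ... | black = x d ℤ.<? N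
      ... | white = - N ℤ.<? x d

      where-is : ∀ d → d ∈ labels F ⊎ d ∈ R ⊎ d ∈ cτ
      where-is d with ∈.∈-++⁻ (labels F) (↭.∈-resp-↭ (↭-sym cover) (∈.∈-allFin d))
      ... | inj₁ i = inj₁ i
      ... | inj₂ i = inj₂ (∈.∈-++⁻ R i)

      -- Conservation modulo N: the unreached vertices cannot be separated by saturated edges only.
      exit : (∃ λ d → d ∈ allDarts × (d ∈ labels F × α d ∈ R × Slack (color d) (x d)))
      exit with search (λ d → (d ∈? labels F) ×-dec (α d ∈? R) ×-dec slackAt? d) allDarts
      ... | inj₁ r = r
      ... | inj₂ stuck = ⊥-elim (no-multiple (∑ (λ d → bit (cross U d) ℤ.* sgn (color d)) allDarts) (count U allDarts) pos (count<N U) (begin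
          N ℤ.* ∑ (λ d → bit (cross U d) ℤ.* sgn (color d)) allDarts ℤ.+ + count U allDarts ≡⟨ cong (ℤ._+ + count U allDarts) (sym (∑-* N _ allDarts)) ⟩
          ∑ (λ d → N ℤ.* (bit (cross U d) ℤ.* sgn (color d))) allDarts ℤ.+ + count U allDarts ≡⟨ cong (ℤ._+ + count U allDarts) (∑-cong allDarts (λ {d} _ → sym (term d))) ⟩
          ∑ (λ d → bit (cross U d) ℤ.* x d) allDarts ℤ.+ + count U allDarts ≡⟨ cong (ℤ._+ + count U allDarts) (sym (∑-cross anti U)) ⟩
          ∑ (λ d → bit (U d) ℤ.* x d) allDarts ℤ.+ + count U allDarts ≡⟨ sym (demand-eq x U) ⟩
          demand x U ≡⟨ conserve U away ⟩
          0ℤ ∎))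
        where
        open ≡-Reasoning
        c-inh = All.lookup VD.inhabited (sub (here refl))
        pos : 0 < count U allDarts
        pos = count>0 U allDarts (∈.∈-allFin (proj₁ c-inh)) (does-yes (proj₁ c-inh ∈? R) (∈.∈-++⁺ˡ (proj₂ c-inh)))
        U-in : ∀ {d} → U d ≡ true → d ∈ R
        U-in {d} e with d ∈? R
        ... | yes i = i
        U-out : ∀ {d} → U d ≡ false → d ∉ R
        U-out {d} e with d ∈? R
        ... | no i = i
        saturated : ∀ {d} → cross U d ≡ true → x d ≡ cap (color d)
        saturated {d} e with p , q ← cross⇒ {U d} e with where-is (α d)
        ... | inj₂ (inj₁ i) = ⊥-elim (U-out q i)
        ... | inj₂ (inj₂ i) = sat-flip anti (sat-τ (cτ-marked i))
        ... | inj₁ i with slack? (color (α d)) (within (α d))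
        ...   | inj₁ s = sat-flip anti s
        ...   | inj₂ s = ⊥-elim (stuck (∈.∈-allFin (α d)) (i , subst (_∈ R) (sym (α-invol d)) (U-in p) , s))
        lem : ∀ b n s → b ℤ.* (n ℤ.* s) ≡ n ℤ.* (b ℤ.* s)
        lem = solve-∀
        term : ∀ d → bit (cross U d) ℤ.* x d ≡ N ℤ.* (bit (cross U d) ℤ.* sgn (color d))
        term d = ≡.trans (go (cross U d) refl) (lem (bit (cross U d)) N (sgn (color d)))
          where
          go : ∀ b → cross U d ≡ b → bit (cross U d) ℤ.* x d ≡ bit (cross U d) ℤ.* (N ℤ.* sgn (color d))
          go true e = cong (λ z → bit (cross U d) ℤ.* z) (≡.trans (saturated e) (cap-sgn (color d)))
          go false e rewrite e = refl

      leaf-d : ∀ d → d ∈ labels F → α d ∈ R → d ∈ leaves F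
      leaf-d d i j with ∈.∈-++⁻ (sides (edges F)) (↭.∈-resp-↭ (↭-sym (sides-leaves F)) i)
      ... | inj₂ k = k
      ... | inj₁ k with sides-∈ (edges F) k
      ...   | z , inj₁ e = ⊥-elim (uniq-disj (labels F) uniq-all (↭.∈-resp-↭ (sides-leaves F) (∈.∈-++⁺ˡ (proj₂ (∈-sides e))))
                (∈.∈-++⁺ˡ (subst (_∈ R) (All.lookup (wf-edges σ α color _ F wf) e) j)))
      ...   | z , inj₂ e = ⊥-elim (uniq-disj (labels F) uniq-all (↭.∈-resp-↭ (sides-leaves F) (∈.∈-++⁺ˡ (proj₁ (∈-sides e))))
                (∈.∈-++⁺ˡ (subst (_∈ R) (≡.trans (cong α (sym (All.lookup (wf-edges σ α color _ F wf) e))) (α-invol z)) j)))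

      next : ∃₂ λ F' Rem' → Partial F' Rem' × length (edges F') ≡ suc (length (edges F)) × length (c ∷ Rem) ≡ suc (length Rem')
      next with d , _ , d∈ , αd∈ , s ← exit with c' , i , q ← R-cyc αd∈ with u , v , refl ← ∈-split i with Rem' , p ← ∈-↭ q
        with F' , I ← insert (α d) (v ++ u) F (leaf-d d d∈ αd∈) = F' , Rem' , record
          { wf = insert-wf {σ = σ} {α} {color} refl cy (All.map (λ e → ≡.trans e (color-α d)) (cycle-color cy (here refl))) I wf
          ; rootRow = subst (Cyc (Graph σ)) (sym (insert-row I)) rootRow
          ; rootHd = proj₁ rootHd , ≡.trans (insert-row I) (proj₂ rootHd)
          ; slack = ↭.All-resp-↭ (↭-sym (insert-edges I)) (s ∷ slack)
          ; cover = trans cov cover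
          ; sub = λ j → sub (↭.∈-resp-↭ (↭-sym p) (there j)) } ,
          ↭.↭-length (insert-edges I) , ↭.↭-length p
        where
        cy : Cyc (Graph σ) (α d ∷ v ++ u)
        cy = cyc-rot u (α d ∷ v) (VD.cyc (sub q))
        cov : labels F' ++ concat Rem' ++ cτ ↭ labels F ++ R ++ cτ
        cov = trans (↭.++⁺ʳ (concat Rem' ++ cτ) (insert-labels I)) (trans (↭-reflexive (List.++-assoc (labels F) (α d ∷ v ++ u) (concat Rem' ++ cτ)))
          (↭.++⁺ˡ (labels F) (trans (↭.++⁺ʳ (concat Rem' ++ cτ) (↭.++-comm (α d ∷ v) u)) (trans (↭-reflexive (sym (List.++-assoc (u ++ α d ∷ v) (concat Rem') cτ)))
            (↭.++⁺ʳ cτ (concat-↭ (↭-sym p)))))))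

    span : ∀ fuel {F Rem} → length Rem ≤ fuel → Partial F Rem → ∃ λ F' → Partial F' [] × length (edges F') ≡ length (edges F) + length Rem
    span fuel {F} {[]} le P = F , P , sym (ℕ.+-identityʳ _)
    span (suc fuel) {F} {c ∷ Rem} le P with F₁ , Rem₁ , P₁ , e , k ← Step.next P
      with F₂ , P₂ , e₂ ← span fuel (ℕ.≤-pred (ℕ.≤-trans (ℕ.≤-reflexive (sym k)) le)) P₁ =
      F₂ , P₂ , ≡.trans e₂ (≡.trans (cong (_+ length Rem₁) e) (≡.trans (sym (ℕ.+-suc (length (edges F)) (length Rem₁))) (cong (λ z → length (edges F) + z) (sym k))))

    -- One tree edge is added per vertex other than the root vertex and τ, hence the summand 2.
    spanning-tree : ∃ λ F → Partial F [] × 2 + length (edges F) ≡ length L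
    spanning-tree with u , v , e ← ∈-split (proj₁ (proj₂ ρ-home)) with L₁ , p ← ∈-↭ (proj₂ (proj₂ ρ-home)) = result (↭.∈-resp-↭ p cτ∈L)
      where
      ρ-not-τ : cτ ≢ cρ
      ρ-not-τ q = case ≡.trans (sym root-not-τ) (cτ-marked (subst (root ∈_) (sym q) (proj₁ (proj₂ ρ-home)))) of λ ()
      cρ-eq : cρ ≡ u ++ root ∷ v
      cρ-eq = e
      cy : Cyc (Graph σ) (root ∷ v ++ u)
      cy = cyc-rot u (root ∷ v) (subst (Cyc (Graph σ)) cρ-eq (VD.cyc (proj₂ (proj₂ ρ-home))))
      result : cτ ∈ cρ ∷ L₁ → ∃ λ F → Partial F [] × 2 + length (edges F) ≡ length L
      result (here q) = ⊥-elim (ρ-not-τ q)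
      result (there q) with L₂ , p₂ ← ∈-↭ q = let F' , P' , k = span (length L₂) ℕ.≤-refl init in
        F' , P' , ≡.trans (cong (λ z → 2 + z) (≡.trans k (cong (_+ length L₂) (cong length (edges-stems (v ++ u))))))
          (≡.trans (cong suc (sym (↭.↭-length p₂))) (sym (↭.↭-length p)))
        where
        init : Partial (stems (root ∷ v ++ u)) L₂
        init = record
          { wf = stems-wf (cycle-color cy (here refl))
          ; rootRow = subst (Cyc (Graph σ)) (sym (row-stems (root ∷ v ++ u))) cy
          ; rootHd = v ++ u , row-stems (root ∷ v ++ u)
          ; slack = subst (All SlackAt) (sym (edges-stems (root ∷ v ++ u))) []
          ; cover = trans (↭.++⁺ (trans (↭-reflexive (labels-stems (root ∷ v ++ u))) (trans (↭.++-comm (root ∷ v) u) (↭-reflexive (sym cρ-eq)))) (↭.++-comm (concat L₂) cτ))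
              (trans (↭.++⁺ˡ cρ (concat-↭ (↭-sym p₂))) (trans (concat-↭ (↭-sym p)) VD.cover))
          ; sub = λ i → ↭.∈-resp-↭ (↭-sym p) (there (↭.∈-resp-↭ (↭-sym p₂) (there i))) }

-- From the order of the search to a parenthesis word

module Open (m : Map) (pb : IsPointedBipartiteMap m) {τc : Color} (τ-is : τColorIs m τc)
  {LF : List (List (Fin (Map.n m)))} (fd : Decomp (Map.σ m ∘ Map.α m) LF) where

  open Flows m pb
  open Dual m pb fd
  open Gaps α (σ ∘ α)

  Pairs : Fin n → Fin n → Set
  Pairs o z = color o ≡ black × color z ≡ white × α o ≡ z

  -- The darts that must be leaves: both sides of the arcs and the other ends of the edges at τ.
  data Stems (es : List (Fin n)) (z : Fin n) : Set where
    out  : z ∈ es → Stems es z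
    back : α z ∈ es → Stems es z
    τ-st : marked (α z) ≡ true → Stems es z

  record Opened (es : List (Fin n)) (w : List (Fin n)) : Set where
    field
      us : List (Fin n)
      good : Good Pairs us w
      gaps : List Gap
      cyc : Cyc Next gaps
      stems≡ : map proj₁ gaps ≡ us
      uniq : Unique us
      us⇒ : ∀ {u} → u ∈ us → marked (α u) ≡ true
      us⇐ : ∀ {u} → marked (α u) ≡ true → u ∈ us

  -- The last face reached is bordered by tree edges only, except for the arc e entering it,
  -- so that e and α e are consecutive among the stems.
  open-arcs : ∀ {es} → Arcs es → (∀ {e} → e ∈ es → marked e ≡ false × marked (α e) ≡ false) →
    ∀ G → Cyc Next G → Unique (map proj₁ G) → (∀ {z} → z ∈ map proj₁ G → Stems es z) → (∀ {z} → Stems es z → z ∈ map proj₁ G) →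
    Opened es (map proj₁ G)
  open-arcs start un G cy u s t = record
    { us = map proj₁ G ; good = base ; gaps = G ; cyc = cy ; stems≡ = refl ; uniq = u
    ; us⇒ = λ i → case s i of λ { (τ-st mk) → mk } ; us⇐ = λ mk → t (τ-st mk) }
  open-arcs {e ∷ es} (arc c ccy be αe∈c e∉c old notτ as) un G cy u s t
    with (e' , mg) , i , refl ← ∈.∈-map⁻ proj₁ (t (out (here refl))) with G₁ , G₂ , refl ← ∈-split i =
    go (G₂ ++ G₁) refl (cyc-rot G₁ ((e , mg) ∷ G₂) cy)
    where
    stems-eq : map proj₁ (G₁ ++ (e , mg) ∷ G₂) ≡ map proj₁ G₁ ++ map proj₁ ((e , mg) ∷ G₂)
    stems-eq = List.map-++ proj₁ G₁ _
    rot-eq : map proj₁ (((e , mg) ∷ G₂) ++ G₁) ≡ map proj₁ ((e , mg) ∷ G₂) ++ map proj₁ G₁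
    rot-eq = List.map-++ proj₁ ((e , mg) ∷ G₂) G₁
    perm : map proj₁ (G₁ ++ (e , mg) ∷ G₂) ↭ e ∷ map proj₁ (G₂ ++ G₁)
    perm = trans (↭-reflexive stems-eq) (trans (↭.++-comm (map proj₁ G₁) _) (↭-reflexive (sym rot-eq)))
    u' : Unique (e ∷ map proj₁ (G₂ ++ G₁))
    u' = uniq-↭ perm u
    αe≢e : α e ≢ e
    αe≢e = α-fixfree e
    face-closed : ∀ {a b} → φ a ≡ b → a ∈ c → b ∈ c
    face-closed refl i with z , refl , j ← cyc-next c ccy i = j
    -- Arcs chosen before `e` have no side on `c`, and a stem leading to τ is followed on its face
    -- by a dart of τ, which `c` does not contain.
    only-αe : ∀ {z} → z ∈ c → Stems (e ∷ es) z → z ≡ α e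
    only-αe i (out (here refl)) = ⊥-elim (e∉c i)
    only-αe i (out (there j)) = ⊥-elim (proj₁ (old j) i)
    only-αe {z} i (back (here q)) = ≡.trans (sym (α-invol z)) (cong α q)
    only-αe {z} i (back (there j)) = ⊥-elim (proj₂ (old j) (subst (_∈ c) (sym (α-invol z)) i))
    only-αe {z} i (τ-st mk) = ⊥-elim (notτ (≡.trans (marked-σ (α z)) mk) (face-closed refl i))
    no-swap : ∀ {z} → α z ≡ e → z ≡ α e
    no-swap {z} q = ≡.trans (sym (α-invol z)) (cong α q)
    go : ∀ H → H ≡ G₂ ++ G₁ → Cyc Next ((e , mg) ∷ H) → Opened (e ∷ es) (map proj₁ (G₁ ++ (e , mg) ∷ G₂))
    go [] q ch with ↭.∈-resp-↭ perm (t (back (here (α-invol e))))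
    ... | here r = ⊥-elim (αe≢e r)
    ... | there j with () ← subst (λ H → α e ∈ map proj₁ H) (sym q) j
    go ((z , mz) ∷ H') q (n , ch)
      -- The gap after `e` runs inside the face `c`, from `α e` on, so the stem that ends it lies on
      -- `c` and must be `α e`.
      with refl ← only-αe (proj₂ (chain-closed {P = _∈ c} face-closed mg n αe∈c))
                          (s (↭.∈-resp-↭ (↭-sym perm) (there (subst (λ H → z ∈ map proj₁ H) q (here refl)))))
      with Data.List.Base.initLast H'
    ... | [] = ⊥-elim (lonely (↭.∈-resp-↭ perm (t (τ-st (≡.trans (cong marked (α-invol t₀)) mt₀)))))
      where
      t₀ = proj₁ nonempty
      mt₀ = proj₂ nonempty
      lonely : α t₀ ∈ e ∷ map proj₁ (G₂ ++ G₁) → ⊥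
      lonely (here r) = case ≡.trans (sym (proj₂ (un (here refl)))) (≡.trans (cong marked (≡.trans (cong α (sym r)) (α-invol t₀))) mt₀) of λ ()
      lonely (there j) with subst (λ H → α t₀ ∈ map proj₁ H) (sym q) j
      ... | here r = case ≡.trans (sym (proj₁ (un (here refl)))) (≡.trans (cong marked (≡.trans (sym (α-invol e)) (≡.trans (cong α (sym r)) (α-invol t₀)))) mt₀) of λ ()
    ... | K Data.List.Base.∷ʳ′ (y , my) = record
      { us = Opened.us rec ; gaps = Opened.gaps rec ; cyc = Opened.cyc rec ; stems≡ = Opened.stems≡ rec ; uniq = Opened.uniq rec
      ; us⇒ = Opened.us⇒ rec ; us⇐ = Opened.us⇐ rec
      ; good = subst (Good Pairs (Opened.us rec)) (sym stems-eq) (good-rot (map proj₁ ((e , mg) ∷ G₂)) (map proj₁ G₁)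
          (subst (Good Pairs (Opened.us rec)) (≡.trans (cong (e ∷_) (≡.trans (cong (α e ∷_) new-stems) (cong (map proj₁) q))) rot-eq)
            (ins (be , ≡.trans (color-α e) (cong flipC be) , refl) (Opened.good rec)))) }
      where
      G' = K ++ [ (y , my ++ e ∷ mz) ]
      new-stems : map proj₁ G' ≡ map proj₁ (K ++ [ (y , my) ])
      new-stems = ≡.trans (List.map-++ proj₁ K _) (sym (List.map-++ proj₁ K _))
      perm' : map proj₁ (G₁ ++ (e , mg) ∷ G₂) ↭ e ∷ α e ∷ map proj₁ G'
      perm' = trans perm (prep e (↭-reflexive (≡.trans (cong (map proj₁) (sym q)) (cong (α e ∷_) (sym new-stems)))))
      u'' : Unique (e ∷ α e ∷ map proj₁ G')
      u'' = uniq-↭ perm' u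
      fwd : ∀ {z} → z ∈ map proj₁ G' → Stems es z
      fwd {z} i with s (↭.∈-resp-↭ (↭-sym perm') (there (there i)))
      ... | out (here refl) = ⊥-elim (uniq-head u'' (there i))
      ... | out (there j) = out j
      ... | back (here r) = ⊥-elim (uniq-head (uniq-tail u'') (subst (_∈ map proj₁ G') (no-swap r) i))
      ... | back (there j) = back j
      ... | τ-st mk = τ-st mk
      widen : ∀ {z} → Stems es z → Stems (e ∷ es) z
      widen (out i) = out (there i)
      widen (back i) = back (there i)
      widen (τ-st mk) = τ-st mk
      no-e : Stems es e → ⊥
      no-e (out i) = proj₂ (old i) αe∈c
      no-e (back i) = proj₁ (old i) αe∈c
      no-e (τ-st mk) = case ≡.trans (sym (proj₂ (un (here refl)))) mk of λ ()
      no-αe : Stems es (α e) → ⊥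
      no-αe (out i) = proj₁ (old i) αe∈c
      no-αe (back i) = proj₂ (old i) (subst (_∈ c) (cong α (sym (α-invol e))) αe∈c)
      no-αe (τ-st mk) = case ≡.trans (sym (proj₁ (un (here refl)))) (≡.trans (cong marked (sym (α-invol e))) mk) of λ ()
      bwd : ∀ {z} → Stems es z → z ∈ map proj₁ G'
      bwd p with ↭.∈-resp-↭ perm' (t (widen p))
      ... | here refl = ⊥-elim (no-e p)
      ... | there (here refl) = ⊥-elim (no-αe p)
      ... | there (there i) = i
      rec : Opened es (map proj₁ G')
      rec = open-arcs as (un ∘ there) G' (merge K (α-invol e) ch) (uniq-tail (uniq-tail u'')) fwd bwd

-- Every tight pair has a structure

module Existence (m : Map) (pb : IsPointedBipartiteMap m) {τc : Color} (τ-is : τColorIs m τc) where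

  open TreeFlow m pb

  module _ {LV LF : List (List (Fin n))} (vd : Decomp σ LV) (fd : Decomp (σ ∘ α) LF) where

    private
      module FD = Decomp fd
      module D = Dual m pb fd
      module P = Primal m pb vd
      open Gaps α (σ ∘ α)
      open Open m pb τ-is fd using (Stems; out; back; τ-st; Opened; open-arcs; Pairs)

    module Trees (ts : List (Fin n)) (uniq-ts : Unique ts) (ts⇒ : ∀ {t} → t ∈ ts → marked t ≡ true) (ts⇐ : ∀ {t} → marked t ≡ true → t ∈ ts)
                 (tf : D.TauFaces ts) (dt : D.DualTree (length (D.TauFaces.Rem tf)))
                 {F : Forest (Fin n)} (span : P.Span.Partial (D.DualTree.flow dt) F []) (edge-number : 2 + length (edges F) ≡ length LV) where

      open D.TauFaces tf using (fresh; sub-ts; uniqF; apart) renaming (number to fresh-number)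
      open D.DualTree dt
      open D.ArcOk
      open P.Span flow using (SlackAt; module Partial)
      open Flow flow
      open Partial span

      labels-cτ : labels F ++ P.cτ ↭ allFin n
      labels-cτ = cover

      uniq-all : Unique (labels F ++ P.cτ)
      uniq-all = uniq-↭ (↭-sym labels-cτ) (Unique.allFin⁺ n)

      uniq-labels : Unique (labels F)
      uniq-labels = uniq-++ˡ (labels F) uniq-all

      unmarked : ∀ {z} → z ∈ labels F → marked z ≡ false
      unmarked {z} i with marked z in e
      ... | false = refl
      ... | true = ⊥-elim (uniq-disj (labels F) uniq-all i (P.marked-cτ e))

      is-label : ∀ {z} → marked z ≡ false → z ∈ labels F
      is-label {z} e with ∈.∈-++⁻ (labels F) (↭.∈-resp-↭ (↭-sym labels-cτ) (∈.∈-allFin z))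
      ... | inj₁ i = i
      ... | inj₂ i = ⊥-elim (case ≡.trans (sym e) (P.cτ-marked i) of λ ())

      split-uniq : Unique (sides (edges F) ++ leaves F)
      split-uniq = uniq-↭ (↭-sym (sides-leaves F)) uniq-labels

      side-slack : ∀ {z} → z ∈ sides (edges F) → Slack (color z) (x z)
      side-slack {z} i with sides-∈ (edges F) i
      ... | y , inj₁ j = All.lookup slack j
      ... | y , inj₂ j with refl ← All.lookup (wf-edges σ α color _ F wf) j =
        ≡.subst₂ Slack (sym (color-α y)) (sym (anti y)) (slack-neg (color y) (All.lookup slack j))

      arc-sat : ∀ {e} → e ∈ es → x e ≡ cap (color e)
      arc-sat i = ≡.trans (full (ok i)) (cong cap (sym (black-e (ok i))))

      stem-sat : ∀ {z} → Stems es z → x z ≡ cap (color z)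
      stem-sat (out i) = arc-sat i
      stem-sat (back i) = sat-flip anti (arc-sat i)
      stem-sat (τ-st mk) = sat-flip anti (sat-τ mk)

      opposite-unmarked : ∀ {z} → marked (α z) ≡ true → marked z ≡ false
      opposite-unmarked {z} mk with marked z in e
      ... | false = refl
      ... | true = ⊥-elim (color-flip-≢ (≡.trans (≡.trans (τ-is z e) (sym (τ-is (α z) mk))) (color-α z)))

      stem-unmarked : ∀ {z} → Stems es z → marked z ≡ false
      stem-unmarked (out i) = un (ok i)
      stem-unmarked {z} (back i) = ≡.trans (cong marked (sym (α-invol z))) (unα (ok i))
      stem-unmarked (τ-st mk) = opposite-unmarked mk

      sat-not-side : ∀ {z} → x z ≡ cap (color z) → z ∉ sides (edges F)
      sat-not-side {z} e i = slack-≢ (color z) (subst (Slack (color z)) e (side-slack i))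

      stem-leaf : ∀ {z} → Stems es z → z ∈ leaves F
      stem-leaf p with ∈.∈-++⁻ (sides (edges F)) (↭.∈-resp-↭ (↭-sym (sides-leaves F)) (is-label (stem-unmarked p)))
      ... | inj₁ i = ⊥-elim (sat-not-side (stem-sat p) i)
      ... | inj₂ i = i

      arcs-uniq : ∀ {es} → D.Arcs es → Unique es
      arcs-uniq D.start = []
      arcs-uniq (D.arc c _ _ αe∈c _ old _ as) = ∷-uniq (λ i → proj₂ (old i) αe∈c) (arcs-uniq as)

      arc-darts τ-darts Z : List (Fin n)
      arc-darts = es ++ map α es
      τ-darts = ts ++ map α ts
      Z = sides (edges F) ++ arc-darts ++ τ-darts

      α-inj : ∀ {a b} → α a ≡ α b → a ≡ b
      α-inj {a} {b} e = ≡.trans (sym (α-invol a)) (≡.trans (cong α e) (α-invol b))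

      arc-dart : ∀ {z} → z ∈ arc-darts → z ∈ es ⊎ α z ∈ es
      arc-dart i with ∈.∈-++⁻ es i
      ... | inj₁ j = inj₁ j
      ... | inj₂ j with e , k , refl ← ∈.∈-map⁻ α j = inj₂ (subst (_∈ es) (sym (α-invol e)) k)

      τ-dart : ∀ {z} → z ∈ τ-darts → marked z ≡ true ⊎ marked (α z) ≡ true
      τ-dart i with ∈.∈-++⁻ ts i
      ... | inj₁ j = inj₁ (ts⇒ j)
      ... | inj₂ j with e , k , refl ← ∈.∈-map⁻ α j = inj₂ (≡.trans (cong marked (α-invol e)) (ts⇒ k))

      -- Tree sides are slack while arcs and edges at τ are saturated. Arcs avoid τ at both ends,
      -- and in each of these two families one side is the black one, which keeps the two sides
      -- apart.
      Z-uniq : Unique Z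
      Z-uniq = uniq-++ (sides (edges F)) (uniq-++ˡ (sides (edges F)) split-uniq)
        (uniq-++ arc-darts
          (uniq-++ es (arcs-uniq arcs) (Unique.map⁺ α-inj (arcs-uniq arcs)) (λ i j → case ∈.∈-map⁻ α j of λ
            { (e , k , refl) → color-flip-≢ (≡.trans (≡.trans (black-e (ok k)) (sym (black-e (ok i)))) (color-α e)) }))
          (uniq-++ ts uniq-ts (Unique.map⁺ α-inj uniq-ts) (λ i j → case ∈.∈-map⁻ α j of λ
            { (t , k , refl) → color-flip-≢ (≡.trans (≡.trans (τ-is t (ts⇒ k)) (sym (τ-is (α t) (ts⇒ i)))) (color-α t)) }))
          (λ i j → arc-τ (arc-dart i) (τ-dart j)))
        (λ i j → case ∈.∈-++⁻ arc-darts j of λ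
          { (inj₁ k) → sat-not-side (case arc-dart k of λ { (inj₁ l) → arc-sat l ; (inj₂ l) → sat-flip anti (arc-sat l) }) i
          ; (inj₂ k) → sat-not-side (case τ-dart k of λ { (inj₁ l) → sat-τ l ; (inj₂ l) → sat-flip anti (sat-τ l) }) i })
        where
        clash : ∀ {b} → b ≡ false → b ≡ true → ⊥
        clash refl ()
        arc-τ : ∀ {z} → z ∈ es ⊎ α z ∈ es → marked z ≡ true ⊎ marked (α z) ≡ true → ⊥
        arc-τ (inj₁ i) (inj₁ k) = clash (un (ok i)) k
        arc-τ (inj₁ i) (inj₂ k) = clash (unα (ok i)) k
        arc-τ {z} (inj₂ i) (inj₁ k) = clash (unα (ok i)) (≡.trans (cong marked (α-invol z)) k)
        arc-τ (inj₂ i) (inj₂ k) = clash (un (ok i)) k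

      private
        ne = length (edges F)
        na = length es
        nf = length fresh
        nt = length ts

      euler-count : n + 4 ≡ ((ne + ne) + (na + na) + 4) + (nf + nf)
      euler-count = begin
        n + 4 ≡⟨ sym euler ⟩
        2 * (numVertices m + numFaces m) ≡⟨ cong₂ (λ a b → 2 * (a + b)) (Decomp.orbits vd) (Decomp.orbits fd) ⟩
        2 * (length LV + length LF) ≡⟨ cong₂ (λ a b → 2 * (a + b)) (sym edge-number) (sym (≡.trans (cong (λ z → nf + z) number) fresh-number)) ⟩
        2 * ((2 + ne) + (nf + na)) ≡⟨ lem ne nf na ⟩
        ((ne + ne) + (na + na) + 4) + (nf + nf) ∎
        where
        open ≡-Reasoning
        lem : ∀ e f a → 2 * ((2 + e) + (f + a)) ≡ ((e + e) + (a + a) + 4) + (f + f)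
        lem = ℕSolver.solve-∀

      Z-length : length Z + 4 ≡ ((ne + ne) + (na + na) + 4) + (nt + nt)
      Z-length = begin
        length Z + 4 ≡⟨ cong (_+ 4) (≡.trans (List.length-++ (sides (edges F))) (cong₂ _+_ (length-sides (edges F)) (≡.trans (List.length-++ arc-darts)
             (cong₂ _+_ (double es) (double ts))))) ⟩
        (ne + ne) + ((na + na) + (nt + nt)) + 4 ≡⟨ lem (ne + ne) (na + na) (nt + nt) ⟩
        ((ne + ne) + (na + na) + 4) + (nt + nt) ∎
        where
        open ≡-Reasoning
        double : ∀ l → length (l ++ map α l) ≡ length l + length l
        double l = ≡.trans (List.length-++ l) (cong (λ z → length l + z) (List.length-map α l))
        lem : ∀ a b c → a + (b + c) + 4 ≡ (a + b + 4) + c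
        lem = ℕSolver.solve-∀

      n-all : length (allFin n) ≡ n
      n-all = List.length-tabulate {n = n} id

      -- Without repetition `Z` has at most `n` entries. Against Euler's formula this leaves at
      -- least as many faces around τ as τ has darts, so distinct darts of τ lie on distinct faces.
      nt≤nf : nt ≤ nf
      nt≤nf = ℕ.≮⇒≥ (λ lt → ℕ.<-irrefl refl (ℕ.<-≤-trans (ℕ.+-mono-< lt lt)
        (ℕ.+-cancelˡ-≤ ((ne + ne) + (na + na) + 4) (nt + nt) (nf + nf)
          (ℕ.≤-trans (ℕ.≤-reflexive (sym Z-length)) (ℕ.≤-trans (ℕ.+-monoˡ-≤ 4 (ℕ.≤-trans (sub-length Z-uniq (λ _ → ∈.∈-allFin _)) (ℕ.≤-reflexive n-all)))
            (ℕ.≤-reflexive euler-count))))))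

      fresh-all : ∀ {t} → marked t ≡ true → t ∈ fresh
      fresh-all mk = ↭.∈-resp-↭ (sub-full uniqF sub-ts nt≤nf) (ts⇐ mk)

      -- With as many fresh darts as darts of τ the count becomes an equality: there is no edge
      -- besides those of the tree, the arcs and the edges at τ.
      Z-all : ∀ z → z ∈ Z
      Z-all z = ↭.∈-resp-↭ (sub-full Z-uniq (λ _ → ∈.∈-allFin _) (ℕ.+-cancelʳ-≤ 4 (length (allFin n)) (length Z) (ℕ.≤-trans (ℕ.≤-reflexive (≡.trans (cong (_+ 4) n-all) euler-count))
        (ℕ.≤-trans (ℕ.+-monoʳ-≤ ((ne + ne) + (na + na) + 4) (ℕ.+-mono-≤ nf≤nt nf≤nt)) (ℕ.≤-reflexive (sym Z-length)))))) (∈.∈-allFin z)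
        where
        nf≤nt : nf ≤ nt
        nf≤nt = sub-length uniqF sub-ts

      -- Distinct darts of τ lie on distinct faces, hence the stems left over are met in reverse order around τ.
      τ-step : ∀ {u u' g} → Chain (Graph (σ ∘ α)) (α u) g u' → marked (α u) ≡ true → marked (α u') ≡ true → σ (α u') ≡ α u
      τ-step {u} {u'} {g} ch mu mu' = let c , k , q = FD.cycleOf (α u) in
        apart (fresh-all (≡.trans (marked-σ (α u')) mu')) (fresh-all mu) q (closed q refl (proj₂ (chain-closed {P = _∈ c} (closed q) g ch k))) k
        where
        closed : ∀ {c y z} → c ∈ LF → σ (α y) ≡ z → y ∈ c → z ∈ c
        closed {c} q refl y∈ with z , refl , w ← cyc-next c (FD.cyc q) y∈ = w

      leaf-stem : ∀ {z} → z ∈ leaves F → Stems es z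
      leaf-stem {z} i = go (∈.∈-++⁻ (sides (edges F)) (Z-all z))
        where
        arc-case : z ∈ es ⊎ α z ∈ es → Stems es z
        arc-case (inj₁ l) = out l
        arc-case (inj₂ l) = back l
        τ-case : marked z ≡ true ⊎ marked (α z) ≡ true → Stems es z
        τ-case (inj₁ l) = ⊥-elim (case ≡.trans (sym (unmarked (leaves⊆labels F i))) l of λ ())
        τ-case (inj₂ l) = τ-st l
        non-side : z ∈ arc-darts ⊎ z ∈ τ-darts → Stems es z
        non-side (inj₁ k) = arc-case (arc-dart k)
        non-side (inj₂ k) = τ-case (τ-dart k)
        go : z ∈ sides (edges F) ⊎ z ∈ arc-darts ++ τ-darts → Stems es z
        go (inj₁ j) = ⊥-elim (uniq-disj (sides (edges F)) split-uniq j i)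
        go (inj₂ j) = non-side (∈.∈-++⁻ arc-darts j)

      private
        cut : Fin n → Bool
        cut z = does (z ∈? leaves F)

        cut-leaf : ∀ {z} → z ∈ leaves F → cut z ≡ true
        cut-leaf {z} = does-yes (z ∈? leaves F)

        cut-side : ∀ {z} → z ∈ sides (edges F) → cut z ≡ false
        cut-side {z} i = does-no (z ∈? leaves F) (uniq-disj (sides (edges F)) split-uniq i)

        t₀ = proj₁ nonempty
        u₀∈ : α t₀ ∈ leaves F
        u₀∈ = stem-leaf (τ-st (≡.trans (cong marked (α-invol t₀)) (proj₂ nonempty)))

        start-gaps = gaps-of cut (contour-cyc α-invol cut _ F wf cut-leaf cut-side (proj₂ rootHd) rootRow)
          (↭.∈-resp-↭ (↭-sym (contour-labels F)) (leaves⊆labels F u₀∈)) (cut-leaf u₀∈)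

        wu wv : List (Fin n)
        wu = proj₁ (proj₂ (proj₂ (proj₂ start-gaps)))
        wv = proj₁ (proj₂ (proj₂ (proj₂ (proj₂ start-gaps))))
        leaves≡ : leaves F ≡ wu ++ wv
        leaves≡ = ≡.trans (sym (contour-leaves cut F cut-leaf cut-side)) (proj₁ (proj₂ (proj₂ (proj₂ (proj₂ (proj₂ start-gaps))))))
        G = proj₁ start-gaps
        stems≡vu : map proj₁ G ≡ wv ++ wu
        stems≡vu = proj₂ (proj₂ (proj₂ (proj₂ (proj₂ (proj₂ start-gaps)))))
        G-leaves : map proj₁ G ↭ leaves F
        G-leaves = trans (↭-reflexive stems≡vu) (trans (↭.++-comm wv wu) (↭-reflexive (sym leaves≡)))

        abstract
         opened : Opened es (map proj₁ G)
         opened = open-arcs arcs (λ i → un (ok i) , unα (ok i)) G (proj₁ (proj₂ start-gaps))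
           (uniq-↭ (↭-sym G-leaves) (uniq-++ʳ (sides (edges F)) split-uniq))
           (leaf-stem ∘ ↭.∈-resp-↭ G-leaves) (↭.∈-resp-↭ (↭-sym G-leaves) ∘ stem-leaf)

      open Opened opened using (us; us⇒; us⇐) renaming (good to good-G; gaps to gaps₀; cyc to cyc₀; stems≡ to stems₀; uniq to uniq-us)

      τ-rotation : Cyc (λ u u' → σ (α u') ≡ α u) us
      τ-rotation = subst (Cyc (λ u u' → σ (α u') ≡ α u)) stems₀ (cyc-map proj₁ gaps₀
        (λ {a} _ (ch , i , j) → τ-step {g = proj₂ a} ch (us⇒ (mem i)) (us⇒ (mem j))) (cyc-both gaps₀ cyc₀))
        where
        mem : ∀ {p} → p ∈ gaps₀ → proj₁ p ∈ us
        mem {p} i = subst (proj₁ p ∈_) stems₀ (∈.∈-map⁺ proj₁ i)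

      private
        root∈ : root ∈ row F
        root∈ = subst (root ∈_) (sym (proj₂ rootHd)) (here refl)

        rots-zero : All (λ (_ , l) → ∑ (λ d → x d ℤ.+ 1ℤ) l ≡ 0ℤ) (rots (color root) F)
        rots-zero = All.tabulate (λ {p} i → let u , r , s = rots-avoid (color root) F uniq-labels root∈ i in
          cycle-demand {x} conserve u (proj₁ (All.lookup (wf-rots σ α color _ F wf) i)) r (unmarked ∘ s))

        -- Conservation at the child, whose other darts are evaluated by `row-demand`, forces
        -- `up c b` on its parent dart; slackness then becomes the charge condition in `charged-by`.
        flow-on : ∀ c F → Wf σ α color c F → All (λ d → x d ≡ cap (color d)) (leaves F) →
          All (λ (_ , l) → ∑ (λ d → x d ℤ.+ 1ℤ) l ≡ 0ℤ) (rots c F) → FlowOn x c F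
        flow-on c ε w l r = tt
        flow-on c (leaf d F) (p , w) (q ∷ l) r = ≡.trans q (cong cap p) , flow-on c F w l r
        flow-on c (edge d d' b F) ((_ , _ , e , _) , w , w') l r
          with lb , lF ← All.++⁻ (leaves b) l with rb , (z ∷ rF) ← All.++⁻ (rots (flipC c) b) r
          with hb ← flow-on (flipC c) b w lb rb =
          (≡.trans (≡.trans (sym (ℤ.neg-involutive (x d))) (cong (-_) (≡.trans (sym (anti d)) (cong x e)))) (cong (-_) up-eq) , up-eq) , hb , flow-on c F w' lF rF
          where
          lem : ∀ p s n → p ≡ ((p ℤ.+ 1ℤ) ℤ.+ (s ℤ.- n)) ℤ.+ (n ℤ.- (1ℤ ℤ.+ s))
          lem = solve-∀
          up-eq : x d' ≡ up c b
          up-eq = ≡.trans (lem (x d') (+ length (labels b)) (N ℤ.* chg (flipC c) b))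
            (≡.trans (cong (ℤ._+ up c b) (≡.trans (cong (λ v → (x d' ℤ.+ 1ℤ) ℤ.+ v) (sym (row-demand (flipC c) b hb))) z)) (ℤ.+-identityˡ (up c b)))

        charged-by : ∀ c F → length (labels F) ≤ n → Wf σ α color c F → FlowOn x c F → All SlackAt (edges F) → Charged c F
        charged-by c ε sz w h s = tt
        charged-by c (leaf d F) sz (_ , w) (_ , h) s = charged-by c F (ℕ.<⇒≤ sz) w h s
        charged-by c (edge d d' b F) sz ((p , _) , w , w') ((e , _) , h , h') (s ∷ ss) with sb , sF ← All.++⁻ (edges b) ss =
          up-bounded c b (subst (Slack (flipC c)) (≡.trans (cong (-_) e) (ℤ.neg-involutive (up c b))) (slack-neg c (subst (λ k → Slack k (x d)) p s)))
            (ℕ.≤-trans (ℕ.m≤n+m _ 1) (ℕ.≤-trans (s≤s (s≤s (ℕ.m≤m+n _ (length (labels F))))) sz')) ,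
          charged-by (flipC c) b (ℕ.≤-trans (ℕ.m≤m+n _ (length (labels F))) (ℕ.≤-trans (ℕ.m≤n+m _ 2) sz')) w h sb ,
          charged-by c F (ℕ.≤-trans (ℕ.m≤n+m _ (length (labels b))) (ℕ.≤-trans (ℕ.m≤n+m _ 2) sz')) w' h' sF
          where
          sz' : 2 + (length (labels b) + length (labels F)) ≤ n
          sz' = subst (λ k → 2 + k ≤ n) (List.length-++ (labels b)) sz

      τ-list : map α us ↭ P.cτ
      τ-list = same-↭ (Unique.map⁺ α-inj uniq-us) (uniq-++ʳ (labels F) uniq-all)
        (λ i → case ∈.∈-map⁻ α i of λ { (u , j , refl) → P.marked-cτ (us⇒ j) })
        (λ {d} i → subst (_∈ map α us) (α-invol d) (∈.∈-map⁺ α (us⇐ (≡.trans (cong marked (α-invol d)) (P.cτ-marked i)))))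

      structure : Structure m (color root) τc F us
      structure = record
        { α-invol = α-invol
        ; wf = wf
        ; rootRow = rootRow
        ; good = subst (Good Pairs us) (sym leaves≡) (good-rot wv wu (subst (Good Pairs us) stems≡vu good-G))
        ; τ-rot = τ-rotation
        ; us-col = All.tabulate (λ {u} i → ≡.trans (≡.trans (sym (flipC-flipC (color u))) (cong flipC (sym (color-α u)))) (cong flipC (τ-is (α u) (us⇒ i))))
        ; τ-col = All.tabulate (λ {u} i → τ-is (α u) (us⇒ i))
        ; us-inh = α t₀ , us⇐ (≡.trans (cong marked (α-invol t₀)) (proj₂ nonempty))
        ; cover = trans (↭.++⁺ˡ (labels F) τ-list) labels-cτ
        ; mark⇒ = λ mk → ↭.∈-resp-↭ (↭-sym τ-list) (P.marked-cτ mk)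
        ; mark⇐ = λ i → P.cτ-marked (↭.∈-resp-↭ τ-list i)
        ; rootHd = rootHd
        ; charged = charged-by (color root) F (ℕ.≤-trans (sub-length uniq-labels (λ _ → ∈.∈-allFin _)) (ℕ.≤-reflexive n-all)) wf
            (flow-on (color root) F wf (All.tabulate (stem-sat ∘ leaf-stem)) rots-zero) slack
        }

    trees-structure : TightFor m τc → ∃₂ λ F us → Structure m (color root) τc F us
    trees-structure tight = _ , _ , Trees.structure ts (Unique.filter⁺ (T? ∘ marked) (Unique.allFin⁺ n)) ts⇒ ts⇐ tf dt
        (proj₁ (proj₂ tree)) (proj₂ (proj₂ tree))
      where
      ts : List (Fin n)
      ts = filterᵇ marked (allFin n)
      ts⇒ : ∀ {t} → t ∈ ts → marked t ≡ true
      ts⇒ i = T→≡ (proj₂ (∈.∈-filter⁻ (T? ∘ marked) {xs = allFin n} i))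
      ts⇐ : ∀ {t} → marked t ≡ true → t ∈ ts
      ts⇐ {t} e = ∈.∈-filter⁺ (T? ∘ marked) (∈.∈-allFin t) (≡→T e)
      tf : D.TauFaces ts
      tf = D.tauFaces ts (Unique.filter⁺ (T? ∘ marked) (Unique.allFin⁺ n))
      dt : D.DualTree (length (D.TauFaces.Rem tf))
      dt = D.grow-tree (D.TauFaces.Rem tf) (length (D.TauFaces.Rem tf)) ℕ.≤-refl (D.TauFaces.rest tf) (λ mk → D.TauFaces.gone tf (ts⇐ mk))
        (proj₂ (Feasible.feasible m pb vd τ-is tight)) D.start (λ ())
      tree : ∃ λ F → P.Span.Partial (D.DualTree.flow dt) F [] × 2 + length (edges F) ≡ length LV
      tree = P.Span.spanning-tree (D.DualTree.flow dt)

  exists-structure : TightFor m τc → ∃₂ λ F us → Structure m (color root) τc F us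
  exists-structure = trees-structure (proj₂ (decompose σ σ⁻ (proj₂ (proj₂ σ-perm))))
    (proj₂ (decompose (σ ∘ α) (α ∘ σ⁻) (λ d → ≡.trans (cong α (proj₂ (proj₂ σ-perm) (α d))) (α-invol d))))

-- Structures along isomorphisms

module Transport {m m' : Map} (iso : m ≅ m') where

  private
    module M = Map m
    module M' = Map m'
  open _≅_ iso
  open Inverse bij using (to; from; inverse)

  to-from : ∀ y → to (from y) ≡ y
  to-from y = proj₁ inverse refl

  from-to : ∀ x → from (to x) ≡ x
  from-to x = proj₂ inverse refl

  transport-wf : ∀ c F → Wf M.σ M.α M.color c F → Wf M'.σ M'.α M'.color c (mapF to F)
  transport-wf c ε w = tt
  transport-wf c (leaf d r) (p , w) = ≡.trans (pres-color d) p , transport-wf c r w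
  transport-wf c (edge d d' b r) ((p , q , e , cy) , w , w') =
    (≡.trans (pres-color d) p , ≡.trans (pres-color d') q , ≡.trans (sym (pres-α d)) (cong to e) ,
      subst (λ l → Cyc (Graph M'.σ) (to d' ∷ l)) (sym (row-mapF to b)) (cyc-map to (d' ∷ row b) (λ { {x} _ refl → sym (pres-σ x) }) cy)) ,
    transport-wf (flipC c) b w , transport-wf c r w'

  transport-charged : ∀ c (F : Forest (Fin M.n)) → Charged c F → Charged c (mapF to F)
  transport-charged c ε h = tt
  transport-charged c (leaf d r) h = transport-charged c r h
  transport-charged c (edge d d' b r) (p , h , h') = subst (Bounded (flipC c)) (sym (chg-mapF to (flipC c) b)) p , transport-charged (flipC c) b h , transport-charged c r h'

  transport : ∀ {c τc F us} → Structure m c τc F us → Structure m' c τc (mapF to F) (map to us)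
  transport {c} {τc} {F} {us} S = record
    { α-invol = λ y → ≡.trans (cong (M'.α ∘ M'.α) (sym (to-from y))) (≡.trans (cong M'.α (sym (pres-α (from y)))) (≡.trans (sym (pres-α (M.α (from y)))) (≡.trans (cong to (α-invol (from y))) (to-from y))))
    ; wf = transport-wf c F wf
    ; rootRow = subst (Cyc (Graph M'.σ)) (sym (row-mapF to F)) (cyc-map to (row F) (λ { {x} _ refl → sym (pres-σ x) }) rootRow)
    ; good = subst (Good _ (map to us)) (sym (leaves-mapF to F)) (good-map to (λ { {x} (p , q , e) → ≡.trans (pres-color _) p , ≡.trans (pres-color _) q , ≡.trans (sym (pres-α x)) (cong to e) }) good)
    ; τ-rot = cyc-map to us (λ {u} {u'} _ e → ≡.trans (cong M'.σ (sym (pres-α u'))) (≡.trans (sym (pres-σ (M.α u'))) (≡.trans (cong to e) (pres-α u)))) τ-rot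
    ; us-col = All.map⁺ (All.map (λ {u} p → ≡.trans (pres-color u) p) us-col)
    ; τ-col = All.map⁺ (All.map (λ {u} p → ≡.trans (cong M'.color (sym (pres-α u))) (≡.trans (pres-color (M.α u)) p)) τ-col)
    ; us-inh = to (proj₁ us-inh) , ∈.∈-map⁺ to (proj₂ us-inh)
    ; cover = subst (_↭ allFin M'.n) total (trans (↭.map⁺ to cover) all-to)
    ; mark⇒ = λ {y} e → subst₂ _∈_ (to-from y) (sym marks) (∈.∈-map⁺ to (mark⇒ (≡.trans (sym (pres-marked (from y))) (≡.trans (cong M'.marked (to-from y)) e))))
    ; mark⇐ = λ i → case ∈.∈-map⁻ to (subst (_ ∈_) marks i) of λ { (x , j , refl) → ≡.trans (pres-marked x) (mark⇐ j) }
    ; rootHd = map to (proj₁ rootHd) , ≡.trans (row-mapF to F) (≡.trans (cong (map to) (proj₂ rootHd)) (cong (_∷ map to (proj₁ rootHd)) pres-root))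
    ; charged = transport-charged c F charged
    }
    where
    open Structure S
    open ≡ using (subst₂)
    marks : map M'.α (map to us) ≡ map to (map M.α us)
    marks = ≡.trans (sym (List.map-∘ us)) (≡.trans (List.map-cong (λ u → sym (pres-α u)) us) (List.map-∘ us))
    total : map to (labels F ++ map M.α us) ≡ labels (mapF to F) ++ map M'.α (map to us)
    total = ≡.trans (List.map-++ to (labels F) _) (cong₂ _++_ (sym (labels-mapF to F)) (sym marks))
    all-to : map to (allFin M.n) ↭ allFin M'.n
    all-to = same-↭ (Unique.map⁺ (λ {x} {y} e → ≡.trans (sym (from-to x)) (≡.trans (cong from e) (from-to y))) (Unique.allFin⁺ M.n)) (Unique.allFin⁺ M'.n)
      (λ _ → ∈.∈-allFin _) (λ {y} _ → subst (_∈ map to (allFin M.n)) (to-from y) (∈.∈-map⁺ to (∈.∈-allFin (from y))))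

-- The bijections

Target : Color → Map → Set
Target black = IsTrumpet
Target white = IsCornet

module _ (τc : Color) (k : ℕ) (0<k : 0 < k) where

  private
    structure-of : ∀ c is → InT (signed τc k) (c , node is) → ∃₂ λ F us →
      Structure (completeClosure (c , node is)) c τc F us × shape c F ≡ is × length us ≡ k
    structure-of c is (wc , ch) = closure-structure c is τc k 0<k wc ch

    in-target : ∀ {m c F us} τc → Structure m c τc F us → Target τc m
    in-target {m} black S = pb , StructureMap.τColor-is S , Tightness.tight-black m pb (StructureMap.τColor-is S) (StructureFlow.flow S pb)
      where pb = StructureMap.isPointedBipartite S
    in-target {m} white S = pb , StructureMap.τColor-is S , Tightness.tight-white m pb (StructureMap.τColor-is S) (StructureFlow.flow S pb)
      where pb = StructureMap.isPointedBipartite S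

    from-target : ∀ {m} τc → Target τc m → ∃₂ λ F us → Structure m (Map.color m (Map.root m)) τc F us
    from-target {m} black (pb , τ-is , tight) = Existence.exists-structure m pb τ-is tight
    from-target {m} white (pb , τ-is , tight) = Existence.exists-structure m pb τ-is tight

  closure-bijection : ClosureBijection (signed τc k) (λ m → Target τc m × degτ m ≡ k)
  closure-bijection = record
    { into = λ { (c , node is) p → let F , us , S , _ , e = structure-of c is p in in-target τc S , ≡.trans (StructureMap.degτ≡ S) e }
    ; injective = inj
    ; onto = λ m (tgt , deg) → let F , us , S = from-target τc tgt
                                   c = Map.color m (Map.root m)
                                   ch = Structure.charged S
        in (c , node (shape c F)) ,
           (wc-shape c F ch , ≡.trans (sym (chg-shape c F ch)) (≡.trans (structure-charge S) (cong (signed τc) (≡.trans (sym (StructureMap.degτ≡ S)) deg)))) ,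
           structure-iso S
    ; pres-degrees = λ { (c , node is) p → let F , us , S , e , _ = structure-of c is p in
        subst (λ js → degDistTree (c , node js) ↭ degDistMap (completeClosure (c , node is))) e (StructureMap.degDist≡ S) }
    ; pres-rootColor = λ { (c , node is) p → let F , us , S , _ = structure-of c is p in StructureMap.root-color S }
    }
    where
    -- Carried along the isomorphism, the forest of the first tree lives in the same map as that of
    -- the second. Uniqueness identifies the labelled forests, and the trees are their shapes.
    inj : ∀ t t' → InT (signed τc k) t → InT (signed τc k) t' → completeClosure t ≅ completeClosure t' → t ≡ t'
    inj (c , node is) (c' , node is') p p' iso
      with F , us , S , e , _ ← structure-of c is p with F' , us' , S' , e' , _ ← structure-of c' is' p'
      with refl , q ← structure-unique (Transport.transport iso S) S' =
      cong (λ js → c , node js) (≡.trans (sym e) (≡.trans (sym (shape-mapF (Inverse.to (_≅_.bij iso)) c F)) (≡.trans (cong (shape c) q) e')))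

theorem2p18 : (k : ℕ) → 0 < k →
    ClosureBijection (+ k) (λ m → IsTrumpet m × degτ m ≡ k)
    × ClosureBijection (- (+ k)) (λ m → IsCornet m × degτ m ≡ k)
theorem2p18 k 0<k = closure-bijection black k 0<k , closure-bijection white k 0<k
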